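{- Let $\mathcal U_{i_0}$ ($1\le i_0\le n$) be the affine charts of the splitting model ${\rm M}^{\rm spl}_I$ (signature $(n-1,1)$, $I=\{\ell\}$ strongly non-special) defined in the context. Let $V_1=[v_1\ \cdots\ v_{2\ell}]^t$, $V_2=[v_{2\ell+1}\ \cdots\ v_n]^t$, $Z_2=[z_{2\ell+1}\ \cdots\ z_n]^t$ be column matrices of indeterminates, $u$ an indeterminate, and $H$ the unit anti-diagonal matrix of size $n-2\ell$. (1) For $1\le i_0\le2\ell$, the affine chart $\mathcal U_{i_0}$ is isomorphic to $${\rm Spec}\,\frac{O_F[V_1,V_2,Z_2]}{(v_{i_0}-1,\ \wedge^2[\,V_2\mid HZ_2\,],\ Z_2^t\cdot V_2-2\pi)}.$$ (2) For $2\ell+1\le i_0\le n$, the affine chart $\mathcal U_{i_0}$ is isomorphic to $${\rm Spec}\,\frac{O_F[V_1,V_2,u]}{(v_{i_0}-1,\ u\cdot(V_2^tHV_2)-2\pi)}.$$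
   Context: $\wedge^2[\,A\mid B\,]$ denotes the set of all $2\times2$ minors of the two-column matrix $[A\mid B]$. Let $F_0$ be a complete discretely valued field with ring of integers $O_{F_0}$, perfect residue field $k$ of characteristic $\ne2$ and uniformizer $\pi_0$; $F/F_0$ a ramified quadratic extension with uniformizer $\pi$, $\pi^2=\pi_0$, ring of integers $O_F$, and $a\mapsto\bar a$ the nontrivial element of ${\rm Gal}(F/F_0)$. Let $V$ be an $F$-vector space of dimension $n>3$ with an $F/F_0$-hermitian form $\phi$ which is split: there is a basis $e_1,\dots,e_n$ with $\phi(ae_i,be_{n+1-j})=\bar ab\,\delta_{i,j}$ for $a,b\in F$. Put $(x,y)=\frac12{\rm Tr}_{F/F_0}(\phi(x,y))$. For $0\le i\le n-1$ let $\Lambda_i={\rm span}_{O_F}\{\pi^{ -1}e_1,\dots,\pi^{ -1}e_i,e_{i+1},\dots,e_n\}$. Let $m=\lfloor n/2\rfloor$ and let $I=\{\ell\}$ be strongly non-special: $0\le\ell\le m$, with $\ell\ne0,m-1,m$ if $n=2m$, and $\ell\ne0,m$ if $n=2m+1$. The form $(\,,\,)$ induces a perfect pairing $\Lambda_{n-\ell}\times\Lambda_\ell\to O_{F_0}$. Let $t$ denote multiplication by $\pi\in O_F$ on the lattices. For an $O_F$-scheme $S$, $\Lambda_j\otimes\mathcal O_S$ means $\Lambda_j\otimes_{O_{F_0}}\mathcal O_S$, on which $\pi$ acts through $\mathcal O_S$. ${\rm M}^{\rm naive}_I$ is the projective $O_F$-scheme whose $S$-points are pairs of $O_F\otimes\mathcal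 O_S$-submodules $\mathcal F_\ell\subset\Lambda_\ell\otimes\mathcal O_S$, $\mathcal F_{n-\ell}\subset\Lambda_{n-\ell}\otimes\mathcal O_S$ such that (1) both are Zariski locally $\mathcal O_S$-direct summands of rank $n$; (2) the maps induced by $\Lambda_\ell\subset\Lambda_{n-\ell}\subset\pi^{ -1}\Lambda_\ell$ restrict to $\mathcal F_\ell\to\mathcal F_{n-\ell}\to\pi^{ -1}\mathcal F_\ell$; (3) $\mathcal F_{n-\ell}$ is the orthogonal complement of $\mathcal F_\ell$ under $(\,,\,)$; (4) $t$ has characteristic polynomial $(T+\pi)^{n-1}(T-\pi)$ on $\mathcal F_\ell$ and on $\mathcal F_{n-\ell}$. ${\rm M}^\wedge_I\subset{\rm M}^{\rm naive}_I$ is the closed subscheme where moreover $\wedge^n(t-\pi\mid\mathcal F_\kappa)=0$ and $\wedge^2(t+\pi\mid\mathcal F_\kappa)=0$ for $\kappa=\ell,n-\ell$. The splitting model ${\rm M}^{\rm spl}_I$ is the projective $O_F$-scheme whose $S$-points are triples $(\mathcal F_\ell,\mathcal F_{n-\ell},\mathcal G_{n-\ell})$ with $(\mathcal F_\ell,\mathcal F_{n-\ell})\in{\rm M}^\wedge_I(S)$ and $\mathcal G_{n-\ell}\subset\mathcal F_{n-\ell}$ Zariski locally an $\mathcal O_S$-direct summand of rank $1$ such that $(t+\pi)\mathcal F_{n-\ell}\subset\mathcal G_{n-\ell}$ and $(t-\pi)\mathcal G_{n-\ell}=0$. **Charts.** Use the ordered $O_{F_0}$-bases $\Lambda_\ell$: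 $e_{n-\ell+1},\dots,e_n,\ \pi^{ -1}e_1,\dots,\pi^{ -1}e_\ell,\ e_{\ell+1},\dots,e_{n-\ell}$, followed by $\pi$ times these $n$ vectors in the same order; $\Lambda_{n-\ell}$: $e_{n-\ell+1},\dots,e_n,\ \pi^{ -1}e_1,\dots,\pi^{ -1}e_\ell,\ \pi^{ -1}e_{\ell+1},\dots,\pi^{ -1}e_{n-\ell}$, followed by $\pi$ times these $n$ vectors in the same order. $\mathcal U_{i_0}$ is the open subscheme of ${\rm M}^{\rm spl}_I$ of points for which, in these bases, $\mathcal F_\ell$ and $\mathcal F_{n-\ell}$ are the column spans of $\begin{bmatrix}X\\ I_n\end{bmatrix}$ and $\begin{bmatrix}Y\\ I_n\end{bmatrix}$ with $X,Y$ of size $n\times n$, and $\mathcal G_{n-\ell}$ is spanned by a column $\begin{bmatrix}G_1\\ G_2\end{bmatrix}$ ($G_1,G_2$ of size $n\times1$) whose $G_2$-part has its $i_0$-th entry invertible (normalized to $1$). It is an affine neighborhood of the point $(t\Lambda_\ell,t\Lambda_{n-\ell},k\{\pi e_{n-\ell+i_0}\})$ if $1\le i_0\le\ell$, and of $(t\Lambda_\ell,t\Lambda_{n-\ell},k\{e_{ -\ell+i_0}\})$ if $\ell+1\le i_0\le n$. -}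

module Defs where

open import Level using (_⊔_) renaming (suc to lsuc)
open import Algebra.Apartness.Bundles using (HeytingField; HeytingCommutativeRing)
open import Algebra.Bundles using (RawRing; Semiring; CommutativeRing; CommutativeMonoid)
import Algebra.Definitions.RawMonoid as RawMonoidOps
import Algebra.Definitions.RawSemiring as RawSemiringOps
open import Algebra.Module.Bundles using (LeftModule)
import Algebra.Morphism.Construct.Composition as Composition
import Algebra.Morphism.RingMonomorphism as RingMonomorphism
open import Algebra.Morphism.Structures using (IsRingHomomorphism; IsRingMonomorphism)
import Algebra.Properties.CommutativeSemigroup as CommutativeSemigroupProperties
import Algebra.Properties.Ring as RingProperties
import Algebra.Solver.Ring.NaturalCoefficients.Default as SemiringSolver
open import Algebra.Structures using (IsCommutativeRing)
open import Data.Bool.Base using (if_then_else_)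
open import Data.Empty using (⊥-elim)
open import Data.Fin.Base as Fin using (Fin; toℕ; fromℕ<; punchIn; opposite; cast; _↑ʳ_)
open import Data.Fin.Properties as Finₚ using (toℕ<n)
open import Data.Integer.Base as ℤ using (ℤ; 0ℤ; 1ℤ)
import Data.Integer.Properties as ℤₚ
open import Data.Nat.Base as ℕ using (ℕ; zero; suc; _∸_; ⌊_/2⌋)
import Data.Nat.Properties as ℕₚ
open import Data.Nat.Primality using (Prime)
open import Data.Product.Base using (Σ; ∃-syntax; _×_; _,_; proj₁; proj₂)
open import Function.Base using (_∘_)
open import Function.Bundles using (Inverse; _⇔_)
open import Relation.Binary.Bundles using (Setoid)
open import Relation.Binary.Construct.Add.Supremum.NonStrict ℤ._≤_ using (_≤⁺_; _≤⊤⁺; [_])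
open import Relation.Binary.PropositionalEquality as ≡ using (_≡_; _≢_)
open import Relation.Nullary.Construct.Add.Supremum using (_⁺; ⊤⁺; [_])
open import Relation.Nullary.Decidable.Core using (Dec; yes; no; does)
open import Relation.Nullary.Decidable using (dec-true; dec-false)
open import Relation.Nullary.Negation using (¬_)
open import Relation.Unary using (Pred; _⊆_; _≐_)
open import Relation.Unary.Properties using (≐-refl; ≐-sym; ≐-trans)

------------------------------------------------------------------------
-- Rings and algebras

CommRing : ∀ a → Set (lsuc a)
CommRing a = CommutativeRing a a

record Hom {a} (A B : CommRing a) : Set a where
  private
    module A = CommutativeRing A
    module B = CommutativeRing B
  field
    ⟦_⟧                : A.Carrier → B.Carrier
    isRingHomomorphism : IsRingHomomorphism A.rawRing B.rawRing ⟦_⟧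

  open IsRingHomomorphism isRingHomomorphism public

module Power {a} (R : CommRing a) where
  open RawSemiringOps (Semiring.rawSemiring (CommutativeRing.semiring R)) public using (_^_)

infixr 9 _∘ʰ_

_∘ʰ_ : ∀ {a} {A B C : CommRing a} → Hom B C → Hom A B → Hom A C
_∘ʰ_ {C = C} g f = record
  { isRingHomomorphism =
      Composition.isRingHomomorphism (CommutativeRing.trans C) f.isRingHomomorphism g.isRingHomomorphism }
  where
  module f = Hom f
  module g = Hom g

record Algebra {a} (K : CommRing a) : Set (lsuc a) where
  field
    commutativeRing : CommRing a
    structureMap    : Hom K commutativeRing

  open CommutativeRing commutativeRing public
  open Hom structureMap public using () renaming (⟦_⟧ to scalar)

record AlgHom {a} {K : CommRing a} (A B : Algebra K) : Set a where
  private
    module A = Algebra A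
    module B = Algebra B
  field
    hom      : Hom A.commutativeRing B.commutativeRing
    commutes : ∀ k → Hom.⟦_⟧ hom (A.scalar k) B.≈ B.scalar k

  open Hom hom public

_∘ᵃ_ : ∀ {a} {K : CommRing a} {A B C : Algebra K} → AlgHom B C → AlgHom A B → AlgHom A C
_∘ᵃ_ {C = C} g f = record
  { hom      = g.hom ∘ʰ f.hom
  ; commutes = λ k → C.trans (g.⟦⟧-cong (f.commutes k)) (g.commutes k)
  }
  where
  module C = Algebra C
  module f = AlgHom f
  module g = AlgHom g

AlgHomSetoid : ∀ {a} {K : CommRing a} → Algebra K → Algebra K → Setoid a a
AlgHomSetoid A B = record
  { Carrier       = AlgHom A B
  ; _≈_           = λ f g → ∀ x → AlgHom.⟦_⟧ f x B.≈ AlgHom.⟦_⟧ g x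
  ; isEquivalence = record
    { refl  = λ _ → B.refl
    ; sym   = λ p x → B.sym (p x)
    ; trans = λ p q x → B.trans (p x) (q x)
    }
  }
  where module B = Algebra B

restrictAlgebra : ∀ {a} {K L : CommRing a} → Hom K L → Algebra L → Algebra K
restrictAlgebra f A = record
  { commutativeRing = Algebra.commutativeRing A
  ; structureMap    = Algebra.structureMap A ∘ʰ f
  }

-- R[√d] = R[T]/(T² - d), with (x , y) standing for x + y√d.
module _ {a} (R : CommRing a) (d : CommutativeRing.Carrier R) where
  private
    open module R = CommutativeRing R
    open SemiringSolver commutativeSemiring using (solve; _:=_; _:+_; _:*_)

    C : Set a
    C = Carrier × Carrier

    infix  4 _≈′_
    infixl 6 _+′_
    infixl 7 _*′_

    _≈′_ : C → C → Set a
    (x , y) ≈′ (z , w) = (x ≈ z) × (y ≈ w)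

    _+′_ _*′_ : C → C → C
    (x , y) +′ (z , w) = x + z , y + w
    (x , y) *′ (z , w) = x * z + d * (y * w) , x * w + y * z

    -′_ : C → C
    -′ (x , y) = - x , - y

    *′-comm : ∀ p q → p *′ q ≈′ q *′ p
    *′-comm (x , y) (z , w) =
      solve 5 (λ d x y z w → x :* z :+ d :* (y :* w) := z :* x :+ d :* (w :* y)) refl d x y z w ,
      solve 4 (λ x y z w → x :* w :+ y :* z := z :* y :+ w :* x) refl x y z w

    *′-assoc : ∀ p q r → (p *′ q) *′ r ≈′ p *′ (q *′ r)
    *′-assoc (x , y) (z , w) (s , t) =
      solve 7 (λ d x y z w s t →
        (x :* z :+ d :* (y :* w)) :* s :+ d :* ((x :* w :+ y :* z) :* t)
          := x :* (z :* s :+ d :* (w :* t)) :+ d :* (y :* (z :* t :+ w :* s)))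
        refl d x y z w s t ,
      solve 7 (λ d x y z w s t →
        (x :* z :+ d :* (y :* w)) :* t :+ (x :* w :+ y :* z) :* s
          := x :* (z :* t :+ w :* s) :+ y :* (z :* s :+ d :* (w :* t)))
        refl d x y z w s t

    *′-distribˡ : ∀ p q r → p *′ (q +′ r) ≈′ p *′ q +′ p *′ r
    *′-distribˡ (x , y) (z , w) (s , t) =
      solve 7 (λ d x y z w s t →
        x :* (z :+ s) :+ d :* (y :* (w :+ t))
          := (x :* z :+ d :* (y :* w)) :+ (x :* s :+ d :* (y :* t)))
        refl d x y z w s t ,
      solve 6 (λ x y z w s t →
        x :* (w :+ t) :+ y :* (z :+ s) := (x :* w :+ y :* z) :+ (x :* t :+ y :* s))
        refl x y z w s t

    *′-identityˡ : ∀ p → (1# , 0#) *′ p ≈′ p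
    *′-identityˡ (x , y) =
      trans (+-cong (*-identityˡ x) (trans (*-congˡ (zeroˡ y)) (zeroʳ d))) (+-identityʳ x) ,
      trans (+-cong (*-identityˡ y) (zeroˡ x)) (+-identityʳ y)

    *′-cong : ∀ {p q r s} → p ≈′ q → r ≈′ s → p *′ r ≈′ q *′ s
    *′-cong (p₁ , p₂) (q₁ , q₂) =
      +-cong (*-cong p₁ q₁) (*-congˡ (*-cong p₂ q₂)) ,
      +-cong (*-cong p₁ q₂) (*-cong p₂ q₁)

    ≈′-trans : ∀ {p q r} → p ≈′ q → q ≈′ r → p ≈′ r
    ≈′-trans (p₁ , p₂) (q₁ , q₂) = trans p₁ q₁ , trans p₂ q₂

    +′-cong : ∀ {p q r s} → p ≈′ q → r ≈′ s → p +′ r ≈′ q +′ s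
    +′-cong (p₁ , p₂) (q₁ , q₂) = +-cong p₁ q₁ , +-cong p₂ q₂

  abstract
    adjoinSqrt-isCommutativeRing :
      IsCommutativeRing _≈′_ _+′_ _*′_ -′_ (0# , 0#) (1# , 0#)
    adjoinSqrt-isCommutativeRing = record
      { isRing = record
        { +-isAbelianGroup = record
          { isGroup = record
            { isMonoid = record
              { isSemigroup = record
                { isMagma = record
                  { isEquivalence = record
                    { refl  = refl , refl
                    ; sym   = λ (p , q) → sym p , sym q
                    ; trans = ≈′-trans
                    }
                  ; ∙-cong = +′-cong
                  }
                ; assoc = λ p q r → +-assoc _ _ _ , +-assoc _ _ _
                }
              ; identity = (λ p → +-identityˡ _ , +-identityˡ _) , (λ p → +-identityʳ _ , +-identityʳ _)
              }
            ; inverse = (λ p → -‿inverseˡ _ , -‿inverseˡ _) , (λ p → -‿inverseʳ _ , -‿inverseʳ _)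
            ; ⁻¹-cong = λ (p , q) → -‿cong p , -‿cong q
            }
          ; comm = λ p q → +-comm _ _ , +-comm _ _
          }
        ; *-cong     = *′-cong
        ; *-assoc    = *′-assoc
        ; *-identity = *′-identityˡ , λ p → ≈′-trans (*′-comm p _) (*′-identityˡ p)
        ; distrib    = *′-distribˡ , λ p q r →
            ≈′-trans (*′-comm (q +′ r) p)
              (≈′-trans (*′-distribˡ p q r) (+′-cong (*′-comm p q) (*′-comm p r)))
        }
      ; *-comm = *′-comm
      }

  AdjoinSqrt : CommRing a
  AdjoinSqrt = record { isCommutativeRing = adjoinSqrt-isCommutativeRing }

  adjoinSqrt-inclusion : Hom R AdjoinSqrt
  adjoinSqrt-inclusion = record
    { ⟦_⟧ = λ x → x , 0#
    ; isRingHomomorphism = record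
      { isSemiringHomomorphism = record
        { isNearSemiringHomomorphism = record
          { +-isMonoidHomomorphism = record
            { isMagmaHomomorphism = record
              { isRelHomomorphism = record { cong = λ p → p , refl }
              ; homo = λ x y → refl , sym (+-identityˡ 0#)
              }
            ; ε-homo = refl , refl
            }
          ; *-homo = λ x y →
              sym (trans (+-congˡ (trans (*-congˡ (zeroˡ 0#)) (zeroʳ d))) (+-identityʳ _)) ,
              sym (trans (+-cong (zeroʳ x) (zeroˡ y)) (+-identityˡ 0#))
          }
        ; 1#-homo = refl , refl
        }
      ; -‿homo = λ x → refl , sym (RingProperties.-0#≈0# ring)
      }
    }

adjoinSqrt-map : ∀ {a} {R S : CommRing a} (f : Hom R S) {d : CommutativeRing.Carrier R}
                 {d′ : CommutativeRing.Carrier S} → CommutativeRing._≈_ S (Hom.⟦_⟧ f d) d′ →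
                 Hom (AdjoinSqrt R d) (AdjoinSqrt S d′)
adjoinSqrt-map {S = S} f d≈d′ = record
  { ⟦_⟧ = λ (x , y) → ⟦ x ⟧ , ⟦ y ⟧
  ; isRingHomomorphism = record
    { isSemiringHomomorphism = record
      { isNearSemiringHomomorphism = record
        { +-isMonoidHomomorphism = record
          { isMagmaHomomorphism = record
            { isRelHomomorphism = record { cong = λ (p , q) → ⟦⟧-cong p , ⟦⟧-cong q }
            ; homo = λ p q → +-homo _ _ , +-homo _ _
            }
          ; ε-homo = 0#-homo , 0#-homo
          }
        ; *-homo = λ p q →
            S.trans (+-homo _ _)
              (S.+-cong (*-homo _ _) (S.trans (*-homo _ _) (S.*-cong d≈d′ (*-homo _ _)))) ,
            S.trans (+-homo _ _) (S.+-cong (*-homo _ _) (*-homo _ _))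
        }
      ; 1#-homo = 1#-homo , 0#-homo
      }
    ; -‿homo = λ p → -‿homo _ , -‿homo _
    }
  }
  where
  module S = CommutativeRing S
  open Hom f

-- The quotient of R by the ideal generated by a family of elements, i.e. by the least
-- congruence that makes them zero.
module _ {a} (R : CommRing a) {I : Set} (gens : I → CommutativeRing.Carrier R) where
  private
    open module R = CommutativeRing R

  infix 4 _∼_
  data _∼_ : Carrier → Carrier → Set a where
    ∼-reflexive : ∀ {x y} → x ≈ y → x ∼ y
    ∼-sym       : ∀ {x y} → x ∼ y → y ∼ x
    ∼-trans     : ∀ {x y z} → x ∼ y → y ∼ z → x ∼ z
    ∼-+-cong    : ∀ {x y z w} → x ∼ y → z ∼ w → x + z ∼ y + w
    ∼-*-cong    : ∀ {x y z w} → x ∼ y → z ∼ w → x * z ∼ y * w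
    ∼-neg-cong  : ∀ {x y} → x ∼ y → - x ∼ - y
    ∼-gen       : ∀ i → gens i ∼ 0#

  Quotient : CommRing a
  Quotient = record
    { Carrier = Carrier
    ; _≈_ = _∼_
    ; _+_ = _+_
    ; _*_ = _*_
    ; -_  = -_
    ; 0#  = 0#
    ; 1#  = 1#
    ; isCommutativeRing = record
      { isRing = record
        { +-isAbelianGroup = record
          { isGroup = record
            { isMonoid = record
              { isSemigroup = record
                { isMagma = record
                  { isEquivalence = record { refl = ∼-reflexive refl ; sym = ∼-sym ; trans = ∼-trans }
                  ; ∙-cong = ∼-+-cong
                  }
                ; assoc = λ x y z → ∼-reflexive (+-assoc x y z)
                }
              ; identity = (λ x → ∼-reflexive (+-identityˡ x)) , (λ x → ∼-reflexive (+-identityʳ x))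
              }
            ; inverse = (λ x → ∼-reflexive (-‿inverseˡ x)) , (λ x → ∼-reflexive (-‿inverseʳ x))
            ; ⁻¹-cong = ∼-neg-cong
            }
          ; comm = λ x y → ∼-reflexive (+-comm x y)
          }
        ; *-cong     = ∼-*-cong
        ; *-assoc    = λ x y z → ∼-reflexive (*-assoc x y z)
        ; *-identity = (λ x → ∼-reflexive (*-identityˡ x)) , (λ x → ∼-reflexive (*-identityʳ x))
        ; distrib    = (λ x y z → ∼-reflexive (distribˡ x y z)) , (λ x y z → ∼-reflexive (distribʳ x y z))
        }
      ; *-comm = λ x y → ∼-reflexive (*-comm x y)
      }
    }

  quotientMap : Hom R Quotient
  quotientMap = record
    { ⟦_⟧ = λ x → x
    ; isRingHomomorphism = record
      { isSemiringHomomorphism = record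
        { isNearSemiringHomomorphism = record
          { +-isMonoidHomomorphism = record
            { isMagmaHomomorphism = record
              { isRelHomomorphism = record { cong = ∼-reflexive }
              ; homo = λ x y → ∼-reflexive refl
              }
            ; ε-homo = ∼-reflexive refl
            }
          ; *-homo = λ x y → ∼-reflexive refl
          }
        ; 1#-homo = ∼-reflexive refl
        }
      ; -‿homo = λ x → ∼-reflexive refl
      }
    }

-- The polynomial ring K[Var], built as the free commutative K-algebra on Var: ring
-- expressions modulo the laws of commutative rings and of the constants.
module _ {a} (K : CommRing a) (Var : Set) where
  private module K = CommutativeRing K

  infix  8 ⊖_
  infixl 7 _⊛_
  infixl 6 _⊕_

  data Expr : Set a where
    con     : K.Carrier → Expr
    var     : Var → Expr
    _⊕_ _⊛_ : Expr → Expr → Expr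
    ⊖_      : Expr → Expr

  infix 4 _≃_
  data _≃_ : Expr → Expr → Set a where
    ≃-refl  : ∀ {p} → p ≃ p
    ≃-sym   : ∀ {p q} → p ≃ q → q ≃ p
    ≃-trans : ∀ {p q r} → p ≃ q → q ≃ r → p ≃ r
    ⊕-cong  : ∀ {p q r s} → p ≃ q → r ≃ s → p ⊕ r ≃ q ⊕ s
    ⊛-cong  : ∀ {p q r s} → p ≃ q → r ≃ s → p ⊛ r ≃ q ⊛ s
    ⊖-cong  : ∀ {p q} → p ≃ q → ⊖ p ≃ ⊖ q
    ⊕-assoc : ∀ p q r → (p ⊕ q) ⊕ r ≃ p ⊕ (q ⊕ r)
    ⊕-comm  : ∀ p q → p ⊕ q ≃ q ⊕ p
    ⊕-identityˡ : ∀ p → con K.0# ⊕ p ≃ p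
    ⊖-inverseˡ  : ∀ p → (⊖ p) ⊕ p ≃ con K.0#
    ⊛-assoc : ∀ p q r → (p ⊛ q) ⊛ r ≃ p ⊛ (q ⊛ r)
    ⊛-comm  : ∀ p q → p ⊛ q ≃ q ⊛ p
    ⊛-identityˡ : ∀ p → con K.1# ⊛ p ≃ p
    ⊛-distribˡ  : ∀ p q r → p ⊛ (q ⊕ r) ≃ p ⊛ q ⊕ p ⊛ r
    con-cong : ∀ {x y} → x K.≈ y → con x ≃ con y
    con-+    : ∀ x y → con (x K.+ y) ≃ con x ⊕ con y
    con-*    : ∀ x y → con (x K.* y) ≃ con x ⊛ con y
    con-neg  : ∀ x → con (K.- x) ≃ ⊖ con x

  PolynomialRing : CommRing a
  PolynomialRing = record
    { Carrier = Expr
    ; _≈_ = _≃_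
    ; _+_ = _⊕_
    ; _*_ = _⊛_
    ; -_  = ⊖_
    ; 0#  = con K.0#
    ; 1#  = con K.1#
    ; isCommutativeRing = record
      { isRing = record
        { +-isAbelianGroup = record
          { isGroup = record
            { isMonoid = record
              { isSemigroup = record
                { isMagma = record
                  { isEquivalence = record { refl = ≃-refl ; sym = ≃-sym ; trans = ≃-trans }
                  ; ∙-cong = ⊕-cong
                  }
                ; assoc = ⊕-assoc
                }
              ; identity = ⊕-identityˡ , λ p → ≃-trans (⊕-comm p _) (⊕-identityˡ p)
              }
            ; inverse = ⊖-inverseˡ , λ p → ≃-trans (⊕-comm p _) (⊖-inverseˡ p)
            ; ⁻¹-cong = ⊖-cong
            }
          ; comm = ⊕-comm
          }
        ; *-cong     = ⊛-cong
        ; *-assoc    = ⊛-assoc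
        ; *-identity = ⊛-identityˡ , λ p → ≃-trans (⊛-comm p _) (⊛-identityˡ p)
        ; distrib    = ⊛-distribˡ , λ p q r →
            ≃-trans (⊛-comm (q ⊕ r) p)
              (≃-trans (⊛-distribˡ p q r) (⊕-cong (⊛-comm p q) (⊛-comm p r)))
        }
      ; *-comm = ⊛-comm
      }
    }

  constantMap : Hom K PolynomialRing
  constantMap = record
    { ⟦_⟧ = con
    ; isRingHomomorphism = record
      { isSemiringHomomorphism = record
        { isNearSemiringHomomorphism = record
          { +-isMonoidHomomorphism = record
            { isMagmaHomomorphism = record
              { isRelHomomorphism = record { cong = con-cong }
              ; homo = con-+
              }
            ; ε-homo = ≃-refl
            }
          ; *-homo = con-*
          }
        ; 1#-homo = ≃-refl
        }
      ; -‿homo = con-neg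
      }
    }

_[_]/_ : ∀ {a} (K : CommRing a) (Var : Set) {I : Set} → (I → Expr K Var) → Algebra K
K [ Var ]/ relations = record
  { commutativeRing = Quotient (PolynomialRing K Var) relations
  ; structureMap    = quotientMap (PolynomialRing K Var) relations ∘ʰ constantMap K Var
  }

------------------------------------------------------------------------
-- Matrices

module Matrices {a} (R : CommRing a) where
  open CommutativeRing R
  open RawMonoidOps +-rawMonoid public using (sum)

  Matrix : ℕ → ℕ → Set a
  Matrix m n = Fin m → Fin n → Carrier

  𝟙 : ∀ {n} → Matrix n n
  𝟙 i j = if does (i Finₚ.≟ j) then 1# else 0#

  antidiagonal : ∀ {n} → Matrix n n
  antidiagonal i j = if does (i Finₚ.≟ opposite j) then 1# else 0#

  infixr 7 _*ᵥ_
  _*ᵥ_ : ∀ {m n} → Matrix m n → (Fin n → Carrier) → (Fin m → Carrier)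
  (A *ᵥ x) i = sum (λ j → A i j * x j)

  infixl 7 _∙ᵥ_
  _∙ᵥ_ : ∀ {n} → (Fin n → Carrier) → (Fin n → Carrier) → Carrier
  x ∙ᵥ y = sum (λ i → x i * y i)

  sign : ∀ {n} → Fin n → Carrier
  sign Fin.zero    = 1#
  sign (Fin.suc j) = - sign j

  det : ∀ {n} → Matrix n n → Carrier
  det {zero}  A = 1#
  det {suc n} A = sum λ j → sign j * (A Fin.zero j * det (λ i k → A (Fin.suc i) (punchIn j k)))

  StrictlyIncreasing : ∀ {k n} → (Fin k → Fin n) → Set
  StrictlyIncreasing r = ∀ {i j} → i Fin.< j → r i Fin.< r j

  -- The entries of the matrix of ∧ᵏ of an endomorphism are the k×k minors of its matrix.
  ⋀_VanishesOn_ : ∀ k {n} → Matrix n n → Set a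
  ⋀ k VanishesOn A = ∀ r c → StrictlyIncreasing r → StrictlyIncreasing c →
    det {k} (λ i j → A (r i) (c j)) ≈ 0#

data 𝕋 : Set where
  T : 𝕋

module CharacteristicPolynomial {a} (R : CommRing a) where
  private module R[T] = CommutativeRing (PolynomialRing R 𝕋)
  open Matrices R using (Matrix)

  R[T] : Set a
  R[T] = R[T].Carrier

  infix 4 _≈ᵀ_
  _≈ᵀ_ : R[T] → R[T] → Set a
  _≈ᵀ_ = R[T]._≈_

  charpoly : ∀ {n} → Matrix n n → R[T]
  charpoly A = det λ i j → 𝟙 i j R[T].* var T R[T].- con (A i j)
    where open Matrices (PolynomialRing R 𝕋)

------------------------------------------------------------------------
-- Modules

-- Over a commutative ring a left module is a module.
Mod : ∀ {a} → CommRing a → Set (lsuc a)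
Mod {a} K = LeftModule (CommutativeRing.ring K) a a

module LinearAlgebra {a} (K : CommRing a) (M : Mod K) where
  private module K = CommutativeRing K
  open LeftModule M

  sumᴹ : ∀ {k} → (Fin k → Carrierᴹ) → Carrierᴹ
  sumᴹ = RawMonoidOps.sum (CommutativeMonoid.rawMonoid +ᴹ-commutativeMonoid)

  lincomb : ∀ {k} → (Fin k → K.Carrier) → (Fin k → Carrierᴹ) → Carrierᴹ
  lincomb c b = sumᴹ λ i → c i *ₗ b i

  record IsSubmodule (N : Pred Carrierᴹ a) : Set a where
    field
      resp  : ∀ {x y} → x ≈ᴹ y → N x → N y
      zero∈ : N 0ᴹ
      +∈    : ∀ {x y} → N x → N y → N (x +ᴹ y)
      *∈    : ∀ k {x} → N x → N (k *ₗ x)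

  Span : ∀ {k} → (Fin k → Carrierᴹ) → Pred Carrierᴹ a
  Span b x = ∃[ c ] x ≈ᴹ lincomb c b

  LinearlyIndependent : ∀ {k} → (Fin k → Carrierᴹ) → Set a
  LinearlyIndependent b = ∀ c → lincomb c b ≈ᴹ 0ᴹ → ∀ i → c i K.≈ K.0#

  IsBasisOf : ∀ {k} → (Fin k → Carrierᴹ) → Pred Carrierᴹ a → Set a
  IsBasisOf b N = LinearlyIndependent b × N ≐ Span b

  IsFreeOfRank : ℕ → Pred Carrierᴹ a → Set a
  IsFreeOfRank k N = ∃[ b ] IsBasisOf {k} b N

  IsDirectSummand : Pred Carrierᴹ a → Set (lsuc a)
  IsDirectSummand N = Σ (Pred Carrierᴹ a) λ C →
    IsSubmodule C ×
    (∀ x → ∃[ y ] ∃[ z ] N y × C z × x ≈ᴹ y +ᴹ z) ×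
    (∀ x → N x → C x → x ≈ᴹ 0ᴹ)

  -- The endomorphism f acts on the span of b, with matrix A.
  IsMatrixOf : ∀ {k} → (Fin k → Carrierᴹ) → (Carrierᴹ → Carrierᴹ) → Matrices.Matrix K k k → Set a
  IsMatrixOf b f A = ∀ j → f (b j) ≈ᴹ lincomb (λ i → A i j) b

  open CommutativeSemigroupProperties
    (CommutativeMonoid.commutativeSemigroup +ᴹ-commutativeMonoid) using (interchange)

  sumᴹ-cong : ∀ {k} {x y : Fin k → Carrierᴹ} → (∀ i → x i ≈ᴹ y i) → sumᴹ x ≈ᴹ sumᴹ y
  sumᴹ-cong {zero}  p = ≈ᴹ-refl
  sumᴹ-cong {suc k} p = +ᴹ-cong (p Fin.zero) (sumᴹ-cong (p ∘ Fin.suc))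

  span-zero : ∀ {k} (b : Fin k → Carrierᴹ) → 0ᴹ ≈ᴹ lincomb (λ _ → K.0#) b
  span-zero {zero}  b = ≈ᴹ-refl
  span-zero {suc k} b = ≈ᴹ-trans (≈ᴹ-sym (+ᴹ-identityˡ 0ᴹ))
    (+ᴹ-cong (≈ᴹ-sym (*ₗ-zeroˡ _)) (span-zero (b ∘ Fin.suc)))

  span-+ : ∀ {k} (c d : Fin k → K.Carrier) b →
           lincomb c b +ᴹ lincomb d b ≈ᴹ lincomb (λ i → c i K.+ d i) b
  span-+ {zero}  c d b = +ᴹ-identityˡ 0ᴹ
  span-+ {suc k} c d b = ≈ᴹ-trans (interchange _ _ _ _)
    (+ᴹ-cong (≈ᴹ-sym (*ₗ-distribʳ _ _ _)) (span-+ (c ∘ Fin.suc) (d ∘ Fin.suc) (b ∘ Fin.suc)))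

  span-* : ∀ {k} s (c : Fin k → K.Carrier) b → s *ₗ lincomb c b ≈ᴹ lincomb (λ i → s K.* c i) b
  span-* {zero}  s c b = *ₗ-zeroʳ s
  span-* {suc k} s c b = ≈ᴹ-trans (*ₗ-distribˡ s _ _)
    (+ᴹ-cong (≈ᴹ-sym (*ₗ-assoc s _ _)) (span-* s (c ∘ Fin.suc) (b ∘ Fin.suc)))

  Span-isSubmodule : ∀ {k} (b : Fin k → Carrierᴹ) → IsSubmodule (Span b)
  Span-isSubmodule b = record
    { resp  = λ x≈y (c , p) → c , ≈ᴹ-trans (≈ᴹ-sym x≈y) p
    ; zero∈ = _ , span-zero b
    ; +∈    = λ (c , p) (d , q) → _ , ≈ᴹ-trans (+ᴹ-cong p q) (span-+ c d b)
    ; *∈    = λ s (c , p) → _ , ≈ᴹ-trans (*ₗ-cong K.refl p) (span-* s c b)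
    }

  generator-coordinates : ∀ {k} (b : Fin k → Carrierᴹ) i → b i ≈ᴹ lincomb (Matrices.𝟙 K i) b
  generator-coordinates b Fin.zero = ≈ᴹ-sym (≈ᴹ-trans
    (+ᴹ-cong (*ₗ-identityˡ _) (≈ᴹ-sym (span-zero (b ∘ Fin.suc)))) (+ᴹ-identityʳ _))
  generator-coordinates b (Fin.suc i) = ≈ᴹ-sym (≈ᴹ-trans
    (+ᴹ-cong (*ₗ-zeroˡ _) (≈ᴹ-sym (generator-coordinates (b ∘ Fin.suc) i))) (+ᴹ-identityˡ _))

  generator∈Span : ∀ {k} (b : Fin k → Carrierᴹ) i → Span b (b i)
  generator∈Span b i = _ , generator-coordinates b i

  Span-mono : ∀ {k} {b b′ : Fin k → Carrierᴹ} (s : Fin k → K.Carrier) →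
              (∀ i → b i ≈ᴹ s i *ₗ b′ i) → Span b ⊆ Span b′
  Span-mono s p (c , q) = (λ i → c i K.* s i) , ≈ᴹ-trans q
    (sumᴹ-cong λ i → ≈ᴹ-trans (*ₗ-cong K.refl (p i)) (≈ᴹ-sym (*ₗ-assoc _ _ _)))

  submodule : ∀ {N} → IsSubmodule N → Mod K
  submodule {N} isSub = record
    { Carrierᴹ = Σ Carrierᴹ N
    ; _≈ᴹ_ = λ x y → proj₁ x ≈ᴹ proj₁ y
    ; _+ᴹ_ = λ (x , p) (y , q) → x +ᴹ y , +∈ p q
    ; _*ₗ_ = λ k (x , p) → k *ₗ x , *∈ k p
    ; 0ᴹ   = 0ᴹ , zero∈
    ; -ᴹ_  = λ (x , p) → (K.- K.1#) *ₗ x , *∈ (K.- K.1#) p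
    ; isLeftModule = record
      { isLeftSemimodule = record
        { +ᴹ-isCommutativeMonoid = record
          { isMonoid = record
            { isSemigroup = record
              { isMagma = record
                { isEquivalence = record { refl = ≈ᴹ-refl ; sym = ≈ᴹ-sym ; trans = ≈ᴹ-trans }
                ; ∙-cong = +ᴹ-cong
                }
              ; assoc = λ x y z → +ᴹ-assoc _ _ _
              }
            ; identity = (λ x → +ᴹ-identityˡ _) , (λ x → +ᴹ-identityʳ _)
            }
          ; comm = λ x y → +ᴹ-comm _ _
          }
        ; isPreleftSemimodule = record
          { *ₗ-cong      = *ₗ-cong
          ; *ₗ-zeroˡ     = λ x → *ₗ-zeroˡ _
          ; *ₗ-distribʳ  = λ x k l → *ₗ-distribʳ _ _ _
          ; *ₗ-identityˡ = λ x → *ₗ-identityˡ _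
          ; *ₗ-assoc     = λ k l x → *ₗ-assoc _ _ _
          ; *ₗ-zeroʳ     = λ k → *ₗ-zeroʳ k
          ; *ₗ-distribˡ  = λ k x y → *ₗ-distribˡ _ _ _
          }
        }
      ; -ᴹ‿cong    = *ₗ-cong K.refl
      ; -ᴹ‿inverse = (λ (x , _) → inverseˡ x) ,
                     (λ (x , _) → ≈ᴹ-trans (+ᴹ-comm _ _) (inverseˡ x))
      }
    }
    where
    open IsSubmodule isSub
    inverseˡ : ∀ x → (K.- K.1#) *ₗ x +ᴹ x ≈ᴹ 0ᴹ
    inverseˡ x = ≈ᴹ-trans (+ᴹ-cong ≈ᴹ-refl (≈ᴹ-sym (*ₗ-identityˡ x)))
      (≈ᴹ-trans (≈ᴹ-sym (*ₗ-distribʳ _ _ _))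
        (≈ᴹ-trans (*ₗ-cong (K.-‿inverseˡ K.1#) ≈ᴹ-refl) (*ₗ-zeroˡ x)))

restrictScalars : ∀ {a} {K L : CommRing a} → Hom K L → Mod L → Mod K
restrictScalars {L = L} f M = record
  { Carrierᴹ = Carrierᴹ
  ; _≈ᴹ_ = _≈ᴹ_
  ; _+ᴹ_ = _+ᴹ_
  ; _*ₗ_ = λ k x → ⟦ k ⟧ *ₗ x
  ; 0ᴹ   = 0ᴹ
  ; -ᴹ_  = -ᴹ_
  ; isLeftModule = record
    { isLeftSemimodule = record
      { +ᴹ-isCommutativeMonoid = +ᴹ-isCommutativeMonoid
      ; isPreleftSemimodule = record
        { *ₗ-cong      = λ p → *ₗ-cong (⟦⟧-cong p)
        ; *ₗ-zeroˡ     = λ x → ≈ᴹ-trans (*ₗ-cong 0#-homo ≈ᴹ-refl) (*ₗ-zeroˡ x)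
        ; *ₗ-distribʳ  = λ x k l → ≈ᴹ-trans (*ₗ-cong (+-homo k l) ≈ᴹ-refl) (*ₗ-distribʳ x _ _)
        ; *ₗ-identityˡ = λ x → ≈ᴹ-trans (*ₗ-cong 1#-homo ≈ᴹ-refl) (*ₗ-identityˡ x)
        ; *ₗ-assoc     = λ k l x → ≈ᴹ-trans (*ₗ-cong (*-homo k l) ≈ᴹ-refl) (*ₗ-assoc _ _ x)
        ; *ₗ-zeroʳ     = λ k → *ₗ-zeroʳ _
        ; *ₗ-distribˡ  = λ k → *ₗ-distribˡ _
        }
      }
    ; -ᴹ‿cong    = -ᴹ‿cong
    ; -ᴹ‿inverse = -ᴹ‿inverse
    }
  }
  where
  open LeftModule M
  open Hom f

-- The R-module M ⊗_K R.
module TensorProduct {a} {K : CommRing a} (M : Mod K) (R : Algebra K) where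
  private
    module M = LeftModule M
    module R = Algebra R

  infixl 6 _⊞_
  infix  7 _⊗_

  data Tensor : Set a where
    𝟘   : Tensor
    _⊞_ : Tensor → Tensor → Tensor
    _⊗_ : M.Carrierᴹ → R.Carrier → Tensor

  infix 4 _≋_
  data _≋_ : Tensor → Tensor → Set a where
    ≋-refl  : ∀ {x} → x ≋ x
    ≋-sym   : ∀ {x y} → x ≋ y → y ≋ x
    ≋-trans : ∀ {x y z} → x ≋ y → y ≋ z → x ≋ z
    ⊞-cong  : ∀ {x y z w} → x ≋ y → z ≋ w → x ⊞ z ≋ y ⊞ w
    ⊞-assoc : ∀ x y z → (x ⊞ y) ⊞ z ≋ x ⊞ (y ⊞ z)
    ⊞-comm  : ∀ x y → x ⊞ y ≋ y ⊞ x
    ⊞-identityˡ : ∀ x → 𝟘 ⊞ x ≋ x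
    ⊗-cong      : ∀ {m m′ r r′} → m M.≈ᴹ m′ → r R.≈ r′ → m ⊗ r ≋ m′ ⊗ r′
    ⊗-distribʳ  : ∀ m m′ r → (m M.+ᴹ m′) ⊗ r ≋ m ⊗ r ⊞ m′ ⊗ r
    ⊗-distribˡ  : ∀ m r r′ → m ⊗ (r R.+ r′) ≋ m ⊗ r ⊞ m ⊗ r′
    ⊗-zeroʳ     : ∀ m → m ⊗ R.0# ≋ 𝟘
    ⊗-balanced  : ∀ k m r → (k M.*ₗ m) ⊗ r ≋ m ⊗ (R.scalar k R.* r)

  infixr 8 _•_
  _•_ : R.Carrier → Tensor → Tensor
  s • 𝟘       = 𝟘
  s • (x ⊞ y) = s • x ⊞ s • y
  s • (m ⊗ r) = m ⊗ (s R.* r)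

  private
    •-congʳ : ∀ {s s′} x → s R.≈ s′ → s • x ≋ s′ • x
    •-congʳ 𝟘       p = ≋-refl
    •-congʳ (x ⊞ y) p = ⊞-cong (•-congʳ x p) (•-congʳ y p)
    •-congʳ (m ⊗ r) p = ⊗-cong M.≈ᴹ-refl (R.*-congʳ p)

    •-congˡ : ∀ s {x y} → x ≋ y → s • x ≋ s • y
    •-congˡ s ≋-refl              = ≋-refl
    •-congˡ s (≋-sym p)           = ≋-sym (•-congˡ s p)
    •-congˡ s (≋-trans p q)       = ≋-trans (•-congˡ s p) (•-congˡ s q)
    •-congˡ s (⊞-cong p q)        = ⊞-cong (•-congˡ s p) (•-congˡ s q)
    •-congˡ s (⊞-assoc x y z)     = ⊞-assoc _ _ _
    •-congˡ s (⊞-comm x y)        = ⊞-comm _ _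
    •-congˡ s (⊞-identityˡ x)     = ⊞-identityˡ _
    •-congˡ s (⊗-cong p q)        = ⊗-cong p (R.*-congˡ q)
    •-congˡ s (⊗-distribʳ m m′ r) = ⊗-distribʳ m m′ _
    •-congˡ s (⊗-distribˡ m r r′) = ≋-trans (⊗-cong M.≈ᴹ-refl (R.distribˡ s r r′)) (⊗-distribˡ m _ _)
    •-congˡ s (⊗-zeroʳ m)         = ≋-trans (⊗-cong M.≈ᴹ-refl (R.zeroʳ s)) (⊗-zeroʳ m)
    •-congˡ s (⊗-balanced k m r)  = ≋-trans (⊗-balanced k m _) (⊗-cong M.≈ᴹ-refl
      (R.trans (R.sym (R.*-assoc _ _ _)) (R.trans (R.*-congʳ (R.*-comm _ _)) (R.*-assoc _ _ _))))

    •-zeroˡ : ∀ x → R.0# • x ≋ 𝟘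
    •-zeroˡ 𝟘       = ≋-refl
    •-zeroˡ (x ⊞ y) = ≋-trans (⊞-cong (•-zeroˡ x) (•-zeroˡ y)) (⊞-identityˡ 𝟘)
    •-zeroˡ (m ⊗ r) = ≋-trans (⊗-cong M.≈ᴹ-refl (R.zeroˡ r)) (⊗-zeroʳ m)

    ⊞-interchange : ∀ x y z w → (x ⊞ y) ⊞ (z ⊞ w) ≋ (x ⊞ z) ⊞ (y ⊞ w)
    ⊞-interchange x y z w = ≋-trans (⊞-assoc x y _) (≋-trans (⊞-cong ≋-refl
      (≋-trans (≋-sym (⊞-assoc y z w)) (≋-trans (⊞-cong (⊞-comm y z) ≋-refl) (⊞-assoc z y w))))
      (≋-sym (⊞-assoc x z _)))

    •-distribʳ : ∀ x s s′ → (s R.+ s′) • x ≋ s • x ⊞ s′ • x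
    •-distribʳ 𝟘       s s′ = ≋-sym (⊞-identityˡ 𝟘)
    •-distribʳ (x ⊞ y) s s′ = ≋-trans (⊞-cong (•-distribʳ x s s′) (•-distribʳ y s s′)) (⊞-interchange _ _ _ _)
    •-distribʳ (m ⊗ r) s s′ = ≋-trans (⊗-cong M.≈ᴹ-refl (R.distribʳ r s s′)) (⊗-distribˡ m _ _)

    •-identityˡ : ∀ x → R.1# • x ≋ x
    •-identityˡ 𝟘       = ≋-refl
    •-identityˡ (x ⊞ y) = ⊞-cong (•-identityˡ x) (•-identityˡ y)
    •-identityˡ (m ⊗ r) = ⊗-cong M.≈ᴹ-refl (R.*-identityˡ r)

    •-assoc : ∀ s s′ x → (s R.* s′) • x ≋ s • s′ • x
    •-assoc s s′ 𝟘       = ≋-refl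
    •-assoc s s′ (x ⊞ y) = ⊞-cong (•-assoc s s′ x) (•-assoc s s′ y)
    •-assoc s s′ (m ⊗ r) = ⊗-cong M.≈ᴹ-refl (R.*-assoc s s′ r)

    inverseˡ : ∀ x → (R.- R.1#) • x ⊞ x ≋ 𝟘
    inverseˡ x = ≋-trans (⊞-cong ≋-refl (≋-sym (•-identityˡ x)))
      (≋-trans (≋-sym (•-distribʳ x _ _)) (≋-trans (•-congʳ x (R.-‿inverseˡ R.1#)) (•-zeroˡ x)))

  tensorModule : Mod R.commutativeRing
  tensorModule = record
    { Carrierᴹ = Tensor
    ; _≈ᴹ_ = _≋_
    ; _+ᴹ_ = _⊞_
    ; _*ₗ_ = _•_
    ; 0ᴹ   = 𝟘
    ; -ᴹ_  = (R.- R.1#) •_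
    ; isLeftModule = record
      { isLeftSemimodule = record
        { +ᴹ-isCommutativeMonoid = record
          { isMonoid = record
            { isSemigroup = record
              { isMagma = record
                { isEquivalence = record { refl = ≋-refl ; sym = ≋-sym ; trans = ≋-trans }
                ; ∙-cong = ⊞-cong
                }
              ; assoc = ⊞-assoc
              }
            ; identity = ⊞-identityˡ , λ x → ≋-trans (⊞-comm x 𝟘) (⊞-identityˡ x)
            }
          ; comm = ⊞-comm
          }
        ; isPreleftSemimodule = record
          { *ₗ-cong      = λ {s} {s′} {x} {y} p q → ≋-trans (•-congʳ x p) (•-congˡ s′ q)
          ; *ₗ-zeroˡ     = •-zeroˡ
          ; *ₗ-distribʳ  = •-distribʳ
          ; *ₗ-identityˡ = •-identityˡ
          ; *ₗ-assoc     = •-assoc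
          ; *ₗ-zeroʳ     = λ s → ≋-refl
          ; *ₗ-distribˡ  = λ s x y → ≋-refl
          }
        }
      ; -ᴹ‿cong    = •-congˡ _
      ; -ᴹ‿inverse = inverseˡ , λ x → ≋-trans (⊞-comm x _) (inverseˡ x)
      }
    }

module _ {a} {K : CommRing a} where
  open TensorProduct

  -- f ⊗ g on M ⊗ R → N ⊗ S.
  tensorMap : {M N : Mod K} {R S : Algebra K} →
              (LeftModule.Carrierᴹ M → LeftModule.Carrierᴹ N) → (Algebra.Carrier R → Algebra.Carrier S) →
              Tensor M R → Tensor N S
  tensorMap f g 𝟘       = 𝟘
  tensorMap f g (x ⊞ y) = tensorMap f g x ⊞ tensorMap f g y
  tensorMap f g (m ⊗ r) = f m ⊗ g r

  -- The R-bilinear extension of a K-bilinear β : M × N → K.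
  module _ {M N : Mod K} (β : LeftModule.Carrierᴹ M → LeftModule.Carrierᴹ N → CommutativeRing.Carrier K)
           (R : Algebra K) where
    private module R = Algebra R

    extendBilinear : Tensor M R → Tensor N R → R.Carrier
    extendBilinear 𝟘        y        = R.0#
    extendBilinear (x ⊞ x′) y        = extendBilinear x y R.+ extendBilinear x′ y
    extendBilinear (m ⊗ r)  𝟘        = R.0#
    extendBilinear (m ⊗ r)  (y ⊞ y′) = extendBilinear (m ⊗ r) y R.+ extendBilinear (m ⊗ r) y′
    extendBilinear (m ⊗ r)  (n ⊗ s)  = r R.* s R.* R.scalar (β m n)

------------------------------------------------------------------------
-- Zariski-local properties

module _ {a} {K : CommRing a} {R R′ : Algebra K} where
  private
    module R = Algebra R
    module R′ = Algebra R′
    module Rᵖ = Power R.commutativeRing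
    module R′ᵖ = Power R′.commutativeRing

  -- φ : R → R′ exhibits R′ as the localization R[1/f].
  record IsLocalizationAway (φ : AlgHom R R′) (f : R.Carrier) : Set a where
    open AlgHom φ
    field
      invertible : ∃[ g ] ⟦ f ⟧ R′.* g R′.≈ R′.1#
      fractions  : ∀ y → ∃[ x ] ∃[ k ] y R′.* (⟦ f ⟧ R′ᵖ.^ k) R′.≈ ⟦ x ⟧
      kernel     : ∀ x → ⟦ x ⟧ R′.≈ R′.0# → ∃[ k ] (f Rᵖ.^ k) R.* x R.≈ R.0#

ZariskiLocally : ∀ {a p} {K : CommRing a} (R : Algebra K) →
                 ((R′ : Algebra K) → AlgHom R R′ → Set p) → Set (lsuc a ⊔ p)
ZariskiLocally {K = K} R P = ∃[ k ] Σ (Fin k → R.Carrier) λ f →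
  (Σ (Fin k → R.Carrier) λ c → sum (λ i → c i R.* f i) R.≈ R.1#) ×
  (∀ i → Σ (Algebra K) λ R′ → Σ (AlgHom R R′) λ φ → IsLocalizationAway φ (f i) × P R′ φ)
  where
  module R = Algebra R
  open Matrices R.commutativeRing using (sum)

------------------------------------------------------------------------
-- Complete discretely valued fields

infixl 6 _+⁺_
_+⁺_ : ℤ ⁺ → ℤ ⁺ → ℤ ⁺
[ m ] +⁺ [ n ] = [ m ℤ.+ n ]
[ m ] +⁺ ⊤⁺    = ⊤⁺
⊤⁺    +⁺ γ     = ⊤⁺

-- The valuation is normalized; v x = ⊤⁺ encodes v x = ∞.
record CompleteDiscretelyValuedField a : Set (lsuc a) where
  field
    heytingField : HeytingField a a a

  open HeytingField heytingField public

  F₀ : CommRing a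
  F₀ = HeytingCommutativeRing.commutativeRing heytingCommutativeRing

  open RawMonoidOps (CommutativeRing.+-rawMonoid F₀) using () renaming (_×_ to _·_)
  open Power F₀ using (_^_)

  field
    v      : Carrier → ℤ ⁺
    v-cong : ∀ {x y} → x ≈ y → v x ≡ v y
    v-0#   : v 0# ≡ ⊤⁺
    v-⊤    : ∀ {x} → v x ≡ ⊤⁺ → x ≈ 0#
    v-#    : ∀ {x} → v x ≢ ⊤⁺ → x # 0#
    v-*    : ∀ x y → v (x * y) ≡ v x +⁺ v y
    v-+    : ∀ {γ x y} → γ ≤⁺ v x → γ ≤⁺ v y → γ ≤⁺ v (x + y)

    complete : ∀ (s : ℕ → Carrier) →
      (∀ (k : ℤ) → ∃[ N ] ∀ i j → N ℕ.≤ i → N ℕ.≤ j → [ k ] ≤⁺ v (s i - s j)) →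
      ∃[ x ] ∀ (k : ℤ) → ∃[ N ] ∀ i → N ℕ.≤ i → [ k ] ≤⁺ v (s i - x)

    π₀   : Carrier
    v-π₀ : v π₀ ≡ [ 1ℤ ]

    -- The residue field is {v ≥ 0} modulo {v ≥ 1}.
    residueChar≢2 : ¬ [ 1ℤ ] ≤⁺ v (1# + 1#)
    residuePerfect : ∀ p → Prime p → [ 1ℤ ] ≤⁺ v (p · 1#) →
      ∀ x → [ 0ℤ ] ≤⁺ v x → ∃[ y ] [ 0ℤ ] ≤⁺ v y × [ 1ℤ ] ≤⁺ v (x - (y ^ p))

module Integers {a} (𝔽 : CompleteDiscretelyValuedField a) where
  open CompleteDiscretelyValuedField 𝔽
  private
    module F₀ = CommutativeRing F₀
    open RingProperties F₀.ring using (-1*x≈-x; -‿involutive; -0#≈0#)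

  ≤⁺-transport : ∀ {γ δ ε} → δ ≡ ε → γ ≤⁺ δ → γ ≤⁺ ε
  ≤⁺-transport ≡.refl p = p

  v-resp : ∀ {γ x y} → x ≈ y → γ ≤⁺ v x → γ ≤⁺ v y
  v-resp p = ≤⁺-transport (v-cong p)

  π₀≉0 : v π₀ ≢ ⊤⁺
  π₀≉0 p with () ← ≡.trans (≡.sym v-π₀) p

  1≉0 : v 1# ≢ ⊤⁺
  1≉0 p = π₀≉0 (≡.trans (v-cong (F₀.trans (F₀.sym (F₀.*-identityˡ π₀))
    (F₀.trans (F₀.*-congʳ (v-⊤ p)) (F₀.zeroˡ π₀)))) v-0#)

  v-1 : v 1# ≡ [ 0ℤ ]
  v-1 = helper (v 1#) ≡.refl
    where
    double : v 1# ≡ v 1# +⁺ v 1#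
    double = ≡.trans (v-cong (F₀.sym (F₀.*-identityˡ 1#))) (v-* 1# 1#)
    helper : ∀ γ → v 1# ≡ γ → v 1# ≡ [ 0ℤ ]
    helper ⊤⁺    p = ⊥-elim (1≉0 p)
    helper [ k ] p with ≡.subst (λ γ → γ ≡ γ +⁺ γ) p double
    ... | q = ≡.trans p (≡.cong [_] (RingProperties.+-identityˡ-unique ℤₚ.+-*-ring k k (≡.sym (unbox q))))
      where
      unbox : ∀ {m n : ℤ} → _≡_ {A = ℤ ⁺} [ m ] [ n ] → m ≡ n
      unbox ≡.refl = ≡.refl

  v-neg1 : [ 0ℤ ] ≤⁺ v (- 1#)
  v-neg1 = helper (v (- 1#)) ≡.refl
    where
    square : v (- 1#) +⁺ v (- 1#) ≡ [ 0ℤ ]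
    square = ≡.trans (≡.sym (v-* _ _))
      (≡.trans (v-cong (F₀.trans (-1*x≈-x (- 1#)) (-‿involutive 1#))) v-1)
    nonneg : ∀ k → _≡_ {A = ℤ ⁺} [ k ℤ.+ k ] [ 0ℤ ] → 0ℤ ℤ.≤ k
    nonneg (ℤ.+ k) p = ℤ.+≤+ ℕ.z≤n
    helper : ∀ γ → v (- 1#) ≡ γ → [ 0ℤ ] ≤⁺ v (- 1#)
    helper ⊤⁺    p = ≤⁺-transport (≡.sym p) (_ ≤⊤⁺)
    helper [ k ] p = ≤⁺-transport (≡.sym p)
      [ nonneg k (≡.subst (λ γ → γ +⁺ γ ≡ [ 0ℤ ]) p square) ]

  +⁺-nonneg : ∀ {γ δ} → [ 0ℤ ] ≤⁺ γ → [ 0ℤ ] ≤⁺ δ → [ 0ℤ ] ≤⁺ γ +⁺ δ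
  +⁺-nonneg [ p ]    [ q ]    = [ ℤₚ.+-mono-≤ p q ]
  +⁺-nonneg [ p ]    (_ ≤⊤⁺)  = _ ≤⊤⁺
  +⁺-nonneg (_ ≤⊤⁺)  q        = _ ≤⊤⁺

  Integral : Carrier → Set
  Integral x = [ 0ℤ ] ≤⁺ v x

  integral-resp : ∀ {x y} → x ≈ y → Integral x → Integral y
  integral-resp = v-resp

  integral-0 : Integral 0#
  integral-0 = ≤⁺-transport (≡.sym v-0#) (_ ≤⊤⁺)

  integral-* : ∀ {x y} → Integral x → Integral y → Integral (x * y)
  integral-* p q = ≤⁺-transport (≡.sym (v-* _ _)) (+⁺-nonneg p q)

  integral-neg : ∀ {x} → Integral x → Integral (- x)
  integral-neg {x} p = v-resp (-1*x≈-x x) (integral-* v-neg1 p)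

  inverse : ∀ x → v x ≢ ⊤⁺ → Carrier
  inverse x p = proj₁ (#⇒invertible (v-# p))

  inverse-rightInverse : ∀ x p → x * inverse x p ≈ 1#
  inverse-rightInverse x p = F₀.trans
    (F₀.*-congʳ (F₀.sym (F₀.trans (F₀.+-congˡ -0#≈0#) (F₀.+-identityʳ x))))
    (proj₂ (proj₂ (#⇒invertible (v-# p))))

  2≉0 : v (1# + 1#) ≢ ⊤⁺
  2≉0 p = residueChar≢2 (≤⁺-transport (≡.sym p) (_ ≤⊤⁺))

  ½ π₀⁻¹ : Carrier
  ½    = inverse (1# + 1#) 2≉0
  π₀⁻¹ = inverse π₀ π₀≉0

  -- O_{F₀}.
  O₀ : CommRing a
  O₀ = record { isCommutativeRing = RingMonomorphism.isCommutativeRing monomorphism F₀.isCommutativeRing }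
    where
    raw : RawRing a a
    raw = record
      { Carrier = Σ Carrier Integral
      ; _≈_ = λ x y → proj₁ x ≈ proj₁ y
      ; _+_ = λ (x , p) (y , q) → x + y , v-+ p q
      ; _*_ = λ (x , p) (y , q) → x * y , integral-* p q
      ; -_  = λ (x , p) → - x , integral-neg p
      ; 0#  = 0# , integral-0
      ; 1#  = 1# , ≤⁺-transport (≡.sym v-1) [ ℤₚ.≤-refl ]
      }
    monomorphism : IsRingMonomorphism raw F₀.rawRing proj₁
    monomorphism = record
      { isRingHomomorphism = record
        { isSemiringHomomorphism = record
          { isNearSemiringHomomorphism = record
            { +-isMonoidHomomorphism = record
              { isMagmaHomomorphism = record
                { isRelHomomorphism = record { cong = λ p → p }
                ; homo = λ x y → F₀.refl
                }
              ; ε-homo = F₀.refl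
              }
            ; *-homo = λ x y → F₀.refl
            }
          ; 1#-homo = F₀.refl
          }
        ; -‿homo = λ x → F₀.refl
        }
      ; injective = λ p → p
      }

  O₀⊂F₀ : Hom O₀ F₀
  O₀⊂F₀ = record
    { ⟦_⟧ = proj₁
    ; isRingHomomorphism = record
      { isSemiringHomomorphism = record
        { isNearSemiringHomomorphism = record
          { +-isMonoidHomomorphism = record
            { isMagmaHomomorphism = record
              { isRelHomomorphism = record { cong = λ p → p }
              ; homo = λ x y → F₀.refl
              }
            ; ε-homo = F₀.refl
            }
          ; *-homo = λ x y → F₀.refl
          }
        ; 1#-homo = F₀.refl
        }
      ; -‿homo = λ x → F₀.refl
      }
    }

  π₀ᴼ : CommutativeRing.Carrier O₀
  π₀ᴼ = π₀ , ≤⁺-transport (≡.sym v-π₀) [ ℤ.+≤+ ℕ.z≤n ]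

  -- F = F₀[√π₀].  As π₀ is a uniformizer, T² - π₀ is an Eisenstein polynomial, and so
  -- the ring of integers O of F is O₀[√π₀].
  F O : CommRing a
  F = AdjoinSqrt F₀ π₀
  O = AdjoinSqrt O₀ π₀ᴼ

  O₀⊂O : Hom O₀ O
  O₀⊂O = adjoinSqrt-inclusion O₀ π₀ᴼ

  O⊂F : Hom O F
  O⊂F = adjoinSqrt-map O₀⊂F₀ {π₀ᴼ} F₀.refl

  private
    module F = CommutativeRing F
    module O = CommutativeRing O

  πᴼ : O.Carrier
  πᴼ = CommutativeRing.0# O₀ , CommutativeRing.1# O₀

  π⁻¹ : F.Carrier
  π⁻¹ = 0# , π₀⁻¹

  conj : F.Carrier → F.Carrier
  conj (x , y) = x , - y

  Tr : F.Carrier → Carrier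
  Tr x = proj₁ (x F.+ conj x)

------------------------------------------------------------------------
-- Split hermitian spaces and their lattices

record SplitHermitianSpace {a} (𝔽 : CompleteDiscretelyValuedField a) (n : ℕ) : Set (lsuc a) where
  open Integers 𝔽 using (F; conj)
  private module F = CommutativeRing F
  open Matrices F using (𝟙)
  field
    V : Mod F
  open LeftModule V public
  open LinearAlgebra F V public
  field
    φ       : Carrierᴹ → Carrierᴹ → F.Carrier
    φ-cong  : ∀ {x x′ y y′} → x ≈ᴹ x′ → y ≈ᴹ y′ → φ x y F.≈ φ x′ y′
    φ-+ˡ    : ∀ x x′ y → φ (x +ᴹ x′) y F.≈ φ x y F.+ φ x′ y
    φ-+ʳ    : ∀ x y y′ → φ x (y +ᴹ y′) F.≈ φ x y F.+ φ x y′
    φ-*     : ∀ k l x y → φ (k *ₗ x) (l *ₗ y) F.≈ conj k F.* l F.* φ x y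
    φ-conj  : ∀ x y → φ y x F.≈ conj (φ x y)

    e       : Fin n → Carrierᴹ
    e-basis : LinearlyIndependent e × (∀ x → Span e x)
    -- Indices start at 0, so that opposite j stands for n + 1 - j.
    e-split : ∀ k l i j → φ (k *ₗ e i) (l *ₗ e (opposite j)) F.≈ conj k F.* l F.* 𝟙 i j

record StronglyNonSpecial (n ℓ : ℕ) : Set where
  m : ℕ
  m = ⌊ n /2⌋
  field
    ℓ≤m  : ℓ ℕ.≤ m
    even : n ≡ 2 ℕ.* m → ℓ ≢ 0 × ℓ ≢ m ∸ 1 × ℓ ≢ m
    odd  : n ≡ 2 ℕ.* m ℕ.+ 1 → ℓ ≢ 0 × ℓ ≢ m

  2ℓ≤n : 2 ℕ.* ℓ ℕ.≤ n
  2ℓ≤n = ℕₚ.≤-trans (ℕₚ.*-monoʳ-≤ 2 ℓ≤m)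
    (ℕₚ.≤-trans (ℕₚ.≤-reflexive (≡.cong (m ℕ.+_) (ℕₚ.+-identityʳ m)))
      (ℕₚ.≤-trans (ℕₚ.+-monoʳ-≤ m (ℕₚ.⌊n/2⌋≤⌈n/2⌉ n)) (ℕₚ.≤-reflexive (ℕₚ.⌊n/2⌋+⌈n/2⌉≡n n))))

  ℓ≤n : ℓ ℕ.≤ n
  ℓ≤n = ℕₚ.≤-trans (ℕₚ.m≤m+n ℓ _) 2ℓ≤n

  ℓ≤n∸ℓ : ℓ ℕ.≤ n ∸ ℓ
  ℓ≤n∸ℓ = ≡.subst (ℕ._≤ n ∸ ℓ) (ℕₚ.m+n∸m≡n ℓ ℓ)
    (ℕₚ.∸-monoˡ-≤ ℓ (ℕₚ.≤-trans (ℕₚ.≤-reflexive (≡.cong (ℓ ℕ.+_) (≡.sym (ℕₚ.+-identityʳ ℓ)))) 2ℓ≤n))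

module Lattices {a} {𝔽 : CompleteDiscretelyValuedField a} {n : ℕ} (H : SplitHermitianSpace 𝔽 n) where
  open CompleteDiscretelyValuedField 𝔽 using (Carrier; _*_; _≈_; v-+; π₀; F₀)
  open Integers 𝔽
  open SplitHermitianSpace H
  private
    module F₀ = CommutativeRing F₀
    module F = CommutativeRing F
    module O = CommutativeRing O
    module O⊂F = Hom O⊂F

  Vᴼ : Mod O
  Vᴼ = restrictScalars O⊂F V

  private module Vᴼ = LinearAlgebra O Vᴼ

  infix 4 _∈Λ[_]
  _∈Λ[_] : Carrierᴹ → (Fin n → Carrierᴹ) → Set a
  x ∈Λ[ g ] = Vᴼ.Span g x

  -- The O-lattice spanned by g.
  Λ[_] : (Fin n → Carrierᴹ) → Mod O
  Λ[ g ] = Vᴼ.submodule (Vᴼ.Span-isSubmodule g)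

  Λ₀[_] : (Fin n → Carrierᴹ) → Mod O₀
  Λ₀[ g ] = restrictScalars O₀⊂O Λ[ g ]

  -- Λᵢ is Λ[ gen i ].
  gen : ℕ → Fin n → Carrierᴹ
  gen i j = if does (toℕ j ℕₚ.<? i) then π⁻¹ *ₗ e j else e j

  ⟨_,_⟩ : Carrierᴹ → Carrierᴹ → Carrier
  ⟨ x , y ⟩ = ½ * Tr (φ x y)

  ππ⁻¹≈1 : O⊂F.⟦ πᴼ ⟧ F.* π⁻¹ F.≈ F.1#
  ππ⁻¹≈1 =
    F₀.trans (F₀.+-cong (F₀.zeroˡ _) (F₀.trans (F₀.*-congˡ (F₀.*-identityˡ _)) (inverse-rightInverse π₀ _)))
      (F₀.+-identityˡ _) ,
    F₀.trans (F₀.+-cong (F₀.zeroˡ _) (F₀.zeroʳ _)) (F₀.+-identityˡ _)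

  ππ⁻¹x≈x : ∀ x → O⊂F.⟦ πᴼ ⟧ *ₗ π⁻¹ *ₗ x ≈ᴹ x
  ππ⁻¹x≈x x = ≈ᴹ-trans (≈ᴹ-sym (*ₗ-assoc _ _ x)) (≈ᴹ-trans (*ₗ-cong ππ⁻¹≈1 ≈ᴹ-refl) (*ₗ-identityˡ x))

  1x≈x : ∀ x → O⊂F.⟦ O.1# ⟧ *ₗ x ≈ᴹ x
  1x≈x x = ≈ᴹ-trans (*ₗ-cong O⊂F.1#-homo ≈ᴹ-refl) (*ₗ-identityˡ x)

  gen-< : ∀ {i j} → toℕ j ℕ.< i → gen i j ≡ π⁻¹ *ₗ e j
  gen-< {i} {j} p = ≡.cong (if_then π⁻¹ *ₗ e j else e j) (dec-true (toℕ j ℕₚ.<? i) p)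

  gen-≮ : ∀ {i j} → ¬ toℕ j ℕ.< i → gen i j ≡ e j
  gen-≮ {i} {j} ¬p = ≡.cong (if_then π⁻¹ *ₗ e j else e j) (dec-false (toℕ j ℕₚ.<? i) ¬p)

  gen-⊂ : ∀ {i i′} → i ℕ.≤ i′ → ∀ {x} → x ∈Λ[ gen i ] → x ∈Λ[ gen i′ ]
  gen-⊂ {i} {i′} i≤i′ = Vᴼ.Span-mono (λ j → proj₁ (factor j)) (λ j → proj₂ (factor j))
    where
    factor : ∀ j → ∃[ s ] gen i j ≈ᴹ O⊂F.⟦ s ⟧ *ₗ gen i′ j
    factor j with toℕ j ℕₚ.<? i | toℕ j ℕₚ.<? i′
    ... | yes p | yes q rewrite gen-< {i} {j} p | gen-< {i′} {j} q = O.1# , ≈ᴹ-sym (1x≈x _)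
    ... | yes p | no ¬q = ⊥-elim (¬q (ℕₚ.<-≤-trans p i≤i′))
    ... | no ¬p | yes q rewrite gen-≮ {i} {j} ¬p | gen-< {i′} {j} q = πᴼ , ≈ᴹ-sym (ππ⁻¹x≈x _)
    ... | no ¬p | no ¬q rewrite gen-≮ {i} {j} ¬p | gen-≮ {i′} {j} ¬q = O.1# , ≈ᴹ-sym (1x≈x _)

  ⊂-π⁻¹gen : ∀ {i i′} → i ℕ.≤ i′ → ∀ {x} → x ∈Λ[ gen i′ ] → x ∈Λ[ (λ j → π⁻¹ *ₗ gen i j) ]
  ⊂-π⁻¹gen {i} {i′} i≤i′ = Vᴼ.Span-mono (λ j → proj₁ (factor j)) (λ j → proj₂ (factor j))
    where
    factor : ∀ j → ∃[ s ] gen i′ j ≈ᴹ O⊂F.⟦ s ⟧ *ₗ π⁻¹ *ₗ gen i j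
    factor j with toℕ j ℕₚ.<? i | toℕ j ℕₚ.<? i′
    ... | yes p | yes q rewrite gen-< {i} {j} p | gen-< {i′} {j} q = πᴼ , ≈ᴹ-sym (ππ⁻¹x≈x _)
    ... | yes p | no ¬q = ⊥-elim (¬q (ℕₚ.<-≤-trans p i≤i′))
    ... | no ¬p | yes q rewrite gen-≮ {i} {j} ¬p | gen-< {i′} {j} q = O.1# , ≈ᴹ-sym (1x≈x _)
    ... | no ¬p | no ¬q rewrite gen-≮ {i} {j} ¬p | gen-≮ {i′} {j} ¬q = πᴼ , ≈ᴹ-sym (ππ⁻¹x≈x _)

  π⁻¹-scale : ∀ {g x} → x ∈Λ[ g ] → π⁻¹ *ₗ x ∈Λ[ (λ j → π⁻¹ *ₗ g j) ]
  π⁻¹-scale {g} (c , p) = c , ≈ᴹ-trans (*ₗ-cong F.refl p) (scale c g)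
    where
    scale : ∀ {k} (c : Fin k → O.Carrier) g → π⁻¹ *ₗ Vᴼ.lincomb c g ≈ᴹ Vᴼ.lincomb c (λ j → π⁻¹ *ₗ g j)
    scale {zero}  c g = *ₗ-zeroʳ π⁻¹
    scale {suc k} c g = ≈ᴹ-trans (*ₗ-distribˡ π⁻¹ _ _) (+ᴹ-cong
      (≈ᴹ-trans (≈ᴹ-sym (*ₗ-assoc _ _ _))
        (≈ᴹ-trans (*ₗ-cong (F.*-comm π⁻¹ O⊂F.⟦ c Fin.zero ⟧) ≈ᴹ-refl) (*ₗ-assoc _ _ _)))
      (scale (c ∘ Fin.suc) (g ∘ Fin.suc)))

  private
    open RingProperties F₀.ring using (-‿distribˡ-*)
    open RingProperties F.ring using () renaming (+-identityˡ-unique to F-identityˡ-unique)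

    ½Tr : ∀ z → ½ * Tr z ≈ proj₁ z
    ½Tr (x , _) = F₀.trans (F₀.*-congˡ (F₀.trans
      (F₀.+-cong (F₀.sym (F₀.*-identityˡ x)) (F₀.sym (F₀.*-identityˡ x))) (F₀.sym (F₀.distribʳ x _ _))))
      (F₀.trans (F₀.sym (F₀.*-assoc _ _ _)) (F₀.trans (F₀.*-congʳ
        (F₀.trans (F₀.*-comm _ _) (inverse-rightInverse _ 2≉0))) (F₀.*-identityˡ x)))

    IntegralRe : F.Carrier → Set
    IntegralRe z = Integral (proj₁ z)

    resp : ∀ {z w} → z F.≈ w → IntegralRe z → IntegralRe w
    resp (p , _) = integral-resp p

    φ-sumˡ : ∀ {k} (x : Fin k → Carrierᴹ) y → (∀ i → IntegralRe (φ (x i) y)) → IntegralRe (φ (sumᴹ x) y)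
    φ-sumˡ {zero}  x y _ = resp (F.sym (F-identityˡ-unique _ _
      (F.trans (F.sym (φ-+ˡ 0ᴹ 0ᴹ y)) (φ-cong (+ᴹ-identityˡ 0ᴹ) ≈ᴹ-refl)))) integral-0
    φ-sumˡ {suc k} x y p = resp (F.sym (φ-+ˡ _ _ y)) (v-+ (p Fin.zero) (φ-sumˡ (x ∘ Fin.suc) y (p ∘ Fin.suc)))

    φ-sumʳ : ∀ {k} x (y : Fin k → Carrierᴹ) → (∀ i → IntegralRe (φ x (y i))) → IntegralRe (φ x (sumᴹ y))
    φ-sumʳ {zero}  x y _ = resp (F.sym (F-identityˡ-unique _ _
      (F.trans (F.sym (φ-+ʳ x 0ᴹ 0ᴹ)) (φ-cong ≈ᴹ-refl (+ᴹ-identityˡ 0ᴹ))))) integral-0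
    φ-sumʳ {suc k} x y p = resp (F.sym (φ-+ʳ x _ _)) (v-+ (p Fin.zero) (φ-sumʳ x (y ∘ Fin.suc) (p ∘ Fin.suc)))

    cπ⁻¹ : ∀ c → O⊂F.⟦ c ⟧ F.* π⁻¹ F.≈ (proj₁ (proj₂ c) , proj₁ (proj₁ c) * π₀⁻¹)
    cπ⁻¹ ((x , _) , (y , _)) =
      F₀.trans (F₀.+-cong (F₀.zeroʳ x) (cancel y)) (F₀.+-identityˡ y) ,
      F₀.trans (F₀.+-congˡ (F₀.zeroʳ y)) (F₀.+-identityʳ _)
      where
      cancel : ∀ y → π₀ * (y * π₀⁻¹) ≈ y
      cancel y = F₀.trans (F₀.*-congˡ (F₀.*-comm y _)) (F₀.trans (F₀.sym (F₀.*-assoc _ _ _))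
        (F₀.trans (F₀.*-congʳ (inverse-rightInverse π₀ _)) (F₀.*-identityˡ y)))

    conj-cong : ∀ {z w} → z F.≈ w → conj z F.≈ conj w
    conj-cong (p , q) = p , F₀.-‿cong q

    cancel-neg : ∀ x y → π₀ * (F₀.- (x * π₀⁻¹) * y) ≈ F₀.- (x * y)
    cancel-neg x y = F₀.trans (F₀.*-congˡ (F₀.sym (-‿distribˡ-* _ y)))
      (F₀.trans (F₀.sym (RingProperties.-‿distribʳ-* F₀.ring π₀ _)) (F₀.-‿cong
        (F₀.trans (F₀.*-congˡ (F₀.trans (F₀.*-congʳ (F₀.*-comm x _)) (F₀.*-assoc _ x y)))
          (F₀.trans (F₀.sym (F₀.*-assoc _ _ _))
            (F₀.trans (F₀.*-congʳ (inverse-rightInverse π₀ _)) (F₀.*-identityˡ _))))))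

    -- conj (c π⁻¹) d and conj c (d π⁻¹) have integral first coordinate.
    integralˡ : ∀ c d → IntegralRe (conj (O⊂F.⟦ c ⟧ F.* π⁻¹) F.* O⊂F.⟦ d ⟧)
    integralˡ c@((x , px) , (y , py)) d@((z , pz) , (w , pw)) =
      resp (F.*-cong (conj-cong (F.sym (cπ⁻¹ c))) (F.refl {O⊂F.⟦ d ⟧}))
        (v-+ (integral-* py pz) (integral-resp (F₀.sym (cancel-neg x w)) (integral-neg (integral-* px pw))))

    integralʳ : ∀ c d → IntegralRe (conj O⊂F.⟦ c ⟧ F.* (O⊂F.⟦ d ⟧ F.* π⁻¹))
    integralʳ c@((x , px) , (y , py)) d@((z , pz) , (w , pw)) =
      resp (F.*-congˡ {conj O⊂F.⟦ c ⟧} (F.sym (cπ⁻¹ d)))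
        (v-+ (integral-* px pw)
          (integral-resp (F₀.sym (F₀.trans (F₀.*-congˡ swap) (cancel-neg z y))) (integral-neg (integral-* pz py))))
      where
      swap : F₀.- y * (z * π₀⁻¹) ≈ F₀.- (z * π₀⁻¹) * y
      swap = F₀.trans (F₀.sym (-‿distribˡ-* y _)) (F₀.trans (F₀.-‿cong (F₀.*-comm y _)) (-‿distribˡ-* _ y))

    φ-integral-e : ∀ k l i j → (i ≡ opposite j → IntegralRe (conj k F.* l)) →
                   IntegralRe (φ (k *ₗ e i) (l *ₗ e j))
    φ-integral-e k l i j p = resp
      (F.trans (F.sym (e-split k l i (opposite j)))
        (F.reflexive (≡.cong (λ j → φ (k *ₗ e i) (l *ₗ e j)) (Finₚ.opposite-involutive j))))
      (δ (i Finₚ.≟ opposite j))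
      where
      open Matrices F using (𝟙)
      δ : ∀ (d : Dec (i ≡ opposite j)) →
          IntegralRe (conj k F.* l F.* (if does d then F.1# else F.0#))
      δ (yes i≡j′) = resp (F.sym (F.*-identityʳ _)) (p i≡j′)
      δ (no  _)    = resp (F.sym (F.zeroʳ (conj k F.* l))) integral-0

    φ-integral-gen : ∀ {ℓ} → ℓ ℕ.≤ n → ∀ c d i j →
      IntegralRe (φ (O⊂F.⟦ c ⟧ *ₗ gen (n ∸ ℓ) i) (O⊂F.⟦ d ⟧ *ₗ gen ℓ j))
    φ-integral-gen {ℓ} ℓ≤n c d i j with toℕ i ℕₚ.<? n ∸ ℓ | toℕ j ℕₚ.<? ℓ
    ... | yes p | yes q rewrite gen-< {n ∸ ℓ} {i} p | gen-< {ℓ} {j} q =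
      resp (φ-cong (*ₗ-assoc _ _ _) (*ₗ-assoc _ _ _)) (φ-integral-e _ _ i j λ { ≡.refl →
        ⊥-elim (ℕₚ.<⇒≱ (≡.subst (ℕ._< n ∸ ℓ) (Finₚ.opposite-prop j) p) (ℕₚ.∸-monoʳ-≤ n q)) })
    ... | yes p | no ¬q rewrite gen-< {n ∸ ℓ} {i} p | gen-≮ {ℓ} {j} ¬q =
      resp (φ-cong (*ₗ-assoc _ _ _) ≈ᴹ-refl) (φ-integral-e _ _ i j λ _ → integralˡ c d)
    ... | no ¬p | yes q rewrite gen-≮ {n ∸ ℓ} {i} ¬p | gen-< {ℓ} {j} q =
      resp (φ-cong ≈ᴹ-refl (*ₗ-assoc _ _ _)) (φ-integral-e _ _ i j λ _ → integralʳ c d)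
    ... | no ¬p | no ¬q rewrite gen-≮ {n ∸ ℓ} {i} ¬p | gen-≮ {ℓ} {j} ¬q =
      φ-integral-e _ _ i j λ { ≡.refl →
        ⊥-elim (¬p (≡.subst (ℕ._< n ∸ ℓ) (≡.sym (Finₚ.opposite-prop j))
          (ℕₚ.∸-monoʳ-< (ℕ.s≤s (ℕₚ.≮⇒≥ ¬q)) (toℕ<n j)))) }

  ⟨,⟩-integral : ∀ {ℓ} → ℓ ℕ.≤ n → ∀ {x y} → x ∈Λ[ gen (n ∸ ℓ) ] → y ∈Λ[ gen ℓ ] → Integral ⟨ x , y ⟩
  ⟨,⟩-integral ℓ≤n {x} {y} (c , p) (d , q) = integral-resp (F₀.sym (½Tr (φ x y)))
    (resp (φ-cong (≈ᴹ-sym p) (≈ᴹ-sym q))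
      (φ-sumˡ _ _ λ i → φ-sumʳ _ _ λ j → φ-integral-gen ℓ≤n (c i) (d j) i j))

  -- The form ⟨_,_⟩ as a pairing Λ_{n-ℓ} × Λ_ℓ → O₀.
  pairing : ∀ {ℓ} → ℓ ℕ.≤ n → LeftModule.Carrierᴹ Λ₀[ gen (n ∸ ℓ) ] → LeftModule.Carrierᴹ Λ₀[ gen ℓ ] →
            CommutativeRing.Carrier O₀
  pairing ℓ≤n (x , p) (y , q) = ⟨ x , y ⟩ , ⟨,⟩-integral ℓ≤n p q

------------------------------------------------------------------------
-- The splitting model and its charts, on affine O-schemes

module SplittingModel {a} {𝔽 : CompleteDiscretelyValuedField a} {n ℓ : ℕ}
                      (H : SplitHermitianSpace 𝔽 n) (ℓ-sns : StronglyNonSpecial n ℓ) where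
  open Integers 𝔽
  open SplitHermitianSpace H using (Carrierᴹ; _*ₗ_)
  open StronglyNonSpecial ℓ-sns using (ℓ≤n; ℓ≤n∸ℓ)
  open Lattices H
  private
    module O = CommutativeRing O

  Family : Set a
  Family = Fin n → Carrierᴹ

  gℓ gₙ₋ℓ π⁻¹gℓ : Family
  gℓ      = gen ℓ
  gₙ₋ℓ    = gen (n ∸ ℓ)
  π⁻¹gℓ j = π⁻¹ *ₗ gen ℓ j

  Element : Family → Set a
  Element g = LeftModule.Carrierᴹ Λ₀[ g ]

  inclusion₁ : Element gℓ → Element gₙ₋ℓ
  inclusion₁ (x , p) = x , gen-⊂ ℓ≤n∸ℓ p

  inclusion₂ : Element gₙ₋ℓ → Element π⁻¹gℓ
  inclusion₂ (x , p) = x , ⊂-π⁻¹gen ℓ≤n∸ℓ p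

  scaleByπ⁻¹ : Element gℓ → Element π⁻¹gℓ
  scaleByπ⁻¹ (x , p) = π⁻¹ *ₗ x , π⁻¹-scale p

  module _ (R : Algebra O) where
    private module R = Algebra R

    R₀ : Algebra O₀
    R₀ = restrictAlgebra O₀⊂O R

    Λ_⊗ : Family → Set a
    Λ g ⊗ = TensorProduct.Tensor Λ₀[ g ] R₀

    Λ⊗-module : Family → Mod R.commutativeRing
    Λ⊗-module g = TensorProduct.tensorModule Λ₀[ g ] R₀

    πᴿ : R.Carrier
    πᴿ = R.scalar πᴼ

  mapΛ : ∀ R g g′ → (Element g → Element g′) → Λ_⊗ R g → Λ_⊗ R g′
  mapΛ R g g′ f = tensorMap {M = Λ₀[ g ]} {N = Λ₀[ g′ ]} {R = R₀ R} {S = R₀ R} f (λ r → r)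

  t : ∀ R g → Λ_⊗ R g → Λ_⊗ R g
  t R g = mapΛ R g g (LeftModule._*ₗ_ Λ[ g ] πᴼ)

  -- t + π and t - π, where π acts through R.
  t+π t-π : ∀ R g → Λ_⊗ R g → Λ_⊗ R g
  t+π R g x = t R g x +ᴹ πᴿ R *ᴿ x
    where open LeftModule (Λ⊗-module R g) renaming (_*ₗ_ to _*ᴿ_)
  t-π R g x = t R g x +ᴹ -ᴹ (πᴿ R *ᴿ x)
    where open LeftModule (Λ⊗-module R g) renaming (_*ₗ_ to _*ᴿ_)

  -- An O ⊗ R-submodule, as O = O₀[π].
  record IsO⊗RSubmodule R g (N : Pred (Λ_⊗ R g) a) : Set a where
    field
      isSubmodule : LinearAlgebra.IsSubmodule (Algebra.commutativeRing R) (Λ⊗-module R g) N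
      t∈          : ∀ {x} → N x → N (t R g x)

  -- For an R-submodule N of Λ ⊗ R, the submodule of Λ ⊗ R′ generated by its image.
  baseChange : ∀ {R R′} → AlgHom R R′ → ∀ g → Pred (Λ_⊗ R g) a → Pred (Λ_⊗ R′ g) a
  baseChange {R} {R′} φ g N y = ∃[ k ] Σ (Fin k → Λ_⊗ R g) λ x → (∀ i → N (x i)) × Span (image ∘ x) y
    where
    open LinearAlgebra (Algebra.commutativeRing R′) (Λ⊗-module R′ g) using (Span)
    image : Λ_⊗ R g → Λ_⊗ R′ g
    image = tensorMap {M = Λ₀[ g ]} {N = Λ₀[ g ]} {R = R₀ R} {S = R₀ R′} (λ m → m) (AlgHom.⟦_⟧ φ)

  -- N is Zariski locally a direct summand that is free of rank k.
  IsLocalSummandOfRank : ∀ R g → ℕ → Pred (Λ_⊗ R g) a → Set (lsuc a)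
  IsLocalSummandOfRank R g k N = ZariskiLocally R λ R′ φ →
    let open LinearAlgebra (Algebra.commutativeRing R′) (Λ⊗-module R′ g)
    in IsFreeOfRank k (baseChange φ g N) × IsDirectSummand (baseChange φ g N)

  -- Zariski locally, N has a basis of k elements in which the matrix of the endomorphism
  -- f satisfies Q.  The Q used below do not depend on the choice of basis.
  LocalMatrix : ∀ R g (k : ℕ) → Pred (Λ_⊗ R g) a → (∀ R′ → Λ_⊗ R′ g → Λ_⊗ R′ g) →
                (∀ R′ → Matrices.Matrix (Algebra.commutativeRing R′) k k → Set a) → Set (lsuc a)
  LocalMatrix R g k N f Q = ZariskiLocally R λ R′ φ →
    let open LinearAlgebra (Algebra.commutativeRing R′) (Λ⊗-module R′ g)
    in ∃[ b ] IsBasisOf {k} b (baseChange φ g N) × ∃[ A ] IsMatrixOf b (f R′) A × Q R′ A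

  -- t has characteristic polynomial (T + π)ⁿ⁻¹(T - π) on N.
  HasCharpoly : ∀ R g → Pred (Λ_⊗ R g) a → Set (lsuc a)
  HasCharpoly R g N = LocalMatrix R g n N (λ R′ → t R′ g) λ R′ A →
    let R′[T] = PolynomialRing (Algebra.commutativeRing R′) 𝕋
        open CharacteristicPolynomial (Algebra.commutativeRing R′)
        open CommutativeRing R′[T] using (_+_; _-_; _*_)
        open Power R′[T] using (_^_)
    in charpoly A ≈ᵀ ((var T + con (πᴿ R′)) ^ (n ∸ 1)) * (var T - con (πᴿ R′))

  -- ∧ᵏ(f | N) = 0.
  WedgeVanishes : ∀ R g → ℕ → (∀ R′ → Λ_⊗ R′ g → Λ_⊗ R′ g) → Pred (Λ_⊗ R g) a → Set (lsuc a)
  WedgeVanishes R g k f N = LocalMatrix R g n N f λ R′ A →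
    let open Matrices (Algebra.commutativeRing R′) in ⋀ k VanishesOn A

  record IsNaivePoint R (ℱℓ : Pred (Λ_⊗ R gℓ) a) (ℱₙ₋ℓ : Pred (Λ_⊗ R gₙ₋ℓ) a) : Set (lsuc a) where
    private module R = Algebra R
    field
      submoduleℓ     : IsO⊗RSubmodule R gℓ ℱℓ
      submoduleₙ₋ℓ   : IsO⊗RSubmodule R gₙ₋ℓ ℱₙ₋ℓ
      summandℓ       : IsLocalSummandOfRank R gℓ n ℱℓ
      summandₙ₋ℓ     : IsLocalSummandOfRank R gₙ₋ℓ n ℱₙ₋ℓ
      restricts₁     : ∀ x → ℱℓ x → ℱₙ₋ℓ (mapΛ R gℓ gₙ₋ℓ inclusion₁ x)
      restricts₂     : ∀ x → ℱₙ₋ℓ x → ∃[ y ] ℱℓ y ×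
                         TensorProduct._≋_ Λ₀[ π⁻¹gℓ ] (R₀ R)
                           (mapΛ R gₙ₋ℓ π⁻¹gℓ inclusion₂ x) (mapΛ R gℓ π⁻¹gℓ scaleByπ⁻¹ y)
      orthogonal     : ∀ x → ℱₙ₋ℓ x ⇔ (∀ y → ℱℓ y →
                         extendBilinear {M = Λ₀[ gₙ₋ℓ ]} {N = Λ₀[ gℓ ]} (pairing ℓ≤n) (R₀ R) x y R.≈ R.0#)
      charpolyℓ      : HasCharpoly R gℓ ℱℓ
      charpolyₙ₋ℓ    : HasCharpoly R gₙ₋ℓ ℱₙ₋ℓ

  record IsWedgePoint R (ℱℓ : Pred (Λ_⊗ R gℓ) a) (ℱₙ₋ℓ : Pred (Λ_⊗ R gₙ₋ℓ) a) : Set (lsuc a) where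
    field
      isNaivePoint : IsNaivePoint R ℱℓ ℱₙ₋ℓ
      ⋀ⁿℓ          : WedgeVanishes R gℓ n (λ R′ → t-π R′ gℓ) ℱℓ
      ⋀ⁿₙ₋ℓ        : WedgeVanishes R gₙ₋ℓ n (λ R′ → t-π R′ gₙ₋ℓ) ℱₙ₋ℓ
      ⋀²ℓ          : WedgeVanishes R gℓ 2 (λ R′ → t+π R′ gℓ) ℱℓ
      ⋀²ₙ₋ℓ        : WedgeVanishes R gₙ₋ℓ 2 (λ R′ → t+π R′ gₙ₋ℓ) ℱₙ₋ℓ

  record Triple (R : Algebra O) : Set (lsuc a) where
    field
      ℱℓ   : Pred (Λ_⊗ R gℓ) a
      ℱₙ₋ℓ : Pred (Λ_⊗ R gₙ₋ℓ) a
      𝒢ₙ₋ℓ : Pred (Λ_⊗ R gₙ₋ℓ) a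

  infix 4 _≐₃_
  _≐₃_ : ∀ {R} → Triple R → Triple R → Set a
  P ≐₃ Q = P.ℱℓ ≐ Q.ℱℓ × P.ℱₙ₋ℓ ≐ Q.ℱₙ₋ℓ × P.𝒢ₙ₋ℓ ≐ Q.𝒢ₙ₋ℓ
    where
    module P = Triple P
    module Q = Triple Q

  baseChange₃ : ∀ {R R′} → AlgHom R R′ → Triple R → Triple R′
  baseChange₃ φ P = record
    { ℱℓ   = baseChange φ gℓ (Triple.ℱℓ P)
    ; ℱₙ₋ℓ = baseChange φ gₙ₋ℓ (Triple.ℱₙ₋ℓ P)
    ; 𝒢ₙ₋ℓ = baseChange φ gₙ₋ℓ (Triple.𝒢ₙ₋ℓ P)
    }

  record IsSplittingPoint {R : Algebra O} (P : Triple R) : Set (lsuc a) where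
    open Triple P
    private module Λₙ₋ℓ⊗ = LeftModule (Λ⊗-module R gₙ₋ℓ)
    field
      isWedgePoint : IsWedgePoint R ℱℓ ℱₙ₋ℓ
      submodule    : LinearAlgebra.IsSubmodule (Algebra.commutativeRing R) (Λ⊗-module R gₙ₋ℓ) 𝒢ₙ₋ℓ
      summand      : IsLocalSummandOfRank R gₙ₋ℓ 1 𝒢ₙ₋ℓ
      𝒢⊆ℱ          : 𝒢ₙ₋ℓ ⊆ ℱₙ₋ℓ
      t+π-maps     : ∀ x → ℱₙ₋ℓ x → 𝒢ₙ₋ℓ (t+π R gₙ₋ℓ x)
      t-π-kills    : ∀ x → 𝒢ₙ₋ℓ x → t-π R gₙ₋ℓ x Λₙ₋ℓ⊗.≈ᴹ Λₙ₋ℓ⊗.0ᴹ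

  -- j ↦ j - ℓ modulo n: with it, the first halves of the ordered O₀-bases of Λ_ℓ and
  -- Λ_{n-ℓ} are gen ℓ ∘ rotate and gen (n - ℓ) ∘ rotate.
  rotate : Fin n → Fin n
  rotate j with toℕ j ℕₚ.<? ℓ
  ... | yes j<ℓ = fromℕ< {n ∸ ℓ ℕ.+ toℕ j}
                    (ℕₚ.<-≤-trans (ℕₚ.+-monoʳ-< (n ∸ ℓ) j<ℓ) (ℕₚ.≤-reflexive (ℕₚ.m∸n+n≡m ℓ≤n)))
  ... | no  _   = fromℕ< {toℕ j ∸ ℓ} (ℕₚ.≤-<-trans (ℕₚ.m∸n≤m (toℕ j) ℓ) (toℕ<n j))

  firstHalf secondHalf : ∀ g → Fin n → Element g
  firstHalf  g j = g (rotate j) , LinearAlgebra.generator∈Span O Vᴼ g (rotate j)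
  secondHalf g j = πᴼ *ᴼ firstHalf g j
    where open LeftModule Λ[ g ] renaming (_*ₗ_ to _*ᴼ_)

  module _ (R : Algebra O) where
    private module R = Algebra R
    open Matrices R.commutativeRing using (Matrix; 𝟙)

    -- The element of Λ ⊗ R with the given coordinates in the ordered basis.
    column : ∀ g → (Fin n → R.Carrier) → (Fin n → R.Carrier) → Λ_⊗ R g
    column g x y = lincomb x (λ j → firstHalf g j ⊗ R.1#) +ᴹ lincomb y (λ j → secondHalf g j ⊗ R.1#)
      where
      open LeftModule (Λ⊗-module R g)
      open LinearAlgebra R.commutativeRing (Λ⊗-module R g)
      open TensorProduct Λ₀[ g ] (R₀ R) using (_⊗_)

    -- The span of the columns of the 2n × k matrix with blocks A and B.
    columnSpan : ∀ g {k} → Matrix n k → Matrix n k → Pred (Λ_⊗ R g) a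
    columnSpan g A B = LinearAlgebra.Span R.commutativeRing (Λ⊗-module R g)
      λ j → column g (λ i → A i j) (λ i → B i j)

    record InChart (i₀ : Fin n) (P : Triple R) : Set a where
      open Triple P
      field
        X          : Matrix n n
        ℱℓ-chart   : ℱℓ ≐ columnSpan gℓ X 𝟙
        Y          : Matrix n n
        ℱₙ₋ℓ-chart : ℱₙ₋ℓ ≐ columnSpan gₙ₋ℓ Y 𝟙
        G₁ G₂      : Matrix n 1
        𝒢ₙ₋ℓ-chart : 𝒢ₙ₋ℓ ≐ columnSpan gₙ₋ℓ G₁ G₂
        normalized : G₂ i₀ Fin.zero R.≈ R.1#

    record ChartPoint (i₀ : Fin n) : Set (lsuc a) where
      field
        triple           : Triple R
        isSplittingPoint : IsSplittingPoint triple
        inChart          : InChart i₀ triple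

    -- The R-points of 𝒰_{i₀}.  No localization of R is needed in InChart: the matrices X, Y
    -- and the normalized column are unique, so that they glue.
    𝒰 : Fin n → Setoid (lsuc a) a
    𝒰 i₀ = record
      { Carrier       = ChartPoint i₀
      ; _≈_           = λ P Q → ChartPoint.triple P ≐₃ ChartPoint.triple Q
      ; isEquivalence = record
        { refl  = ≐-refl , ≐-refl , ≐-refl
        ; sym   = λ (p , q , r) → ≐-sym p , ≐-sym q , ≐-sym r
        ; trans = λ (p , q , r) (p′ , q′ , r′) → ≐-trans p p′ , ≐-trans q q′ , ≐-trans r r′
        }
      }

  -- An isomorphism of O-schemes 𝒰_{i₀} ≅ Spec A, given on functors of points: bijections
  -- Hom(A , R) ≅ 𝒰_{i₀}(R) that are natural in the O-algebra R, which may be A itself.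
  record ChartIsSpec (i₀ : Fin n) (A : Algebra O) : Set (lsuc a) where
    field
      points  : ∀ R → Inverse (AlgHomSetoid A R) (𝒰 R i₀)
      natural : ∀ {R R′} (φ : AlgHom R R′) (h : AlgHom A R) →
        baseChange₃ φ (ChartPoint.triple (Inverse.to (points R) h))
          ≐₃ ChartPoint.triple (Inverse.to (points R′) (φ ∘ᵃ h))

------------------------------------------------------------------------
-- The coordinate rings

module CoordinateRings {a} (𝔽 : CompleteDiscretelyValuedField a) {n ℓ : ℕ}
                       (ℓ-sns : StronglyNonSpecial n ℓ) where
  open Integers 𝔽 using (O; πᴼ)
  private module O = CommutativeRing O
  open StronglyNonSpecial ℓ-sns using (2ℓ≤n)

  N : ℕ
  N = n ∸ 2 ℕ.* ℓ

  -- j ↦ 2ℓ + j.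
  lower : Fin N → Fin n
  lower j = cast (ℕₚ.m+[n∸m]≡n 2ℓ≤n) (2 ℕ.* ℓ ↑ʳ j)

  module Case₁ (i₀ : Fin n) where
    data Var : Set where
      v : Fin n → Var
      z : Fin N → Var

    open CommutativeRing (PolynomialRing O Var) using (Carrier; _-_; _*_; 1#)
    open Matrices (PolynomialRing O Var) using (antidiagonal; _*ᵥ_; _∙ᵥ_)

    V₂ Z₂ HZ₂ : Fin N → Carrier
    V₂ j = var (v (lower j))
    Z₂ j = var (z j)
    HZ₂  = antidiagonal *ᵥ Z₂

    data Relation : Set where
      unit    : Relation
      minor   : (i j : Fin N) → i Fin.< j → Relation
      product : Relation

    relations : Relation → Carrier
    relations unit          = var (v i₀) - 1#
    relations (minor i j _) = V₂ i * HZ₂ j - HZ₂ i * V₂ j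
    relations product       = (Z₂ ∙ᵥ V₂) - con (πᴼ O.+ πᴼ)

    ring : Algebra O
    ring = O [ Var ]/ relations

  module Case₂ (i₀ : Fin n) where
    data Var : Set where
      v : Fin n → Var
      u : Var

    open CommutativeRing (PolynomialRing O Var) using (Carrier; _-_; _*_; 1#)
    open Matrices (PolynomialRing O Var) using (antidiagonal; _*ᵥ_; _∙ᵥ_)

    V₂ : Fin N → Carrier
    V₂ j = var (v (lower j))

    data Relation : Set where
      unit    : Relation
      product : Relation

    relations : Relation → Carrier
    relations unit    = var (v i₀) - 1#
    relations product = var u * (V₂ ∙ᵥ (antidiagonal *ᵥ V₂)) - con (πᴼ O.+ πᴼ)

    ring : Algebra O
    ring = O [ Var ]/ relations

{-# OPTIONS --safe #-}
module Submission where

-- In the ordered bases, ℱ_ℓ and ℱ_{n-ℓ} are the graphs of X and Y.  That t + π maps ℱ_{n-ℓ} into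
-- the line spanned by (πv , v) says Y = v wᵗ - π, and that t - π kills this line says wᵗv = 2π.
-- Orthogonality then gives X = α βᵗ - π, where α and β are w and v reindexed by the duality of the
-- basis, up to sign.  Stability under Λ_ℓ → Λ_{n-ℓ} → π⁻¹Λ_ℓ amounts to w = μβ off the last block
-- for a scalar μ, together with vᵢwⱼ = αᵢβⱼ and πw = -μβ on the last block, where μ is half the
-- square of w.  So v and the last block Z₂ of w are coordinates, subject to the stated relations;
-- if v has an entry 1 in the last block, then w = -uβ there and u replaces Z₂.
-- Conversely these relations imply the conditions on characteristic polynomials and exterior
-- powers, because det (s + x yᵗ) = sⁿ + sⁿ⁻¹ xᵗy.

open import Defs
open import Algebra.Bundles using (CommutativeRing; CommutativeMonoid)
open import Algebra.Module.Bundles using (LeftModule)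
import Algebra.Properties.CommutativeMonoid.Sum as CommutativeMonoidSum
import Algebra.Properties.CommutativeSemigroup as CommutativeSemigroupProperties
import Algebra.Properties.Ring as RingProperties
import Algebra.Properties.Semiring.Mult.TCOptimised as Multiples
import Algebra.Properties.Semiring.Sum as SemiringSum
import Algebra.Solver.Ring as RingSolver
open import Algebra.Solver.Ring.AlmostCommutativeRing using (fromCommutativeRing; _-Raw-AlmostCommutative⟶_)
open import Data.Bool.Base using (Bool; true; false; not; if_then_else_)
open import Data.Empty using (⊥-elim)
open import Data.Fin.Base as Fin using (Fin; toℕ; fromℕ<; opposite; cast; _↑ʳ_; punchIn)
open import Data.Fin.Permutation using (permutation)
open import Data.Fin.Properties as Finₚ using (toℕ<n; toℕ-injective; toℕ-fromℕ<)
open import Data.Integer.Base as ℤ using (ℤ; +_; -[1+_]; 0ℤ; 1ℤ)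
import Data.Integer.Properties as ℤₚ
open import Data.Maybe.Base using (Maybe; just; nothing)
open import Data.Nat.Base as ℕ using (ℕ; zero; suc; _∸_)
import Data.Nat.Properties as ℕₚ
open import Data.Nat.Solver using (module +-*-Solver)
open import Data.Product.Base using (Σ; ∃-syntax; _×_; _,_; proj₁; proj₂)
open import Data.Sum.Base using (_⊎_; inj₁; inj₂)
open import Function.Base using (_∘_)
open import Function.Bundles using (Equivalence; mk⇔)
import Level
open import Relation.Binary.Construct.Add.Supremum.NonStrict ℤ._≤_ using (_≤⁺_; _≤⊤⁺; [_])
open import Relation.Binary.Definitions using (tri<; tri≈; tri>)
open import Relation.Binary.PropositionalEquality as ≡ using (_≡_; _≢_)
import Relation.Binary.Reasoning.Setoid as SetoidReasoning
open import Relation.Nullary.Construct.Add.Supremum using (_⁺; ⊤⁺; [_])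
open import Relation.Nullary.Decidable using (dec-true; dec-false)
open import Relation.Nullary.Decidable.Core using (Dec; yes; no; does)
open import Relation.Nullary.Negation using (¬_)
open import Relation.Unary using (Pred; _≐_)
open import Relation.Unary.Properties using (≐-refl; ≐-sym; ≐-trans)

-- An element of a lattice tensored with `R` is handled through its two blocks `re` and `im`: `t`
-- sends them to `π²·im` and `re`, and `ℱ` is a graph `re = X·im`. The generators of the two
-- lattices agree off the last block and differ by a factor π on it, so Λ_ℓ → Λ_{n-ℓ} acts as `t` on
-- the last block only, and Λ_{n-ℓ} → π⁻¹Λ_ℓ as `t` on its complement only. Hence every condition
-- splits along the blocks.
--
-- The signs of the form decide the outcome. As the conjugate of π⁻¹ is -π⁻¹, the sign with which
-- `j` and `j ᵒ` pair depends on which argument carries π⁻¹. Off the last block this sign flips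
-- under `ᵒ`, so dualizing twice is -1 and the sum of `dual v · v` vanishes there; that is why wᵗv =
-- 2π becomes Z₂ᵗV₂ = 2π. On the last block the sign is constant, dualizing twice is the identity,
-- and the reindexing becomes the symmetric matrix H.
--
-- In these equations the invertibility of 2 gives the vanishing just mentioned, the formula μ = ½
-- Z₂ᵗHZ₂, and πw = -μβ from the minors.

module IntegerSolver {a} (R : CommRing a) where
  private
    open module R = CommutativeRing R
    open RingProperties ring
    open Multiples semiring using (×-homo-+; ×1-homo-*) renaming (_×_ to _·_)
    open SetoidReasoning setoid

    -- Coefficients are normalized in ℤ, where equality is decidable; a general `R` has no decidable
    -- equality. Unlike natural coefficients, they let `solve` treat subtraction and cancellation.
    fromℤ : ℤ → Carrier
    fromℤ (+ n)    = n · 1#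
    fromℤ -[1+ n ] = - (suc n · 1#)

    suc-suc : ∀ x y → x - y ≈ (1# + x) - (1# + y)
    suc-suc x y = begin
      x - y                   ≈⟨ +-congʳ (sym (+-identityˡ x)) ⟩
      (0# + x) - y            ≈⟨ +-congʳ (+-congʳ (sym (-‿inverseʳ 1#))) ⟩
      ((1# - 1#) + x) - y     ≈⟨ +-congʳ (trans (+-assoc _ _ _) (trans (+-congˡ (+-comm _ _)) (sym (+-assoc _ _ _)))) ⟩
      ((1# + x) - 1#) - y     ≈⟨ +-assoc _ _ _ ⟩
      (1# + x) + (- 1# - y)   ≈⟨ +-congˡ (-‿+-comm 1# y) ⟩
      (1# + x) - (1# + y)     ∎

    ⊖-homo : ∀ m n → fromℤ (m ℤ.⊖ n) ≈ m · 1# - n · 1#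
    ⊖-homo zero    zero    = sym (-‿inverseʳ 0#)
    ⊖-homo (suc m) zero    = sym (trans (+-congˡ -0#≈0#) (+-identityʳ _))
    ⊖-homo zero    (suc n) = sym (+-identityˡ _)
    ⊖-homo (suc m) (suc n) = begin
      fromℤ (suc m ℤ.⊖ suc n)       ≡⟨ ≡.cong fromℤ (ℤₚ.[1+m]⊖[1+n]≡m⊖n m n) ⟩
      fromℤ (m ℤ.⊖ n)               ≈⟨ ⊖-homo m n ⟩
      m · 1# - n · 1#               ≈⟨ suc-suc _ _ ⟩
      (1# + m · 1#) - (1# + n · 1#) ≈⟨ +-cong (sym (×-homo-+ 1# 1 m)) (-‿cong (sym (×-homo-+ 1# 1 n))) ⟩
      suc m · 1# - suc n · 1#       ∎

    neg-homo : ∀ i → fromℤ (ℤ.- i) ≈ - fromℤ i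
    neg-homo (+ zero)  = sym -0#≈0#
    neg-homo (+ suc n) = refl
    neg-homo -[1+ n ]  = sym (-‿involutive _)

    +-homo : ∀ i j → fromℤ (i ℤ.+ j) ≈ fromℤ i + fromℤ j
    +-homo (+ m)    (+ n)    = ×-homo-+ 1# m n
    +-homo (+ m)    -[1+ n ] = ⊖-homo m (suc n)
    +-homo -[1+ m ] (+ n)    = trans (⊖-homo n (suc m)) (+-comm _ _)
    +-homo -[1+ m ] -[1+ n ] = begin
      - (suc (suc (m ℕ.+ n)) · 1#)     ≡⟨ ≡.cong (λ k → - (suc k · 1#)) (≡.sym (ℕₚ.+-suc m n)) ⟩
      - ((suc m ℕ.+ suc n) · 1#)       ≈⟨ -‿cong (×-homo-+ 1# (suc m) (suc n)) ⟩
      - (suc m · 1# + suc n · 1#)      ≈⟨ sym (-‿+-comm _ _) ⟩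
      - (suc m · 1#) - suc n · 1#      ∎

    *-homo : ∀ i j → fromℤ (i ℤ.* j) ≈ fromℤ i * fromℤ j
    *-homo (+ m) (+ n) =
      trans (reflexive (≡.cong fromℤ (≡.sym (ℤₚ.pos-* m n)))) (×1-homo-* m n)
    *-homo (+ m) -[1+ n ] = begin
      fromℤ (+ m ℤ.* -[1+ n ])     ≡⟨ ≡.cong fromℤ (≡.sym (ℤₚ.neg-distribʳ-* (+ m) (+ suc n))) ⟩
      fromℤ (ℤ.- (+ m ℤ.* + suc n)) ≈⟨ neg-homo (+ m ℤ.* + suc n) ⟩
      - fromℤ (+ m ℤ.* + suc n)    ≈⟨ -‿cong (*-homo (+ m) (+ suc n)) ⟩
      - (m · 1# * suc n · 1#)      ≈⟨ -‿distribʳ-* _ _ ⟩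
      m · 1# * - (suc n · 1#)      ∎
    *-homo -[1+ m ] (+ n) = begin
      fromℤ (-[1+ m ] ℤ.* + n)      ≡⟨ ≡.cong fromℤ (≡.sym (ℤₚ.neg-distribˡ-* (+ suc m) (+ n))) ⟩
      fromℤ (ℤ.- (+ suc m ℤ.* + n)) ≈⟨ neg-homo (+ suc m ℤ.* + n) ⟩
      - fromℤ (+ suc m ℤ.* + n)     ≈⟨ -‿cong (*-homo (+ suc m) (+ n)) ⟩
      - (suc m · 1# * n · 1#)       ≈⟨ -‿distribˡ-* _ _ ⟩
      - (suc m · 1#) * n · 1#       ∎
    *-homo -[1+ m ] -[1+ n ] = begin
      fromℤ (+ suc m ℤ.* + suc n)          ≈⟨ *-homo (+ suc m) (+ suc n) ⟩
      suc m · 1# * suc n · 1#              ≈⟨ sym (-‿involutive _) ⟩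
      - (- (suc m · 1# * suc n · 1#))      ≈⟨ -‿cong (-‿distribˡ-* _ _) ⟩
      - (- (suc m · 1#) * suc n · 1#)      ≈⟨ -‿distribʳ-* _ _ ⟩
      - (suc m · 1#) * - (suc n · 1#)      ∎

    homomorphism : ℤ.+-*-rawRing -Raw-AlmostCommutative⟶ fromCommutativeRing R
    homomorphism = record
      { ⟦_⟧    = fromℤ
      ; +-homo = +-homo
      ; *-homo = *-homo
      ; -‿homo = neg-homo
      ; 0-homo = refl
      ; 1-homo = refl
      }

    _≟_ : ∀ i j → Maybe (fromℤ i ≈ fromℤ j)
    i ≟ j with i ℤₚ.≟ j
    ... | yes ≡.refl = just refl
    ... | no  _      = nothing

  open RingSolver ℤ.+-*-rawRing (fromCommutativeRing R) homomorphism _≟_ public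
    using (solve; _:=_; _:+_; _:*_; _:-_; :-_; con)

-- Finite sums and the identity matrix

module Sums {a} (R : CommRing a) where
  private
    open module R = CommutativeRing R
    open Matrices R
    open RingProperties ring using (-0#≈0#; -‿+-comm)
    module ∑ = SemiringSum semiring

  sum-cong : ∀ {n} {f g : Fin n → Carrier} → (∀ i → f i ≈ g i) → sum f ≈ sum g
  sum-cong = ∑.sum-cong-≋

  sum-zero : ∀ {n} {f : Fin n → Carrier} → (∀ i → f i ≈ 0#) → sum f ≈ 0#
  sum-zero {n} p = trans (sum-cong p) (∑.sum-replicate-zero n)

  sum-+ : ∀ {n} (f g : Fin n → Carrier) → sum (λ i → f i + g i) ≈ sum f + sum g
  sum-+ = ∑.∑-distrib-+

  sum-neg : ∀ {n} (f : Fin n → Carrier) → sum (λ i → - f i) ≈ - sum f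
  sum-neg {zero}  f = sym -0#≈0#
  sum-neg {suc n} f = trans (+-congˡ (sum-neg (f ∘ Fin.suc))) (-‿+-comm _ _)

  *-sum : ∀ {n} c (f : Fin n → Carrier) → sum (λ i → c * f i) ≈ c * sum f
  *-sum c f = sym (∑.*-distribˡ-sum c f)

  sum-* : ∀ {n} (f : Fin n → Carrier) c → sum (λ i → f i * c) ≈ sum f * c
  sum-* f c = sym (∑.*-distribʳ-sum c f)

  sum-bijection : ∀ {m n} (s : Fin m → Fin n) (s⁻¹ : Fin n → Fin m) →
                  (∀ i → s (s⁻¹ i) ≡ i) → (∀ i → s⁻¹ (s i) ≡ i) → ∀ (f : Fin n → Carrier) → sum f ≈ sum (f ∘ s)
  sum-bijection s s⁻¹ p q f = ∑.sum-permute f (permutation s s⁻¹ p q)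

  sum-involution : ∀ {n} (s : Fin n → Fin n) → (∀ i → s (s i) ≡ i) → ∀ (f : Fin n → Carrier) →
                   sum f ≈ sum (f ∘ s)
  sum-involution s p = sum-bijection s s p p

  sum-𝟙ˡ : ∀ {n} i (f : Fin n → Carrier) → sum (λ j → 𝟙 i j * f j) ≈ f i
  sum-𝟙ˡ Fin.zero    f = trans (+-cong (*-identityˡ _) (sum-zero λ j → zeroˡ (f (Fin.suc j)))) (+-identityʳ _)
  sum-𝟙ˡ (Fin.suc i) f = trans (+-cong (zeroˡ _) (sum-𝟙ˡ i (f ∘ Fin.suc))) (+-identityˡ _)

  𝟙-sym : ∀ {n} (i j : Fin n) → 𝟙 i j ≈ 𝟙 j i
  𝟙-sym Fin.zero    Fin.zero    = refl
  𝟙-sym Fin.zero    (Fin.suc j) = refl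
  𝟙-sym (Fin.suc i) Fin.zero    = refl
  𝟙-sym (Fin.suc i) (Fin.suc j) = 𝟙-sym i j

  sum-𝟙ʳ : ∀ {n} j (f : Fin n → Carrier) → sum (λ i → f i * 𝟙 i j) ≈ f j
  sum-𝟙ʳ j f = trans (sum-cong λ i → trans (*-comm _ _) (*-congʳ (𝟙-sym i j))) (sum-𝟙ˡ j f)

  𝟙-refl : ∀ {n} (i : Fin n) → 𝟙 i i ≈ 1#
  𝟙-refl Fin.zero    = refl
  𝟙-refl (Fin.suc i) = 𝟙-refl i

  𝟙-≢ : ∀ {n} {i j : Fin n} → i ≢ j → 𝟙 i j ≈ 0#
  𝟙-≢ {i = Fin.zero}  {Fin.zero}  i≢j = ⊥-elim (i≢j ≡.refl)
  𝟙-≢ {i = Fin.zero}  {Fin.suc j} i≢j = refl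
  𝟙-≢ {i = Fin.suc i} {Fin.zero}  i≢j = refl
  𝟙-≢ {i = Fin.suc i} {Fin.suc j} i≢j = 𝟙-≢ {i = i} {j} (i≢j ∘ ≡.cong Fin.suc)

-- Determinants of rank-one perturbations of scalar matrices

module Determinant {a} (R : CommRing a) where
  private
    open module R = CommutativeRing R
    open Matrices R
    open Power R
    open Sums R
    open IntegerSolver R
    open SetoidReasoning setoid

  det-cong : ∀ {n} {A B : Matrix n n} → (∀ i j → A i j ≈ B i j) → det A ≈ det B
  det-cong {zero}  p = refl
  det-cong {suc n} p = sum-cong λ j →
    *-congˡ {x = sign j} (*-cong (p Fin.zero j) (det-cong λ i k → p (Fin.suc i) (punchIn j k)))

  sign² : ∀ {n} (j : Fin n) → sign j * sign j ≈ 1#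
  sign² Fin.zero    = *-identityˡ 1#
  sign² (Fin.suc j) = trans (solve 1 (λ x → :- x :* :- x := x :* x) refl (sign j)) (sign² j)

  minor : ∀ {n} → Matrix (suc n) (suc n) → Fin (suc n) → Matrix n n
  minor A j i k = A (Fin.suc i) (punchIn j k)

  _∷ᶜ_ : ∀ {m n} → (Fin m → Carrier) → Matrix m n → Matrix m (suc n)
  (x ∷ᶜ A) i Fin.zero    = x i
  (x ∷ᶜ A) i (Fin.suc k) = A i k

  minor-∷ᶜ : ∀ {n} x (A : Matrix (suc (suc n)) (suc n)) k i m →
             minor (x ∷ᶜ A) (Fin.suc k) i m ≈ ((x ∘ Fin.suc) ∷ᶜ λ i m → A (Fin.suc i) (punchIn k m)) i m
  minor-∷ᶜ x A k i Fin.zero    = refl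
  minor-∷ᶜ x A k i (Fin.suc m) = refl

  -- In the expansion along row zero, the first term contains the factor `c` in its entry; every
  -- later minor still begins with the scaled column, so induction applies.
  scaleColumn : ∀ {n} c (x : Fin (suc n) → Carrier) (A : Matrix (suc n) n) →
                det ((λ i → c * x i) ∷ᶜ A) ≈ c * det (x ∷ᶜ A)
  scaleColumn {zero} c x A =
    solve 2 (λ c y → con (+ 1) :* (c :* y :* con (+ 1)) :+ con (+ 0)
      := c :* (con (+ 1) :* (y :* con (+ 1)) :+ con (+ 0))) refl c (x Fin.zero)
  scaleColumn {suc n} c x A = trans (sum-cong term) (*-sum c λ j → sign j * (xA Fin.zero j * det (minor xA j)))
    where
    cA xA : Matrix (suc (suc n)) (suc (suc n))
    cA = (λ i → c * x i) ∷ᶜ A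
    xA = x ∷ᶜ A
    term : ∀ j → sign j * (cA Fin.zero j * det (minor cA j)) ≈ c * (sign j * (xA Fin.zero j * det (minor xA j)))
    term Fin.zero = solve 3 (λ c y d → con (+ 1) :* (c :* y :* d) := c :* (con (+ 1) :* (y :* d)))
      refl c (x Fin.zero) _
    term (Fin.suc k) = trans (*-congˡ {x = - sign k} (*-congˡ (trans (det-cong (minor-∷ᶜ _ A k))
        (trans (scaleColumn c (x ∘ Fin.suc) A′) (*-congˡ {x = c} (sym (det-cong (minor-∷ᶜ x A k))))))))
        (solve 4 (λ s y c d → s :* (y :* (c :* d)) := c :* (s :* (y :* d))) refl (- sign k) (A Fin.zero k) c _)
      where
      A′ : Matrix (suc n) n
      A′ i m = A (Fin.suc i) (punchIn k m)

  mutual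
    -- The terms of the first two columns are `b·x₀·c·d` and `-c·x₀·b·d` with the same `d`, and
    -- cancel. All other minors again begin with two proportional columns, which is the smaller
    -- instance supplied by `minor-proportional`.
    det-proportional : ∀ {n} b c (x : Fin (suc (suc n)) → Carrier) (A : Matrix (suc (suc n)) n) →
                       det ((λ i → b * x i) ∷ᶜ ((λ i → c * x i) ∷ᶜ A)) ≈ 0#
    det-proportional {n} b c x A = begin
      1# * (b * x₀ * det (minor M Fin.zero)) + (- 1# * (c * x₀ * det (minor M (Fin.suc Fin.zero))) + rest)
        ≈⟨ +-cong (*-congˡ (*-congˡ (trans (det-cong eq₀) (scaleColumn c x′ A′))))
             (+-cong (*-congˡ (*-congˡ (trans (det-cong eq₁) (scaleColumn b x′ A′)))) (sum-zero rest≈0)) ⟩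
      1# * (b * x₀ * (c * d)) + (- 1# * (c * x₀ * (b * d)) + 0#)
        ≈⟨ solve 4 (λ b c y d → con (+ 1) :* (b :* y :* (c :* d)) :+ (:- con (+ 1) :* (c :* y :* (b :* d)) :+ con (+ 0))
                     := con (+ 0)) refl b c x₀ d ⟩
      0# ∎
      where
      M : Matrix (suc (suc n)) (suc (suc n))
      M = (λ i → b * x i) ∷ᶜ ((λ i → c * x i) ∷ᶜ A)
      x₀ = x Fin.zero
      x′ : Fin (suc n) → Carrier
      x′ = x ∘ Fin.suc
      A′ : Matrix (suc n) n
      A′ i = A (Fin.suc i)
      d = det (x′ ∷ᶜ A′)
      term : Fin n → Carrier
      term k = sign (Fin.suc (Fin.suc k)) * (A Fin.zero k * det (minor M (Fin.suc (Fin.suc k))))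
      rest = sum term
      eq₀ : ∀ i k → minor M Fin.zero i k ≈ ((λ i → c * x′ i) ∷ᶜ A′) i k
      eq₀ i Fin.zero    = refl
      eq₀ i (Fin.suc k) = refl
      eq₁ : ∀ i k → minor M (Fin.suc Fin.zero) i k ≈ ((λ i → b * x′ i) ∷ᶜ A′) i k
      eq₁ i Fin.zero    = refl
      eq₁ i (Fin.suc k) = refl
      rest≈0 : ∀ k → term k ≈ 0#
      rest≈0 k = trans (*-congˡ {x = sign (Fin.suc (Fin.suc k))}
        (trans (*-congˡ (minor-proportional b c x A k)) (zeroʳ _))) (zeroʳ _)

    minor-proportional : ∀ {n} b c (x : Fin (suc (suc n)) → Carrier) (A : Matrix (suc (suc n)) n) k →
      det (minor ((λ i → b * x i) ∷ᶜ ((λ i → c * x i) ∷ᶜ A)) (Fin.suc (Fin.suc k))) ≈ 0#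
    minor-proportional {suc n} b c x A k = trans (det-cong eq) (det-proportional b c (x ∘ Fin.suc) A′)
      where
      A′ : Matrix (suc (suc n)) n
      A′ i m = A (Fin.suc i) (punchIn k m)
      eq : ∀ i m → minor ((λ i → b * x i) ∷ᶜ ((λ i → c * x i) ∷ᶜ A)) (Fin.suc (Fin.suc k)) i m
                     ≈ ((λ i → b * x (Fin.suc i)) ∷ᶜ ((λ i → c * x (Fin.suc i)) ∷ᶜ A′)) i m
      eq i Fin.zero              = refl
      eq i (Fin.suc Fin.zero)    = refl
      eq i (Fin.suc (Fin.suc m)) = refl

  _·𝟙+_⊗_ : ∀ {n} → Carrier → (Fin n → Carrier) → (Fin n → Carrier) → Matrix n n
  (s ·𝟙+ x ⊗ y) i j = s * 𝟙 i j + x i * y j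

  withoutColumn : ∀ {n} → Matrix (suc n) (suc n) → Fin (suc n) → Matrix (suc n) n
  withoutColumn A j i k = A i (punchIn j k)

  mutual
    -- The minor at column zero is a smaller matrix of the same shape. The other minors along row
    -- zero are not, which forces the simultaneous induction with `det-rankOne-minor`: they start
    -- with a multiple of `x` and lack one column of the scalar part.
    det-rankOne : ∀ {n} s (x y : Fin (suc n) → Carrier) →
                  det (s ·𝟙+ x ⊗ y) ≈ s ^ suc n + s ^ n * (x ∙ᵥ y)
    det-rankOne {zero} s x y =
      solve 3 (λ s x y → con (+ 1) :* ((s :* con (+ 1) :+ x :* y) :* con (+ 1)) :+ con (+ 0)
        := s :* con (+ 1) :+ con (+ 1) :* (x :* y :+ con (+ 0))) refl s (x Fin.zero) (y Fin.zero)
    det-rankOne {suc n} s x y = begin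
      1# * ((s * 1# + x₀ * y₀) * det (s ·𝟙+ x′ ⊗ y′)) + rest
        ≈⟨ +-cong (*-congˡ (*-congˡ (det-rankOne s x′ y′))) (trans (sum-cong term≈) (*-sum _ (λ k → x′ k * y′ k))) ⟩
      1# * ((s * 1# + x₀ * y₀) * (s * p + p * q)) + - (x₀ * y₀ * p) * q
        ≈⟨ solve 5 (λ s x y p q → con (+ 1) :* ((s :* con (+ 1) :+ x :* y) :* (s :* p :+ p :* q)) :+ :- (x :* y :* p) :* q
             := s :* (s :* p) :+ s :* p :* (x :* y :+ q)) refl s x₀ y₀ p q ⟩
      s * (s * p) + s * p * (x₀ * y₀ + q) ∎
      where
      x₀ = x Fin.zero
      y₀ = y Fin.zero
      x′ y′ : Fin (suc n) → Carrier
      x′ = x ∘ Fin.suc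
      y′ = y ∘ Fin.suc
      p = s ^ n
      q = x′ ∙ᵥ y′
      M : Matrix (suc (suc n)) (suc (suc n))
      M = s ·𝟙+ x ⊗ y
      term : Fin (suc n) → Carrier
      term k = - sign k * ((s * 0# + x₀ * y′ k) * det (minor M (Fin.suc k)))
      rest = sum term
      eq : ∀ k i m → minor M (Fin.suc k) i m ≈ ((λ i → y₀ * x′ i) ∷ᶜ withoutColumn (s ·𝟙+ x′ ⊗ y′) k) i m
      eq k i Fin.zero    = solve 3 (λ s x y → s :* con (+ 0) :+ x :* y := y :* x) refl s (x′ i) y₀
      eq k i (Fin.suc m) = refl
      -- The cofactor sign meets the sign in the value of the minor and their product is -1 for
      -- every `k`; so the terms add up to a multiple of the dot product of `x′` and `y′`.
      term≈ : ∀ k → term k ≈ - (x₀ * y₀ * p) * (x′ k * y′ k)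
      term≈ k = trans (*-congˡ {x = - sign k} (*-congˡ (trans (det-cong (eq k)) (det-rankOne-minor s x′ y′ y₀ k))))
        (trans (solve 7 (λ σ s x u y p v → :- σ :* ((s :* con (+ 0) :+ x :* u) :* (y :* (σ :* (p :* v))))
            := (σ :* σ) :* (:- (x :* y :* p) :* (v :* u))) refl (sign k) s x₀ (y′ k) y₀ p (x′ k))
          (trans (*-congʳ (sign² k)) (*-identityˡ _)))

    -- Conceptually, subtracting multiples of the leading column `x` removes the rank-one part from
    -- the other columns. What remains is `b·x` followed by `s·𝟙` without column `j`, and only row
    -- `j` of the leading column contributes. The induction reaches this value by expanding along
    -- row zero.
    det-rankOne-minor : ∀ {n} s (x y : Fin (suc n) → Carrier) b j →
      det ((λ i → b * x i) ∷ᶜ withoutColumn (s ·𝟙+ x ⊗ y) j) ≈ b * (sign j * (s ^ n * x j))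
    det-rankOne-minor {zero} s x y b Fin.zero =
      solve 2 (λ b x → con (+ 1) :* (b :* x :* con (+ 1)) :+ con (+ 0) := b :* (con (+ 1) :* (con (+ 1) :* x)))
        refl b (x Fin.zero)
    det-rankOne-minor {suc n} s x y b Fin.zero = begin
      1# * (b * x₀ * det (minor M Fin.zero)) + rest
        ≈⟨ +-cong (*-congˡ (*-congˡ (det-rankOne s x′ y′))) (trans (sum-cong term≈) (*-sum _ (λ k → x′ k * y′ k))) ⟩
      1# * (b * x₀ * (s * p + p * q)) + - (x₀ * b * p) * q
        ≈⟨ solve 5 (λ s b x p q → con (+ 1) :* (b :* x :* (s :* p :+ p :* q)) :+ :- (x :* b :* p) :* q
             := b :* (con (+ 1) :* (s :* p :* x))) refl s b x₀ p q ⟩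
      b * (1# * (s * p * x₀)) ∎
      where
      x₀ = x Fin.zero
      x′ y′ : Fin (suc n) → Carrier
      x′ = x ∘ Fin.suc
      y′ = y ∘ Fin.suc
      p = s ^ n
      q = x′ ∙ᵥ y′
      M : Matrix (suc (suc n)) (suc (suc n))
      M = (λ i → b * x i) ∷ᶜ withoutColumn (s ·𝟙+ x ⊗ y) Fin.zero
      term : Fin (suc n) → Carrier
      term k = - sign k * ((s * 0# + x₀ * y′ k) * det (minor M (Fin.suc k)))
      rest = sum term
      eq : ∀ k i m → minor M (Fin.suc k) i m ≈ ((λ i → b * x′ i) ∷ᶜ withoutColumn (s ·𝟙+ x′ ⊗ y′) k) i m
      eq k i Fin.zero    = refl
      eq k i (Fin.suc m) = refl
      term≈ : ∀ k → term k ≈ - (x₀ * b * p) * (x′ k * y′ k)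
      term≈ k = trans (*-congˡ {x = - sign k} (*-congˡ (trans (det-cong (eq k)) (det-rankOne-minor s x′ y′ b k))))
        (trans (solve 7 (λ σ s x u b p v → :- σ :* ((s :* con (+ 0) :+ x :* u) :* (b :* (σ :* (p :* v))))
            := (σ :* σ) :* (:- (x :* b :* p) :* (v :* u))) refl (sign k) s x₀ (y′ k) b p (x′ k))
          (trans (*-congʳ (sign² k)) (*-identityˡ _)))
    det-rankOne-minor {suc n} s x y b (Fin.suc j) = begin
      1# * (b * x₀ * det (minor M Fin.zero)) +
        (- 1# * ((s * 1# + x₀ * y₀) * det (minor M (Fin.suc Fin.zero))) + rest)
        ≈⟨ +-cong (*-congˡ (*-congˡ (trans (det-cong eq₀) (det-rankOne-minor s x′ y′ y₀ j))))
             (+-cong (*-congˡ (*-congˡ (trans (det-cong eq₁) (det-rankOne-minor s x′ y′ b j)))) (sum-zero rest≈0)) ⟩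
      1# * (b * x₀ * (y₀ * (sign j * (p * x′ j)))) +
        (- 1# * ((s * 1# + x₀ * y₀) * (b * (sign j * (p * x′ j)))) + 0#)
        ≈⟨ solve 7 (λ s b x y σ p z →
             con (+ 1) :* (b :* x :* (y :* (σ :* (p :* z)))) :+
               (:- con (+ 1) :* ((s :* con (+ 1) :+ x :* y) :* (b :* (σ :* (p :* z)))) :+ con (+ 0))
             := b :* (:- σ :* (s :* p :* z))) refl s b x₀ y₀ (sign j) p (x′ j) ⟩
      b * (- sign j * (s * p * x′ j)) ∎
      where
      x₀ = x Fin.zero
      y₀ = y Fin.zero
      x′ y′ : Fin (suc n) → Carrier
      x′ = x ∘ Fin.suc
      y′ = y ∘ Fin.suc
      p = s ^ n
      M : Matrix (suc (suc n)) (suc (suc n))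
      M = (λ i → b * x i) ∷ᶜ withoutColumn (s ·𝟙+ x ⊗ y) (Fin.suc j)
      col₀ : ∀ i → s * 0# + x′ i * y₀ ≈ y₀ * x′ i
      col₀ i = solve 3 (λ s x y → s :* con (+ 0) :+ x :* y := y :* x) refl s (x′ i) y₀
      term : Fin n → Carrier
      term k = sign (Fin.suc (Fin.suc k)) * (M Fin.zero (Fin.suc (Fin.suc k)) * det (minor M (Fin.suc (Fin.suc k))))
      rest = sum term
      eq₀ : ∀ i m → minor M Fin.zero i m ≈ ((λ i → y₀ * x′ i) ∷ᶜ withoutColumn (s ·𝟙+ x′ ⊗ y′) j) i m
      eq₀ i Fin.zero    = col₀ i
      eq₀ i (Fin.suc m) = refl
      eq₁ : ∀ i m → minor M (Fin.suc Fin.zero) i m ≈ ((λ i → b * x′ i) ∷ᶜ withoutColumn (s ·𝟙+ x′ ⊗ y′) j) i m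
      eq₁ i Fin.zero    = refl
      eq₁ i (Fin.suc m) = refl
      B : Matrix (suc (suc n)) n
      B i m = withoutColumn (s ·𝟙+ x ⊗ y) (Fin.suc j) i (Fin.suc m)
      -- Column one of `M` is `y₀·x` plus `s` in row zero. Below row zero, which is all that the
      -- minors see, the first two columns are therefore proportional, and only these two columns
      -- contribute to the expansion.
      eq : ∀ i m → M (Fin.suc i) m ≈ ((λ i → b * x i) ∷ᶜ ((λ i → y₀ * x i) ∷ᶜ B)) (Fin.suc i) m
      eq i Fin.zero              = refl
      eq i (Fin.suc Fin.zero)    = col₀ i
      eq i (Fin.suc (Fin.suc m)) = refl
      minor≈0 : ∀ k → det (minor M (Fin.suc (Fin.suc k))) ≈ 0#
      minor≈0 k = trans (det-cong λ i m → eq i (punchIn (Fin.suc (Fin.suc k)) m)) (minor-proportional b y₀ x B k)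
      rest≈0 : ∀ k → term k ≈ 0#
      rest≈0 k = trans (*-congˡ {x = sign (Fin.suc (Fin.suc k))} (trans (*-congˡ (minor≈0 k)) (zeroʳ _))) (zeroʳ _)

-- The equations of a chart

-- The rotated index set: C is the block [ 2ℓ , n ), positive the block [ 0 , ℓ ).  The form on the
-- lattices pairs the basis vectors j and j ᵒ, with sign + exactly when positive j.
record Blocks (n : ℕ) : Set where
  field
    C        : Fin n → Bool
    positive : Fin n → Bool
    _ᵒ       : Fin n → Fin n
    ᵒ-involutive : ∀ j → (j ᵒ) ᵒ ≡ j
    C-ᵒ          : ∀ j → C (j ᵒ) ≡ C j
    positive-ᵒ   : ∀ j → C j ≡ false → positive (j ᵒ) ≡ not (positive j)
    positive-C   : ∀ j → C j ≡ true → positive j ≡ false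

bool-split : ∀ b → b ≡ true ⊎ b ≡ false
bool-split true  = inj₁ ≡.refl
bool-split false = inj₂ ≡.refl

module Core {a} (R : CommRing a) {n} (S : Blocks n)
            (π ½ : CommutativeRing.Carrier R)
            (½+½≈1 : CommutativeRing._≈_ R (CommutativeRing._+_ R ½ ½) (CommutativeRing.1# R)) where
  open CommutativeRing R
  open Matrices R
  open Sums R
  open IntegerSolver R
  open Blocks S public
  open SetoidReasoning setoid

  double-injective : ∀ {x y} → x + x ≈ y + y → x ≈ y
  double-injective {x} {y} p = trans (halve x) (trans (*-congˡ p) (sym (halve y)))
    where
    halve : ∀ z → z ≈ ½ * (z + z)
    halve z = trans (sym (*-identityˡ z)) (trans (*-congʳ (sym ½+½≈1))
      (solve 2 (λ h z → (h :+ h) :* z := h :* (z :+ z)) refl ½ z))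

  -- This is how the two inclusions of lattices act on coordinates: the first is multiplication by
  -- `t` exactly on the block `C`, the second exactly off it.
  sel : {A : Set a} → (Fin n → A) → (Fin n → A) → Fin n → A
  sel x y j = if C j then x j else y j

  sel-C : ∀ {A : Set a} (x y : Fin n → A) {j} → C j ≡ true → sel x y j ≡ x j
  sel-C x y p rewrite p = ≡.refl

  sel-¬C : ∀ {A : Set a} (x y : Fin n → A) {j} → C j ≡ false → sel x y j ≡ y j
  sel-¬C x y p rewrite p = ≡.refl

  sel-cong : ∀ {x x′ y y′ : Fin n → Carrier} j → (C j ≡ true → x j ≈ x′ j) → (C j ≡ false → y j ≈ y′ j) →
             sel x y j ≈ sel x′ y′ j
  sel-cong j p q with C j
  ... | true  = p ≡.refl
  ... | false = q ≡.refl

  sel-same : ∀ (x : Fin n → Carrier) j → sel x x j ≈ x j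
  sel-same x j with C j
  ... | true  = refl
  ... | false = refl

  0ᵥ : Fin n → Carrier
  0ᵥ _ = 0#

  ∑C ∑¬C : (Fin n → Carrier) → Carrier
  ∑C  f = sum (sel f 0ᵥ)
  ∑¬C f = sum (sel 0ᵥ f)

  ∑C-cong : ∀ {f g} → (∀ j → C j ≡ true → f j ≈ g j) → ∑C f ≈ ∑C g
  ∑C-cong {f} {g} p = sum-cong λ j → sel-cong {f} {g} {0ᵥ} {0ᵥ} j (p j) λ _ → refl

  ∑¬C-cong : ∀ {f g} → (∀ j → C j ≡ false → f j ≈ g j) → ∑¬C f ≈ ∑¬C g
  ∑¬C-cong {f} {g} p = sum-cong λ j → sel-cong {0ᵥ} {0ᵥ} {f} {g} j (λ _ → refl) (p j)

  ∑-split : ∀ f → sum f ≈ ∑C f + ∑¬C f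
  ∑-split f = trans (sum-cong split) (sum-+ (sel f 0ᵥ) (sel 0ᵥ f))
    where
    split : ∀ j → f j ≈ sel f 0ᵥ j + sel 0ᵥ f j
    split j with C j
    ... | true  = sym (+-identityʳ _)
    ... | false = sym (+-identityˡ _)

  ∑-sel : ∀ f x y → f ∙ᵥ sel x y ≈ ∑C (λ j → f j * x j) + ∑¬C (λ j → f j * y j)
  ∑-sel f x y = trans (∑-split _) (+-cong
    (∑C-cong λ j p → *-congˡ (reflexive (sel-C x y p)))
    (∑¬C-cong λ j p → *-congˡ (reflexive (sel-¬C x y p))))

  ∑C-+ : ∀ f g → ∑C (λ j → f j + g j) ≈ ∑C f + ∑C g
  ∑C-+ f g = trans (sum-cong add) (sum-+ (sel f 0ᵥ) (sel g 0ᵥ))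
    where
    add : ∀ j → sel (λ j → f j + g j) 0ᵥ j ≈ sel f 0ᵥ j + sel g 0ᵥ j
    add j with C j
    ... | true  = refl
    ... | false = sym (+-identityˡ _)

  ∑¬C-+ : ∀ f g → ∑¬C (λ j → f j + g j) ≈ ∑¬C f + ∑¬C g
  ∑¬C-+ f g = trans (sum-cong add) (sum-+ (sel 0ᵥ f) (sel 0ᵥ g))
    where
    add : ∀ j → sel 0ᵥ (λ j → f j + g j) j ≈ sel 0ᵥ f j + sel 0ᵥ g j
    add j with C j
    ... | true  = sym (+-identityˡ _)
    ... | false = refl

  *-∑C : ∀ c f → ∑C (λ j → c * f j) ≈ c * ∑C f
  *-∑C c f = trans (sum-cong mul) (*-sum c (sel f 0ᵥ))
    where
    mul : ∀ j → sel (λ j → c * f j) 0ᵥ j ≈ c * sel f 0ᵥ j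
    mul j with C j
    ... | true  = refl
    ... | false = sym (zeroʳ c)

  *-∑¬C : ∀ c f → ∑¬C (λ j → c * f j) ≈ c * ∑¬C f
  *-∑¬C c f = trans (sum-cong mul) (*-sum c (sel 0ᵥ f))
    where
    mul : ∀ j → sel 0ᵥ (λ j → c * f j) j ≈ c * sel 0ᵥ f j
    mul j with C j
    ... | true  = sym (zeroʳ c)
    ... | false = refl

  ∑C-𝟙 : ∀ f b → ∑C (λ j → f j * 𝟙 j b) ≈ sel f 0ᵥ b
  ∑C-𝟙 f b = trans (sum-cong mask) (sum-𝟙ʳ b (sel f 0ᵥ))
    where
    mask : ∀ j → sel (λ j → f j * 𝟙 j b) 0ᵥ j ≈ sel f 0ᵥ j * 𝟙 j b
    mask j with C j
    ... | true  = refl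
    ... | false = sym (zeroˡ _)

  ∑¬C-𝟙 : ∀ f b → ∑¬C (λ j → f j * 𝟙 j b) ≈ sel 0ᵥ f b
  ∑¬C-𝟙 f b = trans (sum-cong mask) (sum-𝟙ʳ b (sel 0ᵥ f))
    where
    mask : ∀ j → sel 0ᵥ (λ j → f j * 𝟙 j b) j ≈ sel 0ᵥ f j * 𝟙 j b
    mask j with C j
    ... | true  = sym (zeroˡ _)
    ... | false = refl

  ε : Fin n → Carrier
  ε j = if positive j then 1# else - 1#

  ε² : ∀ j → ε j * ε j ≈ 1#
  ε² j with positive j
  ... | true  = *-identityˡ 1#
  ... | false = solve 0 (:- con (+ 1) :* :- con (+ 1) := con (+ 1)) refl

  ε-ᵒ : ∀ j → C j ≡ false → ε (j ᵒ) ≈ - ε j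
  ε-ᵒ j p rewrite positive-ᵒ j p with positive j
  ... | true  = refl
  ... | false = solve 0 (con (+ 1) := :- (:- con (+ 1))) refl

  ε-C : ∀ j → C j ≡ true → ε j ≈ - 1#
  ε-C j p rewrite positive-C j p = refl

  -- The vectors α and β of the overview are `dual w` and `dual v`.
  dual : (Fin n → Carrier) → Fin n → Carrier
  dual x j = ε (j ᵒ) * x (j ᵒ)

  dual-cong : ∀ {x y} → (∀ j → x j ≈ y j) → ∀ j → dual x j ≈ dual y j
  dual-cong p j = *-congˡ (p (j ᵒ))

  dual-C : ∀ x j → C j ≡ true → dual x j ≈ - x (j ᵒ)
  dual-C x j p = trans (*-congʳ (ε-C (j ᵒ) (≡.trans (C-ᵒ j) p)))
    (solve 1 (λ x → :- con (+ 1) :* x := :- x) refl (x (j ᵒ)))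

  dual-∙ : ∀ x y → dual x ∙ᵥ dual y ≈ x ∙ᵥ y
  dual-∙ x y = trans (sum-cong λ j → trans
      (solve 3 (λ e x y → (e :* x) :* (e :* y) := (e :* e) :* (x :* y)) refl (ε (j ᵒ)) (x (j ᵒ)) (y (j ᵒ)))
      (trans (*-congʳ (ε² (j ᵒ))) (*-identityˡ _)))
    (sym (sum-involution _ᵒ ᵒ-involutive (λ j → x j * y j)))

  -- On the complement of C the pairing is alternating.
  ∑¬C-dual : ∀ x → ∑¬C (λ j → dual x j * x j) ≈ 0#
  ∑¬C-dual x = double-injective (begin
    τ + τ                                ≈⟨ +-congʳ (sum-involution _ᵒ ᵒ-involutive (sel 0ᵥ f)) ⟩
    sum (sel 0ᵥ f ∘ _ᵒ) + τ              ≈⟨ sym (sum-+ (sel 0ᵥ f ∘ _ᵒ) (sel 0ᵥ f)) ⟩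
    sum (λ j → sel 0ᵥ f (j ᵒ) + sel 0ᵥ f j) ≈⟨ sum-zero cancel ⟩
    0#                                   ≈⟨ sym (+-identityˡ 0#) ⟩
    0# + 0# ∎)
    where
    f : Fin n → Carrier
    f j = dual x j * x j
    τ = ∑¬C f
    cancel : ∀ j → sel 0ᵥ f (j ᵒ) + sel 0ᵥ f j ≈ 0#
    cancel j with bool-split (C j)
    ... | inj₁ p rewrite C-ᵒ j | p = +-identityˡ 0#
    ... | inj₂ p = begin
      sel 0ᵥ f (j ᵒ) + sel 0ᵥ f j
        ≈⟨ +-cong (reflexive (sel-¬C 0ᵥ f (≡.trans (C-ᵒ j) p))) (reflexive (sel-¬C 0ᵥ f p)) ⟩
      ε ((j ᵒ) ᵒ) * x ((j ᵒ) ᵒ) * x (j ᵒ) + ε (j ᵒ) * x (j ᵒ) * x j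
        ≡⟨ ≡.cong (λ k → ε k * x k * x (j ᵒ) + ε (j ᵒ) * x (j ᵒ) * x j) (ᵒ-involutive j) ⟩
      ε j * x j * x (j ᵒ) + ε (j ᵒ) * x (j ᵒ) * x j
        ≈⟨ +-congˡ (*-congʳ (*-congʳ (ε-ᵒ j p))) ⟩
      ε j * x j * x (j ᵒ) + - ε j * x (j ᵒ) * x j
        ≈⟨ solve 3 (λ e x y → e :* x :* y :+ :- e :* y :* x := con (+ 0)) refl (ε j) (x j) (x (j ᵒ)) ⟩
      0# ∎

  -- Off `C` the sign `ε` flips under `ᵒ`, so `dual` squares to -1 there.
  dual-¬C : ∀ {x y} μ → (∀ j → C j ≡ false → y j ≈ μ * dual x j) →
            ∀ j → C j ≡ false → dual y j ≈ - (μ * x j)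
  dual-¬C {x} {y} μ p j q = begin
    ε (j ᵒ) * y (j ᵒ)                       ≈⟨ *-congˡ (p (j ᵒ) (≡.trans (C-ᵒ j) q)) ⟩
    ε (j ᵒ) * (μ * (ε ((j ᵒ) ᵒ) * x ((j ᵒ) ᵒ))) ≡⟨ ≡.cong (λ k → ε (j ᵒ) * (μ * (ε k * x k))) (ᵒ-involutive j) ⟩
    ε (j ᵒ) * (μ * (ε j * x j))             ≈⟨ *-congʳ (ε-ᵒ j q) ⟩
    - ε j * (μ * (ε j * x j))
      ≈⟨ solve 3 (λ e m x → :- e :* (m :* (e :* x)) := (e :* e) :* :- (m :* x)) refl (ε j) μ (x j) ⟩
    ε j * ε j * - (μ * x j)                 ≈⟨ trans (*-congʳ (ε² j)) (*-identityˡ _) ⟩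
    - (μ * x j) ∎

  rankOne : (Fin n → Carrier) → (Fin n → Carrier) → Matrix n n
  rankOne x y i j = x i * y j - π * 𝟙 i j

  rankOne-*ᵥ : ∀ x y q i → (rankOne x y *ᵥ q) i ≈ x i * (y ∙ᵥ q) - π * q i
  rankOne-*ᵥ x y q i = begin
    sum (λ j → (x i * y j - π * 𝟙 i j) * q j)
      ≈⟨ sum-cong (λ j → solve 5 (λ x y p d q → (x :* y :- p :* d) :* q := x :* (y :* q) :+ :- p :* (d :* q))
           refl (x i) (y j) π (𝟙 i j) (q j)) ⟩
    sum (λ j → x i * (y j * q j) + - π * (𝟙 i j * q j))
      ≈⟨ sum-+ (λ j → x i * (y j * q j)) (λ j → - π * (𝟙 i j * q j)) ⟩
    sum (λ j → x i * (y j * q j)) + sum (λ j → - π * (𝟙 i j * q j))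
      ≈⟨ +-cong (*-sum (x i) (λ j → y j * q j)) (trans (*-sum (- π) (λ j → 𝟙 i j * q j)) (*-congˡ (sum-𝟙ˡ i q))) ⟩
    x i * (y ∙ᵥ q) + - π * q i
      ≈⟨ solve 3 (λ s p q → s :+ :- p :* q := s :- p :* q) refl (x i * (y ∙ᵥ q)) π (q i) ⟩
    x i * (y ∙ᵥ q) - π * q i ∎

  ∙-comm : ∀ (x y : Fin n → Carrier) → x ∙ᵥ y ≈ y ∙ᵥ x
  ∙-comm x y = sum-cong λ j → *-comm (x j) (y j)

  -- The square of xyᵗ - π is (yᵗx - 2π)xyᵗ + π². As `t` sends the blocks `re`, `im` to `π²·im`,
  -- `re`, a graph is stable under `t` as soon as its matrix squares to π².
  rankOne-square : ∀ x y → y ∙ᵥ x ≈ π + π → ∀ q i → (rankOne x y *ᵥ (rankOne x y *ᵥ q)) i ≈ π * π * q i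
  rankOne-square x y y∙x q i = begin
    (rankOne x y *ᵥ (rankOne x y *ᵥ q)) i
      ≈⟨ rankOne-*ᵥ x y (rankOne x y *ᵥ q) i ⟩
    x i * (y ∙ᵥ (rankOne x y *ᵥ q)) - π * (rankOne x y *ᵥ q) i
      ≈⟨ +-cong (*-congˡ scaled) (-‿cong (*-congˡ (rankOne-*ᵥ x y q i))) ⟩
    x i * (π * s) - π * (x i * s - π * q i)
      ≈⟨ solve 4 (λ x p s q → x :* (p :* s) :- p :* (x :* s :- p :* q) := p :* p :* q) refl (x i) π s (q i) ⟩
    π * π * q i ∎
    where
    s = y ∙ᵥ q
    scaled : y ∙ᵥ (rankOne x y *ᵥ q) ≈ π * s
    scaled = begin
      y ∙ᵥ (rankOne x y *ᵥ q)
        ≈⟨ sum-cong (λ j → trans (*-congˡ (rankOne-*ᵥ x y q j))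
             (solve 5 (λ y x s p q → y :* (x :* s :- p :* q) := y :* x :* s :+ :- p :* (y :* q)) refl (y j) (x j) s π (q j))) ⟩
      sum (λ j → y j * x j * s + - π * (y j * q j))
        ≈⟨ sum-+ (λ j → y j * x j * s) (λ j → - π * (y j * q j)) ⟩
      sum (λ j → y j * x j * s) + sum (λ j → - π * (y j * q j))
        ≈⟨ +-cong (sum-* (λ j → y j * x j) s) (*-sum (- π) (λ j → y j * q j)) ⟩
      (y ∙ᵥ x) * s + - π * s  ≈⟨ +-congʳ (*-congʳ y∙x) ⟩
      (π + π) * s + - π * s   ≈⟨ solve 2 (λ p s → (p :+ p) :* s :+ :- p :* s := p :* s) refl π s ⟩
      π * s ∎

  -- Y = rankOne v w and X = rankOne (dual w) (dual v) satisfy all conditions on a chart point.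
  record IsCore (v w : Fin n → Carrier) (μ : Carrier) : Set a where
    field
      w-¬C   : ∀ j → C j ≡ false → w j ≈ μ * dual v j
      w-dual : ∑C (λ j → w j * dual w j) ≈ - (μ + μ)
      πw-C   : ∀ j → C j ≡ true → π * w j ≈ - (μ * dual v j)
      minors : ∀ i j → C i ≡ true → C j ≡ true → v i * w j ≈ dual w i * dual v j
      w∙v    : w ∙ᵥ v ≈ π + π

    -- This is `πw-C` after dualizing: on `C` all signs are -1 and `dual` is an involution.
    πdual-C : ∀ j → C j ≡ true → π * dual w j ≈ - (μ * v j)
    πdual-C j p = begin
      π * (ε (j ᵒ) * w (j ᵒ))       ≈⟨ solve 3 (λ p e w → p :* (e :* w) := e :* (p :* w)) refl π (ε (j ᵒ)) (w (j ᵒ)) ⟩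
      ε (j ᵒ) * (π * w (j ᵒ))       ≈⟨ *-congˡ (πw-C (j ᵒ) (≡.trans (C-ᵒ j) p)) ⟩
      ε (j ᵒ) * - (μ * (ε ((j ᵒ) ᵒ) * v ((j ᵒ) ᵒ)))
                                    ≡⟨ ≡.cong (λ k → ε (j ᵒ) * - (μ * (ε k * v k))) (ᵒ-involutive j) ⟩
      ε (j ᵒ) * - (μ * (ε j * v j)) ≈⟨ *-cong (ε-C (j ᵒ) (≡.trans (C-ᵒ j) p)) (-‿cong (*-congˡ (*-congʳ (ε-C j p)))) ⟩
      - 1# * - (μ * (- 1# * v j))   ≈⟨ solve 2 (λ m v → :- con (+ 1) :* :- (m :* (:- con (+ 1) :* v)) := :- (m :* v)) refl μ (v j) ⟩
      - (μ * v j) ∎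

    dual-w-¬C : ∀ j → C j ≡ false → dual w j ≈ - (μ * v j)
    dual-w-¬C = dual-¬C μ w-¬C

    dual∙dual : dual w ∙ᵥ dual v ≈ π + π
    dual∙dual = trans (dual-∙ w v) w∙v

    X Y : Matrix n n
    X = rankOne (dual w) (dual v)
    Y = rankOne v w

    private
      -- As πw = -μ·dual v on C and w = μ·dual v off C.
      w∙incl₁ : ∀ d → w ∙ᵥ sel (X *ᵥ d) d ≈ - (μ * (dual v ∙ᵥ d))
      w∙incl₁ d = begin
        w ∙ᵥ sel (X *ᵥ d) d
          ≈⟨ ∑-sel w (X *ᵥ d) d ⟩
        ∑C (λ j → w j * (X *ᵥ d) j) + ∑¬C (λ j → w j * d j)
          ≈⟨ +-cong (∑C-cong on) (∑¬C-cong off) ⟩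
        ∑C (λ j → s * (w j * dual w j) + μ * (dual v j * d j)) + ∑¬C (λ j → μ * (dual v j * d j))
          ≈⟨ +-cong (trans (∑C-+ _ (λ j → μ * (dual v j * d j))) (+-cong (*-∑C s (λ j → w j * dual w j)) (*-∑C μ (λ j → dual v j * d j)))) (*-∑¬C μ (λ j → dual v j * d j)) ⟩
        s * ∑C (λ j → w j * dual w j) + μ * ∑C (λ j → dual v j * d j) + μ * ∑¬C (λ j → dual v j * d j)
          ≈⟨ +-cong (+-congʳ (*-congˡ w-dual)) refl ⟩
        s * - (μ + μ) + μ * ∑C (λ j → dual v j * d j) + μ * ∑¬C (λ j → dual v j * d j)
          ≈⟨ solve 4 (λ s m x y → s :* :- (m :+ m) :+ m :* x :+ m :* y := s :* :- (m :+ m) :+ m :* (x :+ y)) refl s μ _ _ ⟩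
        s * - (μ + μ) + μ * (∑C (λ j → dual v j * d j) + ∑¬C (λ j → dual v j * d j))
          ≈⟨ +-congˡ (*-congˡ (sym (∑-split (λ j → dual v j * d j)))) ⟩
        s * - (μ + μ) + μ * s
          ≈⟨ solve 2 (λ s m → s :* :- (m :+ m) :+ m :* s := :- (m :* s)) refl s μ ⟩
        - (μ * s) ∎
        where
        s = dual v ∙ᵥ d
        on : ∀ j → C j ≡ true → w j * (X *ᵥ d) j ≈ s * (w j * dual w j) + μ * (dual v j * d j)
        on j p = begin
          w j * (X *ᵥ d) j                          ≈⟨ *-congˡ (rankOne-*ᵥ (dual w) (dual v) d j) ⟩
          w j * (dual w j * s - π * d j)            ≈⟨ solve 5 (λ w x s p d → w :* (x :* s :- p :* d) := s :* (w :* x) :- (p :* w) :* d) refl (w j) (dual w j) s π (d j) ⟩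
          s * (w j * dual w j) - (π * w j) * d j    ≈⟨ +-congˡ (-‿cong (*-congʳ (πw-C j p))) ⟩
          s * (w j * dual w j) - - (μ * dual v j) * d j ≈⟨ +-congˡ (solve 3 (λ m b d → :- (:- (m :* b) :* d) := m :* (b :* d)) refl μ (dual v j) (d j)) ⟩
          s * (w j * dual w j) + μ * (dual v j * d j) ∎
        off : ∀ j → C j ≡ false → w j * d j ≈ μ * (dual v j * d j)
        off j p = trans (*-congʳ (w-¬C j p)) (*-assoc _ _ _)

    -- The point of the graph of `X` with lower block `d` is sent by Λ_ℓ → Λ_{n-ℓ} to the vector
    -- whose blocks are these two `sel` expressions, so the equation puts the image on the graph of
    -- `Y`. By `w∙incl₁` the row `i` of the right side involves only `-μ·s`; on `C` it cancels
    -- against `π·dual w`, and off `C` it equals the term of `dual w`.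
    incl₁-stable : ∀ d i → sel (λ j → π * π * d j) (X *ᵥ d) i ≈ (Y *ᵥ sel (X *ᵥ d) d) i
    incl₁-stable d i = begin
      sel (λ j → π * π * d j) (X *ᵥ d) i  ≈⟨ lhs (bool-split (C i)) ⟩
      v i * - (μ * s) - π * sel (X *ᵥ d) d i ≈⟨ +-congʳ (*-congˡ (sym (w∙incl₁ d))) ⟩
      v i * (w ∙ᵥ sel (X *ᵥ d) d) - π * sel (X *ᵥ d) d i ≈⟨ sym (rankOne-*ᵥ v w _ i) ⟩
      (Y *ᵥ sel (X *ᵥ d) d) i ∎
      where
      s = dual v ∙ᵥ d
      lhs : C i ≡ true ⊎ C i ≡ false →
            sel (λ j → π * π * d j) (X *ᵥ d) i ≈ v i * - (μ * s) - π * sel (X *ᵥ d) d i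
      lhs (inj₁ p) = sym (begin
        v i * - (μ * s) - π * sel (X *ᵥ d) d i           ≡⟨ ≡.cong (λ z → v i * - (μ * s) - π * z) (sel-C (X *ᵥ d) d p) ⟩
        v i * - (μ * s) - π * (X *ᵥ d) i                 ≈⟨ +-congˡ (-‿cong (*-congˡ (rankOne-*ᵥ (dual w) (dual v) d i))) ⟩
        v i * - (μ * s) - π * (dual w i * s - π * d i)
          ≈⟨ solve 6 (λ v m s p d a → v :* :- (m :* s) :- p :* (a :* s :- p :* d)
               := v :* :- (m :* s) :- (p :* a) :* s :+ p :* p :* d) refl (v i) μ s π (d i) (dual w i) ⟩
        v i * - (μ * s) - π * dual w i * s + π * π * d i ≈⟨ +-congʳ (+-congˡ (-‿cong (*-congʳ (πdual-C i p)))) ⟩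
        v i * - (μ * s) - - (μ * v i) * s + π * π * d i
          ≈⟨ solve 5 (λ v m s p d → v :* :- (m :* s) :- :- (m :* v) :* s :+ p :* p :* d := p :* p :* d)
               refl (v i) μ s π (d i) ⟩
        π * π * d i                                      ≡⟨ ≡.sym (sel-C (λ j → π * π * d j) (X *ᵥ d) p) ⟩
        sel (λ j → π * π * d j) (X *ᵥ d) i ∎)
      lhs (inj₂ p) = begin
        sel (λ j → π * π * d j) (X *ᵥ d) i     ≡⟨ sel-¬C (λ j → π * π * d j) (X *ᵥ d) p ⟩
        (X *ᵥ d) i                             ≈⟨ rankOne-*ᵥ (dual w) (dual v) d i ⟩
        dual w i * s - π * d i                 ≈⟨ +-congʳ (*-congʳ (dual-w-¬C i p)) ⟩
        - (μ * v i) * s - π * d i              ≈⟨ +-congʳ (solve 3 (λ m v s → :- (m :* v) :* s := v :* :- (m :* s)) refl μ (v i) s) ⟩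
        v i * - (μ * s) - π * d i              ≡⟨ ≡.cong (λ z → v i * - (μ * s) - π * z) (≡.sym (sel-¬C (X *ᵥ d) d p)) ⟩
        v i * - (μ * s) - π * sel (X *ᵥ d) d i ∎

    private
      module _ (c : Fin n → Carrier) where
        r B D : Carrier
        r = w ∙ᵥ c
        B = ∑C (λ j → dual v j * c j)
        D = ∑¬C (λ j → dual v j * c j)

        -- The rank-one part of `Y` contributes `r` times the sum of `dual v · v` off `C`, which
        -- vanishes because the pairing alternates there.
        dual∙incl₂ : dual v ∙ᵥ sel c (Y *ᵥ c) ≈ B - π * D
        dual∙incl₂ = begin
          dual v ∙ᵥ sel c (Y *ᵥ c)
            ≈⟨ ∑-sel (dual v) c (Y *ᵥ c) ⟩
          B + ∑¬C (λ j → dual v j * (Y *ᵥ c) j)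
            ≈⟨ +-congˡ (∑¬C-cong λ j _ → trans (*-congˡ (rankOne-*ᵥ v w c j))
                 (solve 5 (λ b v r p c → b :* (v :* r :- p :* c) := r :* (b :* v) :+ :- p :* (b :* c)) refl (dual v j) (v j) r π (c j))) ⟩
          B + ∑¬C (λ j → r * (dual v j * v j) + - π * (dual v j * c j))
            ≈⟨ +-congˡ (trans (∑¬C-+ (λ j → r * (dual v j * v j)) _)
                 (+-cong (*-∑¬C r (λ j → dual v j * v j)) (*-∑¬C (- π) (λ j → dual v j * c j)))) ⟩
          B + (r * ∑¬C (λ j → dual v j * v j) + - π * D)
            ≈⟨ +-congˡ (+-congʳ (*-congˡ (∑¬C-dual v))) ⟩
          B + (r * 0# + - π * D)
            ≈⟨ solve 4 (λ b r p d → b :+ (r :* con (+ 0) :+ :- p :* d) := b :- p :* d) refl B r π D ⟩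
          B - π * D ∎

        r-split : r ≈ ∑C (λ j → w j * c j) + μ * D
        r-split = trans (∑-split _) (+-congˡ (trans
          (∑¬C-cong λ j p → trans (*-congʳ (w-¬C j p)) (*-assoc _ _ _)) (*-∑¬C μ (λ j → dual v j * c j))))

        πr : π * r ≈ - (μ * (B - π * D))
        πr = begin
          π * r                                  ≈⟨ *-congˡ r-split ⟩
          π * (∑C (λ j → w j * c j) + μ * D)     ≈⟨ distribˡ _ _ _ ⟩
          π * ∑C (λ j → w j * c j) + π * (μ * D) ≈⟨ +-congʳ (sym (*-∑C π (λ j → w j * c j))) ⟩
          ∑C (λ j → π * (w j * c j)) + π * (μ * D)
            ≈⟨ +-congʳ (∑C-cong λ j p → trans (sym (*-assoc _ _ _)) (trans (*-congʳ (πw-C j p))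
                 (solve 3 (λ m b c → :- (m :* b) :* c := :- m :* (b :* c)) refl μ (dual v j) (c j)))) ⟩
          ∑C (λ j → - μ * (dual v j * c j)) + π * (μ * D) ≈⟨ +-congʳ (*-∑C (- μ) (λ j → dual v j * c j)) ⟩
          - μ * B + π * (μ * D)
            ≈⟨ solve 4 (λ m b p d → :- m :* b :+ p :* (m :* d) := :- (m :* (b :- p :* d))) refl μ B π D ⟩
          - (μ * (B - π * D)) ∎

        -- The part of `r` on `C` is the contraction of the minors with `c`; the part off `C` is
        -- `μ·D`, and `μ·v` becomes `-π·dual w` on `C`.
        vr : ∀ i → C i ≡ true → v i * r ≈ dual w i * (B - π * D)
        vr i p = begin
          v i * r                                    ≈⟨ *-congˡ r-split ⟩
          v i * (∑C (λ j → w j * c j) + μ * D)       ≈⟨ distribˡ _ _ _ ⟩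
          v i * ∑C (λ j → w j * c j) + v i * (μ * D) ≈⟨ +-congʳ (sym (*-∑C (v i) (λ j → w j * c j))) ⟩
          ∑C (λ j → v i * (w j * c j)) + v i * (μ * D)
            ≈⟨ +-congʳ (∑C-cong λ j q → trans (sym (*-assoc _ _ _)) (trans (*-congʳ (minors i j p q)) (*-assoc _ _ _))) ⟩
          ∑C (λ j → dual w i * (dual v j * c j)) + v i * (μ * D)
            ≈⟨ +-cong (*-∑C (dual w i) (λ j → dual v j * c j))
                 (solve 3 (λ v m d → v :* (m :* d) := :- (:- (m :* v) :* d)) refl (v i) μ D) ⟩
          dual w i * B - - (μ * v i) * D             ≈⟨ +-congˡ (-‿cong (*-congʳ (sym (πdual-C i p)))) ⟩
          dual w i * B - π * dual w i * D
            ≈⟨ solve 4 (λ a b p d → a :* b :- p :* a :* d := a :* (b :- p :* d)) refl (dual w i) B π D ⟩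
          dual w i * (B - π * D) ∎

    -- The counterpart of `incl₁-stable` for Λ_{n-ℓ} → π⁻¹Λ_ℓ: the two `sel` expressions are the
    -- blocks of the image of the point of the graph of `Y` with lower block `c`. Rows in `C` use
    -- `vr`, the others `πr`.
    incl₂-stable : ∀ c i → sel (Y *ᵥ c) (λ j → π * π * c j) i ≈ (X *ᵥ sel c (Y *ᵥ c)) i
    incl₂-stable c i = begin
      sel (Y *ᵥ c) (λ j → π * π * c j) i                           ≈⟨ lhs (bool-split (C i)) ⟩
      dual w i * (B c - π * D c) - π * sel c (Y *ᵥ c) i            ≈⟨ +-congʳ (*-congˡ (sym (dual∙incl₂ c))) ⟩
      dual w i * (dual v ∙ᵥ sel c (Y *ᵥ c)) - π * sel c (Y *ᵥ c) i ≈⟨ sym (rankOne-*ᵥ (dual w) (dual v) _ i) ⟩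
      (X *ᵥ sel c (Y *ᵥ c)) i ∎
      where
      lhs : C i ≡ true ⊎ C i ≡ false → sel (Y *ᵥ c) (λ j → π * π * c j) i ≈
              dual w i * (B c - π * D c) - π * sel c (Y *ᵥ c) i
      lhs (inj₁ p) = begin
        sel (Y *ᵥ c) (λ j → π * π * c j) i                ≡⟨ sel-C (Y *ᵥ c) (λ j → π * π * c j) p ⟩
        (Y *ᵥ c) i                                        ≈⟨ rankOne-*ᵥ v w c i ⟩
        v i * r c - π * c i                               ≈⟨ +-congʳ (vr c i p) ⟩
        dual w i * (B c - π * D c) - π * c i
          ≡⟨ ≡.cong (λ z → dual w i * (B c - π * D c) - π * z) (≡.sym (sel-C c (Y *ᵥ c) p)) ⟩
        dual w i * (B c - π * D c) - π * sel c (Y *ᵥ c) i ∎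
      lhs (inj₂ p) = sym (begin
        dual w i * (B c - π * D c) - π * sel c (Y *ᵥ c) i
          ≡⟨ ≡.cong (λ z → dual w i * (B c - π * D c) - π * z) (sel-¬C c (Y *ᵥ c) p) ⟩
        dual w i * (B c - π * D c) - π * (Y *ᵥ c) i
          ≈⟨ +-cong (*-congʳ (dual-w-¬C i p)) (-‿cong (*-congˡ (rankOne-*ᵥ v w c i))) ⟩
        - (μ * v i) * (B c - π * D c) - π * (v i * r c - π * c i)
          ≈⟨ solve 6 (λ m v b p r c → :- (m :* v) :* b :- p :* (v :* r :- p :* c) := v :* :- (m :* b) :- v :* (p :* r) :+ p :* p :* c)
               refl μ (v i) (B c - π * D c) π (r c) (c i) ⟩
        v i * - (μ * (B c - π * D c)) - v i * (π * r c) + π * π * c i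
          ≈⟨ +-congʳ (+-congʳ (*-congˡ (sym (πr c)))) ⟩
        v i * (π * r c) - v i * (π * r c) + π * π * c i
          ≈⟨ solve 2 (λ x y → x :- x :+ y := y) refl (v i * (π * r c)) (π * π * c i) ⟩
        π * π * c i                        ≡⟨ ≡.sym (sel-¬C (Y *ᵥ c) (λ j → π * π * c j) p) ⟩
        sel (Y *ᵥ c) (λ j → π * π * c j) i ∎)

  -- Off `C` the sum is `μ` times the alternating expression of `∑¬C-dual`. This is why the relation
  -- on the chart involves only the last block of `v` and `w`.
  ∑C-w∙v : ∀ {v w} μ → (∀ j → C j ≡ false → w j ≈ μ * dual v j) → ∑C (λ j → w j * v j) ≈ w ∙ᵥ v
  ∑C-w∙v {v} {w} μ w-¬C = sym (begin
    w ∙ᵥ v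
      ≈⟨ ∑-split (λ j → w j * v j) ⟩
    ∑C (λ j → w j * v j) + ∑¬C (λ j → w j * v j)
      ≈⟨ +-congˡ (∑¬C-cong λ j p → trans (*-congʳ (w-¬C j p)) (*-assoc _ _ _)) ⟩
    ∑C (λ j → w j * v j) + ∑¬C (λ j → μ * (dual v j * v j))
      ≈⟨ +-congˡ (trans (*-∑¬C μ (λ j → dual v j * v j)) (trans (*-congˡ (∑¬C-dual v)) (zeroʳ μ))) ⟩
    ∑C (λ j → w j * v j) + 0#
      ≈⟨ +-identityʳ _ ⟩
    ∑C (λ j → w j * v j) ∎)

  -- Since 2 is invertible, πw = -μ·dual v on C follows by contracting the minors with w.
  isCore-minors : ∀ {v w} μ →
    (∀ j → C j ≡ false → w j ≈ μ * dual v j) →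
    ∑C (λ j → w j * dual w j) ≈ - (μ + μ) →
    (∀ i j → C i ≡ true → C j ≡ true → v i * w j ≈ dual w i * dual v j) →
    ∑C (λ j → w j * v j) ≈ π + π → IsCore v w μ
  isCore-minors {v} {w} μ w-¬C w-dual minors ∑C-wv = record
    { w-¬C   = w-¬C
    ; w-dual = w-dual
    ; πw-C   = λ j p → double-injective (begin
        π * w j + π * w j                               ≈⟨ sym (distribʳ _ _ _) ⟩
        (π + π) * w j                                   ≈⟨ *-comm _ _ ⟩
        w j * (π + π)                                   ≈⟨ *-congˡ (sym ∑C-wv) ⟩
        w j * ∑C (λ k → w k * v k)                      ≈⟨ sym (*-∑C (w j) (λ k → w k * v k)) ⟩
        ∑C (λ k → w j * (w k * v k))                    ≈⟨ ∑C-cong (λ k q → begin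
          w j * (w k * v k)           ≈⟨ solve 3 (λ x y z → x :* (y :* z) := y :* (z :* x)) refl (w j) (w k) (v k) ⟩
          w k * (v k * w j)           ≈⟨ *-congˡ (minors k j q p) ⟩
          w k * (dual w k * dual v j) ≈⟨ solve 3 (λ x y z → x :* (y :* z) := z :* (x :* y)) refl (w k) (dual w k) (dual v j) ⟩
          dual v j * (w k * dual w k) ∎) ⟩
        ∑C (λ k → dual v j * (w k * dual w k))          ≈⟨ *-∑C (dual v j) (λ k → w k * dual w k) ⟩
        dual v j * ∑C (λ k → w k * dual w k)            ≈⟨ *-congˡ w-dual ⟩
        dual v j * - (μ + μ)
          ≈⟨ solve 2 (λ b m → b :* :- (m :+ m) := :- (m :* b) :+ :- (m :* b)) refl (dual v j) μ ⟩
        - (μ * dual v j) + - (μ * dual v j) ∎)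
    ; minors = minors
    ; w∙v    = trans (sym (∑C-w∙v μ w-¬C)) ∑C-wv
    }

  -- The shape that `w` takes when `v` has an entry 1 in `C`. There HZ₂ is a multiple of V₂, so the
  -- minors vanish by themselves and the product with `v` is the only equation left. The value of μ
  -- is read off from the block outside `C`.
  isCore-multiple : ∀ {v w} ν →
    (∀ j → C j ≡ true → w j ≈ ν * dual v j) →
    (∀ j → C j ≡ false → w j ≈ ν * - (π * dual v j)) →
    ∑C (λ j → w j * v j) ≈ π + π → IsCore v w (- (π * ν))
  isCore-multiple {v} {w} ν w-C w-¬C′ ∑C-wv = record
    { w-¬C   = w-¬C
    ; w-dual = begin
        ∑C (λ j → w j * dual w j)
          ≈⟨ ∑C-cong (λ j p → trans (*-congˡ (dual-w j p))
               (solve 3 (λ w n v → w :* (n :* v) := n :* (w :* v)) refl (w j) ν (v j))) ⟩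
        ∑C (λ j → ν * (w j * v j)) ≈⟨ *-∑C ν (λ j → w j * v j) ⟩
        ν * ∑C (λ j → w j * v j)   ≈⟨ *-congˡ ∑C-wv ⟩
        ν * (π + π)                ≈⟨ solve 2 (λ n p → n :* (p :+ p) := :- (:- (p :* n) :+ :- (p :* n))) refl ν π ⟩
        - (- (π * ν) + - (π * ν))  ∎
    ; πw-C   = λ j p → trans (*-congˡ (w-C j p))
        (solve 3 (λ p n b → p :* (n :* b) := :- (:- (p :* n) :* b)) refl π ν (dual v j))
    ; minors = λ i j p q → begin
        v i * w j             ≈⟨ *-congˡ (w-C j q) ⟩
        v i * (ν * dual v j)  ≈⟨ solve 3 (λ v n b → v :* (n :* b) := n :* v :* b) refl (v i) ν (dual v j) ⟩
        ν * v i * dual v j    ≈⟨ *-congʳ (sym (dual-w i p)) ⟩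
        dual w i * dual v j   ∎
    ; w∙v    = trans (sym (∑C-w∙v (- (π * ν)) w-¬C)) ∑C-wv
    }
    where
    w-¬C : ∀ j → C j ≡ false → w j ≈ - (π * ν) * dual v j
    w-¬C j p = trans (w-¬C′ j p) (solve 3 (λ n p b → n :* :- (p :* b) := :- (p :* n) :* b) refl ν π (dual v j))
    -- On `C` the operation `dual` is an involution, so dualizing `w = ν·dual v` returns `v`.
    dual-w : ∀ j → C j ≡ true → dual w j ≈ ν * v j
    dual-w j p = begin
      dual w j              ≈⟨ dual-C w j p ⟩
      - w (j ᵒ)             ≈⟨ -‿cong (w-C (j ᵒ) (≡.trans (C-ᵒ j) p)) ⟩
      - (ν * dual v (j ᵒ))  ≈⟨ -‿cong (*-congˡ (dual-C v (j ᵒ) (≡.trans (C-ᵒ j) p))) ⟩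
      - (ν * - v ((j ᵒ) ᵒ)) ≡⟨ ≡.cong (λ k → - (ν * - v k)) (ᵒ-involutive j) ⟩
      - (ν * - v j)         ≈⟨ solve 2 (λ n v → :- (n :* :- v) := n :* v) refl ν (v j) ⟩
      ν * v j ∎

  -- The converse of the stability lemmas. It is enough to test the columns of the two graphs,
  -- indexed by `b`; the entry 1 of `v` at `i₀` permits division in row `i₀`.
  module Stable {v w : Fin n → Carrier} {i₀ : Fin n} (v-i₀ : v i₀ ≈ 1#)
    (eigenvector : (rankOne v w *ᵥ v) i₀ ≈ π * v i₀)
    (stable₁ : ∀ b i → sel (λ j → π * π * 𝟙 j b) (λ j → rankOne (dual w) (dual v) j b) i ≈
                       (rankOne v w *ᵥ sel (λ j → rankOne (dual w) (dual v) j b) (λ j → 𝟙 j b)) i)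
    (stable₂ : ∀ b i → sel (λ j → rankOne v w j b) (λ j → π * π * 𝟙 j b) i ≈
                       (rankOne (dual w) (dual v) *ᵥ sel (λ j → 𝟙 j b) (λ j → rankOne v w j b)) i)
    where
    private
      X Y : Matrix n n
      X = rankOne (dual w) (dual v)
      Y = rankOne v w

      cancel : ∀ {x y z} → x - z ≈ y - z → x ≈ y
      cancel {x} {y} {z} p = trans (restore x) (trans (+-congʳ p) (sym (restore y)))
        where
        restore : ∀ t → t ≈ (t - z) + z
        restore t = solve 2 (λ t z → t := (t :- z) :+ z) refl t z

      w∙v : w ∙ᵥ v ≈ π + π
      w∙v = begin
        w ∙ᵥ v                      ≈⟨ solve 2 (λ x p → x := con (+ 1) :* x :- p :* con (+ 1) :+ p) refl (w ∙ᵥ v) π ⟩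
        1# * (w ∙ᵥ v) - π * 1# + π  ≈⟨ +-congʳ (+-cong (*-congʳ (sym v-i₀)) (-‿cong (*-congˡ (sym v-i₀)))) ⟩
        v i₀ * (w ∙ᵥ v) - π * v i₀ + π ≈⟨ +-congʳ (sym (rankOne-*ᵥ v w v i₀)) ⟩
        (Y *ᵥ v) i₀ + π             ≈⟨ +-congʳ (trans eigenvector (trans (*-congˡ v-i₀) (*-identityʳ π))) ⟩
        π + π ∎

      -- It will turn out to be -2μ; at this stage μ is not yet available.
      κ : Carrier
      κ = ∑C (λ j → w j * dual w j)

      w∙incl₁ : ∀ b → C b ≡ false → w ∙ᵥ sel (λ j → X j b) (λ j → 𝟙 j b) ≈ κ * dual v b + w b
      w∙incl₁ b p = begin
        w ∙ᵥ sel (λ j → X j b) (λ j → 𝟙 j b)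
          ≈⟨ ∑-sel w (λ j → X j b) (λ j → 𝟙 j b) ⟩
        ∑C (λ j → w j * (dual w j * dual v b - π * 𝟙 j b)) + ∑¬C (λ j → w j * 𝟙 j b)
          ≈⟨ +-cong (∑C-cong λ j _ → solve 5 (λ w a b p d → w :* (a :* b :- p :* d) := b :* (w :* a) :+ :- p :* (w :* d))
               refl (w j) (dual w j) (dual v b) π (𝟙 j b)) (∑¬C-𝟙 w b) ⟩
        ∑C (λ j → dual v b * (w j * dual w j) + - π * (w j * 𝟙 j b)) + sel 0ᵥ w b
          ≈⟨ +-cong (trans (∑C-+ (λ j → dual v b * (w j * dual w j)) _)
               (+-cong (*-∑C (dual v b) (λ j → w j * dual w j)) (trans (*-∑C (- π) (λ j → w j * 𝟙 j b)) (*-congˡ (∑C-𝟙 w b)))))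
               (reflexive (sel-¬C 0ᵥ w p)) ⟩
        dual v b * κ + - π * sel w 0ᵥ b + w b
          ≡⟨ ≡.cong (λ z → dual v b * κ + - π * z + w b) (sel-¬C w 0ᵥ p) ⟩
        dual v b * κ + - π * 0# + w b
          ≈⟨ solve 4 (λ b k p w → b :* k :+ :- p :* con (+ 0) :+ w := k :* b :+ w) refl (dual v b) κ π (w b) ⟩
        κ * dual v b + w b ∎

      -- The pairing of `dual v` with the image of column `b`: the factor -π off `C` comes from the
      -- scalar part of `Y`, its rank-one part dropping out because the pairing alternates.
      ρ : Fin n → Carrier
      ρ = sel (dual v) (λ j → - (π * dual v j))

      dual∙incl₂ : ∀ b → dual v ∙ᵥ sel (λ j → 𝟙 j b) (λ j → Y j b) ≈ ρ b
      dual∙incl₂ b = begin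
        dual v ∙ᵥ sel (λ j → 𝟙 j b) (λ j → Y j b)
          ≈⟨ ∑-sel (dual v) (λ j → 𝟙 j b) (λ j → Y j b) ⟩
        ∑C (λ j → dual v j * 𝟙 j b) + ∑¬C (λ j → dual v j * (v j * w b - π * 𝟙 j b))
          ≈⟨ +-cong (∑C-𝟙 (dual v) b) (∑¬C-cong λ j _ →
               solve 5 (λ b v w p d → b :* (v :* w :- p :* d) := w :* (b :* v) :+ :- p :* (b :* d)) refl (dual v j) (v j) (w b) π (𝟙 j b)) ⟩
        sel (dual v) 0ᵥ b + ∑¬C (λ j → w b * (dual v j * v j) + - π * (dual v j * 𝟙 j b))
          ≈⟨ +-congˡ (trans (∑¬C-+ (λ j → w b * (dual v j * v j)) _)
               (+-cong (trans (*-∑¬C (w b) (λ j → dual v j * v j)) (*-congˡ (∑¬C-dual v)))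
                       (trans (*-∑¬C (- π) (λ j → dual v j * 𝟙 j b)) (*-congˡ (∑¬C-𝟙 (dual v) b))))) ⟩
        sel (dual v) 0ᵥ b + (w b * 0# + - π * sel 0ᵥ (dual v) b)
          ≈⟨ merge (bool-split (C b)) ⟩
        ρ b ∎
        where
        merge : C b ≡ true ⊎ C b ≡ false → sel (dual v) 0ᵥ b + (w b * 0# + - π * sel 0ᵥ (dual v) b) ≈ ρ b
        merge (inj₁ p) rewrite p =
          solve 3 (λ b w p → b :+ (w :* con (+ 0) :+ :- p :* con (+ 0)) := b) refl (dual v b) (w b) π
        merge (inj₂ p) rewrite p =
          solve 3 (λ b w p → con (+ 0) :+ (w :* con (+ 0) :+ :- p :* b) := :- (p :* b)) refl (dual v b) (w b) π

      -- Row `i` of `stable₂`, where both sides contain the same term `-π·𝟙`. For `b` in `C` it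
      -- gives the minors; for `i = i₀` it determines all of `w`.
      vw : ∀ i b → C i ≡ true → v i * w b ≈ dual w i * ρ b
      vw i b p = cancel (begin
        v i * w b - π * 𝟙 i b                                    ≡⟨ ≡.sym (sel-C (λ j → Y j b) (λ j → π * π * 𝟙 j b) p) ⟩
        sel (λ j → Y j b) (λ j → π * π * 𝟙 j b) i                ≈⟨ stable₂ b i ⟩
        (X *ᵥ sel (λ j → 𝟙 j b) (λ j → Y j b)) i                 ≈⟨ rankOne-*ᵥ (dual w) (dual v) _ i ⟩
        dual w i * (dual v ∙ᵥ sel (λ j → 𝟙 j b) (λ j → Y j b)) - π * sel (λ j → 𝟙 j b) (λ j → Y j b) i
          ≈⟨ +-cong (*-congˡ (dual∙incl₂ b)) (-‿cong (*-congˡ (reflexive (sel-C (λ j → 𝟙 j b) (λ j → Y j b) p)))) ⟩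
        dual w i * ρ b - π * 𝟙 i b ∎)

      minors : ∀ i b → C i ≡ true → C b ≡ true → v i * w b ≈ dual w i * dual v b
      minors i b p q = trans (vw i b p) (*-congˡ (reflexive (sel-C (dual v) (λ j → - (π * dual v j)) q)))

    -- The scalar is forced by row `i₀` of `stable₁`, which reads `dual w i₀ · dual v b = κ · dual v
    -- b + w b` for `b` off `C`.
    core-¬C : C i₀ ≡ false → IsCore v w (dual w i₀ - κ)
    core-¬C p = isCore-minors μ w-¬C κ≈ minors (trans (∑C-w∙v μ w-¬C) w∙v)
      where
      μ = dual w i₀ - κ
      w-¬C : ∀ b → C b ≡ false → w b ≈ μ * dual v b
      w-¬C b q = begin
        w b                                            ≈⟨ solve 2 (λ w k → w := con (+ 1) :* (k :+ w) :- k) refl (w b) (κ * dual v b) ⟩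
        1# * (κ * dual v b + w b) - κ * dual v b       ≈⟨ +-congʳ (*-congʳ (sym v-i₀)) ⟩
        v i₀ * (κ * dual v b + w b) - κ * dual v b     ≈⟨ +-congʳ (sym eq) ⟩
        dual w i₀ * dual v b - κ * dual v b            ≈⟨ solve 3 (λ a k b → a :* b :- k :* b := (a :- k) :* b) refl (dual w i₀) κ (dual v b) ⟩
        μ * dual v b ∎
        where
        eq : dual w i₀ * dual v b ≈ v i₀ * (κ * dual v b + w b)
        eq = cancel (begin
          dual w i₀ * dual v b - π * 𝟙 i₀ b                        ≡⟨ ≡.sym (sel-¬C (λ j → π * π * 𝟙 j b) (λ j → X j b) p) ⟩
          sel (λ j → π * π * 𝟙 j b) (λ j → X j b) i₀               ≈⟨ stable₁ b i₀ ⟩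
          (Y *ᵥ sel (λ j → X j b) (λ j → 𝟙 j b)) i₀                ≈⟨ rankOne-*ᵥ v w _ i₀ ⟩
          v i₀ * (w ∙ᵥ sel (λ j → X j b) (λ j → 𝟙 j b)) - π * sel (λ j → X j b) (λ j → 𝟙 j b) i₀
            ≈⟨ +-cong (*-congˡ (w∙incl₁ b q)) (-‿cong (*-congˡ (reflexive (sel-¬C (λ j → X j b) (λ j → 𝟙 j b) p)))) ⟩
          v i₀ * (κ * dual v b + w b) - π * 𝟙 i₀ b ∎)
      -- As `i₀` lies off `C` and `v i₀` is 1, dualizing `w = μ·dual v` at `i₀` yields
      -- `dual w i₀ = -μ`; now solve the definition of `μ` for `κ`.
      κ≈ : κ ≈ - (μ + μ)
      κ≈ = begin
        κ                    ≈⟨ solve 2 (λ a k → k := a :- (a :- k)) refl (dual w i₀) κ ⟩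
        dual w i₀ - μ        ≈⟨ +-congʳ (trans (dual-¬C μ w-¬C i₀ p) (-‿cong (trans (*-congˡ v-i₀) (*-identityʳ μ)))) ⟩
        - μ - μ              ≈⟨ solve 1 (λ m → :- m :- m := :- (m :+ m)) refl μ ⟩
        - (μ + μ) ∎

    private
      w≈dual*ρ : C i₀ ≡ true → ∀ b → w b ≈ dual w i₀ * ρ b
      w≈dual*ρ p b = trans (sym (trans (*-congʳ v-i₀) (*-identityˡ _))) (vw i₀ b p)

    w-C : C i₀ ≡ true → ∀ b → C b ≡ true → w b ≈ dual w i₀ * dual v b
    w-C p b q = trans (w≈dual*ρ p b) (*-congˡ (reflexive (sel-C (dual v) (λ j → - (π * dual v j)) q)))

    w-¬C : C i₀ ≡ true → ∀ b → C b ≡ false → w b ≈ dual w i₀ * - (π * dual v b)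
    w-¬C p b q = trans (w≈dual*ρ p b) (*-congˡ (reflexive (sel-¬C (dual v) (λ j → - (π * dual v j)) q)))

    core-C : C i₀ ≡ true → IsCore v w (- (π * dual w i₀))
    core-C p = isCore-multiple (dual w i₀) (w-C p) (w-¬C p)
      (trans (∑C-w∙v (- (π * dual w i₀)) λ j q → trans (w-¬C p j q)
        (solve 3 (λ a p b → a :* :- (p :* b) := :- (p :* a) :* b) refl (dual w i₀) π (dual v j))) w∙v)

-- Coordinates on tensor products

record Functional {a} {K : CommRing a} (M : Mod K) : Set a where
  private
    module K = CommutativeRing K
    module M = LeftModule M
  field
    ⟦_⟧    : M.Carrierᴹ → K.Carrier
    cong   : ∀ {x y} → x M.≈ᴹ y → ⟦ x ⟧ K.≈ ⟦ y ⟧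
    +-homo : ∀ x y → ⟦ x M.+ᴹ y ⟧ K.≈ ⟦ x ⟧ K.+ ⟦ y ⟧
    *-homo : ∀ k x → ⟦ k M.*ₗ x ⟧ K.≈ k K.* ⟦ x ⟧

module Extension {a} {K : CommRing a} (M : Mod K) (R : Algebra K) (f : Functional {K = K} M) where
  private
    module K = CommutativeRing K
    module M = LeftModule M
    module R = Algebra R
    module f = Functional f
    module scalar = Hom (Algebra.structureMap R)
    open IntegerSolver R.commutativeRing
  open TensorProduct {K = K} M R

  extend : Tensor → R.Carrier
  extend 𝟘       = R.0#
  extend (x ⊞ y) = extend x R.+ extend y
  extend (m ⊗ r) = r R.* R.scalar f.⟦ m ⟧

  extend-cong : ∀ {x y} → x ≋ y → extend x R.≈ extend y
  extend-cong ≋-refl          = R.refl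
  extend-cong (≋-sym p)       = R.sym (extend-cong p)
  extend-cong (≋-trans p q)   = R.trans (extend-cong p) (extend-cong q)
  extend-cong (⊞-cong p q)    = R.+-cong (extend-cong p) (extend-cong q)
  extend-cong (⊞-assoc x y z) = R.+-assoc _ _ _
  extend-cong (⊞-comm x y)    = R.+-comm _ _
  extend-cong (⊞-identityˡ x) = R.+-identityˡ _
  extend-cong (⊗-cong p q)    = R.*-cong q (scalar.⟦⟧-cong (f.cong p))
  extend-cong (⊗-distribʳ m m′ r) =
    R.trans (R.*-congˡ (R.trans (scalar.⟦⟧-cong (f.+-homo m m′)) (scalar.+-homo _ _))) (R.distribˡ _ _ _)
  extend-cong (⊗-distribˡ m r r′) = R.distribʳ _ _ _
  extend-cong (⊗-zeroʳ m)         = R.zeroˡ _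
  extend-cong (⊗-balanced k m r)  =
    R.trans (R.*-congˡ (R.trans (scalar.⟦⟧-cong (f.*-homo k m)) (scalar.*-homo _ _)))
      (solve 3 (λ r k m → r :* (k :* m) := k :* r :* m) R.refl r (R.scalar k) _)

  extend-• : ∀ s x → extend (s • x) R.≈ s R.* extend x
  extend-• s 𝟘       = R.sym (R.zeroʳ s)
  extend-• s (x ⊞ y) = R.trans (R.+-cong (extend-• s x) (extend-• s y)) (R.sym (R.distribˡ s _ _))
  extend-• s (m ⊗ r) = R.*-assoc s r _

module _ {a} {K : CommRing a} where
  private module K = CommutativeRing K
  open Extension using (extend)
  open TensorProduct

  -- The means to compute `t`, the inclusions and the scaling by π⁻¹ in coordinates: each pulls a
  -- coordinate back to a constant multiple of a coordinate, and this survives the extension of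
  -- scalars.
  extend-map : ∀ {M N : Mod K} (R : Algebra K) (f : Functional {K = K} M) (g : Functional {K = K} N) h k →
    (∀ m → Functional.⟦_⟧ g (h m) K.≈ k K.* Functional.⟦_⟧ f m) → ∀ x →
    Algebra._≈_ R (extend N R g (tensorMap {M = M} {N = N} {R = R} {S = R} h (λ r → r) x))
                  (Algebra._*_ R (Algebra.scalar R k) (extend M R f x))
  extend-map R f g h k p 𝟘       = R.sym (R.zeroʳ _)
    where module R = Algebra R
  extend-map {M} {N} R f g h k p (x ⊞ y) =
    R.trans (R.+-cong (extend-map {M} {N} R f g h k p x) (extend-map {M} {N} R f g h k p y)) (R.sym (R.distribˡ _ _ _))
    where module R = Algebra R
  extend-map R f g h k p (m ⊗ r) =
    R.trans (R.*-congˡ (R.trans (scalar.⟦⟧-cong (p m)) (scalar.*-homo _ _)))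
      (solve 3 (λ r k m → r :* (k :* m) := k :* (r :* m)) R.refl r (R.scalar k) _)
    where
    module R = Algebra R
    module scalar = Hom (Algebra.structureMap R)
    open IntegerSolver R.commutativeRing

  extend-map-1 : ∀ {M N : Mod K} (R : Algebra K) (f : Functional {K = K} M) (g : Functional {K = K} N) h →
    (∀ m → Functional.⟦_⟧ g (h m) K.≈ Functional.⟦_⟧ f m) → ∀ x →
    Algebra._≈_ R (extend N R g (tensorMap {M = M} {N = N} {R = R} {S = R} h (λ r → r) x)) (extend M R f x)
  extend-map-1 {M} {N} R f g h p x =
    R.trans (extend-map {M} {N} R f g h K.1# (λ m → K.trans (p m) (K.sym (K.*-identityˡ _))) x)
      (R.trans (R.*-congʳ (Hom.1#-homo (Algebra.structureMap R))) (R.*-identityˡ _))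
    where module R = Algebra R

  extend-baseChange : ∀ {M : Mod K} {R R′ : Algebra K} (φ : AlgHom R R′) (f : Functional {K = K} M) x →
    Algebra._≈_ R′ (extend M R′ f (tensorMap {M = M} {N = M} {R = R} {S = R′} (λ m → m) (AlgHom.⟦_⟧ φ) x))
                   (AlgHom.⟦_⟧ φ (extend M R f x))
  extend-baseChange {R′ = R′} φ f 𝟘       = R′.sym φ.0#-homo
    where
    module R′ = Algebra R′
    module φ = AlgHom φ
  extend-baseChange {M} {R} {R′} φ f (x ⊞ y) =
    R′.trans (R′.+-cong (extend-baseChange {M} {R} {R′} φ f x) (extend-baseChange {M} {R} {R′} φ f y)) (R′.sym (φ.+-homo _ _))
    where
    module R′ = Algebra R′
    module φ = AlgHom φ
  extend-baseChange {R′ = R′} φ f (m ⊗ r) =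
    R′.trans (R′.*-congˡ (R′.sym (φ.commutes _))) (R′.sym (φ.*-homo _ _))
    where
    module R′ = Algebra R′
    module φ = AlgHom φ

-- re and im are the two blocks of the column of an element in the ordered basis.
record Coordinates {a} (R : CommRing a) (M : Mod R) (n : ℕ) : Set a where
  private module R = CommutativeRing R
  open LeftModule M
  open LinearAlgebra R M
  open Matrices R using (sum; 𝟙)
  open Sums R
  field
    re im    : Carrierᴹ → Fin n → R.Carrier
    re-cong  : ∀ {x y} → x ≈ᴹ y → ∀ j → re x j R.≈ re y j
    im-cong  : ∀ {x y} → x ≈ᴹ y → ∀ j → im x j R.≈ im y j
    re-+     : ∀ x y j → re (x +ᴹ y) j R.≈ re x j R.+ re y j
    im-+     : ∀ x y j → im (x +ᴹ y) j R.≈ im x j R.+ im y j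
    re-*     : ∀ s x j → re (s *ₗ x) j R.≈ s R.* re x j
    im-*     : ∀ s x j → im (s *ₗ x) j R.≈ s R.* im x j
    first second : Fin n → Carrierᴹ
    re-first  : ∀ i j → re (first j) i R.≈ 𝟙 j i
    re-second : ∀ i j → re (second j) i R.≈ R.0#
    im-first  : ∀ i j → im (first j) i R.≈ R.0#
    im-second : ∀ i j → im (second j) i R.≈ 𝟙 j i
    injective : ∀ {x y} → (∀ j → re x j R.≈ re y j) → (∀ j → im x j R.≈ im y j) → x ≈ᴹ y

  private
    fixedPoint⇒0 : ∀ {z} → z R.≈ R.0# R.* z → z R.≈ R.0#
    fixedPoint⇒0 p = R.trans p (R.zeroˡ _)

  re-0 : ∀ j → re 0ᴹ j R.≈ R.0#
  re-0 j = fixedPoint⇒0 (R.trans (re-cong (≈ᴹ-sym (*ₗ-zeroˡ 0ᴹ)) j) (re-* R.0# 0ᴹ j))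

  im-0 : ∀ j → im 0ᴹ j R.≈ R.0#
  im-0 j = fixedPoint⇒0 (R.trans (im-cong (≈ᴹ-sym (*ₗ-zeroˡ 0ᴹ)) j) (im-* R.0# 0ᴹ j))

  re-lincomb : ∀ {k} (c : Fin k → R.Carrier) b j → re (lincomb c b) j R.≈ sum (λ i → c i R.* re (b i) j)
  re-lincomb {zero}  c b j = re-0 j
  re-lincomb {suc k} c b j = R.trans (re-+ _ _ j)
    (R.+-cong (re-* _ _ j) (re-lincomb (c ∘ Fin.suc) (b ∘ Fin.suc) j))

  im-lincomb : ∀ {k} (c : Fin k → R.Carrier) b j → im (lincomb c b) j R.≈ sum (λ i → c i R.* im (b i) j)
  im-lincomb {zero}  c b j = im-0 j
  im-lincomb {suc k} c b j = R.trans (im-+ _ _ j)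
    (R.+-cong (im-* _ _ j) (im-lincomb (c ∘ Fin.suc) (b ∘ Fin.suc) j))

  col : (Fin n → R.Carrier) → (Fin n → R.Carrier) → Carrierᴹ
  col p q = lincomb p first +ᴹ lincomb q second

  re-col : ∀ p q i → re (col p q) i R.≈ p i
  re-col p q i = R.trans (re-+ _ _ i) (R.trans
    (R.+-cong (R.trans (re-lincomb p first i) (R.trans (sum-cong λ j → R.*-congˡ (re-first i j)) (sum-𝟙ʳ i p)))
              (R.trans (re-lincomb q second i) (sum-zero λ j → R.trans (R.*-congˡ (re-second i j)) (R.zeroʳ (q j)))))
    (R.+-identityʳ _))

  im-col : ∀ p q i → im (col p q) i R.≈ q i
  im-col p q i = R.trans (im-+ _ _ i) (R.trans
    (R.+-cong (R.trans (im-lincomb p first i) (sum-zero λ j → R.trans (R.*-congˡ (im-first i j)) (R.zeroʳ (p j))))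
              (R.trans (im-lincomb q second i) (R.trans (sum-cong λ j → R.*-congˡ (im-second i j)) (sum-𝟙ʳ i q))))
    (R.+-identityˡ _))

-- The functionals are the dual basis, so independence is implied by the four evaluation laws, and
-- `expand` adds generation.
record FreeBasis {a} {K : CommRing a} (N : Mod K) (n : ℕ) : Set a where
  private
    module K = CommutativeRing K
    module F = Functional
  open LeftModule N
  open LinearAlgebra K N
  open Matrices K using (𝟙)
  field
    first second        : Fin n → Carrierᴹ
    rational irrational : Fin n → Functional {K = K} N
    rational-first    : ∀ i j → F.⟦ rational i ⟧ (first j) K.≈ 𝟙 j i
    rational-second   : ∀ i j → F.⟦ rational i ⟧ (second j) K.≈ K.0#
    irrational-first  : ∀ i j → F.⟦ irrational i ⟧ (first j) K.≈ K.0#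
    irrational-second : ∀ i j → F.⟦ irrational i ⟧ (second j) K.≈ 𝟙 j i
    expand : ∀ m → m ≈ᴹ lincomb (λ j → F.⟦ rational j ⟧ m) first +ᴹ lincomb (λ j → F.⟦ irrational j ⟧ m) second

module FreeTensor {a} {K : CommRing a} {N : Mod K} {n} (basis : FreeBasis {K = K} N n) (R : Algebra K) where
  private
    module K = CommutativeRing K
    module N = LeftModule N
    module F = Functional
    open Matrices K using (𝟙)
    open LinearAlgebra K N using (lincomb)
    open FreeBasis basis
    module R = Algebra R
    module scalar = Hom (Algebra.structureMap R)
    module 𝟙R = Matrices R.commutativeRing
    open Sums R.commutativeRing
    open TensorProduct {K = K} N R
    open Extension {K = K} N R
    module T = LeftModule tensorModule
    module TL = LinearAlgebra R.commutativeRing tensorModule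
    open CommutativeSemigroupProperties
      (CommutativeMonoid.commutativeSemigroup T.+ᴹ-commutativeMonoid) using (interchange)

    first⊗1 second⊗1 : Fin n → Tensor
    first⊗1 j  = first j ⊗ R.1#
    second⊗1 j = second j ⊗ R.1#

    col : (Fin n → R.Carrier) → (Fin n → R.Carrier) → Tensor
    col p q = TL.lincomb p first⊗1 T.+ᴹ TL.lincomb q second⊗1

    re im : Tensor → Fin n → R.Carrier
    re x j = extend (rational j) x
    im x j = extend (irrational j) x

    scaled-𝟙 : ∀ {k} (i j : Fin n) → k K.≈ 𝟙 i j → R.1# R.* R.scalar k R.≈ 𝟙R.𝟙 i j
    scaled-𝟙 i j p = R.trans (R.*-identityˡ _) (R.trans (scalar.⟦⟧-cong p) (helper i j))
      where
      helper : ∀ {k} (i j : Fin k) → R.scalar (𝟙 i j) R.≈ 𝟙R.𝟙 i j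
      helper i j with i Finₚ.≟ j
      ... | yes _ = scalar.1#-homo
      ... | no  _ = scalar.0#-homo

    scaled-0 : ∀ {k} → k K.≈ K.0# → R.1# R.* R.scalar k R.≈ R.0#
    scaled-0 p = R.trans (R.*-identityˡ _) (R.trans (scalar.⟦⟧-cong p) scalar.0#-homo)

    ⊗-lincomb : ∀ {k} (c : Fin k → K.Carrier) b r →
                lincomb c b ⊗ r ≋ TL.lincomb (λ i → r R.* R.scalar (c i)) (λ i → b i ⊗ R.1#)
    ⊗-lincomb {zero}  c b r = ≋-trans (⊗-cong (N.≈ᴹ-sym (N.*ₗ-zeroˡ N.0ᴹ)) R.refl)
      (≋-trans (⊗-balanced K.0# N.0ᴹ r) (≋-trans
        (⊗-cong N.≈ᴹ-refl (R.trans (R.*-congʳ scalar.0#-homo) (R.zeroˡ r))) (⊗-zeroʳ N.0ᴹ)))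
    ⊗-lincomb {suc k} c b r = ≋-trans (⊗-distribʳ _ _ r)
      (⊞-cong (≋-trans (⊗-balanced _ _ r) (⊗-cong N.≈ᴹ-refl (R.trans (R.*-comm _ r) (R.sym (R.*-identityʳ _)))))
        (⊗-lincomb (c ∘ Fin.suc) (b ∘ Fin.suc) r))

    -- Equality of tensors is a generated congruence, from which nothing can be read off directly.
    -- This expansion reduces it to the equality of 2n elements of `R`.
    recover : ∀ x → x ≋ col (re x) (im x)
    recover 𝟘       = ≋-trans (≋-sym (⊞-identityˡ 𝟘)) (⊞-cong (TL.span-zero first⊗1) (TL.span-zero second⊗1))
    recover (x ⊞ y) = ≋-trans (⊞-cong (recover x) (recover y)) (≋-trans (interchange _ _ _ _)
      (⊞-cong (TL.span-+ (re x) (re y) first⊗1) (TL.span-+ (im x) (im y) second⊗1)))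
    recover (m ⊗ r) = ≋-trans (⊗-cong (expand m) R.refl) (≋-trans (⊗-distribʳ _ _ r)
      (⊞-cong (⊗-lincomb (λ j → F.⟦ rational j ⟧ m) first r) (⊗-lincomb (λ j → F.⟦ irrational j ⟧ m) second r)))

  coordinates : Coordinates R.commutativeRing (TensorProduct.tensorModule {K = K} N R) n
  coordinates = record
    { re        = re
    ; im        = im
    ; re-cong   = λ p j → extend-cong (rational j) p
    ; im-cong   = λ p j → extend-cong (irrational j) p
    ; re-+      = λ x y j → R.refl
    ; im-+      = λ x y j → R.refl
    ; re-*      = λ s x j → extend-• (rational j) s x
    ; im-*      = λ s x j → extend-• (irrational j) s x
    ; first     = first⊗1
    ; second    = second⊗1
    ; re-first  = λ i j → scaled-𝟙 j i (rational-first i j)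
    ; re-second = λ i j → scaled-0 (rational-second i j)
    ; im-first  = λ i j → scaled-0 (irrational-first i j)
    ; im-second = λ i j → scaled-𝟙 j i (irrational-second i j)
    ; injective = λ {x} {y} p q → ≋-trans (recover x) (≋-trans
        (⊞-cong (TL.sumᴹ-cong λ j → T.*ₗ-cong (p j) ≋-refl) (TL.sumᴹ-cong λ j → T.*ₗ-cong (q j) ≋-refl))
        (≋-sym (recover y)))
    }

module _ {a} (K : CommRing a) (d : CommutativeRing.Carrier K) where
  private
    open module K = CommutativeRing K
    module L = CommutativeRing (AdjoinSqrt K d)

  √d² : (d , 0#) L.≈ (0# , 1#) L.* (0# , 1#)
  √d² = sym (trans (+-congʳ (zeroˡ 0#)) (trans (+-identityˡ _) (trans (*-congˡ (*-identityˡ 1#)) (*-identityʳ d)))) ,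
    sym (trans (+-cong (zeroˡ 1#) (zeroʳ 1#)) (+-identityˡ 0#))

module SqrtLattice {a} (K : CommRing a) (d : CommutativeRing.Carrier K) (M : Mod (AdjoinSqrt K d))
                   {n} (g : Fin n → LeftModule.Carrierᴹ M)
                   (independent : LinearAlgebra.LinearlyIndependent (AdjoinSqrt K d) M g) where
  private
    module K = CommutativeRing K
    L = AdjoinSqrt K d
    module L = CommutativeRing L
    module M = LeftModule M
    open LinearAlgebra L M
    open RingProperties K.ring using (x∙y⁻¹≈ε⇒x≈y)

  √d : L.Carrier
  √d = K.0# , K.1#

  Λ : Mod L
  Λ = submodule (Span-isSubmodule g)

  Λ₀ : Mod K
  Λ₀ = restrictScalars (adjoinSqrt-inclusion K d) Λ

  Element : Set a
  Element = LeftModule.Carrierᴹ Λ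

  -- An element of a span carries a coefficient vector as its witness, so coordinates are read off
  -- without any choice. That equal vectors have equal coefficients is the content of
  -- `coefficient-cong`, which rests on independence.
  coefficient : Element → Fin n → L.Carrier
  coefficient (_ , c , _) = c

  lincomb-injective : ∀ {c c′ : Fin n → L.Carrier} → lincomb c g M.≈ᴹ lincomb c′ g → ∀ i → c i L.≈ c′ i
  lincomb-injective {c} {c′} p i =
    x∙y⁻¹≈ε⇒x≈y _ _ (proj₁ (difference i)) , x∙y⁻¹≈ε⇒x≈y _ _ (proj₂ (difference i))
    where
    difference : ∀ i → c i L.+ L.- c′ i L.≈ L.0#
    difference = independent _ (M.≈ᴹ-trans (M.≈ᴹ-sym (span-+ c (λ i → L.- c′ i) g))
      (M.≈ᴹ-trans (M.+ᴹ-cong p M.≈ᴹ-refl) (M.≈ᴹ-trans (span-+ c′ (λ i → L.- c′ i) g)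
        (M.≈ᴹ-trans (sumᴹ-cong λ i → M.*ₗ-cong (L.-‿inverseʳ (c′ i)) M.≈ᴹ-refl) (M.≈ᴹ-sym (span-zero g))))))

  coefficient-unique : ∀ (m : Element) {c} → proj₁ m M.≈ᴹ lincomb c g → ∀ i → coefficient m i L.≈ c i
  coefficient-unique (x , c , p) q = lincomb-injective (M.≈ᴹ-trans (M.≈ᴹ-sym p) q)

  coefficient-cong : ∀ {m m′ : Element} → proj₁ m M.≈ᴹ proj₁ m′ → ∀ i → coefficient m i L.≈ coefficient m′ i
  coefficient-cong {m} {x , c , p} q = coefficient-unique m (M.≈ᴹ-trans q p)

  module Rotated (ρ ρ⁻¹ : Fin n → Fin n) (ρ-ρ⁻¹ : ∀ i → ρ (ρ⁻¹ i) ≡ i) (ρ⁻¹-ρ : ∀ i → ρ⁻¹ (ρ i) ≡ i) where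
    rational irrational : Fin n → Functional {K = K} Λ₀
    rational j = record
      { ⟦_⟧    = λ m → proj₁ (coefficient m (ρ j))
      ; cong   = λ {m} {m′} p → proj₁ (coefficient-cong {m} {m′} p (ρ j))
      ; +-homo = λ m m′ → K.refl
      ; *-homo = λ k m → K.trans (K.+-congˡ (K.trans (K.*-congˡ (K.zeroˡ _)) (K.zeroʳ d))) (K.+-identityʳ _)
      }
    irrational j = record
      { ⟦_⟧    = λ m → proj₂ (coefficient m (ρ j))
      ; cong   = λ {m} {m′} p → proj₂ (coefficient-cong {m} {m′} p (ρ j))
      ; +-homo = λ m m′ → K.refl
      ; *-homo = λ k m → K.trans (K.+-congˡ (K.zeroˡ _)) (K.+-identityʳ _)
      }

    first second : Fin n → Element
    first j  = g (ρ j) , generator∈Span g (ρ j)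
    second j = LeftModule._*ₗ_ Λ √d (first j)

    private
      open Matrices K using (𝟙)
      module F = Functional
      module 𝟙L = Sums L
      𝟙ₗ : ∀ {k} → Fin k → Fin k → L.Carrier
      𝟙ₗ = Matrices.𝟙 L

      ρ-𝟙 : ∀ i j → 𝟙ₗ (ρ i) (ρ j) L.≈ 𝟙ₗ i j
      ρ-𝟙 i j with i Finₚ.≟ j
      ... | yes ≡.refl = 𝟙L.𝟙-refl (ρ i)
      ... | no  i≢j    = 𝟙L.𝟙-≢ λ p → i≢j (≡.trans (≡.sym (ρ⁻¹-ρ i)) (≡.trans (≡.cong ρ⁻¹ p) (ρ⁻¹-ρ j)))

      𝟙-rational : ∀ {k} (i j : Fin k) → proj₁ (𝟙ₗ i j) K.≈ 𝟙 i j
      𝟙-rational i j with i Finₚ.≟ j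
      ... | yes _ = K.refl
      ... | no  _ = K.refl

      𝟙-irrational : ∀ {k} (i j : Fin k) → proj₂ (𝟙ₗ i j) K.≈ K.0#
      𝟙-irrational i j with i Finₚ.≟ j
      ... | yes _ = K.refl
      ... | no  _ = K.refl

    √d-rational : ∀ z → proj₁ (√d L.* z) K.≈ d K.* proj₂ z
    √d-rational (x , y) = K.trans (K.+-cong (K.zeroˡ x) (K.*-congˡ (K.*-identityˡ y))) (K.+-identityˡ _)

    √d-irrational : ∀ z → proj₂ (√d L.* z) K.≈ proj₁ z
    √d-irrational (x , y) = K.trans (K.+-cong (K.zeroˡ y) (K.*-identityˡ x)) (K.+-identityˡ x)

    rational-first : ∀ i j → F.⟦ rational i ⟧ (first j) K.≈ 𝟙 j i
    rational-first i j = K.trans (proj₁ (ρ-𝟙 j i)) (𝟙-rational j i)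

    rational-second : ∀ i j → F.⟦ rational i ⟧ (second j) K.≈ K.0#
    rational-second i j = K.trans (√d-rational _) (K.trans (K.*-congˡ (𝟙-irrational (ρ j) (ρ i))) (K.zeroʳ d))

    irrational-first : ∀ i j → F.⟦ irrational i ⟧ (first j) K.≈ K.0#
    irrational-first i j = 𝟙-irrational (ρ j) (ρ i)

    irrational-second : ∀ i j → F.⟦ irrational i ⟧ (second j) K.≈ 𝟙 j i
    irrational-second i j = K.trans (√d-irrational _) (rational-first i j)

    private
      module N = LeftModule Λ₀
      module NL = LinearAlgebra K Λ₀
      open CommutativeSemigroupProperties
        (CommutativeMonoid.commutativeSemigroup M.+ᴹ-commutativeMonoid) using (interchange)

      split : ∀ ((a , b) : L.Carrier) x →
              (a , b) M.*ₗ x M.≈ᴹ (a , K.0#) M.*ₗ x M.+ᴹ (b , K.0#) M.*ₗ √d M.*ₗ x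
      split (a , b) x = M.≈ᴹ-trans (M.*ₗ-cong (L.sym decompose) M.≈ᴹ-refl)
        (M.≈ᴹ-trans (M.*ₗ-distribʳ x _ _) (M.+ᴹ-cong M.≈ᴹ-refl (M.*ₗ-assoc _ _ x)))
        where
        decompose : (a , K.0#) L.+ (b , K.0#) L.* √d L.≈ (a , b)
        decompose =
          K.trans (K.+-congˡ (K.trans (K.+-cong (K.zeroʳ b) (K.trans (K.*-congˡ (K.zeroˡ _)) (K.zeroʳ d))) (K.+-identityˡ _))) (K.+-identityʳ a) ,
          K.trans (K.+-identityˡ _) (K.trans (K.+-cong (K.*-identityʳ b) (K.zeroˡ _)) (K.+-identityʳ b))

      split-sum : ∀ {k} (c : Fin k → L.Carrier) (h : Fin k → Element) →
        lincomb c (proj₁ ∘ h) M.≈ᴹ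
          proj₁ (NL.lincomb (proj₁ ∘ c) h N.+ᴹ NL.lincomb (proj₂ ∘ c) (λ i → LeftModule._*ₗ_ Λ √d (h i)))
      split-sum {zero}  c h = M.≈ᴹ-sym (M.+ᴹ-identityˡ _)
      split-sum {suc k} c h = M.≈ᴹ-trans
        (M.+ᴹ-cong (split (c Fin.zero) (proj₁ (h Fin.zero))) (split-sum (c ∘ Fin.suc) (h ∘ Fin.suc))) (interchange _ _ _ _)

    expand : ∀ m → m N.≈ᴹ NL.lincomb (λ j → F.⟦ rational j ⟧ m) first N.+ᴹ NL.lincomb (λ j → F.⟦ irrational j ⟧ m) second
    expand (x , c , p) = M.≈ᴹ-trans p (M.≈ᴹ-trans
      (CommutativeMonoidSum.sum-permute M.+ᴹ-commutativeMonoid (λ i → c i M.*ₗ g i) (permutation ρ ρ⁻¹ ρ-ρ⁻¹ ρ⁻¹-ρ))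
      (split-sum (c ∘ ρ) first))

-- The lattices and their form

module Rotation {a} {𝔽 : CompleteDiscretelyValuedField a} {n ℓ : ℕ}
                (H : SplitHermitianSpace 𝔽 n) (ℓ-sns : StronglyNonSpecial n ℓ) where
  open SplittingModel H ℓ-sns using (rotate)
  open StronglyNonSpecial ℓ-sns using (2ℓ≤n; ℓ≤n)
  open +-*-Solver using (solve; _:=_; _:+_; con)

  private
    2ℓ = 2 ℕ.* ℓ

    ℓ+ℓ≡2ℓ : ℓ ℕ.+ ℓ ≡ 2ℓ
    ℓ+ℓ≡2ℓ = ≡.cong (ℓ ℕ.+_) (≡.sym (ℕₚ.+-identityʳ ℓ))

  -- The shift by ℓ modulo n is stated additively here and in `rotate-≥`, so that no truncated
  -- subtraction enters later comparisons.
  rotate-< : ∀ j → toℕ j ℕ.< ℓ → toℕ (rotate j) ℕ.+ ℓ ≡ n ℕ.+ toℕ j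
  rotate-< j j<ℓ with toℕ j ℕₚ.<? ℓ
  ... | no  j≮ℓ = ⊥-elim (j≮ℓ j<ℓ)
  ... | yes p   = ≡.trans (≡.cong (ℕ._+ ℓ) (toℕ-fromℕ< _))
    (≡.trans (solve 3 (λ x j l → x :+ j :+ l := (x :+ l) :+ j) ≡.refl (n ∸ ℓ) (toℕ j) ℓ)
      (≡.cong (ℕ._+ toℕ j) (ℕₚ.m∸n+n≡m ℓ≤n)))

  rotate-≥ : ∀ j → ℓ ℕ.≤ toℕ j → toℕ (rotate j) ℕ.+ ℓ ≡ toℕ j
  rotate-≥ j ℓ≤j with toℕ j ℕₚ.<? ℓ
  ... | yes j<ℓ = ⊥-elim (ℕₚ.<⇒≱ j<ℓ ℓ≤j)
  ... | no  _   = ≡.trans (≡.cong (ℕ._+ ℓ) (toℕ-fromℕ< _)) (ℕₚ.m∸n+n≡m ℓ≤j)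

  unrotate : Fin n → Fin n
  unrotate i with toℕ i ℕ.+ ℓ ℕₚ.<? n
  ... | yes p = fromℕ< p
  ... | no _  = fromℕ< {toℕ i ℕ.+ ℓ ∸ n}
    (ℕₚ.m<n+o⇒m∸n<o (toℕ i ℕ.+ ℓ) n {n} {{ℕ.>-nonZero (ℕₚ.≤-<-trans ℕ.z≤n (toℕ<n i))}} (ℕₚ.+-mono-<-≤ (toℕ<n i) ℓ≤n))

  rotate-unrotate : ∀ i → rotate (unrotate i) ≡ i
  rotate-unrotate i with toℕ i ℕ.+ ℓ ℕₚ.<? n
  ... | yes p = toℕ-injective (ℕₚ.+-cancelʳ-≡ ℓ _ _ (≡.trans (rotate-≥ (fromℕ< p)
    (≡.subst (ℓ ℕ.≤_) (≡.sym (toℕ-fromℕ< p)) (ℕₚ.m≤n+m ℓ (toℕ i)))) (toℕ-fromℕ< p)))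
  ... | no ¬p = toℕ-injective (ℕₚ.+-cancelʳ-≡ ℓ _ _ (≡.trans (rotate-< (fromℕ< _) (≡.subst (ℕ._< ℓ) (≡.sym (toℕ-fromℕ< _)) j<ℓ))
    (≡.trans (≡.cong (n ℕ.+_) (toℕ-fromℕ< _)) (ℕₚ.m+[n∸m]≡n (ℕₚ.≮⇒≥ ¬p)))))
    where
    j<ℓ : toℕ i ℕ.+ ℓ ∸ n ℕ.< ℓ
    j<ℓ = ℕₚ.+-cancelˡ-< n _ _ (≡.subst (ℕ._< n ℕ.+ ℓ) (≡.sym (ℕₚ.m+[n∸m]≡n (ℕₚ.≮⇒≥ ¬p))) (ℕₚ.+-monoˡ-< ℓ (toℕ<n i)))

  rotate-injective : ∀ {i j} → rotate i ≡ rotate j → i ≡ j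
  rotate-injective {i} {j} p = toℕ-injective (helper (ℕₚ.<-≤-connex (toℕ i) ℓ) (ℕₚ.<-≤-connex (toℕ j) ℓ))
    where
    q : toℕ (rotate i) ℕ.+ ℓ ≡ toℕ (rotate j) ℕ.+ ℓ
    q = ≡.cong (λ k → toℕ k ℕ.+ ℓ) p
    overflow : ∀ k {m} → ¬ toℕ {n} k ≡ n ℕ.+ m
    overflow k eq = ℕₚ.m+n≮m n _ (≡.subst (ℕ._< n) eq (toℕ<n k))
    helper : toℕ i ℕ.< ℓ ⊎ ℓ ℕ.≤ toℕ i → toℕ j ℕ.< ℓ ⊎ ℓ ℕ.≤ toℕ j → toℕ i ≡ toℕ j
    helper (inj₁ x) (inj₁ y) = ℕₚ.+-cancelˡ-≡ n _ _ (≡.trans (≡.sym (rotate-< i x)) (≡.trans q (rotate-< j y)))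
    helper (inj₁ x) (inj₂ y) = ⊥-elim (overflow j (≡.trans (≡.sym (rotate-≥ j y)) (≡.trans (≡.sym q) (rotate-< i x))))
    helper (inj₂ x) (inj₁ y) = ⊥-elim (overflow i (≡.trans (≡.sym (rotate-≥ i x)) (≡.trans q (rotate-< j y))))
    helper (inj₂ x) (inj₂ y) = ≡.trans (≡.sym (rotate-≥ i x)) (≡.trans q (rotate-≥ j y))

  unrotate-rotate : ∀ j → unrotate (rotate j) ≡ j
  unrotate-rotate j = rotate-injective (rotate-unrotate (rotate j))

  -- The hermitian form pairs `e i` with `e (opposite i)`; this is that reversal read in the rotated
  -- order of the basis.
  _ᵒ : Fin n → Fin n
  j ᵒ = unrotate (opposite (rotate j))

  rotate-ᵒ : ∀ j → rotate (j ᵒ) ≡ opposite (rotate j)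
  rotate-ᵒ j = rotate-unrotate (opposite (rotate j))

  ᵒ-involutive : ∀ j → (j ᵒ) ᵒ ≡ j
  ᵒ-involutive j = ≡.trans (≡.cong unrotate (≡.trans (≡.cong opposite (rotate-ᵒ j)) (Finₚ.opposite-involutive _)))
    (unrotate-rotate j)

  opposite-+ : ∀ {m} (i : Fin m) → toℕ (opposite i) ℕ.+ suc (toℕ i) ≡ m
  opposite-+ i = ≡.trans (≡.cong (ℕ._+ suc (toℕ i)) (Finₚ.opposite-prop i)) (ℕₚ.m∸n+n≡m (toℕ<n i))

  private
    dual-sum : ∀ j → toℕ (rotate (j ᵒ)) ℕ.+ suc (toℕ (rotate j)) ≡ n
    dual-sum j = ≡.trans (≡.cong (λ k → toℕ k ℕ.+ suc (toℕ (rotate j))) (rotate-ᵒ j)) (opposite-+ (rotate j))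

  -- In the numbering from 1, the three blocks stand for the vectors with indices n-ℓ+1 to n, 1 to
  -- ℓ, and ℓ+1 to n-ℓ. Each constructor keeps both the range of `j` and the range of its original
  -- index.
  data Position (j : Fin n) : Set where
    head   : toℕ j ℕ.< ℓ → n ℕ.≤ toℕ (rotate j) ℕ.+ ℓ → Position j
    middle : ℓ ℕ.≤ toℕ j → toℕ j ℕ.< 2ℓ → toℕ (rotate j) ℕ.< ℓ → Position j
    tail   : 2ℓ ℕ.≤ toℕ j → ℓ ℕ.≤ toℕ (rotate j) → toℕ (rotate j) ℕ.+ ℓ ℕ.< n → Position j

  position : ∀ j → Position j
  position j with ℕₚ.<-≤-connex (toℕ j) ℓ
  ... | inj₁ p = head p (ℕₚ.≤-trans (ℕₚ.m≤m+n n (toℕ j)) (ℕₚ.≤-reflexive (≡.sym (rotate-< j p))))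
  ... | inj₂ p with ℕₚ.<-≤-connex (toℕ j) 2ℓ
  ...   | inj₁ q = middle p q (ℕₚ.+-cancelʳ-< ℓ _ _ (ℕₚ.≤-<-trans (ℕₚ.≤-reflexive (rotate-≥ j p))
            (ℕₚ.<-≤-trans q (ℕₚ.≤-reflexive (≡.sym ℓ+ℓ≡2ℓ)))))
  ...   | inj₂ q = tail q (ℕₚ.+-cancelʳ-≤ ℓ _ _ (ℕₚ.≤-trans (ℕₚ.≤-reflexive ℓ+ℓ≡2ℓ)
            (ℕₚ.≤-trans q (ℕₚ.≤-reflexive (≡.sym (rotate-≥ j p)))))) (≡.subst (ℕ._< n) (≡.sym (rotate-≥ j p)) (toℕ<n j))

  private
    ℓ≤2ℓ : ℓ ℕ.≤ 2ℓ
    ℓ≤2ℓ = ℕₚ.m≤m+n ℓ _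

    -- An original index below ℓ is not among the last ℓ ones, because 2ℓ ≤ n: the first two blocks
    -- are disjoint.
    low-≱ : ∀ {r} → r ℕ.< ℓ → ¬ (n ℕ.≤ r ℕ.+ ℓ)
    low-≱ p q = ℕₚ.<⇒≱ (ℕₚ.<-≤-trans (ℕₚ.+-monoˡ-< ℓ p) (ℕₚ.≤-trans (ℕₚ.≤-reflexive ℓ+ℓ≡2ℓ) 2ℓ≤n)) q

  head-ᵒ : ∀ j → toℕ j ℕ.< ℓ → toℕ (rotate (j ᵒ)) ℕ.< ℓ
  head-ᵒ j p with position j
  ... | middle q _ _ = ⊥-elim (ℕₚ.<⇒≱ p q)
  ... | tail q _ _   = ⊥-elim (ℕₚ.<⇒≱ p (ℕₚ.≤-trans ℓ≤2ℓ q))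
  ... | head _ q     = ℕₚ.+-cancelˡ-≤ (toℕ (rotate j)) _ _ (ℕₚ.≤-trans (ℕₚ.≤-reflexive
    (≡.trans (solve 2 (λ r s → r :+ (con 1 :+ s) := s :+ (con 1 :+ r)) ≡.refl (toℕ (rotate j)) (toℕ (rotate (j ᵒ)))) (dual-sum j))) q)

  -- The original indices of the last block form the interval from ℓ to n-ℓ, which is symmetric
  -- under reversal; the other two positions contradict `dual-sum`.
  tail-ᵒ : ∀ j → 2ℓ ℕ.≤ toℕ j → 2ℓ ℕ.≤ toℕ (j ᵒ)
  tail-ᵒ j p with position j | position (j ᵒ)
  ... | head q _     | _            = ⊥-elim (ℕₚ.<⇒≱ q (ℕₚ.≤-trans ℓ≤2ℓ p))
  ... | middle _ q _ | _            = ⊥-elim (ℕₚ.<⇒≱ q p)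
  ... | tail _ _ _   | tail q _ _   = q
  ... | tail _ q q′  | head _ x     = ⊥-elim (ℕₚ.<⇒≱ (ℕₚ.≤-trans (ℕₚ.≤-reflexive (≡.sym (ℕₚ.+-suc _ ℓ)))
    (ℕₚ.≤-trans (ℕₚ.+-monoʳ-≤ (toℕ (rotate (j ᵒ))) (ℕ.s≤s q)) (ℕₚ.≤-reflexive (dual-sum j)))) x)
  ... | tail _ q q′  | middle _ _ x = ⊥-elim (ℕₚ.<-irrefl (dual-sum j) (ℕₚ.≤-<-trans (ℕₚ.≤-trans
    (ℕₚ.≤-reflexive (ℕₚ.+-suc _ _)) (ℕₚ.≤-trans (ℕₚ.+-monoˡ-≤ (toℕ (rotate j)) x) (ℕₚ.≤-reflexive (ℕₚ.+-comm ℓ _)))) q′))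

  private
    does⇒ : ∀ {P : Set} (d : Dec P) → does d ≡ true → P
    does⇒ (yes p) _ = p

  abstract
    isTail isHead : Fin n → Bool
    isTail j = does (2ℓ ℕₚ.≤? toℕ j)
    isHead j = does (toℕ j ℕₚ.<? ℓ)

    isTail-true : ∀ {j} → 2ℓ ℕ.≤ toℕ j → isTail j ≡ true
    isTail-true {j} = dec-true (2ℓ ℕₚ.≤? toℕ j)

    isTail-false : ∀ {j} → toℕ j ℕ.< 2ℓ → isTail j ≡ false
    isTail-false {j} p = dec-false (2ℓ ℕₚ.≤? toℕ j) (ℕₚ.<⇒≱ p)

    isHead-true : ∀ {j} → toℕ j ℕ.< ℓ → isHead j ≡ true
    isHead-true {j} = dec-true (toℕ j ℕₚ.<? ℓ)

    isHead-false : ∀ {j} → ℓ ℕ.≤ toℕ j → isHead j ≡ false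
    isHead-false {j} p = dec-false (toℕ j ℕₚ.<? ℓ) (ℕₚ.≤⇒≯ p)

    isTail⇒ : ∀ {j} → isTail j ≡ true → 2ℓ ℕ.≤ toℕ j
    isTail⇒ {j} = does⇒ (2ℓ ℕₚ.≤? toℕ j)

  blocks : Blocks n
  blocks = record
    { C            = isTail
    ; positive     = isHead
    ; _ᵒ           = _ᵒ
    ; ᵒ-involutive = ᵒ-involutive
    ; C-ᵒ          = C-ᵒ
    ; positive-ᵒ   = positive-ᵒ
    ; positive-C   = λ j p → isHead-false (ℕₚ.≤-trans ℓ≤2ℓ (isTail⇒ p))
    }
    where
    C-ᵒ : ∀ j → isTail (j ᵒ) ≡ isTail j
    C-ᵒ j with ℕₚ.<-≤-connex (toℕ j) 2ℓ
    ... | inj₂ p = ≡.trans (isTail-true (tail-ᵒ j p)) (≡.sym (isTail-true p))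
    ... | inj₁ p with ℕₚ.<-≤-connex (toℕ (j ᵒ)) 2ℓ
    ...   | inj₁ q = ≡.trans (isTail-false q) (≡.sym (isTail-false p))
    ...   | inj₂ q = ⊥-elim (ℕₚ.<⇒≱ p (≡.subst (λ k → 2ℓ ℕ.≤ toℕ k) (ᵒ-involutive j) (tail-ᵒ (j ᵒ) q)))
    positive-ᵒ : ∀ j → isTail j ≡ false → isHead (j ᵒ) ≡ not (isHead j)
    positive-ᵒ j p with position j | position (j ᵒ)
    ... | tail x _ _   | _            with () ← ≡.trans (≡.sym p) (isTail-true x)
    ... | _            | tail x _ _   with () ← ≡.trans (≡.sym (≡.trans (C-ᵒ j) p)) (isTail-true x)
    ... | head x _     | head _ y     = ⊥-elim (low-≱ (head-ᵒ j x) y)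
    ... | head x _     | middle y _ _ = ≡.trans (isHead-false y) (≡.sym (≡.cong not (isHead-true x)))
    ... | middle x _ _ | head y _     = ≡.trans (isHead-true y) (≡.sym (≡.cong not (isHead-false x)))
    -- The original indices of `j` and `j ᵒ` add up to n-1, so they cannot both be below ℓ.
    ... | middle _ _ x | middle _ _ y = ⊥-elim (low-≱ y (ℕₚ.≤-trans (ℕₚ.≤-reflexive (≡.sym (dual-sum j))) (ℕₚ.+-monoʳ-≤ _ x)))

-- Inclusions of lattices and bilinear forms in coordinates

module SqrtInclusion {a} (K : CommRing a) (d : CommutativeRing.Carrier K) (M : Mod (AdjoinSqrt K d)) {n}
  (g g′ : Fin n → LeftModule.Carrierᴹ M)
  (ind  : LinearAlgebra.LinearlyIndependent (AdjoinSqrt K d) M g)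
  (ind′ : LinearAlgebra.LinearlyIndependent (AdjoinSqrt K d) M g′) where
  private
    module Λ  = SqrtLattice K d M g ind
    module Λ′ = SqrtLattice K d M g′ ind′
    module M = LeftModule M
    module L = CommutativeRing (AdjoinSqrt K d)
    module K = CommutativeRing K
    open LinearAlgebra (AdjoinSqrt K d) M

  module _ (h : Λ.Element → Λ′.Element) (h-id : ∀ m → proj₁ (h m) ≡ proj₁ m)
           (s : Fin n → L.Carrier) (g≈sg′ : ∀ i → g i M.≈ᴹ s i M.*ₗ g′ i) where
    private
      coefficient-h : ∀ m i → Λ′.coefficient (h m) i L.≈ Λ.coefficient m i L.* s i
      coefficient-h m@(x , c , p) = Λ′.coefficient-unique (h m)
        (M.≈ᴹ-trans (M.≈ᴹ-reflexive (h-id m)) (M.≈ᴹ-trans p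
          (sumᴹ-cong λ i → M.≈ᴹ-trans (M.*ₗ-cong L.refl (g≈sg′ i)) (M.≈ᴹ-sym (M.*ₗ-assoc _ _ _)))))

    coefficient-1 : ∀ {i} → s i L.≈ L.1# → ∀ m → Λ′.coefficient (h m) i L.≈ Λ.coefficient m i
    coefficient-1 {i} s≈1 m = L.trans (coefficient-h m i) (L.trans (L.*-congˡ {Λ.coefficient m i} s≈1) (L.*-identityʳ _))

    coefficient-√d : ∀ {i} → s i L.≈ Λ.√d → ∀ m →
      Λ′.coefficient (h m) i L.≈ (d K.* proj₂ (Λ.coefficient m i) , proj₁ (Λ.coefficient m i))
    coefficient-√d {i} s≈√d m = L.trans (coefficient-h m i)
      (L.trans (L.*-congˡ {Λ.coefficient m i} s≈√d) (L.trans (L.*-comm (Λ.coefficient m i) Λ.√d)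
        ( K.trans (K.+-cong (K.zeroˡ _) (K.*-congˡ (K.*-identityˡ _))) (K.+-identityˡ _)
        , K.trans (K.+-cong (K.zeroˡ _) (K.*-identityˡ _)) (K.+-identityˡ _))))

module _ {a} {K : CommRing a} {M N : Mod K} where
  private
    module K = CommutativeRing K
    module F = Functional
    open Matrices K using (sum)

  -- The form is skew in the two coordinate blocks, hence a sum of differences of products of
  -- functionals; this shape persists over `R` because both sides are biadditive, so pure tensors
  -- decide.
  module BilinearExtension
    (β : LeftModule.Carrierᴹ M → LeftModule.Carrierᴹ N → K.Carrier)
    {n} (s : Fin n → K.Carrier) (f f′ : Fin n → Functional {K = K} M) (h h′ : Fin n → Functional {K = K} N)
    (β≈ : ∀ x y → β x y K.≈ sum λ i → s i K.* (F.⟦ f i ⟧ x K.* F.⟦ h i ⟧ y K.- F.⟦ f′ i ⟧ x K.* F.⟦ h′ i ⟧ y))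
    (R : Algebra K) where
    private
      module R = Algebra R
      module scalar = Hom (Algebra.structureMap R)
      module Rₘ = Matrices R.commutativeRing
      open Sums R.commutativeRing
      open IntegerSolver R.commutativeRing
      open Extension {K = K} using (extend)
      open TensorProduct {K = K}

      scalar-sum : ∀ {k} (c : Fin k → K.Carrier) → R.scalar (sum c) R.≈ Rₘ.sum (R.scalar ∘ c)
      scalar-sum {zero}  c = scalar.0#-homo
      scalar-sum {suc k} c = R.trans (scalar.+-homo _ _) (R.+-congˡ (scalar-sum (c ∘ Fin.suc)))

    term : Fin n → Tensor M R → Tensor N R → R.Carrier
    term i x y = R.scalar (s i) R.* (extend M R (f i) x R.* extend N R (h i) y R.- extend M R (f′ i) x R.* extend N R (h′ i) y)

    private
      pure : LeftModule.Carrierᴹ M → LeftModule.Carrierᴹ N → Fin n → K.Carrier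
      pure x y i = s i K.* (F.⟦ f i ⟧ x K.* F.⟦ h i ⟧ y K.- F.⟦ f′ i ⟧ x K.* F.⟦ h′ i ⟧ y)

    extendBilinear-sum : ∀ x y → extendBilinear {K = K} {M = M} {N = N} β R x y R.≈ Rₘ.sum λ i → term i x y
    extendBilinear-sum 𝟘 y = R.sym (sum-zero λ i →
      solve 3 (λ s b c → s :* (con (+ 0) :* b :- con (+ 0) :* c) := con (+ 0)) R.refl (R.scalar (s i)) _ _)
    extendBilinear-sum (x ⊞ x′) y = R.trans (R.+-cong (extendBilinear-sum x y) (extendBilinear-sum x′ y))
      (R.trans (R.sym (sum-+ (λ i → term i x y) (λ i → term i x′ y))) (sum-cong λ i →
        solve 7 (λ s a b c d a′ c′ → s :* (a :* b :- c :* d) :+ s :* (a′ :* b :- c′ :* d) := s :* ((a :+ a′) :* b :- (c :+ c′) :* d))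
          R.refl (R.scalar (s i)) _ _ _ _ _ _))
    extendBilinear-sum (m ⊗ r) 𝟘 = R.sym (sum-zero λ i →
      solve 3 (λ s b c → s :* (b :* con (+ 0) :- c :* con (+ 0)) := con (+ 0)) R.refl (R.scalar (s i)) _ _)
    extendBilinear-sum (m ⊗ r) (y ⊞ y′) = R.trans (R.+-cong (extendBilinear-sum (m ⊗ r) y) (extendBilinear-sum (m ⊗ r) y′))
      (R.trans (R.sym (sum-+ (λ i → term i (m ⊗ r) y) (λ i → term i (m ⊗ r) y′))) (sum-cong λ i →
        solve 7 (λ s a b c d b′ d′ → s :* (a :* b :- c :* d) :+ s :* (a :* b′ :- c :* d′) := s :* (a :* (b :+ b′) :- c :* (d :+ d′)))
          R.refl (R.scalar (s i)) _ _ _ _ _ _))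
    extendBilinear-sum (m ⊗ r) (m′ ⊗ r′) =
      R.trans (R.*-congˡ (R.trans (scalar.⟦⟧-cong (β≈ m m′)) (scalar-sum (pure m m′))))
        (R.trans (R.sym (*-sum _ (R.scalar ∘ pure m m′))) (sum-cong λ i →
          R.trans (R.*-congˡ (R.trans (scalar.*-homo _ _) (R.*-congˡ (R.trans (scalar.+-homo _ _)
              (R.+-cong (scalar.*-homo _ _) (R.trans (scalar.-‿homo _) (R.-‿cong (scalar.*-homo _ _))))))))
            (solve 7 (λ r q s a b c d → r :* q :* (s :* (a :* b :- c :* d)) := s :* ((r :* a) :* (q :* b) :- (r :* c) :* (q :* d)))
              R.refl r r′ (R.scalar (s i)) _ _ _ _)))

module HermitianLattices {a} {𝔽 : CompleteDiscretelyValuedField a} {n ℓ : ℕ}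
                         (H : SplitHermitianSpace 𝔽 n) (ℓ-sns : StronglyNonSpecial n ℓ) where
  open CompleteDiscretelyValuedField 𝔽 using (F₀; π₀)
  open Integers 𝔽
  open SplitHermitianSpace H
  open Lattices H
  open SplittingModel H ℓ-sns
  open StronglyNonSpecial ℓ-sns using (2ℓ≤n; ℓ≤n; ℓ≤n∸ℓ)
  open Rotation H ℓ-sns public
  private
    module F₀ = CommutativeRing F₀
    module F = CommutativeRing F
    module O₀ = CommutativeRing O₀
    module O = CommutativeRing O
    module ι = Hom O⊂F
    module Vᴼ = LinearAlgebra O Vᴼ

  Independent : Family → Set a
  Independent = LinearAlgebra.LinearlyIndependent O Vᴼ

  independent : ∀ {g} (u u⁻¹ : Fin n → F.Carrier) → (∀ j → u j F.* u⁻¹ j F.≈ F.1#) →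
                (∀ j → g j ≈ᴹ u j *ₗ e j) → Independent g
  independent {g} u u⁻¹ uu⁻¹≈1 g≈ue c p j = begin
    ι.⟦ c j ⟧                            ≈⟨ F.sym (F.*-identityʳ _) ⟩
    ι.⟦ c j ⟧ F.* F.1#                   ≈⟨ F.*-congˡ {ι.⟦ c j ⟧} (F.sym (uu⁻¹≈1 j)) ⟩
    ι.⟦ c j ⟧ F.* (u j F.* u⁻¹ j)        ≈⟨ F.sym (F.*-assoc ι.⟦ c j ⟧ (u j) (u⁻¹ j)) ⟩
    ι.⟦ c j ⟧ F.* u j F.* u⁻¹ j          ≈⟨ F.*-congʳ {u⁻¹ j} (proj₁ e-basis _ q j) ⟩
    F.0# F.* u⁻¹ j                       ≈⟨ F.zeroˡ (u⁻¹ j) ⟩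
    F.0# ∎
    where
    open SetoidReasoning F.setoid
    q : lincomb (λ i → ι.⟦ c i ⟧ F.* u i) e ≈ᴹ 0ᴹ
    q = ≈ᴹ-trans (sumᴹ-cong λ i → ≈ᴹ-trans (*ₗ-assoc ι.⟦ c i ⟧ (u i) (e i)) (*ₗ-cong (F.refl {ι.⟦ c i ⟧}) (≈ᴹ-sym (g≈ue i)))) p

  unit unit⁻¹ : ℕ → Fin n → F.Carrier
  unit k j   = if does (toℕ j ℕₚ.<? k) then π⁻¹ else F.1#
  unit⁻¹ k j = if does (toℕ j ℕₚ.<? k) then ι.⟦ πᴼ ⟧ else F.1#

  unit-inverse : ∀ k j → unit k j F.* unit⁻¹ k j F.≈ F.1#
  unit-inverse k j with does (toℕ j ℕₚ.<? k)
  ... | true  = F.trans (F.*-comm π⁻¹ ι.⟦ πᴼ ⟧) ππ⁻¹≈1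
  ... | false = F.*-identityˡ F.1#

  gen-unit : ∀ k j → gen k j ≈ᴹ unit k j *ₗ e j
  gen-unit k j with does (toℕ j ℕₚ.<? k)
  ... | true  = ≈ᴹ-refl
  ... | false = ≈ᴹ-sym (*ₗ-identityˡ _)

  gen-independent : ∀ k → Independent (gen k)
  gen-independent k = independent (unit k) (unit⁻¹ k) (unit-inverse k) (gen-unit k)

  π⁻¹gen-independent : Independent π⁻¹gℓ
  π⁻¹gen-independent = independent (λ j → π⁻¹ F.* unit ℓ j) (λ j → unit⁻¹ ℓ j F.* ι.⟦ πᴼ ⟧)
    (λ j → begin
      π⁻¹ F.* unit ℓ j F.* (unit⁻¹ ℓ j F.* π)   ≈⟨ F.*-assoc π⁻¹ (unit ℓ j) (unit⁻¹ ℓ j F.* π) ⟩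
      π⁻¹ F.* (unit ℓ j F.* (unit⁻¹ ℓ j F.* π)) ≈⟨ F.*-congˡ {π⁻¹} (F.sym (F.*-assoc (unit ℓ j) (unit⁻¹ ℓ j) π)) ⟩
      π⁻¹ F.* (unit ℓ j F.* unit⁻¹ ℓ j F.* π)   ≈⟨ F.*-congˡ {π⁻¹} (F.*-congʳ {π} (unit-inverse ℓ j)) ⟩
      π⁻¹ F.* (F.1# F.* π)                      ≈⟨ F.*-congˡ {π⁻¹} (F.*-identityˡ π) ⟩
      π⁻¹ F.* π                                 ≈⟨ F.*-comm π⁻¹ π ⟩
      π F.* π⁻¹                                 ≈⟨ ππ⁻¹≈1 ⟩
      F.1# ∎)
    (λ j → ≈ᴹ-trans (*ₗ-cong F.refl (gen-unit ℓ j)) (≈ᴹ-sym (*ₗ-assoc π⁻¹ (unit ℓ j) (e j))))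
    where
    open SetoidReasoning F.setoid
    π = ι.⟦ πᴼ ⟧

  -- The Boolean index records which of the two factors occurs, so that from the block of `j` alone
  -- the factor is known to be 1 or π.
  data Ratio (x y : Carrierᴹ) (b : Bool) : Set a where
    one : b ≡ false → x ≈ᴹ ι.⟦ O.1# ⟧ *ₗ y → Ratio x y b
    pi  : b ≡ true → x ≈ᴹ ι.⟦ πᴼ ⟧ *ₗ y → Ratio x y b

  ratio : ∀ {x y b} → Ratio x y b → O.Carrier
  ratio (one _ _) = O.1#
  ratio (pi _ _)  = πᴼ

  ratio-≈ : ∀ {x y b} (r : Ratio x y b) → x ≈ᴹ ι.⟦ ratio r ⟧ *ₗ y
  ratio-≈ (one _ p) = p
  ratio-≈ (pi _ p)  = p

  ratio-one : ∀ {x y b} (r : Ratio x y b) → b ≡ false → ratio r O.≈ O.1#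
  ratio-one (one _ _) p = O.refl {O.1#}
  ratio-one (pi ≡.refl _) ()

  ratio-pi : ∀ {x y b} (r : Ratio x y b) → b ≡ true → ratio r O.≈ πᴼ
  ratio-pi (pi _ _) p = O.refl {πᴼ}
  ratio-pi (one ≡.refl _) ()

  private
    low-<-n∸ℓ : ∀ {r} → r ℕ.+ ℓ ℕ.< n → r ℕ.< n ∸ ℓ
    low-<-n∸ℓ {r} p = ℕₚ.m+n≤o⇒m≤o∸n (suc r) p

    high-≮-n∸ℓ : ∀ {r} → n ℕ.≤ r ℕ.+ ℓ → ¬ r ℕ.< n ∸ ℓ
    high-≮-n∸ℓ {r} p q = ℕₚ.<⇒≱ (ℕₚ.≤-trans (ℕₚ.+-monoˡ-≤ ℓ q) (ℕₚ.≤-reflexive (ℕₚ.m∸n+n≡m ℓ≤n))) p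

    high-≮-ℓ : ∀ {r} → n ℕ.≤ r ℕ.+ ℓ → ¬ r ℕ.< ℓ
    high-≮-ℓ p q = high-≮-n∸ℓ p (ℕₚ.<-≤-trans q ℓ≤n∸ℓ)

  -- Only the original indices between ℓ and n-ℓ acquire a π⁻¹ in passing from Λ_ℓ to Λ_{n-ℓ}; these
  -- form the last block.
  ratio₁ : ∀ j → Ratio (gℓ (rotate j)) (gₙ₋ℓ (rotate j)) (isTail j)
  ratio₁ j with position j
  ... | head p q rewrite gen-≮ {ℓ} {rotate j} (high-≮-ℓ q) | gen-≮ {n ∸ ℓ} {rotate j} (high-≮-n∸ℓ q) =
    one (isTail-false (ℕₚ.<-≤-trans p (ℕₚ.m≤m+n ℓ _))) (≈ᴹ-sym (1x≈x _))
  ... | middle p q r rewrite gen-< {ℓ} {rotate j} r | gen-< {n ∸ ℓ} {rotate j} (ℕₚ.<-≤-trans r ℓ≤n∸ℓ) =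
    one (isTail-false q) (≈ᴹ-sym (1x≈x _))
  ... | tail p q r rewrite gen-≮ {ℓ} {rotate j} (ℕₚ.≤⇒≯ q) | gen-< {n ∸ ℓ} {rotate j} (low-<-n∸ℓ r) =
    pi (isTail-true p) (≈ᴹ-sym (ππ⁻¹x≈x _))

  -- The two factors multiply to π on every index, so this one is π exactly where that of `ratio₁`
  -- is 1.
  ratio₂ : ∀ j → Ratio (gₙ₋ℓ (rotate j)) (π⁻¹gℓ (rotate j)) (not (isTail j))
  ratio₂ j with position j
  ... | head p q rewrite gen-≮ {ℓ} {rotate j} (high-≮-ℓ q) | gen-≮ {n ∸ ℓ} {rotate j} (high-≮-n∸ℓ q) =
    pi (≡.cong not (isTail-false (ℕₚ.<-≤-trans p (ℕₚ.m≤m+n ℓ _)))) (≈ᴹ-sym (ππ⁻¹x≈x _))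
  ... | middle p q r rewrite gen-< {ℓ} {rotate j} r | gen-< {n ∸ ℓ} {rotate j} (ℕₚ.<-≤-trans r ℓ≤n∸ℓ) =
    pi (≡.cong not (isTail-false q)) (≈ᴹ-sym (ππ⁻¹x≈x _))
  ... | tail p q r rewrite gen-≮ {ℓ} {rotate j} (ℕₚ.≤⇒≯ q) | gen-< {n ∸ ℓ} {rotate j} (low-<-n∸ℓ r) =
    one (≡.cong not (isTail-true p)) (≈ᴹ-sym (1x≈x _))

  module Lattice {g} (ind : Independent g) where
    open SqrtLattice O₀ π₀ᴼ Vᴼ g ind public using (coefficient)
    private module L = SqrtLattice.Rotated O₀ π₀ᴼ Vᴼ g ind rotate unrotate rotate-unrotate unrotate-rotate
    open L public using (√d-rational; √d-irrational)

    rational irrational : Fin n → Functional {K = O₀} Λ₀[ g ]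
    rational   = L.rational
    irrational = L.irrational

    basis : FreeBasis {K = O₀} Λ₀[ g ] n
    basis = record
      { first             = firstHalf g
      ; second            = secondHalf g
      ; rational          = rational
      ; irrational        = irrational
      ; rational-first    = L.rational-first
      ; rational-second   = L.rational-second
      ; irrational-first  = L.irrational-first
      ; irrational-second = L.irrational-second
      ; expand            = L.expand
      }

  gℓ-independent : Independent gℓ
  gℓ-independent = gen-independent ℓ

  gₙ₋ℓ-independent : Independent gₙ₋ℓ
  gₙ₋ℓ-independent = gen-independent (n ∸ ℓ)

  module Λℓ   = Lattice {gℓ} gℓ-independent
  module Λₙ₋ℓ = Lattice {gₙ₋ℓ} gₙ₋ℓ-independent
  module Λπ⁻¹ = Lattice {π⁻¹gℓ} π⁻¹gen-independent

  module Form where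
    open Matrices F using (sum; 𝟙)
    open Sums F
    open SetoidReasoning F.setoid
    open RingProperties F.ring using () renaming (+-identityˡ-unique to F-identityˡ-unique)
    private
      o : Fin n → Fin n
      o = opposite

    φ-*ˡ : ∀ k x y → φ (k *ₗ x) y F.≈ conj k F.* φ x y
    φ-*ˡ k x y = F.trans (φ-cong ≈ᴹ-refl (≈ᴹ-sym (*ₗ-identityˡ y)))
      (F.trans (φ-* k F.1# x y) (F.*-congʳ {φ x y} (F.*-identityʳ (conj k))))

    conj-1 : conj F.1# F.≈ F.1#
    conj-1 = F₀.refl , RingProperties.-0#≈0# F₀.ring

    φ-*ʳ : ∀ k x y → φ x (k *ₗ y) F.≈ k F.* φ x y
    φ-*ʳ k x y = F.trans (φ-cong (≈ᴹ-sym (*ₗ-identityˡ x)) ≈ᴹ-refl)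
      (F.trans (φ-* F.1# k x y) (F.*-congʳ {φ x y} (F.trans (F.*-congʳ {k} conj-1) (F.*-identityˡ k))))

    φ-lincombˡ : ∀ {k} c (x : Fin k → Carrierᴹ) y → φ (lincomb c x) y F.≈ sum (λ i → conj (c i) F.* φ (x i) y)
    φ-lincombˡ {zero}  c x y = F-identityˡ-unique _ _ (F.trans (F.sym (φ-+ˡ 0ᴹ 0ᴹ y)) (φ-cong (+ᴹ-identityˡ 0ᴹ) ≈ᴹ-refl))
    φ-lincombˡ {suc k} c x y = F.trans (φ-+ˡ _ _ y) (F.+-cong (φ-*ˡ _ _ y) (φ-lincombˡ (c ∘ Fin.suc) (x ∘ Fin.suc) y))

    φ-lincombʳ : ∀ {k} x c (y : Fin k → Carrierᴹ) → φ x (lincomb c y) F.≈ sum (λ i → c i F.* φ x (y i))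
    φ-lincombʳ {zero}  x c y = F-identityˡ-unique _ _ (F.trans (F.sym (φ-+ʳ x 0ᴹ 0ᴹ)) (φ-cong ≈ᴹ-refl (+ᴹ-identityˡ 0ᴹ)))
    φ-lincombʳ {suc k} x c y = F.trans (φ-+ʳ x _ _) (F.+-cong (φ-*ʳ _ x _) (φ-lincombʳ x (c ∘ Fin.suc) (y ∘ Fin.suc)))

    -- The value of the hermitian form on the generator `i` of Λ_{n-ℓ} and its partner in Λ_ℓ.
    η : Fin n → F.Carrier
    η i = conj (unit (n ∸ ℓ) i) F.* unit ℓ (o i)

    φ-gen : ∀ i j → φ (gₙ₋ℓ i) (gℓ j) F.≈ conj (unit (n ∸ ℓ) i) F.* unit ℓ j F.* 𝟙 i (o j)
    φ-gen i j = F.trans (φ-cong (gen-unit (n ∸ ℓ) i) (gen-unit ℓ j))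
      (F.trans (F.reflexive (≡.cong (λ k → φ (unit (n ∸ ℓ) i *ₗ e i) (unit ℓ j *ₗ e k)) (≡.sym (Finₚ.opposite-involutive j))))
        (e-split (unit (n ∸ ℓ) i) (unit ℓ j) i (o j)))

    𝟙-opposite : ∀ (i j : Fin n) → 𝟙 i (o j) F.≈ 𝟙 (o i) j
    𝟙-opposite i j with i Finₚ.≟ o j | o i Finₚ.≟ j
    ... | yes _ | yes _ = F.refl
    ... | no  _ | no  _ = F.refl
    ... | yes p | no ¬q = ⊥-elim (¬q (≡.trans (≡.cong o p) (Finₚ.opposite-involutive j)))
    ... | no ¬p | yes q = ⊥-elim (¬p (≡.trans (≡.sym (Finₚ.opposite-involutive i)) (≡.cong o q)))

    φ-lincomb-gen : ∀ c d → φ (lincomb c gₙ₋ℓ) (lincomb d gℓ) F.≈ sum (λ i → conj (c i) F.* (d (o i) F.* η i))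
    φ-lincomb-gen c d = F.trans (φ-lincombˡ c gₙ₋ℓ _) (sum-cong λ i → F.*-congˡ {conj (c i)} (begin
      φ (gₙ₋ℓ i) (lincomb d gℓ)                                    ≈⟨ φ-lincombʳ (gₙ₋ℓ i) d gℓ ⟩
      sum (λ j → d j F.* φ (gₙ₋ℓ i) (gℓ j))                        ≈⟨ sum-cong (λ j → inner i j) ⟩
      sum (λ j → 𝟙 (o i) j F.* (d j F.* (conj (unit (n ∸ ℓ) i) F.* unit ℓ j)))
        ≈⟨ sum-𝟙ˡ (o i) (λ j → d j F.* (conj (unit (n ∸ ℓ) i) F.* unit ℓ j)) ⟩
      d (o i) F.* η i ∎))
      where
      inner : ∀ i j → d j F.* φ (gₙ₋ℓ i) (gℓ j) F.≈ 𝟙 (o i) j F.* (d j F.* (conj (unit (n ∸ ℓ) i) F.* unit ℓ j))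
      inner i j = F.trans (F.*-congˡ {d j} (F.trans (φ-gen i j) (F.*-congˡ {conj (unit (n ∸ ℓ) i) F.* unit ℓ j} (𝟙-opposite i j))))
        (F.trans (F.sym (F.*-assoc (d j) (conj (unit (n ∸ ℓ) i) F.* unit ℓ j) (𝟙 (o i) j)))
          (F.*-comm (d j F.* (conj (unit (n ∸ ℓ) i) F.* unit ℓ j)) (𝟙 (o i) j)))

    sign : Bool → F₀.Carrier
    sign b = if b then F₀.1# else F₀.- F₀.1#

    private
      opposite-low : ∀ i → n ℕ.≤ toℕ i ℕ.+ ℓ → toℕ (o i) ℕ.< ℓ
      opposite-low i p = ℕₚ.≤-trans (ℕₚ.≤-reflexive (≡.cong suc (Finₚ.opposite-prop i)))
        (ℕₚ.≤-trans (ℕₚ.≤-reflexive (≡.sym (ℕₚ.+-∸-assoc 1 (toℕ<n i))))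
          (ℕₚ.m≤n+o⇒m∸n≤o n (toℕ i) p))

      opposite-high : ∀ i → toℕ i ℕ.+ ℓ ℕ.< n → ¬ toℕ (o i) ℕ.< ℓ
      opposite-high i p = ℕₚ.≤⇒≯ (ℕₚ.≤-trans (ℕₚ.m+n≤o⇒m≤o∸n ℓ (ℕₚ.≤-trans (ℕₚ.≤-reflexive (ℕₚ.+-comm ℓ (suc (toℕ i)))) p))
        (ℕₚ.≤-reflexive (≡.sym (Finₚ.opposite-prop i))))

      unit-< : ∀ {k i} → toℕ i ℕ.< k → unit k i ≡ π⁻¹
      unit-< {k} {i} p = ≡.cong (if_then π⁻¹ else F.1#) (dec-true (toℕ i ℕₚ.<? k) p)

      unit-≮ : ∀ {k i} → ¬ toℕ i ℕ.< k → unit k i ≡ F.1#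
      unit-≮ {k} {i} p = ≡.cong (if_then π⁻¹ else F.1#) (dec-false (toℕ i ℕₚ.<? k) p)

      conj-π⁻¹ : conj π⁻¹ F.* F.1# F.≈ (F₀.0# , F₀.- F₀.1# F₀.* π₀⁻¹)
      conj-π⁻¹ = F.trans (F.*-identityʳ (conj π⁻¹)) (F₀.refl , F₀.sym (RingProperties.-1*x≈-x F₀.ring π₀⁻¹))

    -- Exactly one of the two paired generators carries π⁻¹. In the first block it is the one in the
    -- linear argument; otherwise it stands in the conjugate-linear argument and becomes -π⁻¹. All
    -- signs `ε` originate here.
    η-rotate : ∀ j → η (rotate j) F.≈ (F₀.0# , sign (isHead j) F₀.* π₀⁻¹)
    η-rotate j with position j
    ... | head p q rewrite isHead-true p | unit-≮ {n ∸ ℓ} {rotate j} (high-≮-n∸ℓ q) | unit-< {ℓ} {o (rotate j)} (opposite-low _ q) =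
      F.trans (F.*-congʳ {π⁻¹} conj-1) (F.trans (F.*-identityˡ π⁻¹) (F₀.refl , F₀.sym (F₀.*-identityˡ π₀⁻¹)))
    ... | middle p q r rewrite isHead-false p | unit-< {n ∸ ℓ} {rotate j} (ℕₚ.<-≤-trans r ℓ≤n∸ℓ)
      | unit-≮ {ℓ} {o (rotate j)} (opposite-high _ (ℕₚ.<-≤-trans (ℕₚ.+-monoˡ-< ℓ r)
          (ℕₚ.≤-trans (ℕₚ.≤-reflexive (≡.cong (ℓ ℕ.+_) (≡.sym (ℕₚ.+-identityʳ ℓ)))) 2ℓ≤n))) = conj-π⁻¹
    ... | tail p q r rewrite isHead-false (ℕₚ.≤-trans (ℕₚ.m≤m+n ℓ (ℓ ℕ.+ 0)) p) | unit-< {n ∸ ℓ} {rotate j} (low-<-n∸ℓ r)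
      | unit-≮ {ℓ} {o (rotate j)} (opposite-high _ r) = conj-π⁻¹

    module ∑₀ = Matrices F₀

    proj₁-sum : ∀ {k} (f : Fin k → F.Carrier) → proj₁ (sum f) F₀.≈ ∑₀.sum (proj₁ ∘ f)
    proj₁-sum {zero}  f = F₀.refl
    proj₁-sum {suc k} f = F₀.+-congˡ (proj₁-sum (f ∘ Fin.suc))

    proj₁-sumᴼ : ∀ {k} (f : Fin k → O₀.Carrier) → proj₁ (Matrices.sum O₀ f) F₀.≈ ∑₀.sum (proj₁ ∘ f)
    proj₁-sumᴼ {zero}  f = F₀.refl
    proj₁-sumᴼ {suc k} f = F₀.+-congˡ (proj₁-sumᴼ (f ∘ Fin.suc))

    open IntegerSolver F₀ using (solve; _:=_; _:+_; _:*_; _:-_; :-_; con)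

    -- Half the trace is the projection to `F₀`. Multiplication by ±π⁻¹ exchanges the two
    -- components, which makes the form pair `re` with `im`; the conjugation supplies the minus
    -- sign.
    real-part : ∀ a b x y s {η} → η F.≈ (F₀.0# , s F₀.* π₀⁻¹) →
                proj₁ (conj (a , b) F.* ((x , y) F.* η)) F₀.≈ s F₀.* (a F₀.* y F₀.- b F₀.* x)
    real-part a b x y s {η} p = F₀.trans (proj₁ (F.*-congˡ {conj (a , b)} (F.*-congˡ {x , y} p)))
      (F₀.trans (solve 7 (λ a b x y s p q →
          a :* (x :* con (+ 0) :+ p :* (y :* (s :* q))) :+ p :* (:- b :* (x :* (s :* q) :+ y :* con (+ 0)))
            := (p :* q) :* (s :* (a :* y :- b :* x))) F₀.refl a b x y s π₀ π₀⁻¹)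
        (F₀.trans (F₀.*-congʳ (inverse-rightInverse π₀ π₀≉0)) (F₀.*-identityˡ _)))

    ½Tr : ∀ z → ½ F₀.* Tr z F₀.≈ proj₁ z
    ½Tr (x , y) = F₀.trans (solve 2 (λ h x → h :* (x :+ x) := ((con (+ 1) :+ con (+ 1)) :* h) :* x) F₀.refl ½ x)
      (F₀.trans (F₀.*-congʳ (inverse-rightInverse _ 2≉0)) (F₀.*-identityˡ x))

    signᴼ : Fin n → O₀.Carrier
    signᴼ j = if isHead j then O₀.1# else O₀.- O₀.1#

    sign-signᴼ : ∀ j → sign (isHead j) ≡ proj₁ (signᴼ j)
    sign-signᴼ j with isHead j
    ... | true  = ≡.refl
    ... | false = ≡.refl

    pairing-≈ : ∀ x y → pairing ℓ≤n x y O₀.≈ Matrices.sum O₀ λ j → signᴼ j O₀.*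
      (Functional.⟦_⟧ (Λₙ₋ℓ.rational j) x O₀.* Functional.⟦_⟧ (Λℓ.irrational (j ᵒ)) y O₀.-
       Functional.⟦_⟧ (Λₙ₋ℓ.irrational j) x O₀.* Functional.⟦_⟧ (Λℓ.rational (j ᵒ)) y)
    pairing-≈ (x , c , p) (y , d , q) =
      F₀.trans (½Tr (φ x y)) (F₀.trans (proj₁ (F.trans (φ-cong p q) (φ-lincomb-gen (ι.⟦_⟧ ∘ c) (ι.⟦_⟧ ∘ d))))
        -- The sum over generators is reindexed by `rotate`, to match the ordered basis of the
        -- charts.
        (F₀.trans (proj₁-sum summand) (F₀.trans (∑₀′.sum-bijection rotate unrotate rotate-unrotate unrotate-rotate (proj₁ ∘ summand))
          (F₀.trans (∑₀′.sum-cong term) (F₀.sym (proj₁-sumᴼ summandᴼ))))))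
      where
      module ∑₀′ = Sums F₀
      summand : Fin n → F.Carrier
      summand i = conj ι.⟦ c i ⟧ F.* (ι.⟦ d (o i) ⟧ F.* η i)
      summandᴼ : Fin n → O₀.Carrier
      summandᴼ j = signᴼ j O₀.* (proj₁ (c (rotate j)) O₀.* proj₂ (d (rotate (j ᵒ))) O₀.-
                                 proj₂ (c (rotate j)) O₀.* proj₁ (d (rotate (j ᵒ))))
      term : ∀ j → proj₁ (summand (rotate j)) F₀.≈ proj₁ (summandᴼ j)
      term j rewrite rotate-ᵒ j = F₀.trans
        (real-part (proj₁ (proj₁ (c r))) (proj₁ (proj₂ (c r))) (proj₁ (proj₁ (d (o r)))) (proj₁ (proj₂ (d (o r))))
          (sign (isHead j)) {η r} (η-rotate j))
        (F₀.*-congʳ (F₀.reflexive (sign-signᴼ j)))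
        where r = rotate j

-- Integrality of one half

module Half {a} (𝔽 : CompleteDiscretelyValuedField a) where
  open CompleteDiscretelyValuedField 𝔽 using (F₀; v; v-*; v-cong; 1#; _+_; residueChar≢2)
  open Integers 𝔽
  private
    module F₀ = CommutativeRing F₀
    module O₀ = CommutativeRing O₀

    [0]≡ : v (1# + 1#) +⁺ v ½ ≡ [ 0ℤ ]
    [0]≡ = ≡.trans (≡.sym (v-* _ _)) (≡.trans (v-cong (inverse-rightInverse _ 2≉0)) v-1)

    unbox : ∀ {x y : ℤ} → _≡_ {A = ℤ ⁺} [ x ] [ y ] → x ≡ y
    unbox ≡.refl = ≡.refl

    -- Applied to the valuations of 2 and ½, which add up to 0: if that of ½ were negative, that of
    -- 2 would be at least 1, against the residue characteristic.
    nonneg : ∀ γ δ → ¬ [ 1ℤ ] ≤⁺ γ → γ +⁺ δ ≡ [ 0ℤ ] → [ 0ℤ ] ≤⁺ δ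
    nonneg ⊤⁺    δ     p q  = ⊥-elim (p (_ ≤⊤⁺))
    nonneg [ k ] ⊤⁺    p ()
    nonneg [ k ] [ m ] p q  = [ ℤₚ.≮⇒≥ (λ m<0 → p [ 1≤k m<0 ]) ]
      where
      k+m≡0 : k ℤ.+ m ≡ 0ℤ
      k+m≡0 = unbox q
      1≤k : m ℤ.< 0ℤ → 1ℤ ℤ.≤ k
      1≤k m<0 = ℤₚ.≤-trans (ℤₚ.i<j⇒suc[i]≤j (≡.subst (ℤ._< k) k+m≡0 (≡.subst (k ℤ.+ m ℤ.<_) (ℤₚ.+-identityʳ k) (ℤₚ.+-monoʳ-< k m<0)))) ℤₚ.≤-refl

  ½ᴼ : O₀.Carrier
  ½ᴼ = ½ , nonneg _ _ residueChar≢2 [0]≡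

  ½ᴼ+½ᴼ≈1 : ½ᴼ O₀.+ ½ᴼ O₀.≈ O₀.1#
  ½ᴼ+½ᴼ≈1 = F₀.trans (F₀.+-cong (F₀.sym (F₀.*-identityˡ ½)) (F₀.sym (F₀.*-identityˡ ½)))
    (F₀.trans (F₀.sym (F₀.distribʳ ½ 1# 1#)) (inverse-rightInverse _ 2≉0))

-- Coordinates on the lattices over an algebra

module Charts {a} {𝔽 : CompleteDiscretelyValuedField a} {n ℓ : ℕ}
              (H : SplitHermitianSpace 𝔽 n) (ℓ-sns : StronglyNonSpecial n ℓ) where
  open Integers 𝔽 using (O₀; O; O₀⊂O; π₀ᴼ; πᴼ)
  open Lattices H using (Vᴼ; pairing; Λ₀[_]; Λ[_])
  open SplittingModel H ℓ-sns
  open StronglyNonSpecial ℓ-sns using (ℓ≤n)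
  open HermitianLattices H ℓ-sns public
  open Half 𝔽
  private
    module O₀ = CommutativeRing O₀
    module O = CommutativeRing O

  module _ (R : Algebra O) where
    private
      module R = Algebra R
      module scalar = Hom R.structureMap
      π = πᴿ R

    ½ᴿ : R.Carrier
    ½ᴿ = Algebra.scalar (R₀ R) ½ᴼ

    ½ᴿ+½ᴿ≈1 : ½ᴿ R.+ ½ᴿ R.≈ R.1#
    ½ᴿ+½ᴿ≈1 = R.trans (R.sym (Hom.+-homo (Algebra.structureMap (R₀ R)) ½ᴼ ½ᴼ))
      (R.trans (Hom.⟦⟧-cong (Algebra.structureMap (R₀ R)) {½ᴼ O₀.+ ½ᴼ} {O₀.1#} ½ᴼ+½ᴼ≈1) (Hom.1#-homo (Algebra.structureMap (R₀ R))))

    -- The tensor product is over O₀, where only π₀ exists; through the O-algebra structure of `R`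
    -- it becomes the square of `π`, the scalar in all equations of the chart.
    π² : Algebra.scalar (R₀ R) π₀ᴼ R.≈ π R.* π
    π² = R.trans (scalar.⟦⟧-cong {Hom.⟦_⟧ O₀⊂O π₀ᴼ} {πᴼ O.* πᴼ} (√d² O₀ π₀ᴼ)) (scalar.*-homo πᴼ πᴼ)

    open module CoreR = Core R.commutativeRing blocks π ½ᴿ ½ᴿ+½ᴿ≈1 using (sel; ε)

    LatticeCoordinates : Family → Set a
    LatticeCoordinates g = Coordinates R.commutativeRing (Λ⊗-module R g) n

    sel-not : ∀ {x y : Fin n → R.Carrier} {j z} → (isTail j ≡ true → z R.≈ x j) → (isTail j ≡ false → z R.≈ y j) →
              z R.≈ sel x y j
    sel-not {j = j} p q with isTail j
    ... | true  = p ≡.refl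
    ... | false = q ≡.refl

    abstract
      coordinatesℓ : LatticeCoordinates gℓ
      coordinatesℓ = FreeTensor.coordinates {K = O₀} {N = Λ₀[ gℓ ]} Λℓ.basis (R₀ R)

      coordinatesₙ₋ℓ : LatticeCoordinates gₙ₋ℓ
      coordinatesₙ₋ℓ = FreeTensor.coordinates {K = O₀} {N = Λ₀[ gₙ₋ℓ ]} Λₙ₋ℓ.basis (R₀ R)

      coordinatesπ⁻¹ : LatticeCoordinates π⁻¹gℓ
      coordinatesπ⁻¹ = FreeTensor.coordinates {K = O₀} {N = Λ₀[ π⁻¹gℓ ]} Λπ⁻¹.basis (R₀ R)

    module ℓᶜ = Coordinates coordinatesℓ
    module ₙ₋ℓᶜ = Coordinates coordinatesₙ₋ℓ
    module π⁻¹ᶜ = Coordinates coordinatesπ⁻¹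

    -- What is remembered about the opaque coordinate systems: they belong to the ordered basis of
    -- the charts, and `t` exchanges the two blocks up to π².
    record IsStandard (g : Family) (c : LatticeCoordinates g) : Set a where
      open Coordinates c
      field
        col-column : ∀ p q → col p q ≡ column R g p q
        re-t : ∀ x j → re (t R g x) j R.≈ π R.* π R.* im x j
        im-t : ∀ x j → im (t R g x) j R.≈ re x j

    abstract
      standardℓ : IsStandard gℓ coordinatesℓ
      standardℓ = record
        { col-column = λ p q → ≡.refl
        ; re-t = λ x j → R.trans (extend-map {K = O₀} {M = Λ₀[ gℓ ]} {N = Λ₀[ gℓ ]} (R₀ R)
            (Λℓ.irrational j) (Λℓ.rational j) (LeftModule._*ₗ_ Λ[ gℓ ] πᴼ) π₀ᴼ
            (λ m → Λℓ.√d-rational (Λℓ.coefficient m (rotate j))) x) (R.*-congʳ π²)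
        ; im-t = λ x j → extend-map-1 {K = O₀} {M = Λ₀[ gℓ ]} {N = Λ₀[ gℓ ]} (R₀ R)
            (Λℓ.rational j) (Λℓ.irrational j) (LeftModule._*ₗ_ Λ[ gℓ ] πᴼ)
            (λ m → Λℓ.√d-irrational (Λℓ.coefficient m (rotate j))) x
        }

      standardₙ₋ℓ : IsStandard gₙ₋ℓ coordinatesₙ₋ℓ
      standardₙ₋ℓ = record
        { col-column = λ p q → ≡.refl
        ; re-t = λ x j → R.trans (extend-map {K = O₀} {M = Λ₀[ gₙ₋ℓ ]} {N = Λ₀[ gₙ₋ℓ ]} (R₀ R)
            (Λₙ₋ℓ.irrational j) (Λₙ₋ℓ.rational j) (LeftModule._*ₗ_ Λ[ gₙ₋ℓ ] πᴼ) π₀ᴼ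
            (λ m → Λₙ₋ℓ.√d-rational (Λₙ₋ℓ.coefficient m (rotate j))) x) (R.*-congʳ π²)
        ; im-t = λ x j → extend-map-1 {K = O₀} {M = Λ₀[ gₙ₋ℓ ]} {N = Λ₀[ gₙ₋ℓ ]} (R₀ R)
            (Λₙ₋ℓ.rational j) (Λₙ₋ℓ.irrational j) (LeftModule._*ₗ_ Λ[ gₙ₋ℓ ] πᴼ)
            (λ m → Λₙ₋ℓ.√d-irrational (Λₙ₋ℓ.coefficient m (rotate j))) x
        }

    incl₁ : Λ_⊗ R gℓ → Λ_⊗ R gₙ₋ℓ
    incl₁ = mapΛ R gℓ gₙ₋ℓ inclusion₁

    incl₂ : Λ_⊗ R gₙ₋ℓ → Λ_⊗ R π⁻¹gℓ
    incl₂ = mapΛ R gₙ₋ℓ π⁻¹gℓ inclusion₂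

    scale : Λ_⊗ R gℓ → Λ_⊗ R π⁻¹gℓ
    scale = mapΛ R gℓ π⁻¹gℓ scaleByπ⁻¹

    form : Λ_⊗ R gₙ₋ℓ → Λ_⊗ R gℓ → R.Carrier
    form = extendBilinear {M = Λ₀[ gₙ₋ℓ ]} {N = Λ₀[ gℓ ]} (pairing ℓ≤n) (R₀ R)

    formTerm : Λ_⊗ R gₙ₋ℓ → Λ_⊗ R gℓ → Fin n → R.Carrier
    formTerm x y j = ε j R.* (ₙ₋ℓᶜ.re x j R.* ℓᶜ.im y (j ᵒ) R.- ₙ₋ℓᶜ.im x j R.* ℓᶜ.re y (j ᵒ))

    private
      ratioAt : ∀ {g g′ : Family} (b : Fin n → Bool) → (∀ j → Ratio (g (rotate j)) (g′ (rotate j)) (b j)) →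
                ∀ i → Ratio (g i) (g′ i) (b (unrotate i))
      ratioAt {g} {g′} b r i = ≡.subst (λ k → Ratio (g k) (g′ k) (b (unrotate i))) (rotate-unrotate i) (r (unrotate i))

      module Incl {g g′ : Family} (ind : Independent g) (ind′ : Independent g′)
                  (h : Element g → Element g′) (h-id : ∀ m → proj₁ (h m) ≡ proj₁ m)
                  (b : Fin n → Bool) (r : ∀ j → Ratio (g (rotate j)) (g′ (rotate j)) (b j)) where
        private
          r′ : ∀ i → Ratio (g i) (g′ i) (b (unrotate i))
          r′ = ratioAt b r
          module I = SqrtInclusion O₀ π₀ᴼ Vᴼ g g′ ind ind′
          module Λ = Lattice ind
          module Λ′ = Lattice ind′

          b-rotate : ∀ j {z} → b j ≡ z → b (unrotate (rotate j)) ≡ z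
          b-rotate j p = ≡.trans (≡.cong b (unrotate-rotate j)) p

          ext : (f : Functional {K = O₀} Λ₀[ g ]) → Λ_⊗ R g → R.Carrier
          ext = Extension.extend {K = O₀} Λ₀[ g ] (R₀ R)
          ext′ : (f : Functional {K = O₀} Λ₀[ g′ ]) → Λ_⊗ R g′ → R.Carrier
          ext′ = Extension.extend {K = O₀} Λ₀[ g′ ] (R₀ R)

        re-false : ∀ x {j} → b j ≡ false → ext′ (Λ′.rational j) (mapΛ R g g′ h x) R.≈ ext (Λ.rational j) x
        re-false x {j} p = extend-map-1 {K = O₀} {M = Λ₀[ g ]} {N = Λ₀[ g′ ]} (R₀ R) (Λ.rational j) (Λ′.rational j) h
          (λ m → proj₁ (I.coefficient-1 h h-id (ratio ∘ r′) (ratio-≈ ∘ r′) {rotate j} (ratio-one (r′ (rotate j)) (b-rotate j p)) m)) x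

        im-false : ∀ x {j} → b j ≡ false → ext′ (Λ′.irrational j) (mapΛ R g g′ h x) R.≈ ext (Λ.irrational j) x
        im-false x {j} p = extend-map-1 {K = O₀} {M = Λ₀[ g ]} {N = Λ₀[ g′ ]} (R₀ R) (Λ.irrational j) (Λ′.irrational j) h
          (λ m → proj₂ (I.coefficient-1 h h-id (ratio ∘ r′) (ratio-≈ ∘ r′) {rotate j} (ratio-one (r′ (rotate j)) (b-rotate j p)) m)) x

        re-true : ∀ x {j} → b j ≡ true → ext′ (Λ′.rational j) (mapΛ R g g′ h x) R.≈ π R.* π R.* ext (Λ.irrational j) x
        re-true x {j} p = R.trans (extend-map {K = O₀} {M = Λ₀[ g ]} {N = Λ₀[ g′ ]} (R₀ R) (Λ.irrational j) (Λ′.rational j) h π₀ᴼ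
          (λ m → proj₁ (I.coefficient-√d h h-id (ratio ∘ r′) (ratio-≈ ∘ r′) {rotate j} (ratio-pi (r′ (rotate j)) (b-rotate j p)) m)) x) (R.*-congʳ π²)

        im-true : ∀ x {j} → b j ≡ true → ext′ (Λ′.irrational j) (mapΛ R g g′ h x) R.≈ ext (Λ.rational j) x
        im-true x {j} p = extend-map-1 {K = O₀} {M = Λ₀[ g ]} {N = Λ₀[ g′ ]} (R₀ R) (Λ.rational j) (Λ′.irrational j) h
          (λ m → proj₂ (I.coefficient-√d h h-id (ratio ∘ r′) (ratio-≈ ∘ r′) {rotate j} (ratio-pi (r′ (rotate j)) (b-rotate j p)) m)) x

    abstract
      -- Where the generators differ by π, a coefficient a + bπ turns into bπ₀ + aπ; elsewhere it is
      -- unchanged.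
      re-incl₁ : ∀ x j → ₙ₋ℓᶜ.re (incl₁ x) j R.≈ sel (λ j → π R.* π R.* ℓᶜ.im x j) (ℓᶜ.re x) j
      re-incl₁ x j = sel-not {λ j → π R.* π R.* ℓᶜ.im x j} {ℓᶜ.re x} {j} (I.re-true x) (I.re-false x)
        where module I = Incl {gℓ} {gₙ₋ℓ} gℓ-independent gₙ₋ℓ-independent inclusion₁ (λ _ → ≡.refl) isTail ratio₁

      im-incl₁ : ∀ x j → ₙ₋ℓᶜ.im (incl₁ x) j R.≈ sel (ℓᶜ.re x) (ℓᶜ.im x) j
      im-incl₁ x j = sel-not {ℓᶜ.re x} {ℓᶜ.im x} {j} (I.im-true x) (I.im-false x)
        where module I = Incl {gℓ} {gₙ₋ℓ} gℓ-independent gₙ₋ℓ-independent inclusion₁ (λ _ → ≡.refl) isTail ratio₁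

      re-incl₂ : ∀ x j → π⁻¹ᶜ.re (incl₂ x) j R.≈ sel (ₙ₋ℓᶜ.re x) (λ j → π R.* π R.* ₙ₋ℓᶜ.im x j) j
      re-incl₂ x j = sel-not {ₙ₋ℓᶜ.re x} {λ j → π R.* π R.* ₙ₋ℓᶜ.im x j} {j} (λ p → I.re-false x (≡.cong not p)) (λ p → I.re-true x (≡.cong not p))
        where module I = Incl {gₙ₋ℓ} {π⁻¹gℓ} gₙ₋ℓ-independent π⁻¹gen-independent inclusion₂ (λ _ → ≡.refl) (not ∘ isTail) ratio₂

      im-incl₂ : ∀ x j → π⁻¹ᶜ.im (incl₂ x) j R.≈ sel (ₙ₋ℓᶜ.im x) (ₙ₋ℓᶜ.re x) j
      im-incl₂ x j = sel-not {ₙ₋ℓᶜ.im x} {ₙ₋ℓᶜ.re x} {j} (λ p → I.im-false x (≡.cong not p)) (λ p → I.im-true x (≡.cong not p))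
        where module I = Incl {gₙ₋ℓ} {π⁻¹gℓ} gₙ₋ℓ-independent π⁻¹gen-independent inclusion₂ (λ _ → ≡.refl) (not ∘ isTail) ratio₂

      re-scale : ∀ x j → π⁻¹ᶜ.re (scale x) j R.≈ ℓᶜ.re x j
      re-scale x j = extend-map-1 {K = O₀} {M = Λ₀[ gℓ ]} {N = Λ₀[ π⁻¹gℓ ]} (R₀ R)
        (Λℓ.rational j) (Λπ⁻¹.rational j) scaleByπ⁻¹ (λ (_ , c , _) → O₀.refl {proj₁ (c (rotate j))}) x

      im-scale : ∀ x j → π⁻¹ᶜ.im (scale x) j R.≈ ℓᶜ.im x j
      im-scale x j = extend-map-1 {K = O₀} {M = Λ₀[ gℓ ]} {N = Λ₀[ π⁻¹gℓ ]} (R₀ R)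
        (Λℓ.irrational j) (Λπ⁻¹.irrational j) scaleByπ⁻¹ (λ (_ , c , _) → O₀.refl {proj₂ (c (rotate j))}) x

      form-≈ : ∀ x y → form x y R.≈ Matrices.sum R.commutativeRing (formTerm x y)
      form-≈ x y = R.trans (B.extendBilinear-sum x y)
        (Sums.sum-cong R.commutativeRing {f = λ j → B.term j x y} {g = formTerm x y} λ j →
          R.*-congʳ {x = ₙ₋ℓᶜ.re x j R.* ℓᶜ.im y (j ᵒ) R.- ₙ₋ℓᶜ.im x j R.* ℓᶜ.re y (j ᵒ)} (scalar-sign j))
        where
        module B = BilinearExtension {K = O₀} {M = Λ₀[ gₙ₋ℓ ]} {N = Λ₀[ gℓ ]} (pairing ℓ≤n) Form.signᴼ
          Λₙ₋ℓ.rational Λₙ₋ℓ.irrational (λ j → Λℓ.irrational (j ᵒ)) (λ j → Λℓ.rational (j ᵒ))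
          Form.pairing-≈ (R₀ R)
        module S₀ = Hom (Algebra.structureMap (R₀ R))
        scalar-sign : ∀ j → Algebra.scalar (R₀ R) (Form.signᴼ j) R.≈ ε j
        scalar-sign j with isHead j
        ... | true  = S₀.1#-homo
        ... | false = R.trans (S₀.-‿homo O₀.1#) (R.-‿cong S₀.1#-homo)

  module _ {R R′ : Algebra O} (φ : AlgHom R R′) where
    private
      module R′ = Algebra R′
      φ₀ : AlgHom (R₀ R) (R₀ R′)
      φ₀ = record { hom = AlgHom.hom φ ; commutes = λ k → AlgHom.commutes φ (Hom.⟦_⟧ O₀⊂O k) }

    image : ∀ g → Λ_⊗ R g → Λ_⊗ R′ g
    image g = tensorMap {M = Λ₀[ g ]} {N = Λ₀[ g ]} {R = R₀ R} {S = R₀ R′} (λ m → m) (AlgHom.⟦_⟧ φ)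

    abstract
      re-imageℓ : ∀ x j → Coordinates.re (coordinatesℓ R′) (image gℓ x) j R′.≈ AlgHom.⟦_⟧ φ (Coordinates.re (coordinatesℓ R) x j)
      re-imageℓ x j = extend-baseChange {K = O₀} {M = Λ₀[ gℓ ]} {R₀ R} {R₀ R′} φ₀ (Λℓ.rational j) x

      im-imageℓ : ∀ x j → Coordinates.im (coordinatesℓ R′) (image gℓ x) j R′.≈ AlgHom.⟦_⟧ φ (Coordinates.im (coordinatesℓ R) x j)
      im-imageℓ x j = extend-baseChange {K = O₀} {M = Λ₀[ gℓ ]} {R₀ R} {R₀ R′} φ₀ (Λℓ.irrational j) x

      re-imageₙ₋ℓ : ∀ x j → Coordinates.re (coordinatesₙ₋ℓ R′) (image gₙ₋ℓ x) j R′.≈ AlgHom.⟦_⟧ φ (Coordinates.re (coordinatesₙ₋ℓ R) x j)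
      re-imageₙ₋ℓ x j = extend-baseChange {K = O₀} {M = Λ₀[ gₙ₋ℓ ]} {R₀ R} {R₀ R′} φ₀ (Λₙ₋ℓ.rational j) x

      im-imageₙ₋ℓ : ∀ x j → Coordinates.im (coordinatesₙ₋ℓ R′) (image gₙ₋ℓ x) j R′.≈ AlgHom.⟦_⟧ φ (Coordinates.im (coordinatesₙ₋ℓ R) x j)
      im-imageₙ₋ℓ x j = extend-baseChange {K = O₀} {M = Λ₀[ gₙ₋ℓ ]} {R₀ R} {R₀ R′} φ₀ (Λₙ₋ℓ.irrational j) x

-- Graphs and lines

module Subspaces {a} {R : CommRing a} {M : Mod R} {n} (c : Coordinates R M n) where
  open CommutativeRing R
  open LeftModule M using (Carrierᴹ; _≈ᴹ_; _+ᴹ_; _*ₗ_; ≈ᴹ-trans; ≈ᴹ-refl)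
  open LinearAlgebra R M
  open Matrices R
  open Sums R
  open IntegerSolver R
  open Coordinates c

  columns : ∀ {k} → Matrix n k → Matrix n k → Fin k → Carrierᴹ
  columns A B j = col (λ i → A i j) (λ i → B i j)

  re-columns : ∀ {k} (A B : Matrix n k) d i → re (lincomb d (columns A B)) i ≈ (A *ᵥ d) i
  re-columns A B d i = trans (re-lincomb d (columns A B) i)
    (sum-cong λ j → trans (*-congˡ (re-col (λ i → A i j) (λ i → B i j) i)) (*-comm _ _))

  im-columns : ∀ {k} (A B : Matrix n k) d i → im (lincomb d (columns A B)) i ≈ (B *ᵥ d) i
  im-columns A B d i = trans (im-lincomb d (columns A B) i)
    (sum-cong λ j → trans (*-congˡ (im-col (λ i → A i j) (λ i → B i j) i)) (*-comm _ _))

  *ᵥ-cong : ∀ {k m} (A : Matrix k m) {x y : Fin m → Carrier} → (∀ j → x j ≈ y j) → ∀ i → (A *ᵥ x) i ≈ (A *ᵥ y) i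
  *ᵥ-cong A p i = sum-cong λ j → *-congˡ (p j)

  -- With the identity as lower block, the coefficients of a combination of the columns are its own
  -- `im`. Membership in the span thus becomes an equation, with no existential quantifier.
  Graph : Matrix n n → Pred Carrierᴹ a
  Graph X x = ∀ i → re x i ≈ (X *ᵥ im x) i

  span⇒graph : ∀ X {x} → Span (columns X 𝟙) x → Graph X x
  span⇒graph X {x} (d , p) i = trans (re-cong p i) (trans (re-columns X 𝟙 d i)
    (*ᵥ-cong X (λ j → sym (trans (im-cong p j) (trans (im-columns X 𝟙 d j) (sum-𝟙ˡ j d)))) i))

  graph≈lincomb : ∀ X {x} → Graph X x → x ≈ᴹ lincomb (im x) (columns X 𝟙)
  graph≈lincomb X {x} p = injective
    (λ i → trans (p i) (sym (re-columns X 𝟙 (im x) i)))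
    (λ i → sym (trans (im-columns X 𝟙 (im x) i) (sum-𝟙ˡ i (im x))))

  graph⇒span : ∀ X {x} → Graph X x → Span (columns X 𝟙) x
  graph⇒span X {x} p = im x , graph≈lincomb X p

  graph-independent : ∀ X → LinearlyIndependent (columns X 𝟙)
  graph-independent X d p i = trans (sym (sum-𝟙ˡ i d))
    (trans (sym (im-columns X 𝟙 d i)) (trans (im-cong p i) (im-0 i)))

  -- A point of the graph has its own lower block as coordinates in the basis of columns, so the
  -- matrix of `f` is read off from `im`.
  graph-matrix : ∀ X f A → (∀ j → Graph X (f (columns X 𝟙 j))) → (∀ i j → im (f (columns X 𝟙 j)) i ≈ A i j) →
                 IsMatrixOf (columns X 𝟙) f A
  graph-matrix X f A p q j = ≈ᴹ-trans (graph≈lincomb X (p j)) (sumᴹ-cong λ i → LeftModule.*ₗ-cong M (q i j) ≈ᴹ-refl)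

  column-graph : ∀ X j → Graph X (columns X 𝟙 j)
  column-graph X j = span⇒graph X (generator∈Span (columns X 𝟙) j)

  *ᵥ-0 : ∀ {k m} (A : Matrix k m) {x : Fin m → Carrier} → (∀ j → x j ≈ 0#) → ∀ i → (A *ᵥ x) i ≈ 0#
  *ᵥ-0 A p i = sum-zero λ j → trans (*-congˡ (p j)) (zeroʳ _)

  im≈0-isSubmodule : IsSubmodule (λ x → ∀ i → im x i ≈ 0#)
  im≈0-isSubmodule = record
    { resp  = λ p q i → trans (sym (im-cong p i)) (q i)
    ; zero∈ = im-0
    ; +∈    = λ p q i → trans (im-+ _ _ i) (trans (+-cong (p i) (q i)) (+-identityˡ 0#))
    ; *∈    = λ k p i → trans (im-* k _ i) (trans (*-congˡ (p i)) (zeroʳ k))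
    }

  -- The complement consists of the vectors with lower block zero; the component in the graph is the
  -- point with the same lower block.
  graph-summand : ∀ X → IsDirectSummand (Span (columns X 𝟙))
  graph-summand X = (λ x → ∀ i → im x i ≈ 0#) , im≈0-isSubmodule ,
    (λ x → let Xq = X *ᵥ im x in
      lincomb (im x) (columns X 𝟙) , col (λ i → re x i - Xq i) (λ _ → 0#) , (im x , ≈ᴹ-refl) , im-col _ _ ,
      injective
        (λ i → sym (trans (re-+ _ _ i) (trans (+-cong (re-columns X 𝟙 (im x) i) (re-col _ _ i))
          (solve 2 (λ y x → y :+ (x :- y) := x) refl (Xq i) (re x i)))))
        (λ i → sym (trans (im-+ _ _ i) (trans (+-cong (trans (im-columns X 𝟙 (im x) i) (sum-𝟙ˡ i (im x))) (im-col _ _ i)) (+-identityʳ _))))) ,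
    λ x p q → injective
      (λ i → trans (span⇒graph X p i) (trans (*ᵥ-0 X q i) (sym (re-0 i))))
      (λ i → trans (q i) (sym (im-0 i)))

  module Line (G₁ G₂ : Matrix n 1) (i₀ : Fin n) (G₂-i₀ : G₂ i₀ Fin.zero ≈ 1#) where
    private
      i₀-coordinate : ∀ d → im (lincomb d (columns G₁ G₂)) i₀ ≈ d Fin.zero
      i₀-coordinate d = trans (im-columns G₁ G₂ d i₀) (trans (+-identityʳ _) (trans (*-congʳ G₂-i₀) (*-identityˡ _)))

    line-coordinates : ∀ {x} → Span (columns G₁ G₂) x →
      (∀ i → re x i ≈ im x i₀ * G₁ i Fin.zero) × (∀ i → im x i ≈ im x i₀ * G₂ i Fin.zero)
    line-coordinates {x} (d , p) =
      (λ i → trans (re-cong p i) (trans (re-columns G₁ G₂ d i) (trans (+-identityʳ _) (trans (*-comm _ _) (*-congʳ d≈))))) ,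
      (λ i → trans (im-cong p i) (trans (im-columns G₁ G₂ d i) (trans (+-identityʳ _) (trans (*-comm _ _) (*-congʳ d≈)))))
      where
      d≈ : d Fin.zero ≈ im x i₀
      d≈ = sym (trans (im-cong p i₀) (i₀-coordinate d))

    line-independent : LinearlyIndependent (columns G₁ G₂)
    line-independent d p Fin.zero = trans (sym (i₀-coordinate d)) (trans (im-cong p i₀) (im-0 i₀))

    -- The generator has lower coordinate 1 at `i₀`, so the kernel of that coordinate is a
    -- complement.
    line-summand : IsDirectSummand (Span (columns G₁ G₂))
    line-summand = (λ x → im x i₀ ≈ 0#) ,
      record
        { resp  = λ p q → trans (sym (im-cong p i₀)) q
        ; zero∈ = im-0 i₀
        ; +∈    = λ p q → trans (im-+ _ _ i₀) (trans (+-cong p q) (+-identityˡ 0#))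
        ; *∈    = λ k p → trans (im-* k _ i₀) (trans (*-congˡ p) (zeroʳ k))
        } ,
      (λ x → let y = lincomb (λ _ → im x i₀) (columns G₁ G₂) in
        y , x +ᴹ (- 1#) *ₗ y , ((λ _ → im x i₀) , ≈ᴹ-refl) ,
        trans (im-+ _ _ i₀) (trans (+-congˡ (trans (im-* _ _ i₀) (*-congˡ (i₀-coordinate (λ _ → im x i₀)))))
          (solve 1 (λ x → x :+ :- con (+ 1) :* x := con (+ 0)) refl (im x i₀))) ,
        injective
          (λ i → sym (trans (re-+ _ _ i) (trans (+-congˡ (trans (re-+ _ _ i) (+-congˡ (re-* _ _ i))))
            (solve 2 (λ y x → y :+ (x :+ :- con (+ 1) :* y) := x) refl (re y i) (re x i)))))
          (λ i → sym (trans (im-+ _ _ i) (trans (+-congˡ (trans (im-+ _ _ i) (+-congˡ (im-* _ _ i))))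
            (solve 2 (λ y x → y :+ (x :+ :- con (+ 1) :* y) := x) refl (im y i) (im x i)))))) ,
      λ x p q → injective
        (λ i → trans (proj₁ (line-coordinates p) i) (trans (*-congʳ q) (trans (zeroˡ _) (sym (re-0 i)))))
        (λ i → trans (proj₂ (line-coordinates p) i) (trans (*-congʳ q) (trans (zeroˡ _) (sym (im-0 i)))))

module _ {a} {R : CommRing a} {M : Mod R} where
  open LeftModule M
  open LinearAlgebra R M

  span-cong : ∀ {k} {b b′ : Fin k → Carrierᴹ} → (∀ j → b j ≈ᴹ b′ j) → Span b ≐ Span b′
  span-cong {b = b} {b′} p =
    (λ (d , q) → d , ≈ᴹ-trans q (sumᴹ-cong λ j → *ₗ-cong (CommutativeRing.refl R) (p j))) ,
    (λ (d , q) → d , ≈ᴹ-trans q (sumᴹ-cong λ j → *ₗ-cong (CommutativeRing.refl R) (≈ᴹ-sym (p j))))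

-- The vectors v and w of a chart point

module Points {a} {𝔽 : CompleteDiscretelyValuedField a} {n ℓ : ℕ}
              (H : SplitHermitianSpace 𝔽 n) (ℓ-sns : StronglyNonSpecial n ℓ)
              (R : Algebra (Integers.O 𝔽)) where
  open SplittingModel H ℓ-sns
  open Charts H ℓ-sns hiding (module ℓᶜ; module ₙ₋ℓᶜ; module π⁻¹ᶜ)
  private module R = Algebra R
  open Matrices R.commutativeRing using (Matrix; 𝟙; sum; _*ᵥ_; _∙ᵥ_) public
  open Sums R.commutativeRing
  open IntegerSolver R.commutativeRing

  π : R.Carrier
  π = πᴿ R

  open Core R.commutativeRing blocks π (½ᴿ R) (½ᴿ+½ᴿ≈1 R) public using
    (sel; ε; ε²; dual; dual-cong; rankOne; rankOne-*ᵥ; rankOne-square; ∙-comm; IsCore; module Stable; sel-cong)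

  module Λℓ⊗ = LeftModule (Λ⊗-module R gℓ)
  module Λₙ₋ℓ⊗ = LeftModule (Λ⊗-module R gₙ₋ℓ)
  module ℓᶜ = Coordinates (coordinatesℓ R)
  module ₙ₋ℓᶜ = Coordinates (coordinatesₙ₋ℓ R)
  module Sℓ = Subspaces (coordinatesℓ R)
  module Sₙ₋ℓ = Subspaces (coordinatesₙ₋ℓ R)
  module LAℓ = LinearAlgebra R.commutativeRing (Λ⊗-module R gℓ)
  module LAₙ₋ℓ = LinearAlgebra R.commutativeRing (Λ⊗-module R gₙ₋ℓ)

  columnSpanℓ : ∀ {k} (A B : Matrix n k) → columnSpan R gℓ A B ≐ LAℓ.Span (Sℓ.columns A B)
  columnSpanℓ A B = span-cong {R = R.commutativeRing} {M = Λ⊗-module R gℓ}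
    λ j → Λℓ⊗.≈ᴹ-reflexive (≡.sym (IsStandard.col-column (standardℓ R) (λ i → A i j) (λ i → B i j)))

  columnSpanₙ₋ℓ : ∀ {k} (A B : Matrix n k) → columnSpan R gₙ₋ℓ A B ≐ LAₙ₋ℓ.Span (Sₙ₋ℓ.columns A B)
  columnSpanₙ₋ℓ A B = span-cong {R = R.commutativeRing} {M = Λ⊗-module R gₙ₋ℓ}
    λ j → Λₙ₋ℓ⊗.≈ᴹ-reflexive (≡.sym (IsStandard.col-column (standardₙ₋ℓ R) (λ i → A i j) (λ i → B i j)))

  re-t+π : ∀ x j → ₙ₋ℓᶜ.re (t+π R gₙ₋ℓ x) j R.≈ π R.* π R.* ₙ₋ℓᶜ.im x j R.+ π R.* ₙ₋ℓᶜ.re x j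
  re-t+π x j = R.trans (ₙ₋ℓᶜ.re-+ _ _ j) (R.+-cong (IsStandard.re-t (standardₙ₋ℓ R) x j) (ₙ₋ℓᶜ.re-* π x j))

  im-t+π : ∀ x j → ₙ₋ℓᶜ.im (t+π R gₙ₋ℓ x) j R.≈ ₙ₋ℓᶜ.re x j R.+ π R.* ₙ₋ℓᶜ.im x j
  im-t+π x j = R.trans (ₙ₋ℓᶜ.im-+ _ _ j) (R.+-cong (IsStandard.im-t (standardₙ₋ℓ R) x j) (ₙ₋ℓᶜ.im-* π x j))

  private
    neg : ∀ x → R.- R.1# R.* x R.≈ R.- x
    neg x = solve 1 (λ x → :- con (+ 1) :* x := :- x) R.refl x

  re-t-π : ∀ x j → ₙ₋ℓᶜ.re (t-π R gₙ₋ℓ x) j R.≈ π R.* π R.* ₙ₋ℓᶜ.im x j R.- π R.* ₙ₋ℓᶜ.re x j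
  re-t-π x j = R.trans (ₙ₋ℓᶜ.re-+ _ _ j) (R.+-cong (IsStandard.re-t (standardₙ₋ℓ R) x j)
    (R.trans (ₙ₋ℓᶜ.re-* (R.- R.1#) _ j) (R.trans (R.*-congˡ (ₙ₋ℓᶜ.re-* π x j)) (neg _))))

  im-t-π : ∀ x j → ₙ₋ℓᶜ.im (t-π R gₙ₋ℓ x) j R.≈ ₙ₋ℓᶜ.re x j R.- π R.* ₙ₋ℓᶜ.im x j
  im-t-π x j = R.trans (ₙ₋ℓᶜ.im-+ _ _ j) (R.+-cong (IsStandard.im-t (standardₙ₋ℓ R) x j)
    (R.trans (ₙ₋ℓᶜ.im-* (R.- R.1#) _ j) (R.trans (R.*-congˡ (ₙ₋ℓᶜ.im-* π x j)) (neg _))))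

  𝟙-ᵒ : ∀ (i j : Fin n) → 𝟙 (i ᵒ) j R.≈ 𝟙 i (j ᵒ)
  𝟙-ᵒ i j with i ᵒ Finₚ.≟ j | i Finₚ.≟ j ᵒ
  ... | yes _ | yes _ = R.refl
  ... | no  _ | no  _ = R.refl
  ... | yes p | no ¬q with () ← ¬q (≡.trans (≡.sym (ᵒ-involutive i)) (≡.cong _ᵒ p))
  ... | no ¬p | yes q with () ← ¬p (≡.trans (≡.cong _ᵒ q) (ᵒ-involutive j))

  𝟙-ᵒᵒ : ∀ (i j : Fin n) → 𝟙 (i ᵒ) (j ᵒ) R.≈ 𝟙 i j
  𝟙-ᵒᵒ i j = R.trans (𝟙-ᵒ i (j ᵒ)) (R.reflexive (≡.cong (𝟙 i) (ᵒ-involutive j)))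

  module FromPoint {i₀ : Fin n} (P : ChartPoint R i₀) where
    open ChartPoint P
    open Triple triple
    open InChart inChart
    open IsSplittingPoint isSplittingPoint
    open IsWedgePoint isWedgePoint
    open IsNaivePoint isNaivePoint
    open SetoidReasoning R.setoid

    -- `Y + π` has columns proportional to `v`, and `v i₀` is 1; hence its row `i₀` lists the
    -- factors of proportionality.
    v w : Fin n → R.Carrier
    v i = G₂ i Fin.zero
    w j = Y i₀ j R.+ π R.* 𝟙 i₀ j

    private
      xCol : Fin n → Λ_⊗ R gℓ
      xCol = Sℓ.columns X 𝟙

      yCol : Fin n → Λ_⊗ R gₙ₋ℓ
      yCol = Sₙ₋ℓ.columns Y 𝟙

      g : Λ_⊗ R gₙ₋ℓ
      g = Sₙ₋ℓ.columns G₁ G₂ Fin.zero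

      xCol∈ : ∀ b → ℱℓ (xCol b)
      xCol∈ b = proj₂ ℱℓ-chart (proj₂ (columnSpanℓ X 𝟙) (LAℓ.generator∈Span xCol b))

      yCol∈ : ∀ b → ℱₙ₋ℓ (yCol b)
      yCol∈ b = proj₂ ℱₙ₋ℓ-chart (proj₂ (columnSpanₙ₋ℓ Y 𝟙) (LAₙ₋ℓ.generator∈Span yCol b))

      g∈ : 𝒢ₙ₋ℓ g
      g∈ = proj₂ 𝒢ₙ₋ℓ-chart (proj₂ (columnSpanₙ₋ℓ G₁ G₂) (LAₙ₋ℓ.generator∈Span (Sₙ₋ℓ.columns G₁ G₂) Fin.zero))

      graphℓ : ∀ {x} → ℱℓ x → Sℓ.Graph X x
      graphℓ p = Sℓ.span⇒graph X (proj₁ (columnSpanℓ X 𝟙) (proj₁ ℱℓ-chart p))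

      graphₙ₋ℓ : ∀ {x} → ℱₙ₋ℓ x → Sₙ₋ℓ.Graph Y x
      graphₙ₋ℓ p = Sₙ₋ℓ.span⇒graph Y (proj₁ (columnSpanₙ₋ℓ Y 𝟙) (proj₁ ℱₙ₋ℓ-chart p))

      re-x : ∀ b i → ℓᶜ.re (xCol b) i R.≈ X i b
      re-x b = ℓᶜ.re-col (λ i → X i b) (λ i → 𝟙 i b)

      im-x : ∀ b i → ℓᶜ.im (xCol b) i R.≈ 𝟙 i b
      im-x b = ℓᶜ.im-col (λ i → X i b) (λ i → 𝟙 i b)

      re-y : ∀ b i → ₙ₋ℓᶜ.re (yCol b) i R.≈ Y i b
      re-y b = ₙ₋ℓᶜ.re-col (λ i → Y i b) (λ i → 𝟙 i b)

      im-y : ∀ b i → ₙ₋ℓᶜ.im (yCol b) i R.≈ 𝟙 i b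
      im-y b = ₙ₋ℓᶜ.im-col (λ i → Y i b) (λ i → 𝟙 i b)

      re-g : ∀ i → ₙ₋ℓᶜ.re g i R.≈ G₁ i Fin.zero
      re-g = ₙ₋ℓᶜ.re-col (λ i → G₁ i Fin.zero) v

      im-g : ∀ i → ₙ₋ℓᶜ.im g i R.≈ v i
      im-g = ₙ₋ℓᶜ.im-col (λ i → G₁ i Fin.zero) v

    v-i₀ : v i₀ R.≈ R.1#
    v-i₀ = normalized

    -- The lower block of `t - π` applied to the generator of the line is `G₁ - π·v`.
    G₁≈πv : ∀ i → G₁ i Fin.zero R.≈ π R.* v i
    G₁≈πv i = begin
      G₁ i Fin.zero                            ≈⟨ solve 2 (λ x y → x := (x :- y) :+ y) R.refl _ (π R.* v i) ⟩
      (G₁ i Fin.zero R.- π R.* v i) R.+ π R.* v i ≈⟨ R.+-congʳ (begin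
        G₁ i Fin.zero R.- π R.* v i             ≈⟨ R.+-cong (R.sym (re-g i)) (R.-‿cong (R.*-congˡ (R.sym (im-g i)))) ⟩
        ₙ₋ℓᶜ.re g i R.- π R.* ₙ₋ℓᶜ.im g i         ≈⟨ R.sym (im-t-π g i) ⟩
        ₙ₋ℓᶜ.im (t-π R gₙ₋ℓ g) i                  ≈⟨ ₙ₋ℓᶜ.im-cong (t-π-kills g g∈) i ⟩
        ₙ₋ℓᶜ.im Λₙ₋ℓ⊗.0ᴹ i                        ≈⟨ ₙ₋ℓᶜ.im-0 i ⟩
        R.0# ∎) ⟩
      R.0# R.+ π R.* v i                       ≈⟨ R.+-identityˡ _ ⟩
      π R.* v i ∎

    Yv≈πv : ∀ i → (Y *ᵥ v) i R.≈ π R.* v i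
    Yv≈πv i = begin
      (Y *ᵥ v) i            ≈⟨ Sₙ₋ℓ.*ᵥ-cong Y (λ j → R.sym (im-g j)) i ⟩
      (Y *ᵥ ₙ₋ℓᶜ.im g) i    ≈⟨ R.sym (graphₙ₋ℓ (𝒢⊆ℱ g∈) i) ⟩
      ₙ₋ℓᶜ.re g i           ≈⟨ re-g i ⟩
      G₁ i Fin.zero         ≈⟨ G₁≈πv i ⟩
      π R.* v i ∎

    -- `t + π` carries column `b` of the graph into the line, and the lower block of the result is
    -- column `b` of `Y + π`. A vector of the line is determined by its coordinate at `i₀`, here
    -- `w b`.
    Y≈ : ∀ i j → Y i j R.≈ rankOne v w i j
    Y≈ i b = begin
      Y i b                                                ≈⟨ solve 2 (λ y z → y := (y :+ z) :- z) R.refl (Y i b) (π R.* 𝟙 i b) ⟩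
      (Y i b R.+ π R.* 𝟙 i b) R.- π R.* 𝟙 i b              ≈⟨ R.+-congʳ (R.sym (entry i)) ⟩
      ₙ₋ℓᶜ.im (t+π R gₙ₋ℓ (yCol b)) i R.- π R.* 𝟙 i b       ≈⟨ R.+-congʳ (proj₂ (L.line-coordinates in-line) i) ⟩
      ₙ₋ℓᶜ.im (t+π R gₙ₋ℓ (yCol b)) i₀ R.* v i R.- π R.* 𝟙 i b ≈⟨ R.+-congʳ (R.trans (R.*-congʳ (entry i₀)) (R.*-comm _ _)) ⟩
      v i R.* w b R.- π R.* 𝟙 i b ∎
      where
      module L = Sₙ₋ℓ.Line G₁ G₂ i₀ v-i₀
      in-line : LAₙ₋ℓ.Span (Sₙ₋ℓ.columns G₁ G₂) (t+π R gₙ₋ℓ (yCol b))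
      in-line = proj₁ (columnSpanₙ₋ℓ G₁ G₂) (proj₁ 𝒢ₙ₋ℓ-chart (t+π-maps (yCol b) (yCol∈ b)))
      entry : ∀ i → ₙ₋ℓᶜ.im (t+π R gₙ₋ℓ (yCol b)) i R.≈ Y i b R.+ π R.* 𝟙 i b
      entry i = R.trans (im-t+π (yCol b) i) (R.+-cong (re-y b i) (R.*-congˡ (im-y b i)))

    private
      form-columns : ∀ c b → form R (yCol c) (xCol b) R.≈ ε (b ᵒ) R.* Y (b ᵒ) c R.- ε c R.* X (c ᵒ) b
      form-columns c b = begin
        form R (yCol c) (xCol b)
          ≈⟨ form-≈ R (yCol c) (xCol b) ⟩
        sum (formTerm R (yCol c) (xCol b))
          ≈⟨ sum-cong {f = formTerm R (yCol c) (xCol b)} {g = λ j → (ε j R.* Y j c) R.* 𝟙 j (b ᵒ) R.+ R.- (ε j R.* X (j ᵒ) b) R.* 𝟙 j c} term ⟩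
        sum (λ j → (ε j R.* Y j c) R.* 𝟙 j (b ᵒ) R.+ R.- (ε j R.* X (j ᵒ) b) R.* 𝟙 j c)
          ≈⟨ sum-+ (λ j → (ε j R.* Y j c) R.* 𝟙 j (b ᵒ)) (λ j → R.- (ε j R.* X (j ᵒ) b) R.* 𝟙 j c) ⟩
        sum (λ j → (ε j R.* Y j c) R.* 𝟙 j (b ᵒ)) R.+ sum (λ j → R.- (ε j R.* X (j ᵒ) b) R.* 𝟙 j c)
          ≈⟨ R.+-cong (sum-𝟙ʳ (b ᵒ) (λ j → ε j R.* Y j c)) (sum-𝟙ʳ c (λ j → R.- (ε j R.* X (j ᵒ) b))) ⟩
        ε (b ᵒ) R.* Y (b ᵒ) c R.- ε c R.* X (c ᵒ) b ∎
        where
        term : ∀ j → formTerm R (yCol c) (xCol b) j R.≈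
               (ε j R.* Y j c) R.* 𝟙 j (b ᵒ) R.+ R.- (ε j R.* X (j ᵒ) b) R.* 𝟙 j c
        term j = R.trans
          (R.*-congˡ {x = ε j} (R.+-cong (R.*-cong (re-y c j) (R.trans (im-x b (j ᵒ)) (𝟙-ᵒ j b)))
            (R.-‿cong (R.*-cong (im-y c j) (re-x b (j ᵒ))))))
          (solve 5 (λ e y d d′ x → e :* (y :* d :- d′ :* x) := (e :* y) :* d :+ :- (e :* x) :* d′)
            R.refl (ε j) (Y j c) (𝟙 j (b ᵒ)) (𝟙 j c) (X (j ᵒ) b))

      -- Column `c` of one graph against column `b` of the other: both lower blocks are unit
      -- vectors, so each half of the form leaves a single entry.
      orthogonality : ∀ c b → ε c R.* X (c ᵒ) b R.≈ ε (b ᵒ) R.* Y (b ᵒ) c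
      orthogonality c b = begin
        ε c R.* X (c ᵒ) b   ≈⟨ solve 2 (λ x y → x := y :- (y :- x)) R.refl _ (ε (b ᵒ) R.* Y (b ᵒ) c) ⟩
        ε (b ᵒ) R.* Y (b ᵒ) c R.- (ε (b ᵒ) R.* Y (b ᵒ) c R.- ε c R.* X (c ᵒ) b)
          ≈⟨ R.+-congˡ (R.-‿cong (R.trans (R.sym (form-columns c b)) (Equivalence.to (orthogonal (yCol c)) (yCol∈ c) (xCol b) (xCol∈ b)))) ⟩
        ε (b ᵒ) R.* Y (b ᵒ) c R.- R.0#  ≈⟨ solve 1 (λ y → y :- con (+ 0) := y) R.refl _ ⟩
        ε (b ᵒ) R.* Y (b ᵒ) c ∎

      ε-𝟙 : ∀ i j → ε (i ᵒ) R.* ε (j ᵒ) R.* 𝟙 (j ᵒ) (i ᵒ) R.≈ 𝟙 i j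
      ε-𝟙 i j with i Finₚ.≟ j
      ... | yes ≡.refl = R.trans (R.*-cong (ε² (i ᵒ)) (𝟙-refl (i ᵒ))) (R.*-identityˡ _)
      ... | no  i≢j    = R.trans (R.*-congˡ (R.trans (𝟙-ᵒᵒ j i) (𝟙-≢ (i≢j ∘ ≡.sym)))) (R.zeroʳ _)

    -- By `orthogonality`, `X` is the transpose of `Y` conjugated by the signed reindexing; this
    -- turns v wᵗ into the product of `dual w` and `dual v` and fixes the scalar part.
    X≈ : ∀ i j → X i j R.≈ rankOne (dual w) (dual v) i j
    X≈ i b = begin
      X i b
        ≡⟨ ≡.cong (λ k → X k b) (≡.sym (ᵒ-involutive i)) ⟩
      X ((i ᵒ) ᵒ) b
        ≈⟨ R.sym (R.*-identityˡ _) ⟩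
      R.1# R.* X ((i ᵒ) ᵒ) b
        ≈⟨ R.*-congʳ (R.sym (ε² (i ᵒ))) ⟩
      ε (i ᵒ) R.* ε (i ᵒ) R.* X ((i ᵒ) ᵒ) b
        ≈⟨ R.trans (R.*-assoc _ _ _) (R.*-congˡ (orthogonality (i ᵒ) b)) ⟩
      ε (i ᵒ) R.* (ε (b ᵒ) R.* Y (b ᵒ) (i ᵒ))
        ≈⟨ R.*-congˡ (R.*-congˡ (Y≈ (b ᵒ) (i ᵒ))) ⟩
      ε (i ᵒ) R.* (ε (b ᵒ) R.* (v (b ᵒ) R.* w (i ᵒ) R.- π R.* 𝟙 (b ᵒ) (i ᵒ)))
        ≈⟨ solve 6 (λ e f v w p d → e :* (f :* (v :* w :- p :* d)) := (e :* w) :* (f :* v) :- p :* (e :* f :* d))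
             R.refl (ε (i ᵒ)) (ε (b ᵒ)) (v (b ᵒ)) (w (i ᵒ)) π (𝟙 (b ᵒ) (i ᵒ)) ⟩
      dual w i R.* dual v b R.- π R.* (ε (i ᵒ) R.* ε (b ᵒ) R.* 𝟙 (b ᵒ) (i ᵒ))
        ≈⟨ R.+-congˡ (R.-‿cong (R.*-congˡ (ε-𝟙 i b))) ⟩
      dual w i R.* dual v b R.- π R.* 𝟙 i b ∎

    private
      X′ Y′ : Matrix n n
      X′ = rankOne (dual w) (dual v)
      Y′ = rankOne v w

      *ᵥ-cong₂ : ∀ {A B : Matrix n n} {x y : Fin n → R.Carrier} → (∀ i j → A i j R.≈ B i j) → (∀ j → x j R.≈ y j) →
                 ∀ i → (A *ᵥ x) i R.≈ (B *ᵥ y) i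
      *ᵥ-cong₂ p q i = sum-cong λ j → R.*-cong (p i j) (q j)

      eigenvector : (Y′ *ᵥ v) i₀ R.≈ π R.* v i₀
      eigenvector = R.trans (*ᵥ-cong₂ {Y′} {Y} {v} {v} (λ i j → R.sym (Y≈ i j)) (λ j → R.refl) i₀) (Yv≈πv i₀)

      stable₁ : ∀ b i → sel (λ j → π R.* π R.* 𝟙 j b) (λ j → X′ j b) i R.≈ (Y′ *ᵥ sel (λ j → X′ j b) (λ j → 𝟙 j b)) i
      stable₁ b i = begin
        sel (λ j → π R.* π R.* 𝟙 j b) (λ j → X′ j b) i
          ≈⟨ sel-cong {λ j → π R.* π R.* 𝟙 j b} {λ j → π R.* π R.* ℓᶜ.im (xCol b) j} {λ j → X′ j b} {ℓᶜ.re (xCol b)} i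
               (λ _ → R.*-congˡ (R.sym (im-x b i))) (λ _ → R.sym (re-x′ i)) ⟩
        sel (λ j → π R.* π R.* ℓᶜ.im (xCol b) j) (ℓᶜ.re (xCol b)) i
          ≈⟨ R.sym (re-incl₁ R (xCol b) i) ⟩
        ₙ₋ℓᶜ.re (incl₁ R (xCol b)) i
          ≈⟨ graphₙ₋ℓ (restricts₁ (xCol b) (xCol∈ b)) i ⟩
        (Y *ᵥ ₙ₋ℓᶜ.im (incl₁ R (xCol b))) i
          ≈⟨ *ᵥ-cong₂ {Y} {Y′} {ₙ₋ℓᶜ.im (incl₁ R (xCol b))} {sel (λ j → X′ j b) (λ j → 𝟙 j b)} Y≈ (λ j → R.trans (im-incl₁ R (xCol b) j)
               (sel-cong {ℓᶜ.re (xCol b)} {λ j → X′ j b} {ℓᶜ.im (xCol b)} {λ j → 𝟙 j b} j (λ _ → re-x′ j) (λ _ → im-x b j))) i ⟩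
        (Y′ *ᵥ sel (λ j → X′ j b) (λ j → 𝟙 j b)) i ∎
        where
        re-x′ : ∀ j → ℓᶜ.re (xCol b) j R.≈ X′ j b
        re-x′ j = R.trans (re-x b j) (X≈ j b)

      -- The vector `z` of `ℱℓ` whose scaling is the image of column `b` is not explicit, but
      -- scaling by π⁻¹ preserves coordinates, so both blocks of `z` are known and its graph
      -- equation is the claim.
      stable₂ : ∀ b i → sel (λ j → Y′ j b) (λ j → π R.* π R.* 𝟙 j b) i R.≈ (X′ *ᵥ sel (λ j → 𝟙 j b) (λ j → Y′ j b)) i
      stable₂ b i = begin
        sel (λ j → Y′ j b) (λ j → π R.* π R.* 𝟙 j b) i
          ≈⟨ sel-cong {λ j → Y′ j b} {ₙ₋ℓᶜ.re (yCol b)} {λ j → π R.* π R.* 𝟙 j b} {λ j → π R.* π R.* ₙ₋ℓᶜ.im (yCol b) j} i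
               (λ _ → R.sym (re-y′ i)) (λ _ → R.*-congˡ (R.sym (im-y b i))) ⟩
        sel (ₙ₋ℓᶜ.re (yCol b)) (λ j → π R.* π R.* ₙ₋ℓᶜ.im (yCol b) j) i
          ≈⟨ R.sym (re-incl₂ R (yCol b) i) ⟩
        π⁻¹ᶜ.re (incl₂ R (yCol b)) i   ≈⟨ π⁻¹ᶜ.re-cong incl≋scale i ⟩
        π⁻¹ᶜ.re (scale R z) i          ≈⟨ re-scale R z i ⟩
        ℓᶜ.re z i                      ≈⟨ graphℓ z∈ i ⟩
        (X *ᵥ ℓᶜ.im z) i
          ≈⟨ *ᵥ-cong₂ {X} {X′} {ℓᶜ.im z} {sel (λ j → 𝟙 j b) (λ j → Y′ j b)} X≈ im-z i ⟩
        (X′ *ᵥ sel (λ j → 𝟙 j b) (λ j → Y′ j b)) i ∎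
        where
        module π⁻¹ᶜ = Coordinates (coordinatesπ⁻¹ R)
        preimage : ∃[ y ] ℱℓ y × LeftModule._≈ᴹ_ (Λ⊗-module R π⁻¹gℓ) (incl₂ R (yCol b)) (scale R y)
        preimage = restricts₂ (yCol b) (yCol∈ b)
        z : Λ_⊗ R gℓ
        z = proj₁ preimage
        z∈ : ℱℓ z
        z∈ = proj₁ (proj₂ preimage)
        incl≋scale : LeftModule._≈ᴹ_ (Λ⊗-module R π⁻¹gℓ) (incl₂ R (yCol b)) (scale R z)
        incl≋scale = proj₂ (proj₂ preimage)
        re-y′ : ∀ j → ₙ₋ℓᶜ.re (yCol b) j R.≈ Y′ j b
        re-y′ j = R.trans (re-y b j) (Y≈ j b)
        im-z : ∀ j → ℓᶜ.im z j R.≈ sel (λ j → 𝟙 j b) (λ j → Y′ j b) j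
        im-z j = begin
          ℓᶜ.im z j                       ≈⟨ R.sym (im-scale R z j) ⟩
          π⁻¹ᶜ.im (scale R z) j           ≈⟨ R.sym (π⁻¹ᶜ.im-cong incl≋scale j) ⟩
          π⁻¹ᶜ.im (incl₂ R (yCol b)) j    ≈⟨ im-incl₂ R (yCol b) j ⟩
          sel (ₙ₋ℓᶜ.im (yCol b)) (ₙ₋ℓᶜ.re (yCol b)) j
            ≈⟨ sel-cong {ₙ₋ℓᶜ.im (yCol b)} {λ j → 𝟙 j b} {ₙ₋ℓᶜ.re (yCol b)} {λ j → Y′ j b} j (λ _ → im-y b j) (λ _ → re-y′ j) ⟩
          sel (λ j → 𝟙 j b) (λ j → Y′ j b) j ∎

    open Stable {v} {w} {i₀} v-i₀ eigenvector stable₁ stable₂ public using (core-C; core-¬C; w-C; w-¬C)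

-- Trivial covers and base change of column spans

module _ {a} {K : CommRing a} (R : Algebra K) where
  private module R = Algebra R

  idAlgHom : AlgHom R R
  idAlgHom = record
    { hom = record
      { ⟦_⟧ = λ x → x
      ; isRingHomomorphism = record
        { isSemiringHomomorphism = record
          { isNearSemiringHomomorphism = record
            { +-isMonoidHomomorphism = record
              { isMagmaHomomorphism = record
                { isRelHomomorphism = record { cong = λ p → p }
                ; homo = λ _ _ → R.refl
                }
              ; ε-homo = R.refl
              }
            ; *-homo = λ _ _ → R.refl
            }
          ; 1#-homo = R.refl
          }
        ; -‿homo = λ _ → R.refl
        }
      }
    ; commutes = λ _ → R.refl
    }

  -- The cover by the single principal open set of the element 1. The standard points have global
  -- bases, so this cover verifies all their local conditions.
  zariskiLocally-trivial : ∀ {p} {P : (R′ : Algebra K) → AlgHom R R′ → Set p} → P R idAlgHom → ZariskiLocally R P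
  zariskiLocally-trivial p = 1 , (λ _ → R.1#) , ((λ _ → R.1#) , R.trans (R.+-identityʳ _) (R.*-identityˡ _)) ,
    λ _ → R , idAlgHom , record
      { invertible = R.1# , R.*-identityˡ _
      ; fractions  = λ y → y , 0 , R.*-identityʳ y
      ; kernel     = λ x x≈0 → 0 , R.trans (R.*-identityˡ x) x≈0
      } , p

module _ {a} {R : CommRing a} {M : Mod R} where
  open LeftModule M
  open LinearAlgebra R M

  isDirectSummand-resp : ∀ {N N′ : Pred Carrierᴹ a} → N ≐ N′ → IsDirectSummand N → IsDirectSummand N′
  isDirectSummand-resp (to , from) (D , D-sub , split , disjoint) = D , D-sub ,
    (λ x → let y , z , y∈ , z∈ , eq = split x in y , z , to y∈ , z∈ , eq) ,
    λ x p q → disjoint x (from p) q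

  lincomb∈ : ∀ {N} → IsSubmodule N → ∀ {k} c (x : Fin k → Carrierᴹ) → (∀ i → N (x i)) → N (lincomb c x)
  lincomb∈ isSub {zero}  c x p = IsSubmodule.zero∈ isSub
  lincomb∈ isSub {suc k} c x p = IsSubmodule.+∈ isSub (IsSubmodule.*∈ isSub _ (p Fin.zero))
    (lincomb∈ isSub (c ∘ Fin.suc) (x ∘ Fin.suc) (p ∘ Fin.suc))

module SpanBaseChange {a} {R R′ : CommRing a} {M : Mod R} {M′ : Mod R′} {n}
  (c : Coordinates R M n) (c′ : Coordinates R′ M′ n) (φ : Hom R R′)
  (image : LeftModule.Carrierᴹ M → LeftModule.Carrierᴹ M′)
  (re-image : ∀ x j → CommutativeRing._≈_ R′ (Coordinates.re c′ (image x) j) (Hom.⟦_⟧ φ (Coordinates.re c x j)))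
  (im-image : ∀ x j → CommutativeRing._≈_ R′ (Coordinates.im c′ (image x) j) (Hom.⟦_⟧ φ (Coordinates.im c x j))) where
  private
    module M = LeftModule M
    module M′ = LeftModule M′
    module R = CommutativeRing R
    module R′ = CommutativeRing R′
    module c = Coordinates c
    module c′ = Coordinates c′
    module φ = Hom φ
    module L = LinearAlgebra R M
    module L′ = LinearAlgebra R′ M′
    module S = Subspaces c
    module S′ = Subspaces c′
    module 𝓜 = Matrices R
    module 𝓜′ = Matrices R′
    module ∑′ = Sums R′

    φ-sum : ∀ {k} (f : Fin k → R.Carrier) → φ.⟦ 𝓜.sum f ⟧ R′.≈ 𝓜′.sum (φ.⟦_⟧ ∘ f)
    φ-sum {zero}  f = φ.0#-homo
    φ-sum {suc k} f = R′.trans (φ.+-homo _ _) (R′.+-congˡ (φ-sum (f ∘ Fin.suc)))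

    φ-*ᵥ : ∀ {k m} (A : 𝓜.Matrix k m) d i →
           φ.⟦ 𝓜._*ᵥ_ A d i ⟧ R′.≈ 𝓜′._*ᵥ_ (λ i j → φ.⟦ A i j ⟧) (φ.⟦_⟧ ∘ d) i
    φ-*ᵥ A d i = R′.trans (φ-sum (λ j → A i j R.* d j)) (∑′.sum-cong λ j → φ.*-homo (A i j) (d j))

  image-span : ∀ {k} (A B : 𝓜.Matrix n k) {x} → L.Span (S.columns A B) x →
               L′.Span (S′.columns (λ i j → φ.⟦ A i j ⟧) (λ i j → φ.⟦ B i j ⟧)) (image x)
  image-span A B {x} (d , p) = φ.⟦_⟧ ∘ d , c′.injective
    (λ i → R′.trans (re-image x i) (R′.trans (φ.⟦⟧-cong (R.trans (c.re-cong p i) (S.re-columns A B d i)))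
      (R′.trans (φ-*ᵥ A d i) (R′.sym (S′.re-columns _ _ (φ.⟦_⟧ ∘ d) i)))))
    (λ i → R′.trans (im-image x i) (R′.trans (φ.⟦⟧-cong (R.trans (c.im-cong p i) (S.im-columns A B d i)))
      (R′.trans (φ-*ᵥ B d i) (R′.sym (S′.im-columns _ _ (φ.⟦_⟧ ∘ d) i)))))

  BaseChange : Pred M.Carrierᴹ a → Pred M′.Carrierᴹ a
  BaseChange N y = ∃[ k ] Σ (Fin k → M.Carrierᴹ) λ x → (∀ i → N (x i)) × L′.Span (image ∘ x) y

  -- Base change is defined through arbitrary finite families in `N`; conversely, the family of
  -- columns itself already generates it.
  baseChange-span : ∀ {k} (A B : 𝓜.Matrix n k) {N} → N ≐ L.Span (S.columns A B) →
    BaseChange N ≐ L′.Span (S′.columns (λ i j → φ.⟦ A i j ⟧) (λ i j → φ.⟦ B i j ⟧))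
  baseChange-span {k} A B (N⊆ , ⊆N) =
    (λ (m , x , x∈ , d , p) → IsSubmodule.resp (L′.Span-isSubmodule _) (M′.≈ᴹ-sym p)
      (lincomb∈ {R = R′} {M = M′} (L′.Span-isSubmodule _) d (image ∘ x) λ i → image-span A B (N⊆ (x∈ i)))) ,
    (λ p → k , S.columns A B , (λ i → ⊆N (L.generator∈Span (S.columns A B) i)) ,
      proj₁ (span-cong {R = R′} {M = M′} λ j → c′.injective
        (λ i → R′.trans (c′.re-col _ _ i) (R′.sym (R′.trans (re-image _ i) (φ.⟦⟧-cong (c.re-col _ _ i)))))
        (λ i → R′.trans (c′.im-col _ _ i) (R′.sym (R′.trans (im-image _ i) (φ.⟦⟧-cong (c.im-col _ _ i)))))) p)
    where open L′ using (module IsSubmodule)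

-- Exterior powers and characteristic polynomials of rank-one perturbations

module RankOne {a} (R : CommRing a) where
  open CommutativeRing R
  open Matrices R
  private
    open Sums R
    open IntegerSolver R
    module Det = Determinant R

  -- The rank-one formula at `-s` gives (-s)ⁿ + (-s)ⁿ⁻¹s = 0. The argument in `Fin n` excludes size
  -- zero, where the determinant is 1.
  det-rankOne-vanishes : ∀ {n} → Fin n → ∀ (x y : Fin n → Carrier) s → x ∙ᵥ y ≈ s →
                         det (λ i j → x i * y j - s * 𝟙 i j) ≈ 0#
  det-rankOne-vanishes {suc m} _ x y s p =
    trans (Det.det-cong λ i j → solve 4 (λ x y s d → x :* y :- s :* d := :- s :* d :+ x :* y) refl (x i) (y j) s (𝟙 i j))
      (trans (Det.det-rankOne (- s) x y) (trans (+-congˡ (*-congˡ p))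
        (solve 2 (λ s q → :- s :* q :+ q :* s := con (+ 0)) refl s _)))

  ⋀²-rankOne-vanishes : ∀ {n} (x y : Fin n → Carrier) → ⋀ 2 VanishesOn (λ i j → x i * y j)
  ⋀²-rankOne-vanishes x y r c _ _ = solve 4 (λ x y z w →
      con (+ 1) :* ((x :* z) :* (con (+ 1) :* ((y :* w) :* con (+ 1)) :+ con (+ 0))) :+
      (:- con (+ 1) :* ((x :* w) :* (con (+ 1) :* ((y :* z) :* con (+ 1)) :+ con (+ 0))) :+ con (+ 0)) := con (+ 0))
    refl (x (r Fin.zero)) (x (r (Fin.suc Fin.zero))) (y (c Fin.zero)) (y (c (Fin.suc Fin.zero)))

  private
    inflationary : ∀ {n} (r : Fin n → Fin n) → StrictlyIncreasing r → ∀ m i → toℕ i ≡ m → m ℕ.≤ toℕ (r i)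
    inflationary r inc zero    i p = ℕ.z≤n
    inflationary r inc (suc m) (Fin.suc i) p = ℕₚ.≤-<-trans
      (inflationary r inc m (Fin.inject₁ i) (≡.trans (Finₚ.toℕ-inject₁ i) (ℕₚ.suc-injective p)))
      (inc (ℕ.s≤s (ℕₚ.≤-reflexive (Finₚ.toℕ-inject₁ i))))

    opposite-< : ∀ {n} {i j : Fin n} → i Fin.< j → opposite j Fin.< opposite i
    opposite-< {n} {i} {j} p = ≡.subst₂ ℕ._<_ (≡.sym (Finₚ.opposite-prop j)) (≡.sym (Finₚ.opposite-prop i))
      (ℕₚ.∸-monoʳ-< (ℕ.s≤s p) (Finₚ.toℕ<n j))

  -- Such a map never decreases an index; applied to its conjugate by `opposite`, the same bound
  -- says that it never increases one. So the only minor of full size is the determinant.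
  strictlyIncreasing⇒id : ∀ {n} (r : Fin n → Fin n) → StrictlyIncreasing r → ∀ i → r i ≡ i
  strictlyIncreasing⇒id r inc i = toℕ-injective (ℕₚ.≤-antisym upper (inflationary r inc _ i ≡.refl))
    where
    r′ : Fin _ → Fin _
    r′ = opposite ∘ r ∘ opposite
    upper : toℕ (r i) ℕ.≤ toℕ i
    upper = ℕₚ.≮⇒≥ λ i<ri → ℕₚ.<⇒≱ (opposite-< i<ri)
      (≡.subst (λ k → toℕ (opposite i) ℕ.≤ toℕ (opposite (r k))) (Finₚ.opposite-involutive i)
        (inflationary r′ (opposite-< ∘ inc ∘ opposite-<) _ (opposite i) ≡.refl))

  ⋀ⁿ-vanishes : ∀ {n} (A : Matrix n n) → det A ≈ 0# → ⋀ n VanishesOn A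
  ⋀ⁿ-vanishes A p r c r-inc c-inc = trans (Det.det-cong λ i j →
    reflexive (≡.cong₂ A (strictlyIncreasing⇒id r r-inc i) (strictlyIncreasing⇒id c c-inc j))) p

module _ {a} (R : CommRing a) where
  private
    module R = CommutativeRing R
    P = PolynomialRing R 𝕋
    module P = CommutativeRing P
    open Matrices R using (Matrix; _∙ᵥ_; sum; 𝟙)
    module MP = Matrices P
    open Power P using (_^_)
    open Sums P
    open IntegerSolver P using (solve; _:=_; _:+_; _:*_; _:-_; :-_)
    module Det = Determinant P
    open CharacteristicPolynomial R

    con-𝟙 : ∀ {n} (i j : Fin n) → con (𝟙 i j) P.≈ MP.𝟙 i j
    con-𝟙 i j with i Finₚ.≟ j
    ... | yes _ = P.refl
    ... | no  _ = P.refl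

    con-sum : ∀ {n} (f : Fin n → R.Carrier) → con (sum f) P.≈ MP.sum (con ∘ f)
    con-sum {zero}  f = P.refl
    con-sum {suc n} f = P.trans (con-+ _ _) (P.+-congˡ (con-sum (f ∘ Fin.suc)))

  -- T - (xyᵗ - s) is the scalar σ = T + s plus the rank-one matrix (-x)yᵗ, with determinant σⁿ -
  -- 2sσⁿ⁻¹ = σⁿ⁻¹(T - s).
  charpoly-rankOne : ∀ {n} → Fin n → ∀ (x y : Fin n → R.Carrier) s → x ∙ᵥ y R.≈ s R.+ s →
    charpoly (λ i j → x i R.* y j R.- s R.* 𝟙 i j) ≈ᵀ
      ((var T P.+ con s) ^ (n ∸ 1)) P.* (var T P.- con s)
  charpoly-rankOne {suc m} _ x y s p = P.trans (Det.det-cong entry)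
    (P.trans (Det.det-rankOne σ (λ i → P.- con (x i)) (con ∘ y))
      (P.trans (P.+-congˡ (P.*-congˡ (P.trans (P.trans (sum-cong λ i → P.trans
          (solve 2 (λ x y → :- x :* y := :- (x :* y)) P.refl (con (x i)) (con (y i))) (P.-‿cong (P.sym (con-* (x i) (y i)))))
          (sum-neg (λ i → con (x i R.* y i))))
        (P.-‿cong (P.trans (P.sym (con-sum (λ i → x i R.* y i))) (P.trans (con-cong p) (con-+ s s)))))))
        (solve 3 (λ t s q → (t :+ s) :* q :+ q :* :- (s :+ s) := q :* (t :- s)) P.refl (var T) (con s) (σ ^ m))))
    where
    σ = var T P.+ con s
    entry : ∀ i j → MP.𝟙 i j P.* var T P.- con (x i R.* y j R.- s R.* 𝟙 i j) P.≈
                    σ P.* MP.𝟙 i j P.+ (P.- con (x i)) P.* con (y j)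
    entry i j = P.trans (P.+-congˡ (P.-‿cong (P.trans (con-+ _ _) (P.+-cong (con-* _ _)
        (P.trans (con-neg _) (P.-‿cong (P.trans (con-* _ _) (P.*-congˡ (con-𝟙 i j)))))))))
      (solve 5 (λ d t x y s → d :* t :- (x :* y :- s :* d) := (t :+ s) :* d :+ :- x :* y) P.refl
        (MP.𝟙 i j) (var T) (con (x i)) (con (y j)) (con s))

module _ {a} {𝔽 : CompleteDiscretelyValuedField a} {n ℓ : ℕ}
         (H : SplitHermitianSpace 𝔽 n) (ℓ-sns : StronglyNonSpecial n ℓ)
         {R R′ : Algebra (Integers.O 𝔽)} (φ : AlgHom R R′) where
  open SplittingModel H ℓ-sns
  open Charts H ℓ-sns
  private
    module φ = AlgHom φ
    module PR = Points H ℓ-sns R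
    module PR′ = Points H ℓ-sns R′
    module SBℓ = SpanBaseChange (coordinatesℓ R) (coordinatesℓ R′) φ.hom (image φ gℓ) (re-imageℓ φ) (im-imageℓ φ)
    module SBₙ₋ℓ = SpanBaseChange (coordinatesₙ₋ℓ R) (coordinatesₙ₋ℓ R′) φ.hom (image φ gₙ₋ℓ) (re-imageₙ₋ℓ φ) (im-imageₙ₋ℓ φ)

  baseChange-columnSpanℓ : ∀ {k} (A B : PR.Matrix n k) → baseChange φ gℓ (columnSpan R gℓ A B) ≐
    PR′.LAℓ.Span (PR′.Sℓ.columns (λ i j → φ.⟦ A i j ⟧) (λ i j → φ.⟦ B i j ⟧))
  baseChange-columnSpanℓ A B = SBℓ.baseChange-span A B (PR.columnSpanℓ A B)

  baseChange-columnSpanₙ₋ℓ : ∀ {k} (A B : PR.Matrix n k) → baseChange φ gₙ₋ℓ (columnSpan R gₙ₋ℓ A B) ≐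
    PR′.LAₙ₋ℓ.Span (PR′.Sₙ₋ℓ.columns (λ i j → φ.⟦ A i j ⟧) (λ i j → φ.⟦ B i j ⟧))
  baseChange-columnSpanₙ₋ℓ A B = SBₙ₋ℓ.baseChange-span A B (PR.columnSpanₙ₋ℓ A B)

-- The chart point of a pair of vectors

module ToPoint {a} {𝔽 : CompleteDiscretelyValuedField a} {n ℓ : ℕ}
               (H : SplitHermitianSpace 𝔽 n) (ℓ-sns : StronglyNonSpecial n ℓ)
               (R : Algebra (Integers.O 𝔽)) (v w : Fin n → Algebra.Carrier R) {μ : Algebra.Carrier R}
               (isCore : Points.IsCore H ℓ-sns R v w μ) (i₀ : Fin n)
               (v-i₀ : Algebra._≈_ R (v i₀) (Algebra.1# R)) where
  open Points H ℓ-sns R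
  open SplittingModel H ℓ-sns
  open Charts H ℓ-sns hiding (module ℓᶜ; module ₙ₋ℓᶜ; module π⁻¹ᶜ)
  private module R = Algebra R
  open IsCore isCore
  open Sums R.commutativeRing
  open IntegerSolver R.commutativeRing
  open SetoidReasoning R.setoid
  private
    module Tℓ = IsStandard (standardℓ R)
    module Tₙ₋ℓ = IsStandard (standardₙ₋ℓ R)

  G₁ G₂ : Matrix n 1
  G₁ i _ = π R.* v i
  G₂ i _ = v i

  point : Triple R
  point = record
    { ℱℓ   = columnSpan R gℓ X 𝟙
    ; ℱₙ₋ℓ = columnSpan R gₙ₋ℓ Y 𝟙
    ; 𝒢ₙ₋ℓ = columnSpan R gₙ₋ℓ G₁ G₂
    }

  private
    open Triple point

    graphℓ : ∀ {x} → ℱℓ x → Sℓ.Graph X x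
    graphℓ p = Sℓ.span⇒graph X (proj₁ (columnSpanℓ X 𝟙) p)

    ∈ℱℓ : ∀ {x} → Sℓ.Graph X x → ℱℓ x
    ∈ℱℓ p = proj₂ (columnSpanℓ X 𝟙) (Sℓ.graph⇒span X p)

    graphₙ₋ℓ : ∀ {x} → ℱₙ₋ℓ x → Sₙ₋ℓ.Graph Y x
    graphₙ₋ℓ p = Sₙ₋ℓ.span⇒graph Y (proj₁ (columnSpanₙ₋ℓ Y 𝟙) p)

    ∈ℱₙ₋ℓ : ∀ {x} → Sₙ₋ℓ.Graph Y x → ℱₙ₋ℓ x
    ∈ℱₙ₋ℓ p = proj₂ (columnSpanₙ₋ℓ Y 𝟙) (Sₙ₋ℓ.graph⇒span Y p)

    *ᵥ-cong : ∀ (A : Matrix n n) {x y : Fin n → R.Carrier} → (∀ j → x j R.≈ y j) → ∀ i → (A *ᵥ x) i R.≈ (A *ᵥ y) i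
    *ᵥ-cong = Sℓ.*ᵥ-cong

    -- The upper block of the image is `π²·im x` and its lower block is `X·im x`, so the claim is
    -- that `X` squares to π².
    t-graphℓ : ∀ {x} → Sℓ.Graph X x → Sℓ.Graph X (t R gℓ x)
    t-graphℓ {x} p i = begin
      ℓᶜ.re (t R gℓ x) i            ≈⟨ Tℓ.re-t x i ⟩
      π R.* π R.* ℓᶜ.im x i         ≈⟨ R.sym (rankOne-square (dual w) (dual v) (R.trans (∙-comm (dual v) (dual w)) dual∙dual) (ℓᶜ.im x) i) ⟩
      (X *ᵥ (X *ᵥ ℓᶜ.im x)) i       ≈⟨ *ᵥ-cong X (λ j → R.sym (R.trans (Tℓ.im-t x j) (p j))) i ⟩
      (X *ᵥ ℓᶜ.im (t R gℓ x)) i     ∎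

    t-graphₙ₋ℓ : ∀ {x} → Sₙ₋ℓ.Graph Y x → Sₙ₋ℓ.Graph Y (t R gₙ₋ℓ x)
    t-graphₙ₋ℓ {x} p i = begin
      ₙ₋ℓᶜ.re (t R gₙ₋ℓ x) i          ≈⟨ Tₙ₋ℓ.re-t x i ⟩
      π R.* π R.* ₙ₋ℓᶜ.im x i         ≈⟨ R.sym (rankOne-square v w w∙v (ₙ₋ℓᶜ.im x) i) ⟩
      (Y *ᵥ (Y *ᵥ ₙ₋ℓᶜ.im x)) i       ≈⟨ *ᵥ-cong Y (λ j → R.sym (R.trans (Tₙ₋ℓ.im-t x j) (p j))) i ⟩
      (Y *ᵥ ₙ₋ℓᶜ.im (t R gₙ₋ℓ x)) i   ∎

    isSubmoduleℓ : LAℓ.IsSubmodule ℱℓ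
    isSubmoduleℓ = LAℓ.Span-isSubmodule _

    isSubmoduleₙ₋ℓ : LAₙ₋ℓ.IsSubmodule ℱₙ₋ℓ
    isSubmoduleₙ₋ℓ = LAₙ₋ℓ.Span-isSubmodule _

    submoduleℓ : IsO⊗RSubmodule R gℓ ℱℓ
    submoduleℓ = record { isSubmodule = isSubmoduleℓ ; t∈ = λ p → ∈ℱℓ (t-graphℓ (graphℓ p)) }

    submoduleₙ₋ℓ : IsO⊗RSubmodule R gₙ₋ℓ ℱₙ₋ℓ
    submoduleₙ₋ℓ = record { isSubmodule = isSubmoduleₙ₋ℓ ; t∈ = λ p → ∈ℱₙ₋ℓ (t-graphₙ₋ℓ (graphₙ₋ℓ p)) }

    baseChange-ℱℓ : baseChange (idAlgHom R) gℓ ℱℓ ≐ LAℓ.Span (Sℓ.columns X 𝟙)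
    baseChange-ℱℓ = baseChange-columnSpanℓ H ℓ-sns (idAlgHom R) X 𝟙

    baseChange-ℱₙ₋ℓ : baseChange (idAlgHom R) gₙ₋ℓ ℱₙ₋ℓ ≐ LAₙ₋ℓ.Span (Sₙ₋ℓ.columns Y 𝟙)
    baseChange-ℱₙ₋ℓ = baseChange-columnSpanₙ₋ℓ H ℓ-sns (idAlgHom R) Y 𝟙

    baseChange-𝒢ₙ₋ℓ : baseChange (idAlgHom R) gₙ₋ℓ 𝒢ₙ₋ℓ ≐ LAₙ₋ℓ.Span (Sₙ₋ℓ.columns G₁ G₂)
    baseChange-𝒢ₙ₋ℓ = baseChange-columnSpanₙ₋ℓ H ℓ-sns (idAlgHom R) G₁ G₂

    summandℓ : IsLocalSummandOfRank R gℓ n ℱℓ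
    summandℓ = zariskiLocally-trivial R
      ( (Sℓ.columns X 𝟙 , Sℓ.graph-independent X , baseChange-ℱℓ)
      , isDirectSummand-resp {R = R.commutativeRing} {M = Λ⊗-module R gℓ} (≐-sym baseChange-ℱℓ) (Sℓ.graph-summand X))

    summandₙ₋ℓ : IsLocalSummandOfRank R gₙ₋ℓ n ℱₙ₋ℓ
    summandₙ₋ℓ = zariskiLocally-trivial R
      ( (Sₙ₋ℓ.columns Y 𝟙 , Sₙ₋ℓ.graph-independent Y , baseChange-ℱₙ₋ℓ)
      , isDirectSummand-resp {R = R.commutativeRing} {M = Λ⊗-module R gₙ₋ℓ} (≐-sym baseChange-ℱₙ₋ℓ) (Sₙ₋ℓ.graph-summand Y))

    module L = Sₙ₋ℓ.Line G₁ G₂ i₀ v-i₀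

    summand : IsLocalSummandOfRank R gₙ₋ℓ 1 𝒢ₙ₋ℓ
    summand = zariskiLocally-trivial R
      ( (Sₙ₋ℓ.columns G₁ G₂ , L.line-independent , baseChange-𝒢ₙ₋ℓ)
      , isDirectSummand-resp {R = R.commutativeRing} {M = Λ⊗-module R gₙ₋ℓ} (≐-sym baseChange-𝒢ₙ₋ℓ) L.line-summand)

    restricts₁ : ∀ x → ℱℓ x → ℱₙ₋ℓ (incl₁ R x)
    restricts₁ x x∈ = ∈ℱₙ₋ℓ λ i → begin
      ₙ₋ℓᶜ.re (incl₁ R x) i                                ≈⟨ re-incl₁ R x i ⟩
      sel (λ j → π R.* π R.* ℓᶜ.im x j) (ℓᶜ.re x) i
        ≈⟨ sel-cong {λ j → π R.* π R.* ℓᶜ.im x j} {λ j → π R.* π R.* ℓᶜ.im x j} {ℓᶜ.re x} {X *ᵥ ℓᶜ.im x} i (λ _ → R.refl) (λ _ → graphℓ x∈ i) ⟩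
      sel (λ j → π R.* π R.* ℓᶜ.im x j) (X *ᵥ ℓᶜ.im x) i    ≈⟨ incl₁-stable (ℓᶜ.im x) i ⟩
      (Y *ᵥ sel (X *ᵥ ℓᶜ.im x) (ℓᶜ.im x)) i
        ≈⟨ *ᵥ-cong Y {sel (X *ᵥ ℓᶜ.im x) (ℓᶜ.im x)} {ₙ₋ℓᶜ.im (incl₁ R x)} (λ j → R.sym (R.trans (im-incl₁ R x j)
             (sel-cong {ℓᶜ.re x} {X *ᵥ ℓᶜ.im x} {ℓᶜ.im x} {ℓᶜ.im x} j (λ _ → graphℓ x∈ j) (λ _ → R.refl)))) i ⟩
      (Y *ᵥ ₙ₋ℓᶜ.im (incl₁ R x)) i ∎

    module π⁻¹ᶜ = Coordinates (coordinatesπ⁻¹ R)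

    -- As scaling preserves coordinates, the lower block `q` of the witness is forced to be that of
    -- the image of `x`; lying on the graph of `X` forces the upper block. The upper blocks agree by
    -- `incl₂-stable`.
    restricts₂ : ∀ x → ℱₙ₋ℓ x → ∃[ y ] ℱℓ y × LeftModule._≈ᴹ_ (Λ⊗-module R π⁻¹gℓ) (incl₂ R x) (scale R y)
    restricts₂ x x∈ = y , ∈ℱℓ (λ i → R.trans (re-y i) (*ᵥ-cong X {q} {ℓᶜ.im y} (λ j → R.sym (im-y j)) i)) , π⁻¹ᶜ.injective
      (λ i → begin
        π⁻¹ᶜ.re (incl₂ R x) i                                    ≈⟨ re-incl₂ R x i ⟩
        sel (ₙ₋ℓᶜ.re x) (λ j → π R.* π R.* c j) i
          ≈⟨ sel-cong {ₙ₋ℓᶜ.re x} {Y *ᵥ c} {λ j → π R.* π R.* c j} {λ j → π R.* π R.* c j} i (λ _ → graphₙ₋ℓ x∈ i) (λ _ → R.refl) ⟩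
        sel (Y *ᵥ c) (λ j → π R.* π R.* c j) i                   ≈⟨ incl₂-stable c i ⟩
        (X *ᵥ q) i                                               ≈⟨ R.sym (re-y i) ⟩
        ℓᶜ.re y i                                                ≈⟨ R.sym (re-scale R y i) ⟩
        π⁻¹ᶜ.re (scale R y) i ∎)
      (λ i → begin
        π⁻¹ᶜ.im (incl₂ R x) i   ≈⟨ im-incl₂ R x i ⟩
        sel c (ₙ₋ℓᶜ.re x) i      ≈⟨ sel-cong {c} {c} {ₙ₋ℓᶜ.re x} {Y *ᵥ c} i (λ _ → R.refl) (λ _ → graphₙ₋ℓ x∈ i) ⟩
        q i                     ≈⟨ R.sym (im-y i) ⟩
        ℓᶜ.im y i               ≈⟨ R.sym (im-scale R y i) ⟩
        π⁻¹ᶜ.im (scale R y) i ∎)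
      where
      c q : Fin n → R.Carrier
      c = ₙ₋ℓᶜ.im x
      q = sel c (Y *ᵥ c)
      y : Λ_⊗ R gℓ
      y = ℓᶜ.col (X *ᵥ q) q
      re-y : ∀ i → ℓᶜ.re y i R.≈ (X *ᵥ q) i
      re-y = ℓᶜ.re-col (X *ᵥ q) q
      im-y : ∀ i → ℓᶜ.im y i R.≈ q i
      im-y = ℓᶜ.im-col (X *ᵥ q) q

    defect : Λ_⊗ R gₙ₋ℓ → Fin n → R.Carrier
    defect x j = ₙ₋ℓᶜ.re x j R.- (v j R.* (w ∙ᵥ ₙ₋ℓᶜ.im x) R.- π R.* ₙ₋ℓᶜ.im x j)

    -- Against the graph of X, the form only sees how far x is from the graph of Y.
    form-defect : ∀ x {y} → Sℓ.Graph X y → form R x y R.≈ sum λ j → ε j R.* defect x j R.* ℓᶜ.im y (j ᵒ)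
    form-defect x {y} y∈ = begin
      form R x y
        ≈⟨ form-≈ R x y ⟩
      sum (formTerm R x y)
        ≈⟨ sum-cong {f = formTerm R x y} {g = λ j → f j R.+ (v′ j R.* s R.- w j R.* q j R.* s′)} term ⟩
      sum (λ j → f j R.+ (v′ j R.* s R.- w j R.* q j R.* s′))
        ≈⟨ sum-+ f (λ j → v′ j R.* s R.- w j R.* q j R.* s′) ⟩
      sum f R.+ sum (λ j → v′ j R.* s R.- w j R.* q j R.* s′)
        ≈⟨ R.+-congˡ (R.trans (sum-+ (λ j → v′ j R.* s) (λ j → R.- (w j R.* q j R.* s′)))
             (R.+-cong (sum-* v′ s) (R.trans (sum-neg (λ j → w j R.* q j R.* s′)) (R.-‿cong (sum-* (λ j → w j R.* q j) s′))))) ⟩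
      sum f R.+ (sum v′ R.* s R.- s R.* s′)
        ≈⟨ R.+-congˡ (R.+-congʳ (R.*-congʳ (R.sym (R.trans (sum-involution _ᵒ ᵒ-involutive (λ j → dual v j R.* d j)) (sum-cong dual-ᵒ))))) ⟩
      sum f R.+ (s′ R.* s R.- s R.* s′)
        ≈⟨ solve 3 (λ f s s′ → f :+ (s′ :* s :- s :* s′) := f) R.refl (sum f) s s′ ⟩
      sum f ∎
      where
      d q f v′ : Fin n → R.Carrier
      d = ℓᶜ.im y
      q = ₙ₋ℓᶜ.im x
      s s′ : R.Carrier
      s  = w ∙ᵥ q
      s′ = dual v ∙ᵥ d
      f j  = ε j R.* defect x j R.* d (j ᵒ)
      v′ j = ε j R.* v j R.* d (j ᵒ)
      dual-ᵒ : ∀ j → dual v (j ᵒ) R.* d (j ᵒ) R.≈ v′ j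
      dual-ᵒ j = R.reflexive (≡.cong (λ k → ε k R.* v k R.* d (j ᵒ)) (ᵒ-involutive j))
      re-y : ∀ j → ℓᶜ.re y (j ᵒ) R.≈ ε j R.* w j R.* s′ R.- π R.* d (j ᵒ)
      re-y j = R.trans (y∈ (j ᵒ)) (R.trans (rankOne-*ᵥ (dual w) (dual v) d (j ᵒ))
        (R.+-congʳ (R.*-congʳ (R.reflexive (≡.cong (λ k → ε k R.* w k) (ᵒ-involutive j))))))
      term : ∀ j → formTerm R x y j R.≈ f j R.+ (v′ j R.* s R.- w j R.* q j R.* s′)
      term j = R.trans (R.*-congˡ {x = ε j} (R.+-congˡ (R.-‿cong (R.*-congˡ (re-y j)))))
        (R.trans (solve 9 (λ e x d q w s′ p v s →
            e :* (x :* d :- q :* (e :* w :* s′ :- p :* d))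
              := e :* (x :- (v :* s :- p :* q)) :* d :+ (e :* v :* d :* s :- e :* e :* (w :* q :* s′))) R.refl
            (ε j) (ₙ₋ℓᶜ.re x j) (d (j ᵒ)) (q j) (w j) s′ π (v j) s)
          (R.+-congˡ (R.+-congˡ (R.-‿cong (R.trans (R.*-congʳ (ε² j)) (R.*-identityˡ _))))))

    orthogonal-to : ∀ {x} → ℱₙ₋ℓ x → ∀ y → ℱℓ y → form R x y R.≈ R.0#
    orthogonal-to {x} x∈ y y∈ = R.trans (form-defect x (graphℓ y∈)) (sum-zero λ j → begin
      ε j R.* defect x j R.* ℓᶜ.im y (j ᵒ)  ≈⟨ R.*-congʳ (R.*-congˡ (R.trans (R.+-congʳ (R.trans (graphₙ₋ℓ x∈ j) (rankOne-*ᵥ v w (ₙ₋ℓᶜ.im x) j))) (R.-‿inverseʳ _))) ⟩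
      ε j R.* R.0# R.* ℓᶜ.im y (j ᵒ)        ≈⟨ solve 2 (λ e d → e :* con (+ 0) :* d := con (+ 0)) R.refl (ε j) _ ⟩
      R.0# ∎)

    -- Pairing with column `i ᵒ` of the graph of `X`, whose lower block is a unit vector, isolates
    -- the `i`-th defect up to the sign `ε i`, which squares to 1.
    orthogonal-from : ∀ {x} → (∀ y → ℱℓ y → form R x y R.≈ R.0#) → ℱₙ₋ℓ x
    orthogonal-from {x} x⊥ = ∈ℱₙ₋ℓ λ i → begin
      ₙ₋ℓᶜ.re x i
        ≈⟨ solve 2 (λ x y → x := con (+ 1) :* (x :- y) :+ y) R.refl _ _ ⟩
      R.1# R.* defect x i R.+ (v i R.* (w ∙ᵥ ₙ₋ℓᶜ.im x) R.- π R.* ₙ₋ℓᶜ.im x i)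
        ≈⟨ R.+-congʳ (R.*-congʳ (R.sym (ε² i))) ⟩
      ε i R.* ε i R.* defect x i R.+ (v i R.* (w ∙ᵥ ₙ₋ℓᶜ.im x) R.- π R.* ₙ₋ℓᶜ.im x i)
        ≈⟨ R.+-congʳ (R.trans (R.*-assoc _ _ _) (R.trans (R.*-congˡ (εdefect≈0 i)) (R.zeroʳ _))) ⟩
      R.0# R.+ (v i R.* (w ∙ᵥ ₙ₋ℓᶜ.im x) R.- π R.* ₙ₋ℓᶜ.im x i)
        ≈⟨ R.trans (R.+-identityˡ _) (R.sym (rankOne-*ᵥ v w (ₙ₋ℓᶜ.im x) i)) ⟩
      (Y *ᵥ ₙ₋ℓᶜ.im x) i ∎
      where
      εdefect≈0 : ∀ i → ε i R.* defect x i R.≈ R.0#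
      εdefect≈0 i = begin
        ε i R.* defect x i
          ≈⟨ R.sym (sum-𝟙ʳ i (λ j → ε j R.* defect x j)) ⟩
        sum (λ j → ε j R.* defect x j R.* 𝟙 j i)
          ≈⟨ sum-cong {f = λ j → ε j R.* defect x j R.* 𝟙 j i} {g = λ j → ε j R.* defect x j R.* ℓᶜ.im (Sℓ.columns X 𝟙 (i ᵒ)) (j ᵒ)}
               (λ j → R.*-congˡ (R.sym (R.trans (ℓᶜ.im-col (λ k → X k (i ᵒ)) (λ k → 𝟙 k (i ᵒ)) (j ᵒ)) (𝟙-ᵒᵒ j i)))) ⟩
        sum (λ j → ε j R.* defect x j R.* ℓᶜ.im (Sℓ.columns X 𝟙 (i ᵒ)) (j ᵒ))
          ≈⟨ R.sym (form-defect x (Sℓ.column-graph X (i ᵒ))) ⟩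
        form R x (Sℓ.columns X 𝟙 (i ᵒ))
          ≈⟨ x⊥ _ (∈ℱℓ (Sℓ.column-graph X (i ᵒ))) ⟩
        R.0# ∎

    -- Every local condition on a matrix is checked in one global basis, the columns of the graph.
    matrixℓ : ∀ (f : ∀ R′ → Λ_⊗ R′ gℓ → Λ_⊗ R′ gℓ) (Q : ∀ R′ → Matrices.Matrix (Algebra.commutativeRing R′) n n → Set a) A →
      (∀ {x} → Sℓ.Graph X x → Sℓ.Graph X (f R x)) → (∀ i j → ℓᶜ.im (f R (Sℓ.columns X 𝟙 j)) i R.≈ A i j) → Q R A →
      LocalMatrix R gℓ n ℱℓ f Q
    matrixℓ f Q A stable entry q = zariskiLocally-trivial R
      (Sℓ.columns X 𝟙 , (Sℓ.graph-independent X , baseChange-ℱℓ) , A ,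
        Sℓ.graph-matrix X (f R) A (λ j → stable (Sℓ.column-graph X j)) entry , q)

    matrixₙ₋ℓ : ∀ (f : ∀ R′ → Λ_⊗ R′ gₙ₋ℓ → Λ_⊗ R′ gₙ₋ℓ) (Q : ∀ R′ → Matrices.Matrix (Algebra.commutativeRing R′) n n → Set a) A →
      (∀ {x} → Sₙ₋ℓ.Graph Y x → Sₙ₋ℓ.Graph Y (f R x)) → (∀ i j → ₙ₋ℓᶜ.im (f R (Sₙ₋ℓ.columns Y 𝟙 j)) i R.≈ A i j) → Q R A →
      LocalMatrix R gₙ₋ℓ n ℱₙ₋ℓ f Q
    matrixₙ₋ℓ f Q A stable entry q = zariskiLocally-trivial R
      (Sₙ₋ℓ.columns Y 𝟙 , (Sₙ₋ℓ.graph-independent Y , baseChange-ℱₙ₋ℓ) , A ,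
        Sₙ₋ℓ.graph-matrix Y (f R) A (λ j → stable (Sₙ₋ℓ.column-graph Y j)) entry , q)

    minus : ∀ x y → x R.+ R.- R.1# R.* y R.≈ x R.- y
    minus x y = solve 2 (λ x y → x :+ :- con (+ 1) :* y := x :- y) R.refl x y

    im-t+πℓ : ∀ x i → ℓᶜ.im (t+π R gℓ x) i R.≈ ℓᶜ.re x i R.+ π R.* ℓᶜ.im x i
    im-t+πℓ x i = R.trans (ℓᶜ.im-+ _ _ i) (R.+-cong (Tℓ.im-t x i) (ℓᶜ.im-* π x i))

    im-t-πℓ : ∀ x i → ℓᶜ.im (t-π R gℓ x) i R.≈ ℓᶜ.re x i R.- π R.* ℓᶜ.im x i
    im-t-πℓ x i = R.trans (ℓᶜ.im-+ _ _ i) (R.trans (R.+-cong (Tℓ.im-t x i)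
      (R.trans (ℓᶜ.im-* (R.- R.1#) _ i) (R.*-congˡ (ℓᶜ.im-* π x i)))) (minus _ _))

    t+π-graphℓ : ∀ {x} → Sℓ.Graph X x → Sℓ.Graph X (t+π R gℓ x)
    t+π-graphℓ p = graphℓ (LAℓ.IsSubmodule.+∈ isSubmoduleℓ (∈ℱℓ (t-graphℓ p)) (LAℓ.IsSubmodule.*∈ isSubmoduleℓ π (∈ℱℓ p)))

    t-π-graphℓ : ∀ {x} → Sℓ.Graph X x → Sℓ.Graph X (t-π R gℓ x)
    t-π-graphℓ p = graphℓ (LAℓ.IsSubmodule.+∈ isSubmoduleℓ (∈ℱℓ (t-graphℓ p))
      (LAℓ.IsSubmodule.*∈ isSubmoduleℓ (R.- R.1#) (LAℓ.IsSubmodule.*∈ isSubmoduleℓ π (∈ℱℓ p))))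

    t+π-graphₙ₋ℓ : ∀ {x} → Sₙ₋ℓ.Graph Y x → Sₙ₋ℓ.Graph Y (t+π R gₙ₋ℓ x)
    t+π-graphₙ₋ℓ p = graphₙ₋ℓ (LAₙ₋ℓ.IsSubmodule.+∈ isSubmoduleₙ₋ℓ (∈ℱₙ₋ℓ (t-graphₙ₋ℓ p)) (LAₙ₋ℓ.IsSubmodule.*∈ isSubmoduleₙ₋ℓ π (∈ℱₙ₋ℓ p)))

    t-π-graphₙ₋ℓ : ∀ {x} → Sₙ₋ℓ.Graph Y x → Sₙ₋ℓ.Graph Y (t-π R gₙ₋ℓ x)
    t-π-graphₙ₋ℓ p = graphₙ₋ℓ (LAₙ₋ℓ.IsSubmodule.+∈ isSubmoduleₙ₋ℓ (∈ℱₙ₋ℓ (t-graphₙ₋ℓ p))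
      (LAₙ₋ℓ.IsSubmodule.*∈ isSubmoduleₙ₋ℓ (R.- R.1#) (LAₙ₋ℓ.IsSubmodule.*∈ isSubmoduleₙ₋ℓ π (∈ℱₙ₋ℓ p))))

    re-colℓ : ∀ j i → ℓᶜ.re (Sℓ.columns X 𝟙 j) i R.≈ X i j
    re-colℓ j = ℓᶜ.re-col (λ i → X i j) (λ i → 𝟙 i j)

    im-colℓ : ∀ j i → ℓᶜ.im (Sℓ.columns X 𝟙 j) i R.≈ 𝟙 i j
    im-colℓ j = ℓᶜ.im-col (λ i → X i j) (λ i → 𝟙 i j)

    re-colₙ₋ℓ : ∀ j i → ₙ₋ℓᶜ.re (Sₙ₋ℓ.columns Y 𝟙 j) i R.≈ Y i j
    re-colₙ₋ℓ j = ₙ₋ℓᶜ.re-col (λ i → Y i j) (λ i → 𝟙 i j)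

    im-colₙ₋ℓ : ∀ j i → ₙ₋ℓᶜ.im (Sₙ₋ℓ.columns Y 𝟙 j) i R.≈ 𝟙 i j
    im-colₙ₋ℓ j = ₙ₋ℓᶜ.im-col (λ i → Y i j) (λ i → 𝟙 i j)

    outer : ∀ x y d → x R.* y R.- π R.* d R.+ π R.* d R.≈ x R.* y
    outer x y d = solve 4 (λ x y p d → x :* y :- p :* d :+ p :* d := x :* y) R.refl x y π d

    outer-2π : ∀ x y d → x R.* y R.- π R.* d R.- π R.* d R.≈ x R.* y R.- (π R.+ π) R.* d
    outer-2π x y d = solve 4 (λ x y p d → x :* y :- p :* d :- p :* d := x :* y :- (p :+ p) :* d) R.refl x y π d

    v∙w : v ∙ᵥ w R.≈ π R.+ π
    v∙w = R.trans (∙-comm v w) w∙v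

    module RO = RankOne R.commutativeRing

    charpolyℓ : HasCharpoly R gℓ ℱℓ
    charpolyℓ = matrixℓ (λ R′ → t R′ gℓ) _ X t-graphℓ (λ i j → R.trans (Tℓ.im-t _ i) (re-colℓ j i))
      (charpoly-rankOne R.commutativeRing i₀ (dual w) (dual v) π dual∙dual)

    charpolyₙ₋ℓ : HasCharpoly R gₙ₋ℓ ℱₙ₋ℓ
    charpolyₙ₋ℓ = matrixₙ₋ℓ (λ R′ → t R′ gₙ₋ℓ) _ Y t-graphₙ₋ℓ (λ i j → R.trans (Tₙ₋ℓ.im-t _ i) (re-colₙ₋ℓ j i))
      (charpoly-rankOne R.commutativeRing i₀ v w π v∙w)

    ⋀ⁿℓ : WedgeVanishes R gℓ n (λ R′ → t-π R′ gℓ) ℱℓ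
    -- The matrix of `t` is `X`, which already contains -π, so `t - π` has the rank-one matrix minus
    -- 2π, singular because the two vectors have product 2π.
    ⋀ⁿℓ = matrixℓ (λ R′ → t-π R′ gℓ) _ (λ i j → dual w i R.* dual v j R.- (π R.+ π) R.* 𝟙 i j) t-π-graphℓ
      (λ i j → R.trans (im-t-πℓ _ i) (R.trans (R.+-cong (re-colℓ j i) (R.-‿cong (R.*-congˡ (im-colℓ j i)))) (outer-2π _ _ _)))
      (RO.⋀ⁿ-vanishes _ (RO.det-rankOne-vanishes i₀ (dual w) (dual v) (π R.+ π) dual∙dual))

    ⋀ⁿₙ₋ℓ : WedgeVanishes R gₙ₋ℓ n (λ R′ → t-π R′ gₙ₋ℓ) ℱₙ₋ℓ
    ⋀ⁿₙ₋ℓ = matrixₙ₋ℓ (λ R′ → t-π R′ gₙ₋ℓ) _ (λ i j → v i R.* w j R.- (π R.+ π) R.* 𝟙 i j) t-π-graphₙ₋ℓ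
      (λ i j → R.trans (im-t-π _ i) (R.trans (R.+-cong (re-colₙ₋ℓ j i) (R.-‿cong (R.*-congˡ (im-colₙ₋ℓ j i)))) (outer-2π _ _ _)))
      (RO.⋀ⁿ-vanishes _ (RO.det-rankOne-vanishes i₀ v w (π R.+ π) v∙w))

    ⋀²ℓ : WedgeVanishes R gℓ 2 (λ R′ → t+π R′ gℓ) ℱℓ
    ⋀²ℓ = matrixℓ (λ R′ → t+π R′ gℓ) _ (λ i j → dual w i R.* dual v j) t+π-graphℓ
      (λ i j → R.trans (im-t+πℓ _ i) (R.trans (R.+-cong (re-colℓ j i) (R.*-congˡ (im-colℓ j i))) (outer _ _ _)))
      (RO.⋀²-rankOne-vanishes (dual w) (dual v))

    ⋀²ₙ₋ℓ : WedgeVanishes R gₙ₋ℓ 2 (λ R′ → t+π R′ gₙ₋ℓ) ℱₙ₋ℓ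
    ⋀²ₙ₋ℓ = matrixₙ₋ℓ (λ R′ → t+π R′ gₙ₋ℓ) _ (λ i j → v i R.* w j) t+π-graphₙ₋ℓ
      (λ i j → R.trans (im-t+π _ i) (R.trans (R.+-cong (re-colₙ₋ℓ j i) (R.*-congˡ (im-colₙ₋ℓ j i))) (outer _ _ _)))
      (RO.⋀²-rankOne-vanishes v w)

    line : ∀ {x} → 𝒢ₙ₋ℓ x → (∀ i → ₙ₋ℓᶜ.re x i R.≈ ₙ₋ℓᶜ.im x i₀ R.* (π R.* v i)) × (∀ i → ₙ₋ℓᶜ.im x i R.≈ ₙ₋ℓᶜ.im x i₀ R.* v i)
    line p = L.line-coordinates (proj₁ (columnSpanₙ₋ℓ G₁ G₂) p)

    re≈π*im : ∀ {x} → 𝒢ₙ₋ℓ x → ∀ i → ₙ₋ℓᶜ.re x i R.≈ π R.* ₙ₋ℓᶜ.im x i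
    re≈π*im {x} p i = R.trans (proj₁ (line p) i) (R.trans
      (solve 3 (λ r p v → r :* (p :* v) := p :* (r :* v)) R.refl (ₙ₋ℓᶜ.im x i₀) π (v i)) (R.*-congˡ (R.sym (proj₂ (line p) i))))

    -- `v` is an eigenvector of `Y` for the eigenvalue wᵗv - π = π, and on the line the upper block
    -- is π times the lower one.
    𝒢⊆ℱ : ∀ {x} → 𝒢ₙ₋ℓ x → ℱₙ₋ℓ x
    𝒢⊆ℱ {x} p = ∈ℱₙ₋ℓ λ i → begin
      ₙ₋ℓᶜ.re x i                            ≈⟨ re≈π*im p i ⟩
      π R.* q i                              ≈⟨ solve 2 (λ p q → p :* q := (p :+ p) :* q :- p :* q) R.refl π (q i) ⟩
      (π R.+ π) R.* q i R.- π R.* q i        ≈⟨ R.+-congʳ (R.trans (R.*-cong (R.sym w∙v) (proj₂ (line p) i))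
        (solve 3 (λ s r v → s :* (r :* v) := v :* (r :* s)) R.refl (w ∙ᵥ v) r (v i))) ⟩
      v i R.* (r R.* (w ∙ᵥ v)) R.- π R.* q i ≈⟨ R.+-congʳ (R.*-congˡ (R.sym w∙q)) ⟩
      v i R.* (w ∙ᵥ q) R.- π R.* q i         ≈⟨ R.sym (rankOne-*ᵥ v w q i) ⟩
      (Y *ᵥ q) i ∎
      where
      q : Fin n → R.Carrier
      q = ₙ₋ℓᶜ.im x
      r : R.Carrier
      r = q i₀
      w∙q : w ∙ᵥ q R.≈ r R.* (w ∙ᵥ v)
      w∙q = R.trans (sum-cong {f = λ j → w j R.* q j} {g = λ j → r R.* (w j R.* v j)} λ j → R.trans (R.*-congˡ (proj₂ (line p) j))
        (solve 3 (λ w r v → w :* (r :* v) := r :* (w :* v)) R.refl (w j) r (v j))) (*-sum r (λ j → w j R.* v j))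

    -- The coefficient on the generator of the line is the product of `w` with the lower block of
    -- `x`, since `Y + π` is v wᵗ.
    t+π-maps : ∀ x → ℱₙ₋ℓ x → 𝒢ₙ₋ℓ (t+π R gₙ₋ℓ x)
    t+π-maps x p = proj₂ (columnSpanₙ₋ℓ G₁ G₂) ((λ _ → s) , ₙ₋ℓᶜ.injective
      (λ i → begin
        ₙ₋ℓᶜ.re (t+π R gₙ₋ℓ x) i                        ≈⟨ re-t+π x i ⟩
        π R.* π R.* q i R.+ π R.* ₙ₋ℓᶜ.re x i           ≈⟨ R.+-congˡ (R.*-congˡ (re-x i)) ⟩
        π R.* π R.* q i R.+ π R.* (v i R.* s R.- π R.* q i)
          ≈⟨ solve 4 (λ p q v s → p :* p :* q :+ p :* (v :* s :- p :* q) := p :* v :* s :+ con (+ 0)) R.refl π (q i) (v i) s ⟩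
        π R.* v i R.* s R.+ R.0#                        ≈⟨ R.sym (Sₙ₋ℓ.re-columns G₁ G₂ (λ _ → s) i) ⟩
        ₙ₋ℓᶜ.re (LAₙ₋ℓ.lincomb (λ _ → s) (Sₙ₋ℓ.columns G₁ G₂)) i ∎)
      (λ i → begin
        ₙ₋ℓᶜ.im (t+π R gₙ₋ℓ x) i                        ≈⟨ im-t+π x i ⟩
        ₙ₋ℓᶜ.re x i R.+ π R.* q i                       ≈⟨ R.+-congʳ (re-x i) ⟩
        v i R.* s R.- π R.* q i R.+ π R.* q i
          ≈⟨ solve 4 (λ p q v s → v :* s :- p :* q :+ p :* q := v :* s :+ con (+ 0)) R.refl π (q i) (v i) s ⟩
        v i R.* s R.+ R.0#                              ≈⟨ R.sym (Sₙ₋ℓ.im-columns G₁ G₂ (λ _ → s) i) ⟩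
        ₙ₋ℓᶜ.im (LAₙ₋ℓ.lincomb (λ _ → s) (Sₙ₋ℓ.columns G₁ G₂)) i ∎))
      where
      q : Fin n → R.Carrier
      q = ₙ₋ℓᶜ.im x
      s : R.Carrier
      s = w ∙ᵥ q
      re-x : ∀ i → ₙ₋ℓᶜ.re x i R.≈ v i R.* s R.- π R.* q i
      re-x i = R.trans (graphₙ₋ℓ p i) (rankOne-*ᵥ v w q i)

    t-π-kills : ∀ x → 𝒢ₙ₋ℓ x → t-π R gₙ₋ℓ x Λₙ₋ℓ⊗.≈ᴹ Λₙ₋ℓ⊗.0ᴹ
    t-π-kills x p = ₙ₋ℓᶜ.injective
      (λ i → R.trans (re-t-π x i) (R.trans (R.+-congˡ (R.-‿cong (R.*-congˡ (re≈π*im p i))))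
        (R.trans (solve 2 (λ p q → p :* p :* q :- p :* (p :* q) := con (+ 0)) R.refl π _) (R.sym (ₙ₋ℓᶜ.re-0 i)))))
      (λ i → R.trans (im-t-π x i) (R.trans (R.+-congʳ (re≈π*im p i)) (R.trans (R.-‿inverseʳ _) (R.sym (ₙ₋ℓᶜ.im-0 i)))))

  isSplittingPoint : IsSplittingPoint point
  isSplittingPoint = record
    { isWedgePoint = record
      { isNaivePoint = record
        { submoduleℓ   = submoduleℓ
        ; submoduleₙ₋ℓ = submoduleₙ₋ℓ
        ; summandℓ     = summandℓ
        ; summandₙ₋ℓ   = summandₙ₋ℓ
        ; restricts₁   = restricts₁
        ; restricts₂   = restricts₂
        ; orthogonal   = λ x → mk⇔ orthogonal-to orthogonal-from
        ; charpolyℓ    = charpolyℓ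
        ; charpolyₙ₋ℓ  = charpolyₙ₋ℓ
        }
      ; ⋀ⁿℓ   = ⋀ⁿℓ
      ; ⋀ⁿₙ₋ℓ = ⋀ⁿₙ₋ℓ
      ; ⋀²ℓ   = ⋀²ℓ
      ; ⋀²ₙ₋ℓ = ⋀²ₙ₋ℓ
      }
    ; submodule = LAₙ₋ℓ.Span-isSubmodule (λ j → column R gₙ₋ℓ (λ i → G₁ i j) (λ i → G₂ i j))
    ; summand   = summand
    ; 𝒢⊆ℱ       = 𝒢⊆ℱ
    ; t+π-maps  = t+π-maps
    ; t-π-kills = t-π-kills
    }

  chartPoint : ChartPoint R i₀
  chartPoint = record
    { triple           = point
    ; isSplittingPoint = isSplittingPoint
    ; inChart          = record
      { X            = X
      ; ℱℓ-chart     = ≐-refl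
      ; Y            = Y
      ; ℱₙ₋ℓ-chart   = ≐-refl
      ; G₁           = G₁
      ; G₂           = G₂
      ; 𝒢ₙ₋ℓ-chart   = ≐-refl
      ; normalized   = v-i₀
      }
    }

-- Points of the coordinate rings

module Evaluation {a} (K : CommRing a) (Var : Set) {I : Set} (relations : I → Expr K Var)
                  (R : Algebra K) where
  private
    module K = CommutativeRing K
    module R = Algebra R
    module scalar = Hom (Algebra.structureMap R)

  module _ (x : Var → R.Carrier) where
    eval : Expr K Var → R.Carrier
    eval (con k) = R.scalar k
    eval (var i) = x i
    eval (p ⊕ q) = eval p R.+ eval q
    eval (p ⊛ q) = eval p R.* eval q
    eval (⊖ p)   = R.- eval p

    private
      eval-≃ : ∀ {p q} → _≃_ K Var p q → eval p R.≈ eval q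
      eval-≃ ≃-refl            = R.refl
      eval-≃ (≃-sym p)         = R.sym (eval-≃ p)
      eval-≃ (≃-trans p q)     = R.trans (eval-≃ p) (eval-≃ q)
      eval-≃ (⊕-cong p q)      = R.+-cong (eval-≃ p) (eval-≃ q)
      eval-≃ (⊛-cong p q)      = R.*-cong (eval-≃ p) (eval-≃ q)
      eval-≃ (⊖-cong p)        = R.-‿cong (eval-≃ p)
      eval-≃ (⊕-assoc p q r)   = R.+-assoc _ _ _
      eval-≃ (⊕-comm p q)      = R.+-comm _ _
      eval-≃ (⊕-identityˡ p)   = R.trans (R.+-congʳ scalar.0#-homo) (R.+-identityˡ _)
      eval-≃ (⊖-inverseˡ p)    = R.trans (R.-‿inverseˡ _) (R.sym scalar.0#-homo)
      eval-≃ (⊛-assoc p q r)   = R.*-assoc _ _ _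
      eval-≃ (⊛-comm p q)      = R.*-comm _ _
      eval-≃ (⊛-identityˡ p)   = R.trans (R.*-congʳ scalar.1#-homo) (R.*-identityˡ _)
      eval-≃ (⊛-distribˡ p q r) = R.distribˡ _ _ _
      eval-≃ (con-cong p)      = scalar.⟦⟧-cong p
      eval-≃ (con-+ k l)       = scalar.+-homo k l
      eval-≃ (con-* k l)       = scalar.*-homo k l
      eval-≃ (con-neg k)       = scalar.-‿homo k

    evalHom : (∀ i → eval (relations i) R.≈ R.0#) → AlgHom (K [ Var ]/ relations) R
    evalHom vanish = record
      { hom = record
        { ⟦_⟧ = eval
        ; isRingHomomorphism = record
          { isSemiringHomomorphism = record
            { isNearSemiringHomomorphism = record
              { +-isMonoidHomomorphism = record
                { isMagmaHomomorphism = record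
                  { isRelHomomorphism = record { cong = eval-∼ }
                  ; homo = λ _ _ → R.refl
                  }
                ; ε-homo = scalar.0#-homo
                }
              ; *-homo = λ _ _ → R.refl
              }
            ; 1#-homo = scalar.1#-homo
            }
          ; -‿homo = λ _ → R.refl
          }
        }
      ; commutes = λ _ → R.refl
      }
      where
      eval-∼ : ∀ {p q} → _∼_ (PolynomialRing K Var) relations p q → eval p R.≈ eval q
      eval-∼ (∼-reflexive p)  = eval-≃ p
      eval-∼ (∼-sym p)        = R.sym (eval-∼ p)
      eval-∼ (∼-trans p q)    = R.trans (eval-∼ p) (eval-∼ q)
      eval-∼ (∼-+-cong p q)   = R.+-cong (eval-∼ p) (eval-∼ q)
      eval-∼ (∼-*-cong p q)   = R.*-cong (eval-∼ p) (eval-∼ q)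
      eval-∼ (∼-neg-cong p)   = R.-‿cong (eval-∼ p)
      eval-∼ (∼-gen i)        = R.trans (vanish i) (R.sym scalar.0#-homo)

  module _ (h : AlgHom (K [ Var ]/ relations) R) where
    private module h = AlgHom h

    hom≈eval : ∀ p → h.⟦ p ⟧ R.≈ eval (h.⟦_⟧ ∘ var) p
    hom≈eval (con k) = h.commutes k
    hom≈eval (var i) = R.refl
    hom≈eval (p ⊕ q) = R.trans (h.+-homo p q) (R.+-cong (hom≈eval p) (hom≈eval q))
    hom≈eval (p ⊛ q) = R.trans (h.*-homo p q) (R.*-cong (hom≈eval p) (hom≈eval q))
    hom≈eval (⊖ p)   = R.trans (h.-‿homo p) (R.-‿cong (hom≈eval p))

    relations-vanish : ∀ i → eval (h.⟦_⟧ ∘ var) (relations i) R.≈ R.0#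
    relations-vanish i = R.trans (R.sym (hom≈eval (relations i))) (R.trans (h.⟦⟧-cong (∼-gen i)) h.0#-homo)

  hom-unique : (h h′ : AlgHom (K [ Var ]/ relations) R) →
               (∀ i → AlgHom.⟦_⟧ h (var i) R.≈ AlgHom.⟦_⟧ h′ (var i)) → ∀ p → AlgHom.⟦_⟧ h p R.≈ AlgHom.⟦_⟧ h′ p
  hom-unique h h′ eq p = R.trans (hom≈eval h p) (R.trans (eval-cong p) (R.sym (hom≈eval h′ p)))
    where
    eval-cong : ∀ p → eval (AlgHom.⟦_⟧ h ∘ var) p R.≈ eval (AlgHom.⟦_⟧ h′ ∘ var) p
    eval-cong (con k) = R.refl
    eval-cong (var i) = eq i
    eval-cong (p ⊕ q) = R.+-cong (eval-cong p) (eval-cong q)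
    eval-cong (p ⊛ q) = R.*-cong (eval-cong p) (eval-cong q)
    eval-cong (⊖ p)   = R.-‿cong (eval-cong p)

  private
    module P = CommutativeRing (PolynomialRing K Var)
    module MP = Matrices (PolynomialRing K Var)
    module MR = Matrices R.commutativeRing
    open Sums R.commutativeRing

  eval-sum : ∀ x {k} (f : Fin k → Expr K Var) → eval x (MP.sum f) R.≈ MR.sum (eval x ∘ f)
  eval-sum x {zero}  f = scalar.0#-homo
  eval-sum x {suc k} f = R.+-congˡ (eval-sum x (f ∘ Fin.suc))

  eval-antidiagonal : ∀ x {k} (f : Fin k → Expr K Var) i → eval x (MP._*ᵥ_ MP.antidiagonal f i) R.≈ eval x (f (opposite i))
  eval-antidiagonal x f i = R.trans (eval-sum x (λ j → MP.antidiagonal i j ⊛ f j))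
    (R.trans (sum-cong {f = λ j → eval x (MP.antidiagonal i j) R.* eval x (f j)} {g = λ j → MR.𝟙 (opposite i) j R.* eval x (f j)}
      (λ j → R.*-congʳ (entry j))) (sum-𝟙ˡ (opposite i) (eval x ∘ f)))
    where
    entry : ∀ j → eval x (MP.antidiagonal i j) R.≈ MR.𝟙 (opposite i) j
    entry j with i Finₚ.≟ opposite j | opposite i Finₚ.≟ j
    ... | yes _ | yes _ = scalar.1#-homo
    ... | no  _ | no  _ = scalar.0#-homo
    ... | yes p | no ¬q = ⊥-elim (¬q (≡.trans (≡.cong opposite p) (Finₚ.opposite-involutive j)))
    ... | no ¬p | yes q = ⊥-elim (¬p (≡.trans (≡.sym (Finₚ.opposite-involutive i)) (≡.cong opposite q)))

module LowerIndices {a} {𝔽 : CompleteDiscretelyValuedField a} {n ℓ : ℕ}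
                    (H : SplitHermitianSpace 𝔽 n) (ℓ-sns : StronglyNonSpecial n ℓ) where
  open Rotation H ℓ-sns
  open SplittingModel H ℓ-sns using (rotate)
  open CoordinateRings 𝔽 ℓ-sns using (N; lower)
  open StronglyNonSpecial ℓ-sns using (2ℓ≤n)
  private
    2ℓ = 2 ℕ.* ℓ

  toℕ-lower : ∀ k → toℕ (lower k) ≡ 2ℓ ℕ.+ toℕ k
  toℕ-lower k = ≡.trans (Finₚ.toℕ-cast _ (2ℓ ↑ʳ k)) (Finₚ.toℕ-↑ʳ 2ℓ k)

  lower-tail : ∀ k → isTail (lower k) ≡ true
  lower-tail k = isTail-true (ℕₚ.≤-trans (ℕₚ.m≤m+n 2ℓ (toℕ k)) (ℕₚ.≤-reflexive (≡.sym (toℕ-lower k))))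

  raise : ∀ j → isTail j ≡ true → Fin N
  raise j p = fromℕ< {toℕ j ∸ 2ℓ} (ℕₚ.∸-monoˡ-< (toℕ<n j) (isTail⇒ p))

  lower-raise : ∀ j p → lower (raise j p) ≡ j
  lower-raise j p = toℕ-injective (≡.trans (toℕ-lower (raise j p))
    (≡.trans (≡.cong (2ℓ ℕ.+_) (toℕ-fromℕ< _)) (ℕₚ.m+[n∸m]≡n (isTail⇒ p))))

  raise-lower : ∀ k (p : isTail (lower k) ≡ true) → raise (lower k) p ≡ k
  raise-lower k p = toℕ-injective (≡.trans (toℕ-fromℕ< _)
    (≡.trans (≡.cong (_∸ 2ℓ) (toℕ-lower k)) (ℕₚ.m+n∸m≡n 2ℓ (toℕ k))))

  -- This identifies the antidiagonal matrix H of the coordinate ring with the duality of the basis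
  -- on the last block.
  lower-opposite : ∀ k → lower (opposite k) ≡ (lower k) ᵒ
  lower-opposite k = rotate-injective (≡.trans (toℕ-injective (ℕₚ.+-cancelʳ-≡ (suc (toℕ (rotate (lower k)))) _ _
    (≡.trans (ℕₚ.+-cancelʳ-≡ 2ℓ _ _ total) (≡.sym (opposite-+ (rotate (lower k))))))) (≡.sym (rotate-ᵒ (lower k))))
    where
    open +-*-Solver
    ℓ≤ : ∀ k → ℓ ℕ.≤ toℕ (lower k)
    ℓ≤ k = ℕₚ.≤-trans (ℕₚ.m≤m+n ℓ _) (isTail⇒ (lower-tail k))
    r : Fin N → ℕ
    r k = toℕ (rotate (lower k))
    r+ℓ : ∀ k → r k ℕ.+ ℓ ≡ 2ℓ ℕ.+ toℕ k
    r+ℓ k = ≡.trans (rotate-≥ (lower k) (ℓ≤ k)) (toℕ-lower k)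
    -- The summand 2ℓ provides one ℓ for each of the two rotated indices, so that `r+ℓ` can undo
    -- both shifts.
    total : r (opposite k) ℕ.+ suc (r k) ℕ.+ 2ℓ ≡ n ℕ.+ 2ℓ
    total = ≡.trans (solve 3 (λ x y l → (x :+ (con 1 :+ y)) :+ (con 2 :* l) := (x :+ l) :+ (con 1 :+ (y :+ l))) ≡.refl (r (opposite k)) (r k) ℓ)
      (≡.trans (≡.cong₂ (λ x y → x ℕ.+ suc y) (r+ℓ (opposite k)) (r+ℓ k))
        (≡.trans (solve 3 (λ l o k → (l :+ o) :+ (con 1 :+ (l :+ k)) := (l :+ (o :+ (con 1 :+ k))) :+ l) ≡.refl 2ℓ (toℕ (opposite k)) (toℕ k))
          (≡.cong (ℕ._+ 2ℓ) (≡.trans (≡.cong (2ℓ ℕ.+_) (opposite-+ k)) (ℕₚ.m+[n∸m]≡n 2ℓ≤n)))))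

  module _ (R : CommRing a) where
    private
      module R = CommutativeRing R
      open Matrices R using (sum)
      open Sums R

      sum-tail : ∀ m {k n} (eq : m ℕ.+ k ≡ n) (f : Fin n → R.Carrier) → (∀ j → toℕ j ℕ.< m → f j R.≈ R.0#) →
                 sum f R.≈ sum (λ j → f (cast eq (m ↑ʳ j)))
      sum-tail zero    ≡.refl f p = sum-cong λ j → R.reflexive (≡.cong f (≡.sym (Finₚ.cast-is-id ≡.refl j)))
      sum-tail (suc m) ≡.refl f p = R.trans (R.+-cong (p Fin.zero (ℕ.s≤s ℕ.z≤n))
          (sum-tail m ≡.refl (f ∘ Fin.suc) λ j q → p (Fin.suc j) (ℕ.s≤s q))) (R.+-identityˡ _)

    sum-lower : ∀ (f : Fin n → R.Carrier) → (∀ j → isTail j ≡ false → f j R.≈ R.0#) → sum f R.≈ sum (f ∘ lower)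
    sum-lower f p = sum-tail 2ℓ (ℕₚ.m+[n∸m]≡n 2ℓ≤n) f λ j q → p j (isTail-false q)

-- Chart points in standard form

module Standard {a} {𝔽 : CompleteDiscretelyValuedField a} {n ℓ : ℕ}
                (H : SplitHermitianSpace 𝔽 n) (ℓ-sns : StronglyNonSpecial n ℓ)
                (R : Algebra (Integers.O 𝔽)) where
  open SplittingModel H ℓ-sns
  open Charts H ℓ-sns hiding (module ℓᶜ; module ₙ₋ℓᶜ; module π⁻¹ᶜ)
  open Points H ℓ-sns R
  private
    module R = Algebra R
    open Sums R.commutativeRing
    open IntegerSolver R.commutativeRing

  standard : (v w : Fin n → R.Carrier) → Triple R
  standard v w = record
    { ℱℓ   = columnSpan R gℓ (rankOne (dual w) (dual v)) 𝟙
    ; ℱₙ₋ℓ = columnSpan R gₙ₋ℓ (rankOne v w) 𝟙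
    ; 𝒢ₙ₋ℓ = columnSpan R gₙ₋ℓ {1} (λ i _ → π R.* v i) (λ i _ → v i)
    }

  columnsℓ-cong : ∀ {k} {A A′ B B′ : Matrix n k} → (∀ i j → A i j R.≈ A′ i j) → (∀ i j → B i j R.≈ B′ i j) →
                  LAℓ.Span (Sℓ.columns A B) ≐ LAℓ.Span (Sℓ.columns A′ B′)
  columnsℓ-cong {A = A} {A′} {B} {B′} p q = span-cong {R = R.commutativeRing} {M = Λ⊗-module R gℓ} λ j → ℓᶜ.injective
    (λ i → R.trans (ℓᶜ.re-col (λ i → A i j) (λ i → B i j) i) (R.trans (p i j) (R.sym (ℓᶜ.re-col (λ i → A′ i j) (λ i → B′ i j) i))))
    (λ i → R.trans (ℓᶜ.im-col (λ i → A i j) (λ i → B i j) i) (R.trans (q i j) (R.sym (ℓᶜ.im-col (λ i → A′ i j) (λ i → B′ i j) i))))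

  columnsₙ₋ℓ-cong : ∀ {k} {A A′ B B′ : Matrix n k} → (∀ i j → A i j R.≈ A′ i j) → (∀ i j → B i j R.≈ B′ i j) →
                    LAₙ₋ℓ.Span (Sₙ₋ℓ.columns A B) ≐ LAₙ₋ℓ.Span (Sₙ₋ℓ.columns A′ B′)
  columnsₙ₋ℓ-cong {A = A} {A′} {B} {B′} p q = span-cong {R = R.commutativeRing} {M = Λ⊗-module R gₙ₋ℓ} λ j → ₙ₋ℓᶜ.injective
    (λ i → R.trans (ₙ₋ℓᶜ.re-col (λ i → A i j) (λ i → B i j) i) (R.trans (p i j) (R.sym (ₙ₋ℓᶜ.re-col (λ i → A′ i j) (λ i → B′ i j) i))))
    (λ i → R.trans (ₙ₋ℓᶜ.im-col (λ i → A i j) (λ i → B i j) i) (R.trans (q i j) (R.sym (ₙ₋ℓᶜ.im-col (λ i → A′ i j) (λ i → B′ i j) i))))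

  columnSpanℓ-cong : ∀ {k} {A A′ B B′ : Matrix n k} → (∀ i j → A i j R.≈ A′ i j) → (∀ i j → B i j R.≈ B′ i j) →
                     columnSpan R gℓ A B ≐ columnSpan R gℓ A′ B′
  columnSpanℓ-cong {A = A} {A′} {B} {B′} p q =
    ≐-trans (columnSpanℓ A B) (≐-trans (columnsℓ-cong {A = A} {A′} {B} {B′} p q) (≐-sym (columnSpanℓ A′ B′)))

  columnSpanₙ₋ℓ-cong : ∀ {k} {A A′ B B′ : Matrix n k} → (∀ i j → A i j R.≈ A′ i j) → (∀ i j → B i j R.≈ B′ i j) →
                       columnSpan R gₙ₋ℓ A B ≐ columnSpan R gₙ₋ℓ A′ B′
  columnSpanₙ₋ℓ-cong {A = A} {A′} {B} {B′} p q =
    ≐-trans (columnSpanₙ₋ℓ A B) (≐-trans (columnsₙ₋ℓ-cong {A = A} {A′} {B} {B′} p q) (≐-sym (columnSpanₙ₋ℓ A′ B′)))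

  rankOne-cong : ∀ {x x′ y y′ : Fin n → R.Carrier} → (∀ i → x i R.≈ x′ i) → (∀ i → y i R.≈ y′ i) →
                 ∀ i j → rankOne x y i j R.≈ rankOne x′ y′ i j
  rankOne-cong p q i j = R.+-congʳ (R.*-cong (p i) (q j))

  standard-cong : ∀ {v v′ w w′} → (∀ i → v i R.≈ v′ i) → (∀ i → w i R.≈ w′ i) → standard v w ≐₃ standard v′ w′
  standard-cong {v} {v′} {w} {w′} p q =
    columnSpanℓ-cong {A = rankOne (dual w) (dual v)} {rankOne (dual w′) (dual v′)} {𝟙} {𝟙}
      (rankOne-cong {dual w} {dual w′} {dual v} {dual v′} (dual-cong q) (dual-cong p)) (λ _ _ → R.refl) ,
    columnSpanₙ₋ℓ-cong {A = rankOne v w} {rankOne v′ w′} {𝟙} {𝟙} (rankOne-cong {v} {v′} {w} {w′} p q) (λ _ _ → R.refl) ,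
    columnSpanₙ₋ℓ-cong {1} {A = λ i _ → π R.* v i} {λ i _ → π R.* v′ i} {λ i _ → v i} {λ i _ → v′ i}
      (λ i _ → R.*-congˡ (p i)) (λ i _ → p i)

  fromPoint-standard : ∀ {i₀} (P : ChartPoint R i₀) →
    ChartPoint.triple P ≐₃ standard (FromPoint.v P) (FromPoint.w P)
  fromPoint-standard P =
    ≐-trans ℱℓ-chart (columnSpanℓ-cong {A = X} {rankOne (dual w) (dual v)} {𝟙} {𝟙} X≈ (λ _ _ → R.refl)) ,
    ≐-trans ℱₙ₋ℓ-chart (columnSpanₙ₋ℓ-cong {A = Y} {rankOne v w} {𝟙} {𝟙} Y≈ (λ _ _ → R.refl)) ,
    ≐-trans 𝒢ₙ₋ℓ-chart (columnSpanₙ₋ℓ-cong {A = G₁} {λ i _ → π R.* v i} {G₂} {λ i _ → v i}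
      (λ { i Fin.zero → G₁≈πv i }) (λ { i Fin.zero → R.refl }))
    where
    open FromPoint P
    open ChartPoint P
    open InChart inChart

  module _ {i₀ : Fin n} (P Q : ChartPoint R i₀) (P≐Q : ChartPoint.triple P ≐₃ ChartPoint.triple Q) where
    private
      module P = FromPoint P
      module Q = FromPoint Q
      module CP = InChart (ChartPoint.inChart P)
      module CQ = InChart (ChartPoint.inChart Q)

      line : LAₙ₋ℓ.Span (Sₙ₋ℓ.columns CQ.G₁ CQ.G₂) (Sₙ₋ℓ.columns CP.G₁ CP.G₂ Fin.zero)
      line = proj₁ (columnSpanₙ₋ℓ CQ.G₁ CQ.G₂) (proj₁ CQ.𝒢ₙ₋ℓ-chart (proj₁ (proj₂ (proj₂ P≐Q))
        (proj₂ CP.𝒢ₙ₋ℓ-chart (proj₂ (columnSpanₙ₋ℓ CP.G₁ CP.G₂) (LAₙ₋ℓ.generator∈Span (Sₙ₋ℓ.columns CP.G₁ CP.G₂) Fin.zero)))))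

      graph : ∀ b → Sₙ₋ℓ.Graph CQ.Y (Sₙ₋ℓ.columns CP.Y 𝟙 b)
      graph b = Sₙ₋ℓ.span⇒graph CQ.Y (proj₁ (columnSpanₙ₋ℓ CQ.Y 𝟙) (proj₁ CQ.ℱₙ₋ℓ-chart (proj₁ (proj₁ (proj₂ P≐Q))
        (proj₂ CP.ℱₙ₋ℓ-chart (proj₂ (columnSpanₙ₋ℓ CP.Y 𝟙) (LAₙ₋ℓ.generator∈Span (Sₙ₋ℓ.columns CP.Y 𝟙) b))))))

      im-g : ∀ i → ₙ₋ℓᶜ.im (Sₙ₋ℓ.columns CP.G₁ CP.G₂ Fin.zero) i R.≈ P.v i
      im-g = ₙ₋ℓᶜ.im-col (λ i → CP.G₁ i Fin.zero) (λ i → CP.G₂ i Fin.zero)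

    -- The generator of one line is a multiple of the generator of the other, and comparing the
    -- entries at `i₀` shows the factor to be 1.
    v-unique : ∀ i → P.v i R.≈ Q.v i
    v-unique i = R.trans (R.sym (im-g i)) (R.trans (proj₂ (L.line-coordinates line) i)
      (R.trans (R.*-congʳ (R.trans (im-g i₀) P.v-i₀)) (R.*-identityˡ _)))
      where module L = Sₙ₋ℓ.Line CQ.G₁ CQ.G₂ i₀ Q.v-i₀

    -- A submodule is the graph of at most one matrix; so `Y`, and with it row `i₀` of `Y + π`,
    -- depends only on the point.
    w-unique : ∀ b → P.w b R.≈ Q.w b
    w-unique b = R.+-congʳ (R.trans (R.sym (ₙ₋ℓᶜ.re-col (λ i → CP.Y i b) (λ i → 𝟙 i b) i₀)) (R.trans (graph b i₀)
      (R.trans (Sₙ₋ℓ.*ᵥ-cong CQ.Y (ₙ₋ℓᶜ.im-col (λ i → CP.Y i b) (λ i → 𝟙 i b)) i₀) (sum-𝟙ʳ b (CQ.Y i₀)))))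

module _ {a} {𝔽 : CompleteDiscretelyValuedField a} {n ℓ : ℕ}
         (H : SplitHermitianSpace 𝔽 n) (ℓ-sns : StronglyNonSpecial n ℓ)
         {R R′ : Algebra (Integers.O 𝔽)} (φ : AlgHom R R′) where
  open SplittingModel H ℓ-sns
  open Charts H ℓ-sns hiding (module ℓᶜ; module ₙ₋ℓᶜ; module π⁻¹ᶜ)
  private
    module φ = AlgHom φ
    module R = Algebra R
    module R′ = Algebra R′
    module PR = Points H ℓ-sns R
    module PR′ = Points H ℓ-sns R′
    module SR = Standard H ℓ-sns R
    module SR′ = Standard H ℓ-sns R′

    φ-𝟙 : ∀ {k} (i j : Fin k) → φ.⟦ Matrices.𝟙 R.commutativeRing i j ⟧ R′.≈ Matrices.𝟙 R′.commutativeRing i j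
    φ-𝟙 i j with i Finₚ.≟ j
    ... | yes _ = φ.1#-homo
    ... | no  _ = φ.0#-homo

    φ-ε : ∀ j → φ.⟦ PR.ε j ⟧ R′.≈ PR′.ε j
    φ-ε j with isHead j
    ... | true  = φ.1#-homo
    ... | false = R′.trans (φ.-‿homo _) (R′.-‿cong φ.1#-homo)

  φ-dual : ∀ {x x′} → (∀ j → φ.⟦ x j ⟧ R′.≈ x′ j) → ∀ j → φ.⟦ PR.dual x j ⟧ R′.≈ PR′.dual x′ j
  φ-dual p j = R′.trans (φ.*-homo _ _) (R′.*-cong (φ-ε (j ᵒ)) (p (j ᵒ)))

  private
    φ-π : φ.⟦ PR.π ⟧ R′.≈ PR′.π
    φ-π = φ.commutes _

    φ-rankOne : ∀ {x x′ y y′} → (∀ j → φ.⟦ x j ⟧ R′.≈ x′ j) → (∀ j → φ.⟦ y j ⟧ R′.≈ y′ j) →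
                ∀ i j → φ.⟦ PR.rankOne x y i j ⟧ R′.≈ PR′.rankOne x′ y′ i j
    φ-rankOne p q i j = R′.trans (φ.+-homo _ _) (R′.+-cong (R′.trans (φ.*-homo _ _) (R′.*-cong (p i) (q j)))
      (R′.trans (φ.-‿homo _) (R′.-‿cong (R′.trans (φ.*-homo _ _) (R′.*-cong φ-π (φ-𝟙 i j))))))

  baseChange-standard : ∀ {v v′ w w′} → (∀ j → φ.⟦ v j ⟧ R′.≈ v′ j) → (∀ j → φ.⟦ w j ⟧ R′.≈ w′ j) →
                        baseChange₃ φ (SR.standard v w) ≐₃ SR′.standard v′ w′
  baseChange-standard {v} {v′} {w} {w′} p q =
    ≐-trans (baseChange-columnSpanℓ H ℓ-sns φ (PR.rankOne (PR.dual w) (PR.dual v)) PR.𝟙)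
      (≐-trans (SR′.columnsℓ-cong {A′ = PR′.rankOne (PR′.dual w′) (PR′.dual v′)} {B′ = PR′.𝟙}
        (φ-rankOne {PR.dual w} {PR′.dual w′} {PR.dual v} {PR′.dual v′} (φ-dual q) (φ-dual p)) φ-𝟙)
        (≐-sym (PR′.columnSpanℓ (PR′.rankOne (PR′.dual w′) (PR′.dual v′)) PR′.𝟙))) ,
    ≐-trans (baseChange-columnSpanₙ₋ℓ H ℓ-sns φ (PR.rankOne v w) PR.𝟙)
      (≐-trans (SR′.columnsₙ₋ℓ-cong {A′ = PR′.rankOne v′ w′} {B′ = PR′.𝟙} (φ-rankOne {v} {v′} {w} {w′} p q) φ-𝟙)
        (≐-sym (PR′.columnSpanₙ₋ℓ (PR′.rankOne v′ w′) PR′.𝟙))) ,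
    ≐-trans (baseChange-columnSpanₙ₋ℓ H ℓ-sns φ {1} (λ i _ → PR.π R.* v i) (λ i _ → v i))
      (≐-trans (SR′.columnsₙ₋ℓ-cong {1} {A′ = λ i _ → PR′.π R′.* v′ i} {B′ = λ i _ → v′ i}
        (λ i _ → R′.trans (φ.*-homo _ _) (R′.*-cong φ-π (p i))) (λ i _ → p i))
        (≐-sym (PR′.columnSpanₙ₋ℓ {1} (λ i _ → PR′.π R′.* v′ i) (λ i _ → v′ i))))

-- From a parametrization of the vectors to an isomorphism of functors

module Assembly {a} {𝔽 : CompleteDiscretelyValuedField a} {n ℓ : ℕ}
                (H : SplitHermitianSpace 𝔽 n) (ℓ-sns : StronglyNonSpecial n ℓ) (i₀ : Fin n) where
  open Integers 𝔽 using (O)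
  open SplittingModel H ℓ-sns
  private
    module P (R : Algebra O) = Points H ℓ-sns R
    module S (R : Algebra O) = Standard H ℓ-sns R

  -- A chart point is determined by its pair of vectors, so an isomorphism with Spec A amounts to a
  -- natural injective family of pairs satisfying the core equations that reaches the pair of every
  -- chart point. Both cases of the theorem supply one.
  record Parametrization (A : Algebra O) : Set (Level.suc a) where
    field
      v w     : ∀ {R} → AlgHom A R → Fin n → Algebra.Carrier R
      μ       : ∀ {R} → AlgHom A R → Algebra.Carrier R
      isCore  : ∀ {R} (h : AlgHom A R) → P.IsCore R (v h) (w h) (μ h)
      v-i₀    : ∀ {R} (h : AlgHom A R) → Algebra._≈_ R (v h i₀) (Algebra.1# R)
      v-cong  : ∀ {R} {h h′ : AlgHom A R} → (∀ x → Algebra._≈_ R (AlgHom.⟦_⟧ h x) (AlgHom.⟦_⟧ h′ x)) →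
                ∀ j → Algebra._≈_ R (v h j) (v h′ j)
      w-cong  : ∀ {R} {h h′ : AlgHom A R} → (∀ x → Algebra._≈_ R (AlgHom.⟦_⟧ h x) (AlgHom.⟦_⟧ h′ x)) →
                ∀ j → Algebra._≈_ R (w h j) (w h′ j)
      injective : ∀ {R} {h h′ : AlgHom A R} → (∀ j → Algebra._≈_ R (v h j) (v h′ j)) →
                (∀ j → Algebra._≈_ R (w h j) (w h′ j)) → ∀ x → Algebra._≈_ R (AlgHom.⟦_⟧ h x) (AlgHom.⟦_⟧ h′ x)
      v-natural : ∀ {R R′} (φ : AlgHom R R′) (h : AlgHom A R) j → Algebra._≈_ R′ (AlgHom.⟦_⟧ φ (v h j)) (v (φ ∘ᵃ h) j)
      w-natural : ∀ {R R′} (φ : AlgHom R R′) (h : AlgHom A R) j → Algebra._≈_ R′ (AlgHom.⟦_⟧ φ (w h j)) (w (φ ∘ᵃ h) j)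
      preimage   : ∀ {R} → ChartPoint R i₀ → AlgHom A R
      v-preimage : ∀ {R} (p : ChartPoint R i₀) j → Algebra._≈_ R (v (preimage p) j) (P.FromPoint.v R p j)
      w-preimage : ∀ {R} (p : ChartPoint R i₀) j → Algebra._≈_ R (w (preimage p) j) (P.FromPoint.w R p j)

  module _ {A : Algebra O} (param : Parametrization A) where
    open Parametrization param

    private
      module Pointwise (R : Algebra O) where
        module R = Algebra R
        open IntegerSolver R.commutativeRing

        toPoint : AlgHom A R → ChartPoint R i₀
        toPoint h = ToPoint.chartPoint H ℓ-sns R (v h) (w h) (isCore h) i₀ (v-i₀ h)

        -- Row `i₀` of v wᵗ is `w`, since `v i₀` is 1.
        w-toPoint : ∀ h j → P.FromPoint.w R (toPoint h) j R.≈ w h j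
        w-toPoint h j = R.trans (solve 2 (λ x y → x :- y :+ y := x) R.refl _ _)
          (R.trans (R.*-congʳ (v-i₀ h)) (R.*-identityˡ _))

        _≈ₕ_ : AlgHom A R → AlgHom A R → Set a
        h ≈ₕ h′ = ∀ x → AlgHom.⟦_⟧ h x R.≈ AlgHom.⟦_⟧ h′ x

        _≈ₚ_ : ChartPoint R i₀ → ChartPoint R i₀ → Set a
        p ≈ₚ q = ChartPoint.triple p ≐₃ ChartPoint.triple q

        toPoint-cong : ∀ {h h′} → h ≈ₕ h′ → toPoint h ≈ₚ toPoint h′
        toPoint-cong {h} {h′} p = S.standard-cong R (v-cong {R} {h} {h′} p) (w-cong {R} {h} {h′} p)

        preimage-cong : ∀ {p q} → p ≈ₚ q → preimage p ≈ₕ preimage q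
        preimage-cong {p} {q} eq = injective {R} {preimage p} {preimage q}
          (λ j → R.trans (v-preimage p j) (R.trans (S.v-unique R p q eq j) (R.sym (v-preimage q j))))
          (λ j → R.trans (w-preimage p j) (R.trans (S.w-unique R p q eq j) (R.sym (w-preimage q j))))

        toPoint-preimage : ∀ p → toPoint (preimage p) ≈ₚ p
        toPoint-preimage p =
          let x , y , z = S.standard-cong R (v-preimage p) (w-preimage p)
              x′ , y′ , z′ = S.fromPoint-standard R p
          in ≐-trans x (≐-sym x′) , ≐-trans y (≐-sym y′) , ≐-trans z (≐-sym z′)

        preimage-toPoint : ∀ h → preimage (toPoint h) ≈ₕ h
        preimage-toPoint h = injective {R} {preimage (toPoint h)} {h} (v-preimage (toPoint h))
          (λ j → R.trans (w-preimage (toPoint h) j) (w-toPoint h j))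

    chartIsSpec : ChartIsSpec i₀ A
    chartIsSpec = record
      { points  = λ R → let open Pointwise R in record
        { to        = toPoint
        ; from      = preimage
        ; to-cong   = λ {h} {h′} → toPoint-cong {h} {h′}
        ; from-cong = λ {p} {q} → preimage-cong {p} {q}
        ; inverse   =
            (λ {p} {h} eq → let x , y , z = toPoint-cong {h} {preimage p} eq
                                x′ , y′ , z′ = toPoint-preimage p
                            in ≐-trans x x′ , ≐-trans y y′ , ≐-trans z z′) ,
            (λ {h} {p} eq x → Algebra.trans R (preimage-cong {p} {toPoint h} eq x) (preimage-toPoint h x))
        }
      ; natural = λ φ h → baseChange-standard H ℓ-sns φ (v-natural φ h) (w-natural φ h)
      }

-- Recovering w from the coordinates of a chart

module LowerBlock {a} {𝔽 : CompleteDiscretelyValuedField a} {n ℓ : ℕ}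
                  (H : SplitHermitianSpace 𝔽 n) (ℓ-sns : StronglyNonSpecial n ℓ)
                  (R : Algebra (Integers.O 𝔽)) where
  open Charts H ℓ-sns using (_ᵒ; isTail; ½ᴿ; ½ᴿ+½ᴿ≈1; blocks)
  open LowerIndices H ℓ-sns public
  open CoordinateRings 𝔽 ℓ-sns using (N; lower) public
  open Points H ℓ-sns R using (π) public
  module R = Algebra R
  open Core R.commutativeRing blocks π (½ᴿ R) (½ᴿ+½ᴿ≈1 R) public hiding (_ᵒ; ᵒ-involutive; C-ᵒ)
  open Matrices R.commutativeRing using (sum) public
  open Sums R.commutativeRing
  open IntegerSolver R.commutativeRing
  open SetoidReasoning R.setoid

  ½ : R.Carrier
  ½ = ½ᴿ R

  ∑C-lower : ∀ f → ∑C f R.≈ sum (f ∘ lower)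
  ∑C-lower f = R.trans (sum-lower R.commutativeRing (sel f 0ᵥ) (λ j p → R.reflexive (sel-¬C f 0ᵥ p)))
    (sum-cong λ k → R.reflexive (sel-C f 0ᵥ (lower-tail k)))

  tail-elim : ∀ {p} (Q : Fin n → Set p) → (∀ k → Q (lower k)) → ∀ j → isTail j ≡ true → Q j
  tail-elim Q q j p = ≡.subst Q (lower-raise j p) (q (raise j p))

  ᵒ-lower : ∀ (f : Fin n → R.Carrier) k → f ((lower k) ᵒ) R.≈ f (lower (opposite k))
  ᵒ-lower f k = R.reflexive (≡.cong f (≡.sym (lower-opposite k)))

  dual-lower : ∀ x k → dual x (lower k) R.≈ R.- x (lower (opposite k))
  dual-lower x k = R.trans (dual-C x (lower k) (lower-tail k)) (R.-‿cong (ᵒ-lower x k))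

  private
    -- `raise` needs a proof that `j` is in the last block. Passing the Boolean with its equation
    -- keeps that proof available in the case distinction.
    pick : (Fin N → R.Carrier) → (Fin n → R.Carrier) → ∀ j b → isTail j ≡ b → R.Carrier
    pick z y j true  p = z (raise j p)
    pick z y j false p = y j

    pick-lower : ∀ z y k b p → pick z y (lower k) b p R.≈ z k
    pick-lower z y k true  p = R.reflexive (≡.cong z (raise-lower k p))
    pick-lower z y k false p with () ← ≡.trans (≡.sym (lower-tail k)) p

    pick-¬tail : ∀ z y j b p → isTail j ≡ false → pick z y j b p R.≈ y j
    pick-¬tail z y j true  p q with () ← ≡.trans (≡.sym p) q
    pick-¬tail z y j false p q = R.refl

  glue : (Fin N → R.Carrier) → (Fin n → R.Carrier) → Fin n → R.Carrier
  glue z y j = pick z y j (isTail j) ≡.refl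

  glue-lower : ∀ z y k → glue z y (lower k) R.≈ z k
  glue-lower z y k = pick-lower z y k (isTail (lower k)) ≡.refl

  glue-¬tail : ∀ z y j → isTail j ≡ false → glue z y j R.≈ y j
  glue-¬tail z y j p = pick-¬tail z y j (isTail j) ≡.refl p

  by-blocks : ∀ {x y : Fin n → R.Carrier} → (∀ k → x (lower k) R.≈ y (lower k)) →
              (∀ j → isTail j ≡ false → x j R.≈ y j) → ∀ j → x j R.≈ y j
  by-blocks {x} {y} p q j with bool-split (isTail j)
  ... | inj₁ t = tail-elim (λ j → x j R.≈ y j) p j t
  ... | inj₂ t = q j t

  glue-unique : ∀ {z y x} → (∀ k → z k R.≈ x (lower k)) → (∀ j → isTail j ≡ false → y j R.≈ x j) →
                ∀ j → glue z y j R.≈ x j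
  glue-unique {z} {y} {x} p q = by-blocks {glue z y} {x} (λ k → R.trans (glue-lower z y k) (p k))
    (λ j t → R.trans (glue-¬tail z y j t) (q j t))

  -- The quadratic form zᵗHz.
  square : (Fin N → R.Carrier) → R.Carrier
  square z = sum λ k → z k R.* z (opposite k)

  ∑C-dual : ∀ w → ∑C (λ j → w j R.* dual w j) R.≈ R.- square (w ∘ lower)
  ∑C-dual w = R.trans (∑C-lower (λ j → w j R.* dual w j)) (R.trans
    (sum-cong λ k → R.trans (R.*-congˡ (dual-lower w k)) (solve 2 (λ x y → x :* :- y := :- (x :* y)) R.refl _ _))
    (sum-neg λ k → w (lower k) R.* w (lower (opposite k))))

  double-half : ∀ s → ½ R.* s R.+ ½ R.* s R.≈ s
  double-half s = R.trans (R.sym (R.distribʳ s ½ ½)) (R.trans (R.*-congʳ (½ᴿ+½ᴿ≈1 R)) (R.*-identityˡ s))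

  module _ (v : Fin n → R.Carrier) (z : Fin N → R.Carrier) where
    μ₁ : R.Carrier
    μ₁ = ½ R.* square z

    w₁ : Fin n → R.Carrier
    w₁ = glue z (λ j → μ₁ R.* dual v j)

    -- Off the last block `w₁` satisfies the required proportionality by construction, and `μ₁` is
    -- chosen as half the square for the equation `w-dual`. Only the two hypotheses on the last
    -- block remain to be translated.
    core₁ : (∀ i j → v (lower i) R.* z (opposite j) R.≈ z (opposite i) R.* v (lower j)) →
            sum (λ k → z k R.* v (lower k)) R.≈ π R.+ π → IsCore v w₁ μ₁
    core₁ minors product = isCore-minors μ₁ (glue-¬tail z _)
      (R.trans (∑C-dual w₁) (R.-‿cong (R.trans (sum-cong λ k → R.*-cong (w₁-lower k) (w₁-lower (opposite k))) (R.sym (double-half _)))))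
      (λ i j p q → tail-elim (λ i → v i R.* w₁ j R.≈ dual w₁ i R.* dual v j)
        (λ i → tail-elim (λ j → v (lower i) R.* w₁ j R.≈ dual w₁ (lower i) R.* dual v j) (minor i) j q) i p)
      (R.trans (∑C-lower (λ j → w₁ j R.* v j)) (R.trans (sum-cong λ k → R.*-congʳ (w₁-lower k)) product))
      where
      w₁-lower : ∀ k → w₁ (lower k) R.≈ z k
      w₁-lower = glue-lower z _
      minor : ∀ i j → v (lower i) R.* w₁ (lower j) R.≈ dual w₁ (lower i) R.* dual v (lower j)
      minor i j = begin
        v (lower i) R.* w₁ (lower j)                  ≈⟨ R.*-congˡ (w₁-lower j) ⟩
        v (lower i) R.* z j                           ≡⟨ ≡.cong (λ j → v (lower i) R.* z j) (≡.sym (Finₚ.opposite-involutive j)) ⟩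
        -- The minor in rows `i` and `opposite j` of [V₂ | HZ₂] is the one needed: `dual` reverses
        -- both indices and its two signs cancel.
        v (lower i) R.* z (opposite (opposite j))     ≈⟨ minors i (opposite j) ⟩
        z (opposite i) R.* v (lower (opposite j))     ≈⟨ solve 2 (λ x y → x :* y := (:- x) :* (:- y)) R.refl _ _ ⟩
        R.- z (opposite i) R.* R.- v (lower (opposite j))
          ≈⟨ R.*-cong (R.-‿cong (R.sym (w₁-lower (opposite i)))) (R.sym (dual-lower v j)) ⟩
        R.- w₁ (lower (opposite i)) R.* dual v (lower j) ≈⟨ R.*-congʳ (R.sym (dual-lower w₁ i)) ⟩
        dual w₁ (lower i) R.* dual v (lower j) ∎

  module _ {v w : Fin n → R.Carrier} {μ : R.Carrier} (isCore : IsCore v w μ) where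
    open IsCore isCore

    core-minors : ∀ i j → v (lower i) R.* w (lower (opposite j)) R.≈ w (lower (opposite i)) R.* v (lower j)
    core-minors i j = begin
      v (lower i) R.* w (lower (opposite j))                     ≈⟨ minors _ _ (lower-tail i) (lower-tail (opposite j)) ⟩
      dual w (lower i) R.* dual v (lower (opposite j))           ≈⟨ R.*-cong (dual-lower w i) (dual-lower v (opposite j)) ⟩
      R.- w (lower (opposite i)) R.* R.- v (lower (opposite (opposite j)))
        ≈⟨ solve 2 (λ x y → (:- x) :* (:- y) := x :* y) R.refl _ _ ⟩
      w (lower (opposite i)) R.* v (lower (opposite (opposite j)))
        ≡⟨ ≡.cong (λ j → w (lower (opposite i)) R.* v (lower j)) (Finₚ.opposite-involutive j) ⟩
      w (lower (opposite i)) R.* v (lower j) ∎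

    core-product : sum (λ k → w (lower k) R.* v (lower k)) R.≈ π R.+ π
    core-product = R.trans (R.sym (∑C-lower (λ j → w j R.* v j))) (R.trans (∑C-w∙v μ w-¬C) w∙v)

    -- The equation `w-dual` gives 2μ as a function of the last block of `w`, and 2 can be
    -- cancelled. Hence that block and `v` determine all of `w`.
    core-μ : μ₁ v (w ∘ lower) R.≈ μ
    core-μ = double-injective (begin
      μ₁ v (w ∘ lower) R.+ μ₁ v (w ∘ lower)     ≈⟨ double-half _ ⟩
      square (w ∘ lower)                        ≈⟨ solve 1 (λ x → x := :- (:- x)) R.refl _ ⟩
      R.- (R.- square (w ∘ lower))              ≈⟨ R.-‿cong (R.trans (R.sym (∑C-dual w)) w-dual) ⟩
      R.- (R.- (μ R.+ μ))                       ≈⟨ solve 1 (λ x → :- (:- x) := x) R.refl _ ⟩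
      μ R.+ μ ∎)

  module _ (v : Fin n → R.Carrier) (u : R.Carrier) where
    -- On the last block this is Z₂ = u·HV₂, because `dual` is there the reversal with sign -1.
    w₂ : Fin n → R.Carrier
    w₂ = sel (λ j → R.- u R.* dual v j) (λ j → R.- u R.* R.- (π R.* dual v j))

    w₂-tail : ∀ j → isTail j ≡ true → w₂ j R.≈ R.- u R.* dual v j
    w₂-tail j p = R.reflexive (sel-C (λ j → R.- u R.* dual v j) (λ j → R.- u R.* R.- (π R.* dual v j)) p)

    -- With Z₂ = u·HV₂ the product Z₂ᵗV₂ is u·V₂ᵗHV₂, so the hypothesis is the remaining equation of
    -- `isCore-multiple`.
    core₂ : u R.* square (v ∘ lower) R.≈ π R.+ π → IsCore v w₂ (R.- (π R.* R.- u))
    core₂ product = isCore-multiple (R.- u) w₂-tail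
      (λ j p → R.reflexive (sel-¬C (λ j → R.- u R.* dual v j) (λ j → R.- u R.* R.- (π R.* dual v j)) p))
      (begin
        ∑C (λ j → w₂ j R.* v j)                       ≈⟨ ∑C-lower (λ j → w₂ j R.* v j) ⟩
        sum (λ k → w₂ (lower k) R.* v (lower k))
          ≈⟨ sum-cong (λ k → R.trans (R.*-congʳ (R.trans (w₂-tail (lower k) (lower-tail k)) (R.*-congˡ (dual-lower v k))))
               (solve 3 (λ u x y → :- u :* :- x :* y := u :* (y :* x)) R.refl u _ _)) ⟩
        sum (λ k → u R.* (v (lower k) R.* v (lower (opposite k)))) ≈⟨ *-sum u (λ k → v (lower k) R.* v (lower (opposite k))) ⟩
        u R.* square (v ∘ lower)                      ≈⟨ product ⟩
        π R.+ π ∎)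

    -- Dualizing twice on the last block is the identity, so the entry 1 of `v` exposes `u`; thus
    -- `u` is a function of `w`.
    u-w₂ : ∀ {i} → isTail i ≡ true → v i R.≈ R.1# → u R.≈ R.- dual w₂ i
    u-w₂ {i} p v≈1 = R.sym (begin
      R.- dual w₂ i                        ≈⟨ R.-‿cong (dual-C w₂ i p) ⟩
      R.- (R.- w₂ (i ᵒ))                   ≈⟨ R.-‿cong (R.-‿cong (R.trans (w₂-tail (i ᵒ) tail-ᵒ) (R.*-congˡ (dual-C v (i ᵒ) tail-ᵒ)))) ⟩
      R.- (R.- (R.- u R.* R.- v ((i ᵒ) ᵒ))) ≡⟨ ≡.cong (λ k → R.- (R.- (R.- u R.* R.- v k))) (Blocks.ᵒ-involutive blocks i) ⟩
      R.- (R.- (R.- u R.* R.- v i))        ≈⟨ solve 2 (λ u v → :- (:- (:- u :* :- v)) := u :* v) R.refl u (v i) ⟩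
      u R.* v i                            ≈⟨ R.trans (R.*-congˡ v≈1) (R.*-identityʳ u) ⟩
      u ∎)
      where
      tail-ᵒ : isTail (i ᵒ) ≡ true
      tail-ᵒ = ≡.trans (Blocks.C-ᵒ blocks i) p

open import Data.Nat.Base using (_*_; _≤_; _<_)

-- Charts at an index outside the last block

module FirstCase {a} {𝔽 : CompleteDiscretelyValuedField a} {n ℓ : ℕ}
                 (H : SplitHermitianSpace 𝔽 n) (ℓ-sns : StronglyNonSpecial n ℓ) (i₀ : Fin n)
                 (i₀<2ℓ : toℕ i₀ < 2 * ℓ) where
  open Integers 𝔽 using (O; πᴼ)
  open SplittingModel H ℓ-sns using (ChartPoint)
  open Rotation H ℓ-sns using (isTail-false)
  open CoordinateRings 𝔽 ℓ-sns using (N; module Case₁)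
  open Case₁ i₀
  open Assembly H ℓ-sns i₀

  module _ (R : Algebra O) where
    open LowerBlock H ℓ-sns R hiding (N)
    open Sums R.commutativeRing using (sum-cong)
    open RingProperties R.ring using (x∙y⁻¹≈ε⇒x≈y; x≈y⇒x∙y⁻¹≈ε)
    module E = Evaluation O Var relations R
    module scalar = Hom R.structureMap

    record IsSolution (x : Fin n → R.Carrier) (y : Fin N → R.Carrier) : Set a where
      field
        x-i₀      : x i₀ R.≈ R.1#
        x-minor   : ∀ i j → x (lower i) R.* y (opposite j) R.≈ y (opposite i) R.* x (lower j)
        x-product : sum (λ k → y k R.* x (lower k)) R.≈ π R.+ π

    assign : (Fin n → R.Carrier) → (Fin N → R.Carrier) → Var → R.Carrier
    assign x y (v j) = x j
    assign x y (z k) = y k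

    private
      eval-product : ∀ f → E.eval f (relations product) R.≈
        sum (λ k → f (z k) R.* f (v (lower k))) R.- (π R.+ π)
      eval-product f = R.+-cong (E.eval-sum f (λ k → var (z k) ⊛ var (v (lower k)))) (R.-‿cong (scalar.+-homo πᴼ πᴼ))

      eval-minor : ∀ f i j p → E.eval f (relations (minor i j p)) R.≈
        f (v (lower i)) R.* f (z (opposite j)) R.- f (z (opposite i)) R.* f (v (lower j))
      eval-minor f i j p = R.+-cong (R.*-congˡ (E.eval-antidiagonal f (λ k → var (z k)) j))
        (R.-‿cong (R.*-congʳ (E.eval-antidiagonal f (λ k → var (z k)) i)))

      eval-unit : ∀ f → E.eval f (relations unit) R.≈ f (v i₀) R.- R.1#
      eval-unit f = R.+-congˡ (R.-‿cong scalar.1#-homo)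

    solution⇒hom : ∀ {x y} → IsSolution x y → AlgHom ring R
    solution⇒hom {x} {y} sol = E.evalHom (assign x y) vanish
      where
      open IsSolution sol
      vanish : ∀ r → E.eval (assign x y) (relations r) R.≈ R.0#
      vanish unit          = R.trans (eval-unit (assign x y)) (x≈y⇒x∙y⁻¹≈ε x-i₀)
      vanish (minor i j p) = R.trans (eval-minor (assign x y) i j p) (x≈y⇒x∙y⁻¹≈ε (x-minor i j))
      vanish product       = R.trans (eval-product (assign x y)) (x≈y⇒x∙y⁻¹≈ε x-product)

    module _ (h : AlgHom ring R) where
      private
        module h = AlgHom h
        f : Var → R.Carrier
        f i = h.⟦ var i ⟧

        minor-< : ∀ i j → i Fin.< j → f (v (lower i)) R.* f (z (opposite j)) R.≈ f (z (opposite i)) R.* f (v (lower j))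
        minor-< i j p = x∙y⁻¹≈ε⇒x≈y _ _ (R.trans (R.sym (eval-minor f i j p)) (E.relations-vanish h (minor i j p)))

        -- The relations list the minors for `i < j` only. Exchanging the rows changes the sign of a
        -- minor, and on the diagonal it is zero by commutativity.
        minor′ : ∀ i j → f (v (lower i)) R.* f (z (opposite j)) R.≈ f (z (opposite i)) R.* f (v (lower j))
        minor′ i j with Finₚ.<-cmp i j
        ... | tri< i<j _ _ = minor-< i j i<j
        ... | tri≈ _ ≡.refl _ = R.*-comm _ _
        ... | tri> _ _ j<i = R.trans (R.*-comm _ _) (R.trans (R.sym (minor-< j i j<i)) (R.*-comm _ _))

      solution : IsSolution (f ∘ v) (f ∘ z)
      solution = record
        { x-i₀      = x∙y⁻¹≈ε⇒x≈y _ _ (R.trans (R.sym (eval-unit f)) (E.relations-vanish h unit))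
        ; x-minor   = minor′
        ; x-product = x∙y⁻¹≈ε⇒x≈y _ _ (R.trans (R.sym (eval-product f)) (E.relations-vanish h product))
        }

    coreOf : ∀ {x y} → IsSolution x y → IsCore x (w₁ x y) (μ₁ x y)
    coreOf {x} {y} sol = core₁ x y (IsSolution.x-minor sol) (IsSolution.x-product sol)

    w₁-cong : ∀ {x x′ y y′} → (∀ j → x j R.≈ x′ j) → (∀ k → y k R.≈ y′ k) → ∀ j → w₁ x y j R.≈ w₁ x′ y′ j
    w₁-cong {x} {x′} {y} {y′} p q = glue-unique {y} {λ j → μ₁ x y R.* dual x j} {w₁ x′ y′}
      (λ k → R.trans (q k) (R.sym (glue-lower y′ _ k)))
      (λ j t → R.trans (R.*-cong (R.*-congˡ (sum-cong λ k → R.*-cong (q k) (q (opposite k)))) (dual-cong p j))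
        (R.sym (glue-¬tail y′ (λ j → μ₁ x′ y′ R.* dual x′ j) j t)))

    module _ (P : ChartPoint R i₀) where
      private
        module P = Points.FromPoint H ℓ-sns R P
        core = P.core-¬C (isTail-false i₀<2ℓ)

      pointSolution : IsSolution P.v (P.w ∘ lower)
      pointSolution = record
        { x-i₀      = P.v-i₀
        ; x-minor   = core-minors core
        ; x-product = core-product core
        }

      -- Off the last block `w` is `μ·dual v` with the scalar of `core-¬C`, which `core-μ`
      -- identifies with half the square of the last block.
      w₁-point : ∀ j → w₁ P.v (P.w ∘ lower) j R.≈ P.w j
      w₁-point = glue-unique {P.w ∘ lower} {λ j → μ₁ P.v (P.w ∘ lower) R.* dual P.v j} {P.w} (λ k → R.refl)
        (λ j t → R.trans (R.*-congʳ (core-μ core)) (R.sym (IsCore.w-¬C core j t)))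

  module _ {R R′ : Algebra O} (φ : AlgHom R R′) where
    private
      module R = Algebra R
      module R′ = Algebra R′
      module φ = AlgHom φ
      module L = LowerBlock H ℓ-sns R
      module L′ = LowerBlock H ℓ-sns R′
      φ-sum : ∀ {k} (f : Fin k → R.Carrier) → φ.⟦ L.sum f ⟧ R′.≈ L′.sum (φ.⟦_⟧ ∘ f)
      φ-sum {ℕ.zero}  f = φ.0#-homo
      φ-sum {ℕ.suc k} f = R′.trans (φ.+-homo _ _) (R′.+-congˡ (φ-sum (f ∘ Fin.suc)))

    w₁-natural : ∀ x y j → φ.⟦ L.w₁ x y j ⟧ R′.≈ L′.w₁ (φ.⟦_⟧ ∘ x) (φ.⟦_⟧ ∘ y) j
    w₁-natural x y = L′.by-blocks {φ.⟦_⟧ ∘ L.w₁ x y} {L′.w₁ (φ.⟦_⟧ ∘ x) (φ.⟦_⟧ ∘ y)}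
      (λ k → R′.trans (φ.⟦⟧-cong (L.glue-lower y _ k)) (R′.sym (L′.glue-lower (φ.⟦_⟧ ∘ y) _ k)))
      (λ j t → R′.trans (φ.⟦⟧-cong (L.glue-¬tail y (λ j → L.μ₁ x y R.* L.dual x j) j t))
        (R′.trans (φ.*-homo _ _) (R′.trans (R′.*-cong φ-μ (φ-dual H ℓ-sns φ {x} (λ j → R′.refl) j))
          (R′.sym (L′.glue-¬tail (φ.⟦_⟧ ∘ y) (λ j → L′.μ₁ (φ.⟦_⟧ ∘ x) (φ.⟦_⟧ ∘ y) R′.* L′.dual (φ.⟦_⟧ ∘ x) j) j t)))))
      where
      φ-μ : φ.⟦ L.μ₁ x y ⟧ R′.≈ L′.μ₁ (φ.⟦_⟧ ∘ x) (φ.⟦_⟧ ∘ y)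
      φ-μ = R′.trans (φ.*-homo _ _) (R′.*-cong (φ.commutes _)
        (R′.trans (φ-sum (λ k → y k R.* y (opposite k))) (Sums.sum-cong R′.commutativeRing λ k → φ.*-homo (y k) (y (opposite k)))))

  parametrization : Parametrization ring
  parametrization = record
    { v          = λ h j → AlgHom.⟦_⟧ h (var (v j))
    ; w          = λ {R} h → LowerBlock.w₁ H ℓ-sns R (λ j → AlgHom.⟦_⟧ h (var (v j))) (λ k → AlgHom.⟦_⟧ h (var (z k)))
    ; μ          = λ {R} h → LowerBlock.μ₁ H ℓ-sns R (λ j → AlgHom.⟦_⟧ h (var (v j))) (λ k → AlgHom.⟦_⟧ h (var (z k)))
    ; isCore     = λ {R} h → coreOf R (solution R h)
    ; v-i₀       = λ {R} h → IsSolution.x-i₀ (solution R h)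
    ; v-cong     = λ p j → p (var (v j))
    ; w-cong     = λ {R} p → w₁-cong R (λ j → p (var (v j))) (λ k → p (var (z k)))
    ; injective  = λ {R} {h} {h′} p q → E.hom-unique R h h′ λ
        { (v j) → p j
        ; (z k) → Algebra.trans R (Algebra.sym R (LowerBlock.glue-lower H ℓ-sns R _ _ k))
            (Algebra.trans R (q (CoordinateRings.lower 𝔽 ℓ-sns k)) (LowerBlock.glue-lower H ℓ-sns R _ _ k))
        }
    ; v-natural  = λ {R} {R′} φ h j → Algebra.refl R′
    ; w-natural  = λ φ h → w₁-natural φ (λ j → AlgHom.⟦_⟧ h (var (v j))) (λ k → AlgHom.⟦_⟧ h (var (z k)))
    ; preimage   = λ {R} P → solution⇒hom R (pointSolution R P)
    ; v-preimage = λ {R} P j → Algebra.refl R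
    ; w-preimage = λ {R} P → w₁-point R P
    }

-- Charts at an index in the last block

module SecondCase {a} {𝔽 : CompleteDiscretelyValuedField a} {n ℓ : ℕ}
                  (H : SplitHermitianSpace 𝔽 n) (ℓ-sns : StronglyNonSpecial n ℓ) (i₀ : Fin n)
                  (2ℓ≤i₀ : 2 * ℓ ≤ toℕ i₀) where
  open Integers 𝔽 using (O; πᴼ)
  open SplittingModel H ℓ-sns using (ChartPoint)
  open Rotation H ℓ-sns using (isTail; isTail-true)
  open CoordinateRings 𝔽 ℓ-sns using (N; module Case₂)
  open Case₂ i₀
  open Assembly H ℓ-sns i₀

  module _ (R : Algebra O) where
    open LowerBlock H ℓ-sns R hiding (N)
    open Sums R.commutativeRing using (sum-cong; *-sum)
    open IntegerSolver R.commutativeRing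
    open RingProperties R.ring using (x∙y⁻¹≈ε⇒x≈y; x≈y⇒x∙y⁻¹≈ε)
    module E = Evaluation O Var relations R
    module scalar = Hom R.structureMap

    record IsSolution (x : Fin n → R.Carrier) (y : R.Carrier) : Set a where
      field
        x-i₀      : x i₀ R.≈ R.1#
        x-product : y R.* square (x ∘ lower) R.≈ π R.+ π

    assign : (Fin n → R.Carrier) → R.Carrier → Var → R.Carrier
    assign x y (v j) = x j
    assign x y u     = y

    private
      eval-product : ∀ f → E.eval f (relations product) R.≈ f u R.* square (f ∘ v ∘ lower) R.- (π R.+ π)
      eval-product f = R.+-cong
        (R.*-congˡ (R.trans (E.eval-sum f (λ k → V₂ k ⊛ Matrices._*ᵥ_ (PolynomialRing O Var) (Matrices.antidiagonal (PolynomialRing O Var)) V₂ k))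
          (sum-cong λ k → R.*-congˡ (E.eval-antidiagonal f V₂ k))))
        (R.-‿cong (scalar.+-homo πᴼ πᴼ))

      eval-unit : ∀ f → E.eval f (relations unit) R.≈ f (v i₀) R.- R.1#
      eval-unit f = R.+-congˡ (R.-‿cong scalar.1#-homo)

    solution⇒hom : ∀ {x y} → IsSolution x y → AlgHom ring R
    solution⇒hom {x} {y} sol = E.evalHom (assign x y) vanish
      where
      open IsSolution sol
      vanish : ∀ r → E.eval (assign x y) (relations r) R.≈ R.0#
      vanish unit    = R.trans (eval-unit (assign x y)) (x≈y⇒x∙y⁻¹≈ε x-i₀)
      vanish product = R.trans (eval-product (assign x y)) (x≈y⇒x∙y⁻¹≈ε x-product)

    module _ (h : AlgHom ring R) where
      private
        f : Var → R.Carrier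
        f i = AlgHom.⟦_⟧ h (var i)

      solution : IsSolution (f ∘ v) (f u)
      solution = record
        { x-i₀      = x∙y⁻¹≈ε⇒x≈y _ _ (R.trans (R.sym (eval-unit f)) (E.relations-vanish h unit))
        ; x-product = x∙y⁻¹≈ε⇒x≈y _ _ (R.trans (R.sym (eval-product f)) (E.relations-vanish h product))
        }

    w₂-cong : ∀ {x x′ y y′} → (∀ j → x j R.≈ x′ j) → y R.≈ y′ → ∀ j → w₂ x y j R.≈ w₂ x′ y′ j
    w₂-cong {x} {x′} {y} {y′} p q j = sel-cong
      {λ j → R.- y R.* dual x j} {λ j → R.- y′ R.* dual x′ j}
      {λ j → R.- y R.* R.- (π R.* dual x j)} {λ j → R.- y′ R.* R.- (π R.* dual x′ j)} j
      (λ _ → R.*-cong (R.-‿cong q) (dual-cong p j))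
      (λ _ → R.*-cong (R.-‿cong q) (R.-‿cong (R.*-congˡ (dual-cong p j))))

    μ₂ : R.Carrier → R.Carrier
    μ₂ y = R.- (π R.* R.- y)

    i₀-tail : isTail i₀ ≡ true
    i₀-tail = isTail-true 2ℓ≤i₀

    u-unique : ∀ {x x′ y y′} → x i₀ R.≈ R.1# → x′ i₀ R.≈ R.1# → (∀ j → w₂ x y j R.≈ w₂ x′ y′ j) → y R.≈ y′
    u-unique {x} {x′} {y} {y′} p p′ q = R.trans (u-w₂ x y i₀-tail p)
      (R.trans (R.-‿cong (dual-cong q i₀)) (R.sym (u-w₂ x′ y′ i₀-tail p′)))

    module _ (P : ChartPoint R i₀) where
      private
        module P = Points.FromPoint H ℓ-sns R P
        u′ : R.Carrier
        -- For a chart point, `w` is `dual w i₀` times `dual v` on the last block and times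
        -- `-π·dual v` off it; so this value of `u` makes `w₂` return `w`.
        u′ = R.- dual P.w i₀
        -u′≈ : R.- u′ R.≈ dual P.w i₀
        -u′≈ = solve 1 (λ x → :- (:- x) := x) R.refl _

      w₂-point : ∀ j → w₂ P.v u′ j R.≈ P.w j
      w₂-point j = R.trans
        (sel-cong {λ j → R.- u′ R.* dual P.v j} {λ j → P.w j} {λ j → R.- u′ R.* R.- (π R.* dual P.v j)} {λ j → P.w j} j
          (λ t → R.trans (R.*-congʳ -u′≈) (R.sym (P.w-C i₀-tail j t)))
          (λ t → R.trans (R.*-congʳ -u′≈) (R.sym (P.w-¬C i₀-tail j t))))
        (sel-same P.w j)

      pointSolution : IsSolution P.v u′
      pointSolution = record
        { x-i₀      = P.v-i₀
        -- Each term of u·V₂ᵗHV₂ is an entry of `w` on the last block times the entry of `v`, so the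
        -- sum is the product 2π of the core equations.
        ; x-product = R.trans (R.sym (*-sum u′ (λ k → P.v (lower k) R.* P.v (lower (opposite k)))))
            (R.trans (sum-cong λ k → R.trans (solve 3 (λ u x y → u :* (x :* y) := (:- u :* :- y) :* x) R.refl u′ _ _)
              (R.*-congʳ (R.trans (R.*-cong -u′≈ (R.sym (dual-lower P.v k))) (R.sym (P.w-C i₀-tail (lower k) (lower-tail k))))))
              (core-product (P.core-C i₀-tail)))
        }

  module _ {R R′ : Algebra O} (φ : AlgHom R R′) where
    private
      module R = Algebra R
      module R′ = Algebra R′
      module φ = AlgHom φ
      module L = LowerBlock H ℓ-sns R
      module L′ = LowerBlock H ℓ-sns R′

    w₂-natural : ∀ x y j → φ.⟦ L.w₂ x y j ⟧ R′.≈ L′.w₂ (φ.⟦_⟧ ∘ x) φ.⟦ y ⟧ j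
    w₂-natural x y j with isTail j
    ... | true  = R′.trans (φ.*-homo _ _) (R′.*-cong (φ.-‿homo y) (φ-dual H ℓ-sns φ {x} (λ j → R′.refl) j))
    ... | false = R′.trans (φ.*-homo _ _) (R′.*-cong (φ.-‿homo y) (R′.trans (φ.-‿homo _)
      (R′.-‿cong (R′.trans (φ.*-homo _ _) (R′.*-cong (φ.commutes πᴼ) (φ-dual H ℓ-sns φ {x} (λ j → R′.refl) j))))))

  parametrization : Parametrization ring
  parametrization = record
    { v          = λ h j → AlgHom.⟦_⟧ h (var (v j))
    ; w          = λ {R} h → LowerBlock.w₂ H ℓ-sns R (λ j → AlgHom.⟦_⟧ h (var (v j))) (AlgHom.⟦_⟧ h (var u))
    ; μ          = λ {R} h → μ₂ R (AlgHom.⟦_⟧ h (var u))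
    ; isCore     = λ {R} h → LowerBlock.core₂ H ℓ-sns R (λ j → AlgHom.⟦_⟧ h (var (v j))) (AlgHom.⟦_⟧ h (var u)) (IsSolution.x-product (solution R h))
    ; v-i₀       = λ {R} h → IsSolution.x-i₀ (solution R h)
    ; v-cong     = λ p j → p (var (v j))
    ; w-cong     = λ {R} p → w₂-cong R (λ j → p (var (v j))) (p (var u))
    ; injective  = λ {R} {h} {h′} p q → E.hom-unique R h h′ λ
        { (v j) → p j
        ; u     → u-unique R {λ j → AlgHom.⟦_⟧ h (var (v j))} {λ j → AlgHom.⟦_⟧ h′ (var (v j))} (IsSolution.x-i₀ (solution R h)) (IsSolution.x-i₀ (solution R h′)) q
        }
    ; v-natural  = λ {R} {R′} φ h j → Algebra.refl R′
    ; w-natural  = λ φ h → w₂-natural φ (λ j → AlgHom.⟦_⟧ h (var (v j))) (AlgHom.⟦_⟧ h (var u))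
    ; preimage   = λ {R} P → solution⇒hom R (pointSolution R P)
    ; v-preimage = λ {R} P j → Algebra.refl R
    ; w-preimage = λ {R} P → w₂-point R P
    }

proposition4p2 : ∀ {a} (𝔽 : CompleteDiscretelyValuedField a) (n ℓ : ℕ) (n>3 : 3 < n)
    (H : SplitHermitianSpace 𝔽 n) (ℓ-sns : StronglyNonSpecial n ℓ) (i₀ : Fin n) →
    (toℕ i₀ < 2 * ℓ →
    SplittingModel.ChartIsSpec H ℓ-sns i₀ (CoordinateRings.Case₁.ring 𝔽 ℓ-sns i₀))
    ×
    (2 * ℓ ≤ toℕ i₀ →
    SplittingModel.ChartIsSpec H ℓ-sns i₀ (CoordinateRings.Case₂.ring 𝔽 ℓ-sns i₀))
proposition4p2 𝔽 n ℓ n>3 H ℓ-sns i₀ =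
  (λ i₀<2ℓ → Assembly.chartIsSpec H ℓ-sns i₀ (FirstCase.parametrization H ℓ-sns i₀ i₀<2ℓ)) ,
  (λ 2ℓ≤i₀ → Assembly.chartIsSpec H ℓ-sns i₀ (SecondCase.parametrization H ℓ-sns i₀ 2ℓ≤i₀))
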